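{- Let $d\ge 1$ and let $\mathcal{S}\subset\{ -1,0,1\}^d\setminus\{\mathbf{0}\}$ be a weighted step set that is symmetric over each of the first $d-1$ coordinate axes, that contains, for each $1\le j\le d$, a step with $j$th coordinate $+1$ and a step with $j$th coordinate $-1$, and that has zero drift, i.e. $A(\mathbf{1})=B(\mathbf{1})$. Let $s_n$ be the total weight of walks of length $n$ taking steps in $\mathcal{S}$, starting at the origin, and never leaving $\mathbb{N}^d$. Then, as $n\to\infty$, \[ s_n \sim S(\mathbf{1})^n \cdot n^{ -d/2}\cdot \frac{S(\mathbf{1})^{d/2}}{\pi^{d/2}(b_1\cdots b_d)^{1/2}}. \]
   Context: Each step $\mathbf{i}\in\mathcal{S}$ carries a positive real weight $w_{\mathbf{i}}$; the weight of a walk is the product of the weights of its steps. The characteristic polynomial is the Laurent polynomial $S(\mathbf{z})=\sum_{\mathbf{i}\in\mathcal{S}} w_{\mathbf{i}} z_1^{i_1}\cdots z_d^{i_d}$. $\mathcal{S}$ is symmetric over the $k$th coordinate axis if $\mathcal{S}$ is invariant under negating the $k$th coordinate and each step has the same weight as its reflection. Writing $\hat{\mathbf{z}}=(z_1,\dots,z_{d-1})$, symmetry over the first $d-1$ axes means $S(\mathbf{z})=z_d^{ -1}A(\hat{\mathbf{z}})+Q(\hat{\mathbf{z}})+z_dB(\hat{\mathbf{z}})$ for Laurent polynomials $A,Q,B$ invariant under $z_j\mapsto 1/z_j$ for each $j\le d-1$. $\mathbf{1}=(1,\dots,1)$. For $1\le k\le d$, $b_k=\sum_{\mathbf{i}\in\mathcal{S},\,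 i_k=1} w_{\mathbf{i}}$ is the total weight of steps moving forward in coordinate $k$. -}

module Defs where

open import Data.Empty using (⊥-elim)
open import Data.Fin.Base using (Fin; fromℕ)
open import Data.Integer.Base as ℤ using (ℤ; +_; -[1+_])
import Data.Integer.Properties as ℤP
open import Data.List.Base as List using (List; []; _∷_)
open import Data.List.Membership.Propositional using (_∈_; _∉_)
open import Data.List.Membership.Propositional.Properties using (∈-filter⁺)
open import Data.List.Relation.Unary.Any using (here)
open import Data.List.Relation.Unary.Unique.Propositional using (Unique)
open import Data.Nat.Base as ℕ using (ℕ; zero; suc; NonZero; z≤n; s≤s)
import Data.Nat.Properties as ℕP
open import Data.Nat.Solver using () renaming (module +-*-Solver to ℕ-Solver)
open import Data.Product.Base using (∃-syntax; _×_; _,_; proj₁; proj₂)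
open import Data.Rational.Base as ℚ using (ℚ; 0ℚ; 1ℚ; ½)
import Data.Rational.Properties as ℚP
open import Data.Rational.Solver using () renaming (module +-*-Solver to ℚ-Solver)
import Data.Rational.Unnormalised.Base as ℚᵘ
import Data.Rational.Unnormalised.Properties as ℚᵘP
open import Data.Sum.Base using (inj₁; inj₂)
open import Data.Vec.Base as Vec using (Vec; []; _∷_)
open import Data.Vec.Relation.Unary.All using (All; all?)
open import Relation.Binary.Definitions using (DecidableEquality)
open import Relation.Binary.PropositionalEquality
  using (_≡_; refl; sym; trans; cong; cong₂; subst; subst₂)
open import Relation.Nullary.Decidable using (Dec; yes; no; _×-dec_)

module RationalLemmas where
  *-mono-≤ : ∀ {a b c d} → 0ℚ ℚ.≤ a → a ℚ.≤ b → 0ℚ ℚ.≤ c → c ℚ.≤ d →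
             a ℚ.* c ℚ.≤ b ℚ.* d
  *-mono-≤ {a} {b} {c} {d} 0≤a a≤b 0≤c c≤d = ℚP.≤-trans
    (ℚP.*-monoʳ-≤-nonNeg c {{ℚ.nonNegative 0≤c}} a≤b)
    (ℚP.*-monoˡ-≤-nonNeg b {{ℚ.nonNegative (ℚP.≤-trans 0≤a a≤b)}} c≤d)

  *-pos : ∀ {a b} → 0ℚ ℚ.< a → 0ℚ ℚ.< b → 0ℚ ℚ.< a ℚ.* b
  *-pos {a} {b} 0<a 0<b =
    ℚP.positive⁻¹ _ {{ℚP.pos*pos⇒pos a {{ℚ.positive 0<a}} b {{ℚ.positive 0<b}}}}

  *-mono-< : ∀ {a b c d} → 0ℚ ℚ.≤ a → a ℚ.< b → 0ℚ ℚ.≤ c → c ℚ.< d →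
             a ℚ.* c ℚ.< b ℚ.* d
  *-mono-< {a} {b} {c} {d} 0≤a a<b 0≤c c<d = ℚP.≤-<-trans
    (ℚP.*-monoʳ-≤-nonNeg c {{ℚ.nonNegative 0≤c}} (ℚP.<⇒≤ a<b))
    (ℚP.*-monoʳ-<-pos b {{ℚ.positive (ℚP.≤-<-trans 0≤a a<b)}} c<d)

  sq-cancel-< : ∀ {a b} → 0ℚ ℚ.≤ b → a ℚ.* a ℚ.< b ℚ.* b → a ℚ.< b
  sq-cancel-< 0≤b a²<b² = ℚP.≰⇒> λ b≤a →
    ℚP.<-irrefl refl (ℚP.<-≤-trans a²<b² (*-mono-≤ 0≤b b≤a 0≤b b≤a))

  half-pos : ∀ {ε} → 0ℚ ℚ.< ε → 0ℚ ℚ.< ½ ℚ.* ε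
  half-pos = *-pos (ℚP.positive⁻¹ ½)

  half+half : ∀ ε → ½ ℚ.* ε ℚ.+ ½ ℚ.* ε ≡ ε
  half+half = solve 1 (λ e → con ½ :* e :+ con ½ :* e := e) refl
    where open ℚ-Solver

  +-pos : ∀ {a b} → 0ℚ ℚ.< a → 0ℚ ℚ.< b → 0ℚ ℚ.< a ℚ.+ b
  +-pos = ℚP.+-mono-<

  1/-pos : ∀ {a} (0<a : 0ℚ ℚ.< a) → 0ℚ ℚ.< (ℚ.1/ a) {{ℚ.>-nonZero 0<a}}
  1/-pos {a} 0<a = ℚP.positive⁻¹ _ {{ℚP.1/pos⇒pos a {{ℚ.positive 0<a}}}}

  1/-anti : ∀ {a b} (0<a : 0ℚ ℚ.< a) (0<b : 0ℚ ℚ.< b) → a ℚ.≤ b →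
            (ℚ.1/ b) {{ℚ.>-nonZero 0<b}} ℚ.≤ (ℚ.1/ a) {{ℚ.>-nonZero 0<a}}
  1/-anti {a} {b} 0<a 0<b a≤b = subst₂ ℚ._≤_ eq₁ eq₂
      (*-mono-≤ (ℚP.<⇒≤ 0<a) a≤b (ℚP.<⇒≤ 0<uv) (ℚP.≤-refl {u ℚ.* v}))
    where
    instance
      nza : ℚ.NonZero a
      nza = ℚ.>-nonZero 0<a
      nzb : ℚ.NonZero b
      nzb = ℚ.>-nonZero 0<b
    u = ℚ.1/ a
    v = ℚ.1/ b
    0<uv : 0ℚ ℚ.< u ℚ.* v
    0<uv = *-pos (1/-pos 0<a) (1/-pos 0<b)
    eq₁ : a ℚ.* (u ℚ.* v) ≡ v
    eq₁ = trans (sym (ℚP.*-assoc a u v))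
            (trans (cong (ℚ._* v) (ℚP.*-inverseʳ a)) (ℚP.*-identityˡ v))
    eq₂ : b ℚ.* (u ℚ.* v) ≡ u
    eq₂ = trans (cong (b ℚ.*_) (ℚP.*-comm u v))
            (trans (sym (ℚP.*-assoc b v u))
              (trans (cong (ℚ._* u) (ℚP.*-inverseʳ b)) (ℚP.*-identityˡ u)))

  ≤-move : ∀ {p q r} → p ℚ.≤ q ℚ.+ r → p ℚ.- q ℚ.≤ r
  ≤-move {p} {q} {r} h = ℚP.≤-trans (ℚP.+-monoˡ-≤ (ℚ.- q) h)
    (ℚP.≤-reflexive (solve 2 (λ q r → q :+ r :- q := r) refl q r))
    where open ℚ-Solver

  <-move : ∀ {p q r} → p ℚ.< q ℚ.+ r → p ℚ.- q ℚ.< r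
  <-move {p} {q} {r} h = ℚP.<-≤-trans (ℚP.+-monoˡ-< (ℚ.- q) h)
    (ℚP.≤-reflexive (solve 2 (λ q r → q :+ r :- q := r) refl q r))
    where open ℚ-Solver

  neg-sub : ∀ p q → ℚ.- (p ℚ.- q) ≡ q ℚ.- p
  neg-sub = solve 2 (λ p q → :- (p :- q) := q :- p) refl
    where open ℚ-Solver

  p≤∣p∣ : ∀ p → p ℚ.≤ ℚ.∣ p ∣
  p≤∣p∣ p with ℚP.≤-total 0ℚ p
  ... | inj₁ 0≤p = ℚP.≤-reflexive (sym (ℚP.0≤p⇒∣p∣≡p 0≤p))
  ... | inj₂ p≤0 = ℚP.≤-trans p≤0 (ℚP.0≤∣p∣ p)

  ∣-∣-comm : ∀ p q → ℚ.∣ p ℚ.- q ∣ ≡ ℚ.∣ q ℚ.- p ∣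
  ∣-∣-comm p q = trans (sym (ℚP.∣-p∣≡∣p∣ _)) (cong ℚ.∣_∣ (neg-sub p q))

  ∣-∣-< : ∀ {p q ε} → p ℚ.< q ℚ.+ ε → q ℚ.< p ℚ.+ ε → ℚ.∣ p ℚ.- q ∣ ℚ.< ε
  ∣-∣-< {p} {q} h₁ h₂ with ℚP.∣p∣≡p∨∣p∣≡-p (p ℚ.- q)
  ... | inj₁ eq = subst (ℚ._< _) (sym eq) (<-move h₁)
  ... | inj₂ eq = subst (ℚ._< _) (sym (trans eq (neg-sub p q))) (<-move h₂)

  ∣-∣-≤ : ∀ {p q ε} → p ℚ.≤ q ℚ.+ ε → q ℚ.≤ p ℚ.+ ε → ℚ.∣ p ℚ.- q ∣ ℚ.≤ ε
  ∣-∣-≤ {p} {q} h₁ h₂ with ℚP.∣p∣≡p∨∣p∣≡-p (p ℚ.- q)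
  ... | inj₁ eq = subst (ℚ._≤ _) (sym eq) (≤-move h₁)
  ... | inj₂ eq = subst (ℚ._≤ _) (sym (trans eq (neg-sub p q))) (≤-move h₂)

  ∣-∣-unfold : ∀ p q → p ℚ.≤ q ℚ.+ ℚ.∣ p ℚ.- q ∣
  ∣-∣-unfold p q = subst (ℚ._≤ q ℚ.+ ℚ.∣ p ℚ.- q ∣)
    (solve 2 (λ p q → q :+ (p :- q) := p) refl p q)
    (ℚP.+-monoʳ-≤ q (p≤∣p∣ (p ℚ.- q)))
    where open ℚ-Solver

  ∣∣-unfold : ∀ p q → ℚ.∣ p ∣ ℚ.≤ ℚ.∣ q ∣ ℚ.+ ℚ.∣ p ℚ.- q ∣
  ∣∣-unfold p q = subst (ℚ._≤ ℚ.∣ q ∣ ℚ.+ ℚ.∣ p ℚ.- q ∣)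
    (cong ℚ.∣_∣ (solve 2 (λ p q → q :+ (p :- q) := p) refl p q))
    (ℚP.∣p+q∣≤∣p∣+∣q∣ q (p ℚ.- q))
    where open ℚ-Solver

  ∣∣-lipschitz : ∀ p q → ℚ.∣ ℚ.∣ p ∣ ℚ.- ℚ.∣ q ∣ ∣ ℚ.≤ ℚ.∣ p ℚ.- q ∣
  ∣∣-lipschitz p q = ∣-∣-≤ (∣∣-unfold p q)
    (subst (λ t → ℚ.∣ q ∣ ℚ.≤ ℚ.∣ p ∣ ℚ.+ t) (∣-∣-comm q p) (∣∣-unfold q p))

  /-mono-≤ : ∀ a b c d .{{_ : NonZero b}} .{{_ : NonZero d}} →
             a ℕ.* d ℕ.≤ c ℕ.* b → + a ℚ./ b ℚ.≤ + c ℚ./ d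
  /-mono-≤ a (suc b) c (suc d) h = ℚP.toℚᵘ-cancel-≤
    (ℚᵘP.≤-respˡ-≃ (ℚᵘP.≃-sym (ℚP.toℚᵘ-fromℚᵘ (ℚᵘ.mkℚᵘ (+ a) b)))
      (ℚᵘP.≤-respʳ-≃ (ℚᵘP.≃-sym (ℚP.toℚᵘ-fromℚᵘ (ℚᵘ.mkℚᵘ (+ c) d)))
        (ℚᵘ.*≤* (subst₂ ℤ._≤_ (ℤP.pos-* a (suc d)) (ℤP.pos-* c (suc b)) (ℤ.+≤+ h)))))

  /-mono-< : ∀ a b c d .{{_ : NonZero b}} .{{_ : NonZero d}} →
             a ℕ.* d ℕ.< c ℕ.* b → + a ℚ./ b ℚ.< + c ℚ./ d
  /-mono-< a (suc b) c (suc d) h = ℚP.toℚᵘ-cancel-<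
    (ℚᵘP.<-respˡ-≃ (ℚᵘP.≃-sym (ℚP.toℚᵘ-fromℚᵘ (ℚᵘ.mkℚᵘ (+ a) b)))
      (ℚᵘP.<-respʳ-≃ (ℚᵘP.≃-sym (ℚP.toℚᵘ-fromℚᵘ (ℚᵘ.mkℚᵘ (+ c) d)))
        (ℚᵘ.*<* (subst₂ ℤ._<_ (ℤP.pos-* a (suc d)) (ℤP.pos-* c (suc b)) (ℤ.+<+ h)))))

  /-* : ∀ a b c d → (+ a ℚ./ suc b) ℚ.* (+ c ℚ./ suc d) ≡ + (a ℕ.* c) ℚ./ (suc b ℕ.* suc d)
  /-* a b c d = ℚP.toℚᵘ-injective
    (ℚᵘP.≃-trans (ℚP.toℚᵘ-homo-* (+ a ℚ./ suc b) (+ c ℚ./ suc d))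
      (ℚᵘP.≃-trans (ℚᵘP.*-cong (ℚP.toℚᵘ-fromℚᵘ (ℚᵘ.mkℚᵘ (+ a) b)) (ℚP.toℚᵘ-fromℚᵘ (ℚᵘ.mkℚᵘ (+ c) d)))
        (ℚᵘP.≃-trans (ℚᵘP.≃-reflexive (cong (λ z → ℚᵘ.mkℚᵘ z _) (sym (ℤP.pos-* a c))))
        (ℚᵘP.≃-sym (ℚP.toℚᵘ-fromℚᵘ (ℚᵘ.mkℚᵘ (+ (a ℕ.* c)) (d ℕ.+ b ℕ.* suc d)))))))

  /-suc : ∀ a b → + suc a ℚ./ suc b ≡ (+ a ℚ./ suc b) ℚ.+ (+ 1 ℚ./ suc b)
  /-suc a b = ℚP.toℚᵘ-injective
    (ℚᵘP.≃-trans (ℚP.toℚᵘ-fromℚᵘ (ℚᵘ.mkℚᵘ (+ suc a) b))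
      (ℚᵘP.≃-trans (ℚᵘ.*≡* eq)
        (ℚᵘP.≃-sym (ℚᵘP.≃-trans (ℚP.toℚᵘ-homo-+ (+ a ℚ./ suc b) (+ 1 ℚ./ suc b))
          (ℚᵘP.+-cong (ℚP.toℚᵘ-fromℚᵘ (ℚᵘ.mkℚᵘ (+ a) b)) (ℚP.toℚᵘ-fromℚᵘ (ℚᵘ.mkℚᵘ (+ 1) b)))))))
    where
    open import Data.Integer.Solver using () renaming (module +-*-Solver to ℤ-Solver)
    open ℤ-Solver
    eq : + suc a ℤ.* + (suc b ℕ.* suc b) ≡ (+ a ℤ.* + suc b ℤ.+ + 1 ℤ.* + suc b) ℤ.* + suc b
    eq = trans (cong₂ ℤ._*_ (ℤP.pos-+ 1 a) (ℤP.pos-* (suc b) (suc b)))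
      (solve 2 (λ a b → (con (+ 1) :+ a) :* (b :* b) := (a :* b :+ con (+ 1) :* b) :* b)
        refl (+ a) (+ suc b))

  0≤/ : ∀ a b .{{_ : NonZero b}} → 0ℚ ℚ.≤ + a ℚ./ b
  0≤/ a b = /-mono-≤ 0 1 a b z≤n

  0</ : ∀ a b .{{_ : NonZero b}} → 0ℚ ℚ.< + suc a ℚ./ b
  0</ a b = /-mono-< 0 1 (suc a) b (s≤s z≤n)

  archimedean : ∀ {ε} → 0ℚ ℚ.< ε → ∃[ N ] ∀ n → N ℕ.≤ n → + 1 ℚ./ suc n ℚ.< ε
  archimedean {ε@(ℚ.mkℚ (+ zero) d c)} 0<ε = ⊥-elim (ℚP.<⇒≢ 0<ε (sym (ℚP.↥p≡0⇒p≡0 ε refl)))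
  archimedean {ε@(ℚ.mkℚ (+ suc a) d c)} 0<ε = suc d , λ n d<n →
    subst (+ 1 ℚ./ suc n ℚ.<_) (ℚP.↥p/↧p≡p ε)
      (/-mono-< 1 (suc n) (suc a) (suc d)
        (ℕP.≤-trans (s≤s (subst (ℕ._≤ n) (sym (ℕP.*-identityˡ (suc d))) d<n))
          (ℕP.m≤m+n (suc n) (a ℕ.* suc n))))
  archimedean {ε@(ℚ.mkℚ -[1+ a ] d c)} 0<ε =
    ⊥-elim (ℚP.<-asym 0<ε (ℚP.negative⁻¹ ε))

  sqrt-modulus : ∀ {ε} → 0ℚ ℚ.< ε → ∃[ δ ] 0ℚ ℚ.< δ × δ ℚ.* δ ℚ.≤ ε
  sqrt-modulus {ε} 0<ε with ℚP.≤-total ε 1ℚ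
  ... | inj₁ ε≤1 = ε , 0<ε , ℚP.≤-trans
    (*-mono-≤ (ℚP.<⇒≤ 0<ε) ℚP.≤-refl (ℚP.<⇒≤ 0<ε) ε≤1)
    (ℚP.≤-reflexive (ℚP.*-identityʳ ε))
  ... | inj₂ 1≤ε = 1ℚ , ℚP.positive⁻¹ 1ℚ , 1≤ε

open RationalLemmas

isqrt : ℕ → ℕ
isqrt zero    = zero
isqrt (suc n) with suc (isqrt n) ℕ.* suc (isqrt n) ℕP.≤? suc n
... | yes _ = suc (isqrt n)
... | no  _ = isqrt n

module IsqrtLemmas where
  isqrt-≤ : ∀ n → isqrt n ℕ.* isqrt n ℕ.≤ n
  isqrt-≤ zero = z≤n
  isqrt-≤ (suc n) with suc (isqrt n) ℕ.* suc (isqrt n) ℕP.≤? suc n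
  ... | yes p = p
  ... | no  _ = ℕP.m≤n⇒m≤1+n (isqrt-≤ n)

  isqrt-< : ∀ n → n ℕ.< suc (isqrt n) ℕ.* suc (isqrt n)
  isqrt-< zero = s≤s z≤n
  isqrt-< (suc n) with suc (isqrt n) ℕ.* suc (isqrt n) ℕP.≤? suc n
  ... | yes p = ℕP.≤-<-trans (isqrt-< n)
    (ℕP.*-mono-< (ℕP.n<1+n (suc (isqrt n))) (ℕP.n<1+n (suc (isqrt n))))
  ... | no ¬p = ℕP.≰⇒> ¬p

open IsqrtLemmas

-- For |q| = a/b in lowest terms, √|q| = √(a b (n+1)²) / (b (n+1)); rounding the
-- integer root down gives an approximation from below with error at most 1/(n+1).
sqrtℚ : ℕ → ℚ → ℚ
sqrtℚ n q = + isqrt (ℤ.∣ ℚ.↥ q ∣ ℕ.* ℚ.↧ₙ q ℕ.* (suc n ℕ.* suc n)) ℚ./ (ℚ.↧ₙ q ℕ.* suc n)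

module SqrtℚLemmas where
  0≤sqrtℚ : ∀ n q → 0ℚ ℚ.≤ sqrtℚ n q
  0≤sqrtℚ n q =
    0≤/ (isqrt (ℤ.∣ ℚ.↥ q ∣ ℕ.* ℚ.↧ₙ q ℕ.* (suc n ℕ.* suc n))) (ℚ.↧ₙ q ℕ.* suc n)

  sqrtℚ-≤ : ∀ n q → sqrtℚ n q ℚ.* sqrtℚ n q ℚ.≤ ℚ.∣ q ∣
  sqrtℚ-≤ n q@(ℚ.mkℚ i d c) = subst₂ ℚ._≤_ (sym (/-* s (n ℕ.+ d ℕ.* suc n) s (n ℕ.+ d ℕ.* suc n)))
      (ℚP.↥p/↧p≡p ℚ.∣ q ∣)
      (/-mono-≤ (s ℕ.* s) (D ℕ.* D) a b
        (ℕP.≤-trans (ℕP.*-monoˡ-≤ b (isqrt-≤ (a ℕ.* b ℕ.* (suc n ℕ.* suc n))))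
          (ℕP.≤-reflexive (solve 3 (λ a b k → a :* b :* (k :* k) :* b := a :* (b :* k :* (b :* k))) refl a b (suc n)))))
    where
    open ℕ-Solver
    a = ℤ.∣ i ∣
    b = suc d
    D = b ℕ.* suc n
    s = isqrt (a ℕ.* b ℕ.* (suc n ℕ.* suc n))

  sqrtℚ-< : ∀ n q → ℚ.∣ q ∣ ℚ.<
    (sqrtℚ n q ℚ.+ + 1 ℚ./ suc n) ℚ.* (sqrtℚ n q ℚ.+ + 1 ℚ./ suc n)
  sqrtℚ-< n q@(ℚ.mkℚ i d c) = ℚP.<-≤-trans step₁ (*-mono-≤ 0≤t t≤ 0≤t t≤)
    where
    open ℕ-Solver
    a = ℤ.∣ i ∣
    b = suc d
    e = n ℕ.+ d ℕ.* suc n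
    D = b ℕ.* suc n
    s = isqrt (a ℕ.* b ℕ.* (suc n ℕ.* suc n))
    t = + suc s ℚ./ suc e
    0≤t : 0ℚ ℚ.≤ t
    0≤t = 0≤/ (suc s) (suc e)
    t≤ : t ℚ.≤ sqrtℚ n q ℚ.+ + 1 ℚ./ suc n
    t≤ = ℚP.≤-trans (ℚP.≤-reflexive (/-suc s e))
      (ℚP.+-monoʳ-≤ (sqrtℚ n q) (/-mono-≤ 1 (suc e) 1 (suc n)
        (ℕP.*-monoʳ-≤ 1 (ℕP.m≤m+n (suc n) (d ℕ.* suc n)))))
    step₁ : ℚ.∣ q ∣ ℚ.< t ℚ.* t
    step₁ = subst₂ ℚ._<_ (ℚP.↥p/↧p≡p ℚ.∣ q ∣) (sym (/-* (suc s) e (suc s) e))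
      (/-mono-< a b (suc s ℕ.* suc s) (D ℕ.* D)
        (ℕP.≤-<-trans (ℕP.≤-reflexive
            (solve 3 (λ a b k → a :* (b :* k :* (b :* k)) := a :* b :* (k :* k) :* b) refl a b (suc n)))
          (ℕP.*-monoˡ-< b (isqrt-< (a ℕ.* b ℕ.* (suc n ℕ.* suc n))))))

open SqrtℚLemmas

-- Real numbers are Cauchy sequences of rationals, with equality _≃_ rather than _≡_.

IsCauchy : (ℕ → ℚ) → Set
IsCauchy x = ∀ ε → 0ℚ ℚ.< ε →
  ∃[ N ] ∀ m n → N ℕ.≤ m → N ℕ.≤ n → ℚ.∣ x m ℚ.- x n ∣ ℚ.< ε

record ℝ : Set where
  constructor real
  field
    seq      : ℕ → ℚ
    isCauchy : IsCauchy seq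

open ℝ public

infix 4 _≃_ _<_

_≃_ : ℝ → ℝ → Set
x ≃ y = ∀ ε → 0ℚ ℚ.< ε → ∃[ N ] ∀ n → N ℕ.≤ n → ℚ.∣ seq x n ℚ.- seq y n ∣ ℚ.< ε

_<_ : ℝ → ℝ → Set
x < y = ∃[ ε ] 0ℚ ℚ.< ε × ∃[ N ] ∀ n → N ℕ.≤ n → seq x n ℚ.+ ε ℚ.≤ seq y n

fromℚ : ℚ → ℝ
fromℚ q = real (λ _ → q) λ ε 0<ε → 0 , λ _ _ _ _ →
  subst (ℚ._< ε) (cong ℚ.∣_∣ (sym (ℚP.+-inverseʳ q))) 0<ε

0ℝ 1ℝ : ℝ
0ℝ = fromℚ 0ℚ
1ℝ = fromℚ 1ℚ

infix  8 -_
infixl 7 _*_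
infixl 6 _+_ _-_

_+_ : ℝ → ℝ → ℝ
x + y = real (λ n → seq x n ℚ.+ seq y n) λ ε 0<ε →
  let (M , hM) = isCauchy x (½ ℚ.* ε) (half-pos 0<ε)
      (N , hN) = isCauchy y (½ ℚ.* ε) (half-pos 0<ε)
  in M ℕ.⊔ N , λ m n m≥ n≥ →
    ℚP.≤-<-trans (split (seq x m) (seq y m) (seq x n) (seq y n))
      (subst (_ ℚ.<_) (half+half ε)
        (ℚP.+-mono-< (hM m n (ℕP.m⊔n≤o⇒m≤o M N m≥) (ℕP.m⊔n≤o⇒m≤o M N n≥))
                     (hN m n (ℕP.m⊔n≤o⇒n≤o M N m≥) (ℕP.m⊔n≤o⇒n≤o M N n≥))))
  where
  split : ∀ a b c d → ℚ.∣ a ℚ.+ b ℚ.- (c ℚ.+ d) ∣ ℚ.≤ ℚ.∣ a ℚ.- c ∣ ℚ.+ ℚ.∣ b ℚ.- d ∣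
  split a b c d = ℚP.≤-trans
    (ℚP.≤-reflexive (cong ℚ.∣_∣
      (solve 4 (λ a b c d → a :+ b :- (c :+ d) := (a :- c) :+ (b :- d)) refl a b c d)))
    (ℚP.∣p+q∣≤∣p∣+∣q∣ (a ℚ.- c) (b ℚ.- d))
    where open ℚ-Solver

-_ : ℝ → ℝ
- x = real (λ n → ℚ.- seq x n) λ ε 0<ε →
  let (N , h) = isCauchy x ε 0<ε
  in N , λ m n m≥ n≥ → subst (ℚ._< ε)
    (trans (∣-∣-comm (seq x m) (seq x n)) (cong ℚ.∣_∣ (eq (seq x m) (seq x n))))
    (h m n m≥ n≥)
  where
  open ℚ-Solver
  eq : ∀ a b → b ℚ.- a ≡ (ℚ.- a) ℚ.- (ℚ.- b)
  eq = solve 2 (λ a b → b :- a := :- a :- :- b) refl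

_-_ : ℝ → ℝ → ℝ
x - y = x + - y

∣_∣ : ℝ → ℝ
∣ x ∣ = real (λ n → ℚ.∣ seq x n ∣) λ ε 0<ε →
  let (N , h) = isCauchy x ε 0<ε
  in N , λ m n m≥ n≥ → ℚP.≤-<-trans (∣∣-lipschitz (seq x m) (seq x n)) (h m n m≥ n≥)

module BoundLemmas where
  bounded : (x : ℝ) → ∃[ B ] 0ℚ ℚ.< B × ∃[ N ] ∀ n → N ℕ.≤ n → ℚ.∣ seq x n ∣ ℚ.≤ B
  bounded x with isCauchy x 1ℚ (ℚP.positive⁻¹ 1ℚ)
  ... | N , h = ℚ.∣ seq x N ∣ ℚ.+ 1ℚ
      , ℚP.+-mono-≤-< (ℚP.0≤∣p∣ (seq x N)) (ℚP.positive⁻¹ 1ℚ)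
      , N , λ n n≥ → ℚP.≤-trans (∣∣-unfold (seq x n) (seq x N))
                       (ℚP.+-monoʳ-≤ ℚ.∣ seq x N ∣ (ℚP.<⇒≤ (h n N n≥ ℕP.≤-refl)))

  divide : ∀ {B} (0<B : 0ℚ ℚ.< B) ε → B ℚ.* (ε ℚ.* (ℚ.1/ B) {{ℚ.>-nonZero 0<B}}) ≡ ε
  divide {B} 0<B ε = trans (cong (B ℚ.*_) (ℚP.*-comm ε _))
    (trans (sym (ℚP.*-assoc B _ ε))
      (trans (cong (ℚ._* ε) (ℚP.*-inverseʳ B {{ℚ.>-nonZero 0<B}})) (ℚP.*-identityˡ ε)))

open BoundLemmas

_*_ : ℝ → ℝ → ℝ
x * y = real (λ n → seq x n ℚ.* seq y n) cauchy
  where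
  split : ∀ a b c d → ℚ.∣ a ℚ.* b ℚ.- c ℚ.* d ∣ ℚ.≤
                      ℚ.∣ a ∣ ℚ.* ℚ.∣ b ℚ.- d ∣ ℚ.+ ℚ.∣ d ∣ ℚ.* ℚ.∣ a ℚ.- c ∣
  split a b c d = ℚP.≤-trans
    (ℚP.≤-reflexive (cong ℚ.∣_∣
      (solve 4 (λ a b c d → a :* b :- c :* d := a :* (b :- d) :+ d :* (a :- c)) refl a b c d)))
    (ℚP.≤-trans (ℚP.∣p+q∣≤∣p∣+∣q∣ (a ℚ.* (b ℚ.- d)) (d ℚ.* (a ℚ.- c)))
      (ℚP.≤-reflexive (cong₂ ℚ._+_ (ℚP.∣p*q∣≡∣p∣*∣q∣ a (b ℚ.- d)) (ℚP.∣p*q∣≡∣p∣*∣q∣ d (a ℚ.- c)))))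
    where open ℚ-Solver
  bound : ∀ {B ε} p r (0<B : 0ℚ ℚ.< B) → ℚ.∣ p ∣ ℚ.≤ B →
          ℚ.∣ r ∣ ℚ.< ε ℚ.* (ℚ.1/ B) {{ℚ.>-nonZero 0<B}} → ℚ.∣ p ∣ ℚ.* ℚ.∣ r ∣ ℚ.< ε
  bound {B} {ε} p r 0<B p≤ r< = ℚP.≤-<-trans
    (*-mono-≤ (ℚP.0≤∣p∣ p) p≤ (ℚP.0≤∣p∣ r) ℚP.≤-refl)
    (subst (B ℚ.* ℚ.∣ r ∣ ℚ.<_) (divide 0<B ε)
      (ℚP.*-monoʳ-<-pos B {{ℚ.positive 0<B}} r<))
  combine : ∀ ε →
    (∃[ K ] ∀ m n → K ℕ.≤ m → K ℕ.≤ n → ℚ.∣ seq x m ∣ ℚ.* ℚ.∣ seq y m ℚ.- seq y n ∣ ℚ.< ½ ℚ.* ε) →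
    (∃[ L ] ∀ m n → L ℕ.≤ m → L ℕ.≤ n → ℚ.∣ seq y n ∣ ℚ.* ℚ.∣ seq x m ℚ.- seq x n ∣ ℚ.< ½ ℚ.* ε) →
    ∃[ N ] ∀ m n → N ℕ.≤ m → N ℕ.≤ n → ℚ.∣ seq x m ℚ.* seq y m ℚ.- seq x n ℚ.* seq y n ∣ ℚ.< ε
  combine ε (K , hK) (L , hL) = K ℕ.⊔ L , λ m n m≥ n≥ →
    ℚP.≤-<-trans (split (seq x m) (seq y m) (seq x n) (seq y n))
      (subst (ℚ.∣ seq x m ∣ ℚ.* ℚ.∣ seq y m ℚ.- seq y n ∣ ℚ.+ ℚ.∣ seq y n ∣ ℚ.* ℚ.∣ seq x m ℚ.- seq x n ∣ ℚ.<_)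
        (half+half ε)
        (ℚP.+-mono-< (hK m n (ℕP.m⊔n≤o⇒m≤o K L m≥) (ℕP.m⊔n≤o⇒m≤o K L n≥))
                     (hL m n (ℕP.m⊔n≤o⇒n≤o K L m≥) (ℕP.m⊔n≤o⇒n≤o K L n≥))))
  left : ∀ ε → 0ℚ ℚ.< ε →
    (∃[ B ] 0ℚ ℚ.< B × ∃[ N ] ∀ n → N ℕ.≤ n → ℚ.∣ seq x n ∣ ℚ.≤ B) →
    ∃[ K ] ∀ m n → K ℕ.≤ m → K ℕ.≤ n → ℚ.∣ seq x m ∣ ℚ.* ℚ.∣ seq y m ℚ.- seq y n ∣ ℚ.< ε
  left ε 0<ε (B , 0<B , M , hM) =
    let (N , hN) = isCauchy y (ε ℚ.* (ℚ.1/ B) {{ℚ.>-nonZero 0<B}}) (*-pos 0<ε (1/-pos 0<B))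
    in M ℕ.⊔ N , λ m n m≥ n≥ →
      bound (seq x m) (seq y m ℚ.- seq y n) 0<B (hM m (ℕP.m⊔n≤o⇒m≤o M N m≥))
        (hN m n (ℕP.m⊔n≤o⇒n≤o M N m≥) (ℕP.m⊔n≤o⇒n≤o M N n≥))
  right : ∀ ε → 0ℚ ℚ.< ε →
    (∃[ B ] 0ℚ ℚ.< B × ∃[ N ] ∀ n → N ℕ.≤ n → ℚ.∣ seq y n ∣ ℚ.≤ B) →
    ∃[ L ] ∀ m n → L ℕ.≤ m → L ℕ.≤ n → ℚ.∣ seq y n ∣ ℚ.* ℚ.∣ seq x m ℚ.- seq x n ∣ ℚ.< ε
  right ε 0<ε (B , 0<B , M , hM) =
    let (N , hN) = isCauchy x (ε ℚ.* (ℚ.1/ B) {{ℚ.>-nonZero 0<B}}) (*-pos 0<ε (1/-pos 0<B))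
    in M ℕ.⊔ N , λ m n m≥ n≥ →
      bound (seq y n) (seq x m ℚ.- seq x n) 0<B (hM n (ℕP.m⊔n≤o⇒m≤o M N n≥))
        (hN m n (ℕP.m⊔n≤o⇒n≤o M N m≥) (ℕP.m⊔n≤o⇒n≤o M N n≥))
  cauchy : IsCauchy (λ n → seq x n ℚ.* seq y n)
  cauchy ε 0<ε = combine ε (left (½ ℚ.* ε) (half-pos 0<ε) (bounded x))
                           (right (½ ℚ.* ε) (half-pos 0<ε) (bounded y))

_⟶_ : (ℕ → ℝ) → ℝ → Set
u ⟶ l = ∀ ε → 0ℝ < ε → ∃[ N ] ∀ n → N ℕ.≤ n → ∣ u n - l ∣ < ε

infix 4 _,⁺_

record ℝ⁺ : Set where
  constructor _,⁺_
  field
    val      : ℝ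
    positive : 0ℝ < val

open ℝ⁺ public

module PositivityLemmas where
  eventually : ∀ {x} → 0ℝ < x → ∃[ ε ] 0ℚ ℚ.< ε × ∃[ N ] ∀ n → N ℕ.≤ n → ε ℚ.≤ seq x n
  eventually {x} (ε , 0<ε , N , h) = ε , 0<ε , N , λ n n≥ →
    subst (ℚ._≤ seq x n) (ℚP.+-identityˡ ε) (h n n≥)

  mk-pos : ∀ {x ε} → 0ℚ ℚ.< ε → ∀ N → (∀ n → N ℕ.≤ n → ε ℚ.≤ seq x n) → 0ℝ < x
  mk-pos {x} {ε} 0<ε N h = ε , 0<ε , N , λ n n≥ →
    subst (ℚ._≤ seq x n) (sym (ℚP.+-identityˡ ε)) (h n n≥)

  +-positive : ∀ {x y} → 0ℝ < x → 0ℝ < y → 0ℝ < x + y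
  +-positive {x} {y} 0<x 0<y =
    let (_ , 0<δ , M , hM) = eventually {x} 0<x
        (_ , 0<ε , N , hN) = eventually {y} 0<y
    in mk-pos {x + y} (+-pos 0<δ 0<ε) (M ℕ.⊔ N) λ n n≥ →
      ℚP.+-mono-≤ (hM n (ℕP.m⊔n≤o⇒m≤o M N n≥)) (hN n (ℕP.m⊔n≤o⇒n≤o M N n≥))

  *-positive : ∀ {x y} → 0ℝ < x → 0ℝ < y → 0ℝ < x * y
  *-positive {x} {y} 0<x 0<y =
    let (_ , 0<δ , M , hM) = eventually {x} 0<x
        (_ , 0<ε , N , hN) = eventually {y} 0<y
    in mk-pos {x * y} (*-pos 0<δ 0<ε) (M ℕ.⊔ N) λ n n≥ →
      *-mono-≤ (ℚP.<⇒≤ 0<δ) (hM n (ℕP.m⊔n≤o⇒m≤o M N n≥))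
               (ℚP.<⇒≤ 0<ε) (hN n (ℕP.m⊔n≤o⇒n≤o M N n≥))

open PositivityLemmas

fromℚ⁺ : (q : ℚ) → 0ℚ ℚ.< q → ℝ⁺
fromℚ⁺ q 0<q = fromℚ q ,⁺ mk-pos {fromℚ q} 0<q 0 λ _ _ → ℚP.≤-refl

fromℕ⁺ : (n : ℕ) .{{_ : NonZero n}} → ℝ⁺
fromℕ⁺ (suc n) = fromℚ⁺ (+ suc n ℚ./ 1) (0</ n 1)

1ℝ⁺ : ℝ⁺
1ℝ⁺ = fromℕ⁺ 1

infixl 7 _*⁺_
infixr 8 _^_
infix  9 _⁻¹

_*⁺_ : ℝ⁺ → ℝ⁺ → ℝ⁺
(x ,⁺ 0<x) *⁺ (y ,⁺ 0<y) = x * y ,⁺ *-positive {x} {y} 0<x 0<y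

_^_ : ℝ⁺ → ℕ → ℝ⁺
x ^ zero  = 1ℝ⁺
x ^ suc n = x *⁺ x ^ n

module ReciprocalLemmas where
  1/-diff : ∀ {e a b} (0<e : 0ℚ ℚ.< e) (0<a : 0ℚ ℚ.< a) (0<b : 0ℚ ℚ.< b) → e ℚ.≤ a → e ℚ.≤ b →
    ℚ.∣ (ℚ.1/ a) {{ℚ.>-nonZero 0<a}} ℚ.- (ℚ.1/ b) {{ℚ.>-nonZero 0<b}} ∣ ℚ.≤
    (ℚ.1/ e) {{ℚ.>-nonZero 0<e}} ℚ.* (ℚ.1/ e) {{ℚ.>-nonZero 0<e}} ℚ.* ℚ.∣ a ℚ.- b ∣
  1/-diff {e} {a} {b} 0<e 0<a 0<b e≤a e≤b = ℚP.≤-trans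
      (ℚP.≤-reflexive (trans (cong ℚ.∣_∣ eq) (trans (ℚP.∣p*q∣≡∣p∣*∣q∣ (u ℚ.* v) (b ℚ.- a))
        (cong₂ ℚ._*_ (ℚP.0≤p⇒∣p∣≡p (ℚP.<⇒≤ (*-pos (1/-pos 0<a) (1/-pos 0<b)))) (∣-∣-comm b a)))))
      (*-mono-≤ (ℚP.<⇒≤ (*-pos (1/-pos 0<a) (1/-pos 0<b)))
        (*-mono-≤ (ℚP.<⇒≤ (1/-pos 0<a)) (1/-anti 0<e 0<a e≤a)
                  (ℚP.<⇒≤ (1/-pos 0<b)) (1/-anti 0<e 0<b e≤b))
        (ℚP.0≤∣p∣ (a ℚ.- b)) ℚP.≤-refl)
    where
    open ℚ-Solver
    instance
      nza : ℚ.NonZero a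
      nza = ℚ.>-nonZero 0<a
      nzb : ℚ.NonZero b
      nzb = ℚ.>-nonZero 0<b
    u = ℚ.1/ a
    v = ℚ.1/ b
    eq : u ℚ.- v ≡ u ℚ.* v ℚ.* (b ℚ.- a)
    eq = sym (trans
      (solve 4 (λ a b u v → u :* v :* (b :- a) := u :* (b :* v) :- v :* (a :* u)) refl a b u v)
      (cong₂ (λ s t → u ℚ.* s ℚ.- v ℚ.* t) (ℚP.*-inverseʳ b) (ℚP.*-inverseʳ a)
        ⨾ cong₂ ℚ._-_ (ℚP.*-identityʳ u) (ℚP.*-identityʳ v)))
      where
      infixr 5 _⨾_
      _⨾_ : ∀ {x y z : ℚ} → x ≡ y → y ≡ z → x ≡ z
      _⨾_ = trans

open ReciprocalLemmas

-- The representing sequence is shifted to start where the terms of x are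
-- known to be bounded away from 0.
inverse : (x : ℝ) → ∃[ e ] 0ℚ ℚ.< e × ∃[ N ] (∀ n → N ℕ.≤ n → e ℚ.≤ seq x n) → ℝ⁺
inverse x (e , 0<e , N , h) = y ,⁺ pos (bounded x)
  where
  0<x+ : ∀ n → 0ℚ ℚ.< seq x (N ℕ.+ n)
  0<x+ n = ℚP.<-≤-trans 0<e (h (N ℕ.+ n) (ℕP.m≤m+n N n))
  c = (ℚ.1/ e) {{ℚ.>-nonZero 0<e}} ℚ.* (ℚ.1/ e) {{ℚ.>-nonZero 0<e}}
  0<c : 0ℚ ℚ.< c
  0<c = *-pos (1/-pos 0<e) (1/-pos 0<e)
  y : ℝ
  y = real (λ n → (ℚ.1/ seq x (N ℕ.+ n)) {{ℚ.>-nonZero (0<x+ n)}}) λ ε 0<ε →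
    let (M , hM) = isCauchy x (ε ℚ.* (ℚ.1/ c) {{ℚ.>-nonZero 0<c}}) (*-pos 0<ε (1/-pos 0<c))
    in M , λ m n m≥ n≥ → ℚP.≤-<-trans
      (1/-diff 0<e (0<x+ m) (0<x+ n) (h (N ℕ.+ m) (ℕP.m≤m+n N m)) (h (N ℕ.+ n) (ℕP.m≤m+n N n)))
      (subst (c ℚ.* _ ℚ.<_) (divide 0<c ε)
        (ℚP.*-monoʳ-<-pos c {{ℚ.positive 0<c}}
          (hM (N ℕ.+ m) (N ℕ.+ n) (ℕP.≤-trans m≥ (ℕP.m≤n+m m N)) (ℕP.≤-trans n≥ (ℕP.m≤n+m n N)))))
  pos : ∃[ B ] 0ℚ ℚ.< B × ∃[ M ] (∀ n → M ℕ.≤ n → ℚ.∣ seq x n ∣ ℚ.≤ B) → 0ℝ < y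
  pos (B , 0<B , M , hB) = mk-pos {y} (1/-pos 0<B) M λ n n≥ →
    1/-anti (0<x+ n) 0<B
      (ℚP.≤-trans (p≤∣p∣ (seq x (N ℕ.+ n))) (hB (N ℕ.+ n) (ℕP.≤-trans n≥ (ℕP.m≤n+m n N))))

_⁻¹ : ℝ⁺ → ℝ⁺
(x ,⁺ 0<x) ⁻¹ = inverse x (eventually {x} 0<x)

module SqrtLemmas where
  sqrt-step : ∀ {a b r s k δ} → 0ℚ ℚ.≤ s → 0ℚ ℚ.≤ k → k ℚ.≤ δ →
    r ℚ.* r ℚ.≤ a → b ℚ.< (s ℚ.+ k) ℚ.* (s ℚ.+ k) → a ℚ.≤ b ℚ.+ δ ℚ.* δ →
    r ℚ.< s ℚ.+ (δ ℚ.+ δ)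
  sqrt-step {a} {b} {r} {s} {k} {δ} 0≤s 0≤k k≤δ r²≤a b< a≤ =
    sq-cancel-< (ℚP.+-mono-≤ 0≤s (ℚP.+-mono-≤ 0≤δ 0≤δ))
      (ℚP.≤-<-trans r²≤a (ℚP.≤-<-trans a≤
        (ℚP.<-≤-trans (ℚP.+-monoˡ-< (δ ℚ.* δ) b<)
          (ℚP.≤-trans (ℚP.+-monoˡ-≤ (δ ℚ.* δ) (*-mono-≤ 0≤s+k s+k≤ 0≤s+k s+k≤))
            final))))
    where
    open ℚ-Solver
    0≤δ : 0ℚ ℚ.≤ δ
    0≤δ = ℚP.≤-trans 0≤k k≤δ
    0≤s+k : 0ℚ ℚ.≤ s ℚ.+ k
    0≤s+k = ℚP.+-mono-≤ 0≤s 0≤k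
    s+k≤ : s ℚ.+ k ℚ.≤ s ℚ.+ δ
    s+k≤ = ℚP.+-monoʳ-≤ s k≤δ
    rest : ℚ
    rest = (s ℚ.* δ ℚ.+ s ℚ.* δ) ℚ.+ (δ ℚ.* δ ℚ.+ δ ℚ.* δ)
    0≤ : ∀ {p q} → 0ℚ ℚ.≤ p → 0ℚ ℚ.≤ q → 0ℚ ℚ.≤ p ℚ.* q
    0≤ 0≤p 0≤q = *-mono-≤ ℚP.≤-refl 0≤p ℚP.≤-refl 0≤q
    final : (s ℚ.+ δ) ℚ.* (s ℚ.+ δ) ℚ.+ δ ℚ.* δ ℚ.≤ (s ℚ.+ (δ ℚ.+ δ)) ℚ.* (s ℚ.+ (δ ℚ.+ δ))
    final = subst₂ ℚ._≤_ (ℚP.+-identityʳ _)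
      (solve 2 (λ s d → (s :+ d) :* (s :+ d) :+ d :* d :+ ((s :* d :+ s :* d) :+ (d :* d :+ d :* d))
                        := (s :+ (d :+ d)) :* (s :+ (d :+ d))) refl s δ)
      (ℚP.+-monoʳ-≤ ((s ℚ.+ δ) ℚ.* (s ℚ.+ δ) ℚ.+ δ ℚ.* δ)
        (ℚP.+-mono-≤ {0ℚ} {s ℚ.* δ ℚ.+ s ℚ.* δ} {0ℚ}
          (ℚP.+-mono-≤ (0≤ 0≤s 0≤δ) (0≤ 0≤s 0≤δ))
          (ℚP.+-mono-≤ (0≤ 0≤δ 0≤δ) (0≤ 0≤δ 0≤δ))))

  sqrt-close : ∀ {p q ε} m n → + 1 ℚ./ suc n ℚ.< ½ ℚ.* ε →
    ℚ.∣ ℚ.∣ p ∣ ℚ.- ℚ.∣ q ∣ ∣ ℚ.< (½ ℚ.* ε) ℚ.* (½ ℚ.* ε) →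
    sqrtℚ m p ℚ.< sqrtℚ n q ℚ.+ ε
  sqrt-close {p} {q} {ε} m n k< h =
    subst (λ t → sqrtℚ m p ℚ.< sqrtℚ n q ℚ.+ t) (half+half ε)
      (sqrt-step (0≤sqrtℚ n q) (0≤/ 1 (suc n)) (ℚP.<⇒≤ k<) (sqrtℚ-≤ m p) (sqrtℚ-< n q)
        (ℚP.≤-trans (∣-∣-unfold ℚ.∣ p ∣ ℚ.∣ q ∣) (ℚP.+-monoʳ-≤ ℚ.∣ q ∣ (ℚP.<⇒≤ h))))

  sqrt-cauchy : (x : ℝ) → IsCauchy (λ n → sqrtℚ n (seq x n))
  sqrt-cauchy x ε 0<ε =
    let (M , hM) = isCauchy ∣ x ∣ ((½ ℚ.* ε) ℚ.* (½ ℚ.* ε)) (*-pos (half-pos 0<ε) (half-pos 0<ε))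
        (N , hN) = archimedean (half-pos 0<ε)
    in M ℕ.⊔ N , λ m n m≥ n≥ → ∣-∣-<
      (sqrt-close {seq x m} {seq x n} m n (hN n (ℕP.m⊔n≤o⇒n≤o M N n≥))
        (hM m n (ℕP.m⊔n≤o⇒m≤o M N m≥) (ℕP.m⊔n≤o⇒m≤o M N n≥)))
      (sqrt-close {seq x n} {seq x m} n m (hN m (ℕP.m⊔n≤o⇒n≤o M N m≥))
        (hM n m (ℕP.m⊔n≤o⇒m≤o M N n≥) (ℕP.m⊔n≤o⇒m≤o M N m≥)))

  sqrt-lower : ∀ {δ r k q} → 0ℚ ℚ.≤ r ℚ.+ k → k ℚ.< ½ ℚ.* δ → δ ℚ.* δ ℚ.≤ q →
    q ℚ.< (r ℚ.+ k) ℚ.* (r ℚ.+ k) → ½ ℚ.* δ ℚ.≤ r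
  sqrt-lower {δ} {r} {k} 0≤ k< δ²≤ q< =
    subst₂ ℚ._≤_ (cancel (½ ℚ.* δ) (½ ℚ.* δ)) (cancel r (½ ℚ.* δ))
      (ℚP.+-monoˡ-≤ (ℚ.- (½ ℚ.* δ))
        (subst (ℚ._≤ r ℚ.+ ½ ℚ.* δ) (sym (half+half δ))
          (ℚP.≤-trans (ℚP.<⇒≤ (sq-cancel-< 0≤ (ℚP.≤-<-trans δ²≤ q<)))
            (ℚP.+-monoʳ-≤ r (ℚP.<⇒≤ k<)))))
    where
    open ℚ-Solver
    cancel : ∀ p q → p ℚ.+ q ℚ.+ ℚ.- q ≡ p
    cancel = solve 2 (λ p q → p :+ q :+ :- q := p) refl

open SqrtLemmas

sqrt : ℝ → ℝ
sqrt x = real (λ n → sqrtℚ n (seq x n)) (sqrt-cauchy x)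

module SqrtPositivity where
  sqrt-positive : ∀ {x} → 0ℝ < x → 0ℝ < sqrt x
  sqrt-positive {x} 0<x =
    let (ε , 0<ε , M , hM) = eventually {x} 0<x
        (δ , 0<δ , δ²≤ε)   = sqrt-modulus 0<ε
        (N , hN)           = archimedean (half-pos 0<δ)
    in mk-pos {sqrt x} (half-pos 0<δ) (M ℕ.⊔ N) λ n n≥ →
      sqrt-lower {δ} (ℚP.+-mono-≤ (0≤sqrtℚ n (seq x n)) (0≤/ 1 (suc n)))
        (hN n (ℕP.m⊔n≤o⇒n≤o M N n≥))
        (ℚP.≤-trans δ²≤ε
          (ℚP.≤-trans (hM n (ℕP.m⊔n≤o⇒m≤o M N n≥)) (p≤∣p∣ (seq x n))))
        (sqrtℚ-< n (seq x n))

open SqrtPositivity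

√_ : ℝ⁺ → ℝ⁺
√ (x ,⁺ 0<x) = sqrt x ,⁺ sqrt-positive {x} 0<x

-- leibniz k n = Σ_{j<n} (-1)^j / (2(k+j)+1)
leibniz : ℕ → ℕ → ℚ
leibniz k zero    = 0ℚ
leibniz k (suc n) = + 1 ℚ./ suc (2 ℕ.* k) ℚ.- leibniz (suc k) n

module LeibnizLemmas where
  odd⁻¹ : ℕ → ℚ
  odd⁻¹ k = + 1 ℚ./ suc (2 ℕ.* k)

  odd⁻¹-anti : ∀ {k l} → k ℕ.≤ l → odd⁻¹ l ℚ.≤ odd⁻¹ k
  odd⁻¹-anti {k} {l} k≤l = /-mono-≤ 1 (suc (2 ℕ.* l)) 1 (suc (2 ℕ.* k))
    (ℕP.*-monoʳ-≤ 1 (s≤s (ℕP.*-monoʳ-≤ 2 k≤l)))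

  leibniz-bounds : ∀ k n → 0ℚ ℚ.≤ leibniz k n × leibniz k n ℚ.≤ odd⁻¹ k
  leibniz-bounds k zero = ℚP.≤-refl , 0≤/ 1 (suc (2 ℕ.* k))
  leibniz-bounds k (suc n) with leibniz-bounds (suc k) n
  ... | 0≤t , t≤ =
    subst (ℚ._≤ odd⁻¹ k ℚ.- t) (ℚP.+-inverseʳ t)
      (ℚP.+-monoˡ-≤ (ℚ.- t) (ℚP.≤-trans t≤ (odd⁻¹-anti (ℕP.n≤1+n k)))) ,
    subst (odd⁻¹ k ℚ.- t ℚ.≤_) (ℚP.+-identityʳ (odd⁻¹ k))
      (ℚP.+-monoʳ-≤ (odd⁻¹ k) (ℚP.neg-antimono-≤ 0≤t))
    where t = leibniz (suc k) n

  leibniz-diff : ∀ N k m n → N ℕ.≤ m → N ℕ.≤ n →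
    ℚ.∣ leibniz k m ℚ.- leibniz k n ∣ ℚ.≤ odd⁻¹ (k ℕ.+ N)
  leibniz-diff zero k m n _ _ = ∣-∣-≤ (one m n) (one n m)
    where
    one : ∀ m n → leibniz k m ℚ.≤ leibniz k n ℚ.+ odd⁻¹ (k ℕ.+ 0)
    one m n = subst₂ ℚ._≤_ (ℚP.+-identityˡ (leibniz k m))
      (cong (λ j → leibniz k n ℚ.+ odd⁻¹ j) (sym (ℕP.+-identityʳ k)))
      (ℚP.+-mono-≤ (proj₁ (leibniz-bounds k n)) (proj₂ (leibniz-bounds k m)))
  leibniz-diff (suc N) k (suc m) (suc n) (s≤s m≥) (s≤s n≥) =
    subst₂ ℚ._≤_
      (trans (∣-∣-comm (leibniz (suc k) m) (leibniz (suc k) n))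
        (cong ℚ.∣_∣ (eq (odd⁻¹ k) (leibniz (suc k) m) (leibniz (suc k) n))))
      (cong odd⁻¹ (sym (ℕP.+-suc k N)))
      (leibniz-diff N (suc k) m n m≥ n≥)
    where
    open ℚ-Solver
    eq : ∀ c a b → b ℚ.- a ≡ (c ℚ.- a) ℚ.- (c ℚ.- b)
    eq = solve 3 (λ c a b → b :- a := (c :- a) :- (c :- b)) refl

open LeibnizLemmas

-- arctan 1 = Σ_{j≥0} (-1)^j / (2j+1)
arctan1 : ℝ⁺
arctan1 = x ,⁺ mk-pos {x} {½} (ℚP.positive⁻¹ ½) 1 lower
  where
  x : ℝ
  x = real (leibniz 0) λ ε 0<ε →
    let (N , h) = archimedean 0<ε
    in N , λ m n m≥ n≥ → ℚP.≤-<-trans (leibniz-diff N 0 m n m≥ n≥)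
      (ℚP.≤-<-trans
        (/-mono-≤ 1 (suc (2 ℕ.* N)) 1 (suc N) (ℕP.*-monoʳ-≤ 1 (s≤s (ℕP.m≤n*m N 2))))
        (h N ℕP.≤-refl))
  lower : ∀ n → 1 ℕ.≤ n → ½ ℚ.≤ leibniz 0 n
  lower (suc n) _ = ℚP.≤-trans (/-mono-≤ 1 2 2 3 (s≤s (s≤s (s≤s z≤n))))
    (ℚP.+-monoʳ-≤ 1ℚ (ℚP.neg-antimono-≤ (proj₂ (leibniz-bounds 1 n))))

-- π = 4 arctan 1
π : ℝ⁺
π = fromℕ⁺ 4 *⁺ arctan1

-- x ^ k /2 is x^{k/2}.
infix 8 _^_/2

_^_/2 : ℝ⁺ → ℕ → ℝ⁺
x ^ k /2 = (√ x) ^ k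

infix 4 _∼_

_∼_ : (ℕ → ℝ) → ((n : ℕ) .{{_ : NonZero n}} → ℝ⁺) → Set
f ∼ g = (λ n → f (suc n) * val ((g (suc n)) ⁻¹)) ⟶ 1ℝ

Σᴸ : List ℝ⁺ → ℝ
Σᴸ = List.foldr (λ x s → val x + s) 0ℝ

∏ : ∀ {n} → Vec ℝ⁺ n → ℝ⁺
∏ = Vec.foldr _ _*⁺_ 1ℝ⁺

module SumLemmas where
  +-0-positive : ∀ {x} → 0ℝ < x → 0ℝ < x + 0ℝ
  +-0-positive {x} 0<x with eventually {x} 0<x
  ... | ε , 0<ε , N , h = mk-pos {x + 0ℝ} 0<ε N λ n n≥ →
    subst (ε ℚ.≤_) (sym (ℚP.+-identityʳ (seq x n))) (h n n≥)

  Σᴸ-positive : ∀ {A : Set} (f : A → ℝ⁺) {a xs} → a ∈ xs → 0ℝ < Σᴸ (List.map f xs)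
  Σᴸ-positive f {xs = y ∷ []} _ = +-0-positive {val (f y)} (positive (f y))
  Σᴸ-positive f {xs = y ∷ z ∷ zs} _ =
    +-positive {val (f y)} {Σᴸ (List.map f (z ∷ zs))} (positive (f y))
      (Σᴸ-positive f {xs = z ∷ zs} (here refl))

open SumLemmas

data Coord : Set where
  back stay forth : Coord

toℤ : Coord → ℤ
toℤ back  = ℤ.-1ℤ
toℤ stay  = ℤ.0ℤ
toℤ forth = ℤ.1ℤ

negate : Coord → Coord
negate back  = forth
negate stay  = stay
negate forth = back

_≟_ : DecidableEquality Coord
back  ≟ back  = yes refl
back  ≟ stay  = no λ ()
back  ≟ forth = no λ ()
stay  ≟ back  = no λ ()
stay  ≟ stay  = yes refl
stay  ≟ forth = no λ ()
forth ≟ back  = no λ ()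
forth ≟ stay  = no λ ()
forth ≟ forth = yes refl

Step : ℕ → Set
Step d = Vec Coord d

-- A finite set is a duplicate-free list. Only the values of weight on the
-- steps in the set are ever used.
record WeightedStepSet (d : ℕ) : Set where
  field
    steps   : List (Step d)
    unique  : Unique steps
    nonzero : Vec.replicate d stay ∉ steps
    weight  : Step d → ℝ⁺

open WeightedStepSet public

SymmetricOver : ∀ {d} → WeightedStepSet d → Fin d → Set
SymmetricOver 𝒮 k = ∀ i → i ∈ steps 𝒮 →
  let i′ = Vec.updateAt i k negate in
  i′ ∈ steps 𝒮 × val (weight 𝒮 i′) ≃ val (weight 𝒮 i)

HasStep : ∀ {d} → WeightedStepSet d → Fin d → Coord → Set
HasStep 𝒮 j c = ∃[ i ] i ∈ steps 𝒮 × Vec.lookup i j ≡ c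

-- Laurent polynomials are evaluated at points with positive coordinates.

_^ᶜ_ : ℝ⁺ → Coord → ℝ⁺
z ^ᶜ back  = z ⁻¹
z ^ᶜ stay  = 1ℝ⁺
z ^ᶜ forth = z

monomial : ∀ {d} → Vec ℝ⁺ d → Step d → ℝ⁺
monomial z i = ∏ (Vec.zipWith _^ᶜ_ z i)

𝟏 : ∀ {d} → Vec ℝ⁺ d
𝟏 = Vec.replicate _ 1ℝ⁺

S : ∀ {d} → WeightedStepSet d → Vec ℝ⁺ d → ℝ
S 𝒮 z = Σᴸ (List.map (λ i → weight 𝒮 i *⁺ monomial z i) (steps 𝒮))

S⁺ : ∀ {d} (𝒮 : WeightedStepSet d) {j c} → HasStep 𝒮 j c → Vec ℝ⁺ d → ℝ⁺
S⁺ 𝒮 (_ , i∈ , _) z = S 𝒮 z ,⁺ Σᴸ-positive (λ i → weight 𝒮 i *⁺ monomial z i) i∈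

stepsWith : ∀ {d} → WeightedStepSet d → Fin d → Coord → List (Step d)
stepsWith 𝒮 j c = List.filter (λ i → Vec.lookup i j ≟ c) (steps 𝒮)

-- The coefficient of z_d^c in S, as a Laurent polynomial in z_1, …, z_{d-1}
-- (here d is suc m).
coefficient : ∀ {m} → WeightedStepSet (suc m) → Coord → Vec ℝ⁺ m → ℝ
coefficient {m} 𝒮 c ẑ =
  Σᴸ (List.map (λ i → weight 𝒮 i *⁺ monomial ẑ (Vec.init i)) (stepsWith 𝒮 (fromℕ m) c))

A B : ∀ {m} → WeightedStepSet (suc m) → Vec ℝ⁺ m → ℝ
A 𝒮 = coefficient 𝒮 back
B 𝒮 = coefficient 𝒮 forth

b : ∀ {d} (𝒮 : WeightedStepSet d) (k : Fin d) → HasStep 𝒮 k forth → ℝ⁺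
b 𝒮 k (_ , i∈ , ik≡forth) = Σᴸ (List.map (weight 𝒮) (stepsWith 𝒮 k forth)) ,⁺
  Σᴸ-positive (weight 𝒮) (∈-filter⁺ (λ i → Vec.lookup i k ≟ forth) i∈ ik≡forth)

Walk : ℕ → ℕ → Set
Walk d n = Vec (Step d) n

walks : ∀ {d} → List (Step d) → (n : ℕ) → List (Walk d n)
walks steps zero    = [] ∷ []
walks steps (suc n) = List.cartesianProductWith _∷_ steps (walks steps n)

Orthant : ∀ {d} → Vec ℤ d → Set
Orthant = All (ℤ.0ℤ ℤ.≤_)

move : ∀ {d} → Vec ℤ d → Step d → Vec ℤ d
move p i = Vec.zipWith ℤ._+_ p (Vec.map toℤ i)

StaysInOrthant : ∀ {d n} → Vec ℤ d → Walk d n → Set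
StaysInOrthant p []       = Orthant p
StaysInOrthant p (i ∷ is) = Orthant p × StaysInOrthant (move p i) is

staysInOrthant? : ∀ {d n} (p : Vec ℤ d) (ω : Walk d n) → Dec (StaysInOrthant p ω)
staysInOrthant? p []       = all? (ℤ.0ℤ ℤP.≤?_) p
staysInOrthant? p (i ∷ is) = all? (ℤ.0ℤ ℤP.≤?_) p ×-dec staysInOrthant? (move p i) is

origin : ∀ {d} → Vec ℤ d
origin = Vec.replicate _ ℤ.0ℤ

walkWeight : ∀ {d n} → WeightedStepSet d → Walk d n → ℝ⁺
walkWeight 𝒮 ω = ∏ (Vec.map (weight 𝒮) ω)

s : ∀ {d} → WeightedStepSet d → ℕ → ℝ
s 𝒮 n = Σᴸ (List.map (walkWeight 𝒮)
  (List.filter (staysInOrthant? origin) (walks (steps 𝒮) n)))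

{-# OPTIONS --safe #-}
-- Divided by S(𝟏) ^ n, s n is the probability that a random walk stays in the
-- orthant.  By the symmetry of the first axis, the sign of each nonzero first
-- coordinate is an independent fair coin, so given the number N of nonzero first
-- coordinates and everything else, the first coordinate stays nonnegative with
-- probability c(N) = C(N, ⌊N/2⌋) / 2 ^ N.  Chernoff bounds confine N / n to a
-- neighbourhood of 2 b₁ / S(𝟏) up to an error ρ ^ n, negligible against s n, which
-- is at least polynomially small; as c is monotone, s n ≈ c(2 b₁ n / S(𝟏)) s′ n,
-- where s′ belongs to the marginal step set in the other coordinates.  Marginals
-- inherit the symmetry, and the last one is symmetric because A(𝟏) = B(𝟏), so the
-- argument iterates through all the coordinates.
--
-- What is left is Wallis' bound c(N)² N π ≤ 2 ≤ c(N)² (N + 2) π for the π defined by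
-- Leibniz' series.  The sums V(x) = ₂F₁(1, -x/2; 2 + x/2; -1) satisfy Kummer's
-- recurrence (x + 3) V(x + 2) = (x + 4) V(x); V(-1) is Leibniz' series, V(0) = 1, and
-- V(2n - 1) ≤ V(2n) ≤ V(2n + 1) by comparing terms.
module Submission where

import Algebra.Properties.CommutativeSemiring.Exp as Exp
import Algebra.Solver.Ring.NaturalCoefficients.Default as Solver
open import Algebra.Bundles using (CommutativeRing; CommutativeSemiring)
open import Data.Nat.Base as ℕ using (ℕ; zero; suc; z≤n; s≤s)
import Data.Nat.Properties as ℕP
open import Data.Product.Base using (∃-syntax; _×_; _,_; proj₁; proj₂)
open import Data.Rational.Base as ℚ using (ℚ; 0ℚ; 1ℚ; ½)
import Data.Rational.Properties as ℚP
open import Data.Rational.Solver using () renaming (module +-*-Solver to ℚ-Solver)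
open import Data.Sum.Base using (_⊎_; inj₁; inj₂)
open import Data.Unit.Base using (⊤; tt)
open import Level using (0ℓ)
open import Relation.Binary.PropositionalEquality as ≡ using (_≡_; cong; cong₂; subst)
import Defs

-- All estimates are proved in squared form, s(n)² ∏ (n π b_k) against S(𝟏)^(2n) S(𝟏)^d: Wallis'
-- bound controls c(N)², so square roots enter only at the very end. Comparison is multiplicative,
-- up to every rational factor μ > 1; such factors multiply along the coordinates, and a tolerance
-- is divided by taking rational roots of it.
--
-- The weights are arbitrary Cauchy reals, whose order cannot be decided. The ratio 2 b_k / S(𝟏) is
-- therefore first replaced by fractions a / D on either side of it, and the Chernoff bounds see
-- natural numbers only. Their tilts are rational as well, κ = 1 ± h with small h, estimated by
-- Bernoulli's inequality and a second-order converse.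
--
-- The polynomial lower bound on s(n) comes from c(N) ≥ 1 / (N + 1): it gives S(𝟏)^n ≤ (n + 1)^d
-- s(n) for every n. So the Chernoff error is ρ^n (n + 1)^d times s(n) itself, and for large n it is
-- absorbed into s(n).

module Rat where
  open import Data.Integer.Base as ℤ using (+_)
  open import Data.Rational.Base
  open import Data.Rational.Properties
  open import Relation.Binary.PropositionalEquality
  open Exp (CommutativeRing.commutativeSemiring +-*-commutativeRing) public using (_^_; ^-homo-*; ^-assocʳ; ^-distrib-*)
  open Defs using (leibniz; module LeibnizLemmas)
  open Defs.RationalLemmas public using (1/-pos; archimedean; *-pos; p≤∣p∣)
  open ℚ-Solver using (solve; _:=_; _:+_; _:*_; _:-_; :-_; con)

  -- Rational arithmetic and null sequences.

  2ℚ 3ℚ 4ℚ : ℚ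
  2ℚ = + 2 / 1
  3ℚ = + 3 / 1
  4ℚ = + 4 / 1

  ⟦_⟧ : ℕ → ℚ
  ⟦ n ⟧ = + n / 1

  ⟦suc⟧ : ∀ n → ⟦ suc n ⟧ ≡ 1ℚ + ⟦ n ⟧
  ⟦suc⟧ n = trans (Defs.RationalLemmas./-suc n 0) (+-comm ⟦ n ⟧ 1ℚ)

  ⟦⟧-+ : ∀ m n → ⟦ m ℕ.+ n ⟧ ≡ ⟦ m ⟧ + ⟦ n ⟧
  ⟦⟧-+ zero    n = sym (+-identityˡ ⟦ n ⟧)
  ⟦⟧-+ (suc m) n rewrite ⟦suc⟧ (m ℕ.+ n) | ⟦suc⟧ m | ⟦⟧-+ m n = sym (+-assoc 1ℚ ⟦ m ⟧ ⟦ n ⟧)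

  ⟦⟧-* : ∀ m n → ⟦ m ℕ.* n ⟧ ≡ ⟦ m ⟧ * ⟦ n ⟧
  ⟦⟧-* m n = sym (Defs.RationalLemmas./-* m 0 n 0)

  ⟦⟧-mono : ∀ {m n} → m ℕ.≤ n → ⟦ m ⟧ ≤ ⟦ n ⟧
  ⟦⟧-mono {m} {n} m≤n = Defs.RationalLemmas./-mono-≤ m 1 n 1 (ℕP.*-monoˡ-≤ 1 m≤n)

  0≤⟦⟧ : ∀ n → 0ℚ ≤ ⟦ n ⟧
  0≤⟦⟧ n = Defs.RationalLemmas.0≤/ n 1

  0<⟦suc⟧ : ∀ n → 0ℚ < ⟦ suc n ⟧
  0<⟦suc⟧ n = Defs.RationalLemmas.0</ n 1

  0≤1 : 0ℚ ≤ 1ℚ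
  0≤1 = 0≤⟦⟧ 1

  0≤+ : ∀ {p q} → 0ℚ ≤ p → 0ℚ ≤ q → 0ℚ ≤ p + q
  0≤+ = +-mono-≤

  0≤* : ∀ {p q} → 0ℚ ≤ p → 0ℚ ≤ q → 0ℚ ≤ p * q
  0≤* 0≤p 0≤q = Defs.RationalLemmas.*-mono-≤ ≤-refl 0≤p ≤-refl 0≤q

  *-mono-≤ : ∀ {p q r s} → 0ℚ ≤ p → p ≤ q → 0ℚ ≤ r → r ≤ s → p * r ≤ q * s
  *-mono-≤ = Defs.RationalLemmas.*-mono-≤

  *-monoʳ : ∀ {p q r} → 0ℚ ≤ r → p ≤ q → r * p ≤ r * q
  *-monoʳ {r = r} 0≤r = *-monoˡ-≤-nonNeg r {{nonNegative 0≤r}}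

  *-monoˡ : ∀ {p q r} → 0ℚ ≤ r → p ≤ q → p * r ≤ q * r
  *-monoˡ {r = r} 0≤r = *-monoʳ-≤-nonNeg r {{nonNegative 0≤r}}

  *-cancelˡ : ∀ {p q r} → 0ℚ < r → r * p ≤ r * q → p ≤ q
  *-cancelˡ {r = r} 0<r = *-cancelˡ-≤-pos r {{positive 0<r}}

  ≤-slack : ∀ {p q} r → 0ℚ ≤ r → q ≡ p + r → p ≤ q
  ≤-slack {p} r 0≤r refl = subst (_≤ p + r) (+-identityʳ p) (+-monoʳ-≤ p 0≤r)

  <-slack : ∀ {p q} r → 0ℚ < r → q ≡ p + r → p < q
  <-slack {p} r 0<r refl = subst (_< p + r) (+-identityʳ p) (+-monoʳ-< p 0<r)

  0≤-diff : ∀ {p q} → p ≤ q → 0ℚ ≤ q - p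
  0≤-diff {p} {q} p≤q = subst (_≤ q - p) (+-inverseʳ p) (+-monoˡ-≤ (- p) p≤q)

  diff-≤ : ∀ {p q} → 0ℚ ≤ q - p → p ≤ q
  diff-≤ {p} {q} h = ≤-slack (q - p) h (solve 2 (λ p q → q := p :+ (q :- p)) refl p q)

  0<-diff : ∀ {p q} → p < q → 0ℚ < q - p
  0<-diff {p} {q} p<q = subst (_< q - p) (+-inverseʳ p) (+-monoˡ-< (- p) p<q)

  inv : ℕ → ℚ
  inv n = + 1 / suc n

  0<inv : ∀ n → 0ℚ < inv n
  0<inv n = Defs.RationalLemmas.0</ 0 (suc n)

  0≤inv : ∀ n → 0ℚ ≤ inv n
  0≤inv n = <⇒≤ (0<inv n)

  ⟦⟧-inv : ∀ n → ⟦ suc n ⟧ * inv n ≡ 1ℚ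
  ⟦⟧-inv n = begin
      ⟦ suc n ⟧ * inv n ≡⟨ Defs.RationalLemmas./-* (suc n) 0 1 n ⟩
      + (suc n ℕ.* 1) / (1 ℕ.* suc n) ≡⟨ ≤-antisym (cross (suc n ℕ.* 1) (1 ℕ.* suc n) 1 1 e₁) (cross 1 1 (suc n ℕ.* 1) (1 ℕ.* suc n) e₂) ⟩
      1ℚ ∎
    where
    open ≡-Reasoning
    cross = Defs.RationalLemmas./-mono-≤
    e = trans (ℕP.*-identityʳ (suc n ℕ.* 1)) (trans (ℕP.*-comm (suc n) 1) (sym (ℕP.*-identityˡ (1 ℕ.* suc n))))
    e₁ = ℕP.≤-reflexive e
    e₂ = ℕP.≤-reflexive (sym e)

  inv-cancel : ∀ n p → ⟦ suc n ⟧ * (p * inv n) ≡ p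
  inv-cancel n p = trans (solve 3 (λ c p i → c :* (p :* i) := (c :* i) :* p) refl ⟦ suc n ⟧ p (inv n))
    (trans (cong (_* p) (⟦⟧-inv n)) (*-identityˡ p))

  fraction : ∀ {p} → 0ℚ < p → ∃[ a ] ∃[ f ] ⟦ suc f ⟧ * p ≡ ⟦ suc a ⟧
  fraction {p@(mkℚ (+ zero) d c)} 0<p with () ← <⇒≢ 0<p (sym (↥p≡0⇒p≡0 p refl))
  fraction {p@(mkℚ (+ suc a) d c)} 0<p = a , d , (begin
      ⟦ suc d ⟧ * p ≡⟨ cong (⟦ suc d ⟧ *_) (↥p/↧p≡p p) ⟨
      ⟦ suc d ⟧ * (+ suc a / suc d) ≡⟨ cong (⟦ suc d ⟧ *_) split ⟨
      ⟦ suc d ⟧ * (⟦ suc a ⟧ * inv d) ≡⟨ solve 3 (λ x y z → x :* (y :* z) := (x :* z) :* y) refl ⟦ suc d ⟧ ⟦ suc a ⟧ (inv d) ⟩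
      (⟦ suc d ⟧ * inv d) * ⟦ suc a ⟧ ≡⟨ cong (_* ⟦ suc a ⟧) (⟦⟧-inv d) ⟩
      1ℚ * ⟦ suc a ⟧ ≡⟨ *-identityˡ ⟦ suc a ⟧ ⟩
      ⟦ suc a ⟧ ∎)
    where
    open ≡-Reasoning
    split : ⟦ suc a ⟧ * inv d ≡ + suc a / suc d
    split = trans (Defs.RationalLemmas./-* (suc a) 0 1 d)
      (/-cong (cong +_ (ℕP.*-identityʳ (suc a))) (ℕP.*-identityˡ (suc d)))
  fraction {p@(mkℚ ℤ.-[1+ a ] d c)} 0<p with () ← <-asym 0<p (negative⁻¹ p)

  Null : (ℕ → ℚ) → Set
  Null u = ∀ ε → 0ℚ < ε → ∃[ N ] ∀ n → N ℕ.≤ n → ∣ u n ∣ ≤ ε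

  null-cong : ∀ {u v} → (∀ n → u n ≡ v n) → Null u → Null v
  null-cong u≡v h ε 0<ε with N , hN ← h ε 0<ε =
    N , λ n n≥ → subst (λ t → ∣ t ∣ ≤ ε) (u≡v n) (hN n n≥)

  null-suc : ∀ {u} → Null (λ n → u (suc n)) → Null u
  null-suc h ε 0<ε with N , hN ← h ε 0<ε = suc N , λ { (suc n) (s≤s n≥) → hN n n≥ }

  null-+ : ∀ {u v} → Null u → Null v → Null (λ n → u n + v n)
  null-+ {u} {v} hu hv ε 0<ε with M , hM ← hu (½ * ε) (Defs.RationalLemmas.half-pos 0<ε)
                                | N , hN ← hv (½ * ε) (Defs.RationalLemmas.half-pos 0<ε) =
    M ℕ.⊔ N , λ n n≥ → ≤-trans (∣p+q∣≤∣p∣+∣q∣ (u n) (v n))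
      (subst (∣ u n ∣ + ∣ v n ∣ ≤_) (Defs.RationalLemmas.half+half ε)
        (+-mono-≤ (hM n (ℕP.m⊔n≤o⇒m≤o M N n≥)) (hN n (ℕP.m⊔n≤o⇒n≤o M N n≥))))

  null-inv : ∀ {u} C → (∀ n → ∣ u n ∣ ≤ ⟦ suc C ⟧ * inv n) → Null u
  null-inv {u} C h ε 0<ε with N , hN ← archimedean (*-pos 0<ε (0<inv C)) =
    N , λ n n≥ → ≤-trans (h n) (begin
      ⟦ suc C ⟧ * inv n ≤⟨ *-monoʳ (0≤⟦⟧ (suc C)) (<⇒≤ (hN n n≥)) ⟩
      ⟦ suc C ⟧ * (ε * inv C) ≡⟨ inv-cancel C ε ⟩
      ε ∎)
    where open ≤-Reasoning

  ≤⟦suc⟧ : ∀ p → ∃[ C ] p ≤ ⟦ suc C ⟧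
  ≤⟦suc⟧ p with ≤-total p 0ℚ
  ... | inj₁ p≤0 = 0 , ≤-trans p≤0 (0≤⟦⟧ 1)
  ... | inj₂ 0≤p with a , f , eq ← fraction (+-mono-≤-< 0≤p (0<⟦suc⟧ 0)) = a , (begin
      p ≤⟨ ≤-slack 1ℚ 0≤1 refl ⟩
      p + 1ℚ ≡⟨ *-identityˡ (p + 1ℚ) ⟨
      1ℚ * (p + 1ℚ) ≤⟨ *-monoˡ (0≤+ 0≤p 0≤1) (⟦⟧-mono (s≤s (z≤n {f}))) ⟩
      ⟦ suc f ⟧ * (p + 1ℚ) ≡⟨ eq ⟩
      ⟦ suc a ⟧ ∎)
    where open ≤-Reasoning

  null-*ˡ : ∀ {u} c → Null u → Null (λ n → c * u n)
  null-*ˡ {u} c h ε 0<ε with C , c≤C ← ≤⟦suc⟧ ∣ c ∣ with h (ε * inv C) (*-pos 0<ε (0<inv C))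
  ... | N , hN = N , λ n n≥ → begin
      ∣ c * u n ∣ ≡⟨ ∣p*q∣≡∣p∣*∣q∣ c (u n) ⟩
      ∣ c ∣ * ∣ u n ∣ ≤⟨ *-mono-≤ (0≤∣p∣ c) c≤C (0≤∣p∣ (u n)) (hN n n≥) ⟩
      ⟦ suc C ⟧ * (ε * inv C) ≡⟨ inv-cancel C ε ⟩
      ε ∎
    where open ≤-Reasoning

  -- Kummer's recurrence and the alternating hypergeometric sums.

  -- kummer x y e K is, with e = x + 3 + 2 y, the partial sum of a tail of
  -- ₂F₁(1, -x/2; 2 + x/2; -1) in Horner form.
  kummer : ℚ → ℚ → ℕ → ℕ → ℚ
  kummer x y e zero    = 0ℚ
  kummer x y e (suc K) = 1ℚ + (x - 2ℚ * y) * inv e * kummer x (1ℚ + y) (2 ℕ.+ e) K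

  -- The defect of Kummer's recurrence caused by truncation to `K` terms. The base value makes
  -- `kummer-shift` true for two empty sums, and each Horner step multiplies the defect by a single
  -- factor.
  remainder : ℚ → ℚ → ℕ → ℕ → ℚ
  remainder x y e zero    = - (y * (x + 3ℚ + 2ℚ * y))
  remainder x y e (suc K) = (x + 1ℚ - 2ℚ * y) * inv (2 ℕ.+ e) * remainder x (1ℚ + y) (2 ℕ.+ e) K

  ⟦3+⟧ : ∀ e {z} → ⟦ suc e ⟧ ≡ z → ⟦ suc (2 ℕ.+ e) ⟧ ≡ z + 2ℚ
  ⟦3+⟧ e {z} eq rewrite ⟦suc⟧ (2 ℕ.+ e) | ⟦suc⟧ (1 ℕ.+ e) | eq = solve 1 (λ z → con 1ℚ :+ (con 1ℚ :+ z) := z :+ con 2ℚ) refl z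

  next : ∀ x y e → ⟦ suc e ⟧ ≡ x + 3ℚ + 2ℚ * y → ⟦ suc (2 ℕ.+ e) ⟧ ≡ x + 3ℚ + 2ℚ * (1ℚ + y)
  next x y e eq = trans (⟦3+⟧ e eq)
    (solve 2 (λ x y → x :+ con 3ℚ :+ con 2ℚ :* y :+ con 2ℚ := x :+ con 3ℚ :+ con 2ℚ :* (con 1ℚ :+ y)) refl x y)

  -- At `y = 0`, with `x + 1` cancelled and the remainder gone, this is the recurrence from V(x - 1)
  -- to V(x + 1). Induction along the Horner form moves `y` to `1 + y`, so the statement has to
  -- cover tails, at the price of the inhomogeneous term `y * (x + 3ℚ + 2ℚ * y)`.
  kummer-shift : ∀ K x y e → ⟦ suc e ⟧ ≡ x + 3ℚ + 2ℚ * y →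
    (x + 1ℚ) * (x + 2ℚ) * kummer (x + 1ℚ) y (2 ℕ.+ e) K ≡
    (x + 1ℚ - 2ℚ * y) * (x + 3ℚ + 2ℚ * y) * kummer (x - 1ℚ) y e K + y * (x + 3ℚ + 2ℚ * y) + remainder x y e K
  kummer-shift zero x y e eq = solve 2 (λ x y →
      (x :+ con 1ℚ) :* (x :+ con 2ℚ) :* con 0ℚ :=
      (x :+ con 1ℚ :- con 2ℚ :* y) :* (x :+ con 3ℚ :+ con 2ℚ :* y) :* con 0ℚ :+ y :* (x :+ con 3ℚ :+ con 2ℚ :* y)
        :+ :- (y :* (x :+ con 3ℚ :+ con 2ℚ :* y)))
    refl x y
  kummer-shift (suc K) x y e eq = begin
      c * (1ℚ + u * r′ * P)
        ≡⟨ solve 4 (λ c u r P → c :* (con 1ℚ :+ u :* r :* P) := c :+ u :* r :* (c :* P)) refl c u r′ P ⟩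
      c + u * r′ * (c * P)
        ≡⟨ cong (λ t → c + u * r′ * t) (kummer-shift K x (1ℚ + y) (2 ℕ.+ e) (next x y e eq)) ⟩
      c + u * r′ * (w′ * d′ * Q + (1ℚ + y) * d′ + E)
        ≡⟨ solve 8 (λ c u r w d Q y E → c :+ u :* r :* (w :* d :* Q :+ (con 1ℚ :+ y) :* d :+ E)
             := c :+ (d :* r) :* (u :* (w :* Q :+ (con 1ℚ :+ y))) :+ u :* r :* E) refl c u r′ w′ d′ Q y E ⟩
      c + (d′ * r′) * (u * (w′ * Q + (1ℚ + y))) + u * r′ * E
        -- Both `d′ * r′` and `d * r` are 1. Trading one for the other produces the factor `r` from
        -- which the Horner step of `kummer (x - 1ℚ)` is rebuilt.
        ≡⟨ cong (λ t → c + t * (u * (w′ * Q + (1ℚ + y))) + u * r′ * E)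
             (trans (cong (_* r′) (sym (next x y e eq))) (trans (⟦⟧-inv (2 ℕ.+ e)) (sym (trans (cong (_* r) (sym eq)) (⟦⟧-inv e))))) ⟩
      c + (d * r) * (u * (w′ * Q + (1ℚ + y))) + u * r′ * E
        ≡⟨ solve 6 (λ x y r Q F t →
             (x :+ con 1ℚ) :* (x :+ con 2ℚ) :+ t :* ((x :+ con 1ℚ :- con 2ℚ :* y) :* ((x :+ con 1ℚ :- con 2ℚ :* (con 1ℚ :+ y)) :* Q :+ (con 1ℚ :+ y))) :+ F
             := (x :+ con 1ℚ) :* (x :+ con 2ℚ) :+ t :* ((x :+ con 1ℚ :- con 2ℚ :* y) :* (con 1ℚ :+ y)) :+ (x :+ con 1ℚ :- con 2ℚ :* y) :* ((x :- con 1ℚ :- con 2ℚ :* y) :* t :* Q) :+ F)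
             refl x y r Q (u * r′ * E) (d * r) ⟩
      c + (d * r) * (u * (1ℚ + y)) + u * (w * (d * r) * Q) + u * r′ * E
        ≡⟨ cong (λ t → c + t * (u * (1ℚ + y)) + u * (w * (d * r) * Q) + u * r′ * E) (trans (cong (_* r) (sym eq)) (⟦⟧-inv e)) ⟩
      c + 1ℚ * (u * (1ℚ + y)) + u * (w * (d * r) * Q) + u * r′ * E
        ≡⟨ solve 5 (λ x y r Q F →
             (x :+ con 1ℚ) :* (x :+ con 2ℚ) :+ con 1ℚ :* ((x :+ con 1ℚ :- con 2ℚ :* y) :* (con 1ℚ :+ y)) :+ (x :+ con 1ℚ :- con 2ℚ :* y) :* ((x :- con 1ℚ :- con 2ℚ :* y) :* ((x :+ con 3ℚ :+ con 2ℚ :* y) :* r) :* Q) :+ F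
             := (x :+ con 1ℚ :- con 2ℚ :* y) :* (x :+ con 3ℚ :+ con 2ℚ :* y) :* (con 1ℚ :+ (x :- con 1ℚ :- con 2ℚ :* y) :* r :* Q)
                  :+ y :* (x :+ con 3ℚ :+ con 2ℚ :* y) :+ F)
             refl x y r Q (u * r′ * E) ⟩
      u * d * (1ℚ + w * r * Q) + y * d + u * r′ * E ∎
    where
    open ≡-Reasoning
    c = (x + 1ℚ) * (x + 2ℚ)
    u = x + 1ℚ - 2ℚ * y
    w = x - 1ℚ - 2ℚ * y
    w′ = x + 1ℚ - 2ℚ * (1ℚ + y)
    d = x + 3ℚ + 2ℚ * y
    d′ = x + 3ℚ + 2ℚ * (1ℚ + y)
    r = inv e
    r′ = inv (2 ℕ.+ e)
    P = kummer (x + 1ℚ) (1ℚ + y) (4 ℕ.+ e) K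
    Q = kummer (x - 1ℚ) (1ℚ + y) (2 ℕ.+ e) K
    E = remainder x (1ℚ + y) (2 ℕ.+ e) K

  ∣∣≤ : ∀ {p q} → p ≤ q → - p ≤ q → ∣ p ∣ ≤ q
  ∣∣≤ {p} p≤q -p≤q with ∣p∣≡p∨∣p∣≡-p p
  ... | inj₁ eq = ≤-trans (≤-reflexive eq) p≤q
  ... | inj₂ eq = ≤-trans (≤-reflexive eq) -p≤q

  -- Each factor has modulus at most (x - 1 + 2y) / (x + 5 + 2y), numerator and denominator being
  -- three steps apart, so the product telescopes to cubic decay in `K`. The base value is quadratic
  -- in `K`, which leaves decay of order 1 / K. The bound on the factors requires `y` to stay away
  -- from 0.
  remainder-bound : ∀ K x y e → 0ℚ ≤ x → 1ℚ ≤ y → ⟦ suc e ⟧ ≡ x + 3ℚ + 2ℚ * y →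
    ∣ remainder x y e K ∣ * (x - 1ℚ + 2ℚ * (y + ⟦ K ⟧)) ≤
    (x - 1ℚ + 2ℚ * y) * (x + 1ℚ + 2ℚ * y) * (x + 3ℚ + 2ℚ * y)
  remainder-bound zero x y e 0≤x 1≤y eq = begin
      ∣ - (y * d) ∣ * (x - 1ℚ + 2ℚ * (y + 0ℚ))
        ≡⟨ cong₂ _*_ (trans (∣-p∣≡∣p∣ (y * d)) (0≤p⇒∣p∣≡p (0≤* 0≤y 0≤d)))
             (cong (λ t → x - 1ℚ + 2ℚ * t) (+-identityʳ y)) ⟩
      y * d * a
        ≡⟨ solve 3 (λ y d a → y :* d :* a := y :* (a :* d)) refl y d a ⟩
      y * (a * d)
        ≤⟨ *-monoˡ (0≤* 0≤a 0≤d) (≤-slack {y} {x + 1ℚ + 2ℚ * y} (x + 1ℚ + y) (0≤+ (0≤+ 0≤x 0≤1) 0≤y)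
             (solve 2 (λ x y → x :+ con 1ℚ :+ con 2ℚ :* y := y :+ (x :+ con 1ℚ :+ y)) refl x y)) ⟩
      (x + 1ℚ + 2ℚ * y) * (a * d)
        ≡⟨ solve 3 (λ y d a → y :* (a :* d) := a :* y :* d) refl (x + 1ℚ + 2ℚ * y) d a ⟩
      a * (x + 1ℚ + 2ℚ * y) * d ∎
    where
    open ≤-Reasoning
    d = x + 3ℚ + 2ℚ * y
    a = x - 1ℚ + 2ℚ * y
    0≤y = ≤-trans 0≤1 1≤y
    0≤d : 0ℚ ≤ d
    0≤d = 0≤+ (0≤+ 0≤x (0≤⟦⟧ 3)) (0≤* (0≤⟦⟧ 2) 0≤y)
    0≤a : 0ℚ ≤ a
    0≤a = ≤-trans (0≤+ (0≤+ 0≤x (0≤* (0≤⟦⟧ 2) (0≤-diff 1≤y))) 0≤1)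
      (≤-reflexive (solve 2 (λ x y → x :+ con 2ℚ :* (y :- con 1ℚ) :+ con 1ℚ := x :- con 1ℚ :+ con 2ℚ :* y) refl x y))
  remainder-bound (suc K) x y e 0≤x 1≤y eq = begin
      ∣ u * r * E ∣ * (x - 1ℚ + 2ℚ * (y + ⟦ suc K ⟧))
        ≡⟨ cong₂ _*_ (trans (∣p*q∣≡∣p∣*∣q∣ (u * r) E) (cong (_* ∣ E ∣) (∣p*q∣≡∣p∣*∣q∣ u r)))
             (cong (λ t → x - 1ℚ + 2ℚ * t) (trans (cong (λ t → y + t) (⟦suc⟧ K))
               (solve 2 (λ y k → y :+ (con 1ℚ :+ k) := con 1ℚ :+ y :+ k) refl y ⟦ K ⟧))) ⟩
      ∣ u ∣ * ∣ r ∣ * ∣ E ∣ * T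
        ≡⟨ cong (λ t → ∣ u ∣ * t * ∣ E ∣ * T) (0≤p⇒∣p∣≡p (0≤inv (2 ℕ.+ e))) ⟩
      ∣ u ∣ * r * ∣ E ∣ * T
        ≡⟨ solve 4 (λ u r E T → u :* r :* E :* T := u :* r :* (E :* T)) refl (∣ u ∣) r (∣ E ∣) T ⟩
      ∣ u ∣ * r * (∣ E ∣ * T)
        ≤⟨ *-monoʳ (0≤* (0≤∣p∣ u) (0≤inv (2 ℕ.+ e))) (remainder-bound K x (1ℚ + y) (2 ℕ.+ e) 0≤x (≤-trans 1≤y (≤-slack 1ℚ 0≤1 (+-comm 1ℚ y))) eq′) ⟩
      ∣ u ∣ * r * ((x - 1ℚ + 2ℚ * (1ℚ + y)) * (x + 1ℚ + 2ℚ * (1ℚ + y)) * d)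
        ≡⟨ cong₂ (λ s t → ∣ u ∣ * r * (s * t * d))
             (solve 2 (λ x y → x :- con 1ℚ :+ con 2ℚ :* (con 1ℚ :+ y) := x :+ con 1ℚ :+ con 2ℚ :* y) refl x y)
             (solve 2 (λ x y → x :+ con 1ℚ :+ con 2ℚ :* (con 1ℚ :+ y) := x :+ con 3ℚ :+ con 2ℚ :* y) refl x y) ⟩
      ∣ u ∣ * r * ((x + 1ℚ + 2ℚ * y) * (x + 3ℚ + 2ℚ * y) * d)
        ≡⟨ solve 5 (λ u r s t d → u :* r :* (s :* t :* d) := u :* s :* t :* (d :* r)) refl (∣ u ∣) r (x + 1ℚ + 2ℚ * y) (x + 3ℚ + 2ℚ * y) d ⟩
      ∣ u ∣ * (x + 1ℚ + 2ℚ * y) * (x + 3ℚ + 2ℚ * y) * (d * r)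
        ≡⟨ cong (∣ u ∣ * (x + 1ℚ + 2ℚ * y) * (x + 3ℚ + 2ℚ * y) *_) (trans (cong (_* r) (sym eq′)) (⟦⟧-inv (2 ℕ.+ e))) ⟩
      ∣ u ∣ * (x + 1ℚ + 2ℚ * y) * (x + 3ℚ + 2ℚ * y) * 1ℚ
        ≡⟨ *-identityʳ _ ⟩
      ∣ u ∣ * (x + 1ℚ + 2ℚ * y) * (x + 3ℚ + 2ℚ * y)
        ≤⟨ *-monoˡ (0≤+ (0≤+ 0≤x (0≤⟦⟧ 3)) 0≤2y) (*-monoˡ (0≤+ (0≤+ 0≤x 0≤1) 0≤2y) ∣u∣≤) ⟩
      (x - 1ℚ + 2ℚ * y) * (x + 1ℚ + 2ℚ * y) * (x + 3ℚ + 2ℚ * y) ∎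
    where
    open ≤-Reasoning
    eq′ = next x y e eq
    u = x + 1ℚ - 2ℚ * y
    r = inv (2 ℕ.+ e)
    E = remainder x (1ℚ + y) (2 ℕ.+ e) K
    T = x - 1ℚ + 2ℚ * (1ℚ + y + ⟦ K ⟧)
    d = x + 3ℚ + 2ℚ * (1ℚ + y)
    0≤y = ≤-trans 0≤1 1≤y
    0≤2y = 0≤* (0≤⟦⟧ 2) 0≤y
    ∣u∣≤ : ∣ u ∣ ≤ x - 1ℚ + 2ℚ * y
    ∣u∣≤ = ∣∣≤
      (≤-slack (4ℚ * (y - 1ℚ) + 2ℚ) (0≤+ (0≤* (0≤⟦⟧ 4) (0≤-diff 1≤y)) (0≤⟦⟧ 2))
        (solve 2 (λ x y → x :- con 1ℚ :+ con 2ℚ :* y := x :+ con 1ℚ :- con 2ℚ :* y :+ (con 4ℚ :* (y :- con 1ℚ) :+ con 2ℚ)) refl x y))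
      (≤-slack (x + x) (0≤+ 0≤x 0≤x)
        (solve 2 (λ x y → x :- con 1ℚ :+ con 2ℚ :* y := :- (x :+ con 1ℚ :- con 2ℚ :* y) :+ (x :+ x)) refl x y))

  remainder-null : ∀ x e → 0ℚ ≤ x → ⟦ suc e ⟧ ≡ x + 3ℚ + 2ℚ * 0ℚ → Null (remainder x 0ℚ e)
  -- The factor at `y = 0` escapes `remainder-bound`; it is split off as a constant, which shifts
  -- the sequence by one.
  remainder-null x e 0≤x eq = null-suc
    (null-*ˡ ((x + 1ℚ - 2ℚ * 0ℚ) * inv (2 ℕ.+ e)) (null-inv (proj₁ C) bound))
    where
    B = (x - 1ℚ + 2ℚ * 1ℚ) * (x + 1ℚ + 2ℚ * 1ℚ) * (x + 3ℚ + 2ℚ * 1ℚ)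
    C = ≤⟦suc⟧ B
    E = remainder x 1ℚ (2 ℕ.+ e)
    open ≤-Reasoning
    bound : ∀ K → ∣ E K ∣ ≤ ⟦ suc (proj₁ C) ⟧ * inv K
    bound K = begin
      ∣ E K ∣ ≡⟨ *-identityʳ (∣ E K ∣) ⟨
      ∣ E K ∣ * 1ℚ ≡⟨ cong (∣ E K ∣ *_) (⟦⟧-inv K) ⟨
      ∣ E K ∣ * (⟦ suc K ⟧ * inv K) ≡⟨ *-assoc (∣ E K ∣) ⟦ suc K ⟧ (inv K) ⟨
      ∣ E K ∣ * ⟦ suc K ⟧ * inv K ≤⟨ *-monoˡ (0≤inv K) (*-monoʳ (0≤∣p∣ (E K))
        (≤-slack {⟦ suc K ⟧} {x - 1ℚ + 2ℚ * (1ℚ + ⟦ K ⟧)} (x + ⟦ K ⟧) (0≤+ 0≤x (0≤⟦⟧ K)) (trans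
          (solve 2 (λ x k → x :- con 1ℚ :+ con 2ℚ :* (con 1ℚ :+ k) := (con 1ℚ :+ k) :+ (x :+ k)) refl x ⟦ K ⟧)
          (cong (_+ (x + ⟦ K ⟧)) (sym (⟦suc⟧ K)))))) ⟩
      ∣ E K ∣ * (x - 1ℚ + 2ℚ * (1ℚ + ⟦ K ⟧)) * inv K
        ≤⟨ *-monoˡ (0≤inv K) (≤-trans (remainder-bound K x 1ℚ (2 ℕ.+ e) 0≤x ≤-refl (next x 0ℚ e eq)) (proj₂ C)) ⟩
      ⟦ suc (proj₁ C) ⟧ * inv K ∎

  -- Unfolds by two successors at a time, in step with the index `e` of `kummer`, which grows by 2
  -- with each term.
  twice : ℕ → ℕ
  twice zero    = zero
  twice (suc n) = suc (suc (twice n))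

  ⟦2+⟧ : ∀ n → ⟦ 2 ℕ.+ n ⟧ ≡ 2ℚ + ⟦ n ⟧
  ⟦2+⟧ n = ⟦⟧-+ 2 n

  -- The factors x + 1 - 2y descend through the even numbers and reach 0, so the recurrence is exact
  -- for terminating series.
  remainder-vanishes : ∀ k j x y e → x + 1ℚ - 2ℚ * y ≡ ⟦ twice k ⟧ → remainder x y e (suc k ℕ.+ j) ≡ 0ℚ
  remainder-vanishes zero    j x y e eq rewrite eq =
    trans (cong (_* remainder x (1ℚ + y) (2 ℕ.+ e) j) (*-zeroˡ (inv (2 ℕ.+ e)))) (*-zeroˡ (remainder x (1ℚ + y) (2 ℕ.+ e) j))
  remainder-vanishes (suc k) j x y e eq =
    trans (cong ((x + 1ℚ - 2ℚ * y) * inv (2 ℕ.+ e) *_) (remainder-vanishes k j x (1ℚ + y) (2 ℕ.+ e)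
        (trans (solve 2 (λ x y → x :+ con 1ℚ :- con 2ℚ :* (con 1ℚ :+ y) := x :+ con 1ℚ :- con 2ℚ :* y :- con 2ℚ) refl x y)
          (trans (cong (_- 2ℚ) (trans eq (⟦2+⟧ (twice k))))
            (solve 1 (λ k → con 2ℚ :+ k :- con 2ℚ := k) refl ⟦ twice k ⟧)))))
      (*-zeroʳ ((x + 1ℚ - 2ℚ * y) * inv (2 ℕ.+ e)))

  down : ∀ x y {z} → x - 2ℚ * y ≡ 2ℚ + z → x - 2ℚ * (1ℚ + y) ≡ z
  down x y {z} eq = trans (solve 2 (λ x y → x :- con 2ℚ :* (con 1ℚ :+ y) := x :- con 2ℚ :* y :- con 2ℚ) refl x y)
    (trans (cong (_- 2ℚ) eq) (solve 1 (λ k → con 2ℚ :+ k :- con 2ℚ := k) refl z))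

  kummer-stable : ∀ k j x y e → x - 2ℚ * y ≡ ⟦ twice k ⟧ → kummer x y e (suc k ℕ.+ j) ≡ kummer x y e (suc k)
  kummer-stable zero    j x y e eq rewrite eq = cong (λ t → 1ℚ + t)
    (trans (cong (_* P) (*-zeroˡ (inv e))) (trans (*-zeroˡ P) (sym (*-zeroʳ (0ℚ * inv e)))))
    where P = kummer x (1ℚ + y) (2 ℕ.+ e) j
  kummer-stable (suc k) j x y e eq = cong (λ t → 1ℚ + (x - 2ℚ * y) * inv e * t)
    (kummer-stable k j x (1ℚ + y) (2 ℕ.+ e) (down x y (trans eq (⟦2+⟧ (twice k)))))

  -- Once `2ℚ * y` has passed `x`, every ratio of consecutive terms lies in [-1, 0], so each Horner
  -- step maps [0, 1] into itself. The bound by `suc e` persists because both sides grow by 2.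
  kummer-alternating : ∀ K x y e → x - 2ℚ * y ≤ 0ℚ → 2ℚ * y - x ≤ ⟦ suc e ⟧ →
    0ℚ ≤ kummer x y e K × kummer x y e K ≤ 1ℚ
  kummer-alternating zero    x y e a≤0 -a≤d = ≤-refl , 0≤1
  kummer-alternating (suc K) x y e a≤0 -a≤d =
    ≤-trans (0≤-diff gP≤1) (≤-reflexive e₁) , ≤-slack {1ℚ + (x - 2ℚ * y) * inv e * P} {1ℚ} (g * P) (0≤* 0≤g (proj₁ IH)) e₂
    where
    P = kummer x (1ℚ + y) (2 ℕ.+ e) K
    g = (2ℚ * y - x) * inv e
    down≤ : x - 2ℚ * (1ℚ + y) ≤ x - 2ℚ * y
    down≤ = ≤-slack {x - 2ℚ * (1ℚ + y)} {x - 2ℚ * y} 2ℚ (0≤⟦⟧ 2) (solve 2 (λ x y → x :- con 2ℚ :* y := x :- con 2ℚ :* (con 1ℚ :+ y) :+ con 2ℚ) refl x y)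
    up≤ : 2ℚ * (1ℚ + y) - x ≤ ⟦ suc (2 ℕ.+ e) ⟧
    up≤ = subst₂ _≤_ (solve 2 (λ x y → con 2ℚ :* y :- x :+ con 2ℚ := con 2ℚ :* (con 1ℚ :+ y) :- x) refl x y) (sym (⟦3+⟧ e refl)) (+-monoˡ-≤ 2ℚ -a≤d)
    IH : 0ℚ ≤ P × P ≤ 1ℚ
    IH = kummer-alternating K x (1ℚ + y) (2 ℕ.+ e) (≤-trans down≤ a≤0) up≤
    0≤2y-x : 0ℚ ≤ 2ℚ * y - x
    0≤2y-x = ≤-trans (0≤-diff a≤0) (≤-reflexive (solve 2 (λ x y → con 0ℚ :- (x :- con 2ℚ :* y) := con 2ℚ :* y :- x) refl x y))
    0≤g : 0ℚ ≤ g
    0≤g = 0≤* 0≤2y-x (0≤inv e)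
    g≤1 : g ≤ 1ℚ
    g≤1 = ≤-trans (*-monoˡ (0≤inv e) -a≤d) (≤-reflexive (⟦⟧-inv e))
    gP≤1 : g * P ≤ 1ℚ
    gP≤1 = *-mono-≤ 0≤g g≤1 (proj₁ IH) (proj₂ IH)
    e₁ : 1ℚ - g * P ≡ 1ℚ + (x - 2ℚ * y) * inv e * P
    e₁ = solve 4 (λ x y r P → con 1ℚ :- (con 2ℚ :* y :- x) :* r :* P := con 1ℚ :+ (x :- con 2ℚ :* y) :* r :* P) refl x y (inv e) P
    e₂ : 1ℚ ≡ 1ℚ + (x - 2ℚ * y) * inv e * P + g * P
    e₂ = solve 4 (λ x y r P → con 1ℚ := con 1ℚ :+ (x :- con 2ℚ :* y) :* r :* P :+ (con 2ℚ :* y :- x) :* r :* P) refl x y (inv e) P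

  -- Raising `x` by one adds one to both numerator and denominator of a term ratio, which cannot
  -- decrease a ratio that is at most 1.
  ratio-mono : ∀ a e → a ≤ ⟦ suc e ⟧ → a * inv e ≤ (1ℚ + a) * inv (suc e)
  ratio-mono a e a≤d = *-cancelˡ (0<⟦suc⟧ (suc e)) (*-cancelˡ (0<⟦suc⟧ e) (begin
      d * (d′ * (a * r)) ≡⟨ solve 4 (λ d d′ a r → d :* (d′ :* (a :* r)) := (d :* r) :* (d′ :* a)) refl d d′ a r ⟩
      (d * r) * (d′ * a) ≡⟨ cong₂ (λ s t → s * (t * a)) (⟦⟧-inv e) (⟦suc⟧ (suc e)) ⟩
      1ℚ * ((1ℚ + d) * a) ≡⟨ solve 2 (λ d a → con 1ℚ :* ((con 1ℚ :+ d) :* a) := d :* a :+ a) refl d a ⟩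
      d * a + a ≤⟨ +-monoʳ-≤ (d * a) a≤d ⟩
      d * a + d ≡⟨ solve 2 (λ d a → d :* a :+ d := con 1ℚ :* (d :* (con 1ℚ :+ a))) refl d a ⟩
      1ℚ * (d * (1ℚ + a)) ≡⟨ cong (_* (d * (1ℚ + a))) (⟦⟧-inv (suc e)) ⟨
      (d′ * r′) * (d * (1ℚ + a)) ≡⟨ solve 4 (λ d d′ a r → (d′ :* r) :* (d :* a) := d :* (d′ :* (a :* r))) refl d d′ (1ℚ + a) r′ ⟩
      d * (d′ * ((1ℚ + a) * r′)) ∎))
    where
    open ≤-Reasoning
    d = ⟦ suc e ⟧
    d′ = ⟦ suc (suc e) ⟧
    r = inv e
    r′ = inv (suc e)

  -- This gives V(2n - 1) ≤ V(2n). While the ratios are positive, the Horner form is monotone in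
  -- them. Where the even series ends, its tail is 1, whereas the odd one has turned alternating and
  -- its tail is at most 1.
  kummer-odd≤even : ∀ k K x y e → x - 2ℚ * y ≡ ⟦ twice k ⟧ - 1ℚ → twice k ℕ.≤ suc e →
    0ℚ ≤ kummer x y e K × kummer x y e K ≤ kummer (1ℚ + x) y (suc e) (suc k)
  kummer-odd≤even zero K x y e eq _ = proj₁ alt , ≤-trans (proj₂ alt) (≤-reflexive (sym one))
    where
    a≤0 : x - 2ℚ * y ≤ 0ℚ
    a≤0 = ≤-trans (≤-reflexive eq) (≤-slack {⟦ 0 ⟧ - 1ℚ} {0ℚ} 1ℚ 0≤1 refl)
    -a≤d : 2ℚ * y - x ≤ ⟦ suc e ⟧
    -a≤d = ≤-trans (≤-reflexive (trans (solve 2 (λ x y → con 2ℚ :* y :- x := :- (x :- con 2ℚ :* y)) refl x y) (cong -_ eq)))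
      (⟦⟧-mono {1} {suc e} (s≤s z≤n))
    alt : 0ℚ ≤ kummer x y e K × kummer x y e K ≤ 1ℚ
    alt = kummer-alternating K x y e a≤0 -a≤d
    one : kummer (1ℚ + x) y (suc e) 1 ≡ 1ℚ
    one = trans (cong (λ t → 1ℚ + t) (*-zeroʳ ((1ℚ + x - 2ℚ * y) * inv (suc e)))) (+-identityʳ 1ℚ)
  kummer-odd≤even (suc k) K x y e eq 2k≤ = go K
    where
    a = x - 2ℚ * y
    eq′ : x - 2ℚ * (1ℚ + y) ≡ ⟦ twice k ⟧ - 1ℚ
    eq′ = down x y (trans eq (trans (cong (_- 1ℚ) (⟦2+⟧ (twice k))) (+-assoc 2ℚ ⟦ twice k ⟧ (- 1ℚ))))
    2k≤′ : twice k ℕ.≤ suc (2 ℕ.+ e)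
    2k≤′ = ℕP.≤-trans (ℕP.≤-trans (ℕP.n≤1+n _) (ℕP.n≤1+n _)) (ℕP.≤-trans 2k≤ (ℕP.≤-trans (ℕP.n≤1+n _) (ℕP.n≤1+n _)))
    IH : ∀ K → 0ℚ ≤ kummer x (1ℚ + y) (2 ℕ.+ e) K × kummer x (1ℚ + y) (2 ℕ.+ e) K ≤ kummer (1ℚ + x) (1ℚ + y) (3 ℕ.+ e) (suc k)
    IH K = kummer-odd≤even k K x (1ℚ + y) (2 ℕ.+ e) eq′ 2k≤′
    0≤a : 0ℚ ≤ a
    0≤a = ≤-trans (0≤+ 0≤1 (0≤⟦⟧ (twice k))) (≤-reflexive (sym (trans eq (trans (cong (_- 1ℚ) (⟦2+⟧ (twice k)))
      (solve 1 (λ k → con 2ℚ :+ k :- con 1ℚ := con 1ℚ :+ k) refl ⟦ twice k ⟧)))))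
    a≤d : a ≤ ⟦ suc e ⟧
    a≤d = ≤-trans (≤-reflexive eq) (≤-trans (≤-slack 1ℚ 0≤1 (solve 1 (λ k → k := k :- con 1ℚ :+ con 1ℚ) refl ⟦ 2 ℕ.+ twice k ⟧)) (⟦⟧-mono 2k≤))
    f≤ : a * inv e ≤ (1ℚ + x - 2ℚ * y) * inv (suc e)
    f≤ = ≤-trans (ratio-mono a e a≤d) (≤-reflexive (cong (_* inv (suc e)) (sym (+-assoc 1ℚ x (- (2ℚ * y))))))
    0≤f : 0ℚ ≤ a * inv e
    0≤f = 0≤* 0≤a (0≤inv e)
    go : ∀ K → 0ℚ ≤ kummer x y e K × kummer x y e K ≤ kummer (1ℚ + x) y (suc e) (suc (suc k))
    go zero = ≤-refl , 0≤+ 0≤1 (0≤* (≤-trans 0≤f f≤) (≤-trans (proj₁ (IH 0)) (proj₂ (IH 0))))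
    go (suc K) = 0≤+ 0≤1 (0≤* 0≤f (proj₁ (IH K))) , +-monoʳ-≤ 1ℚ (*-mono-≤ 0≤f f≤ (proj₁ (IH K)) (proj₂ (IH K)))

  -- This gives V(2n) ≤ V(2n + 1). Where the even series ends with tail 1, the odd one still has one
  -- positive ratio, followed by an alternating tail that is nonnegative, so it is at least 1 there.
  kummer-even≤odd : ∀ k j x y e → x - 2ℚ * y ≡ ⟦ twice k ⟧ → twice k ℕ.≤ suc e →
    0ℚ ≤ kummer x y e (suc k) × kummer x y e (suc k) ≤ kummer (1ℚ + x) y (suc e) (suc k ℕ.+ j)
  kummer-even≤odd zero j x y e eq _ =
    ≤-trans 0≤1 (≤-reflexive (sym one)) , ≤-trans (≤-reflexive one) (≤-slack (f * P) (0≤* 0≤f (proj₁ alt)) refl)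
    where
    one : kummer x y e 1 ≡ 1ℚ
    one = trans (cong (λ t → 1ℚ + t) (*-zeroʳ ((x - 2ℚ * y) * inv e))) (+-identityʳ 1ℚ)
    f = (1ℚ + x - 2ℚ * y) * inv (suc e)
    P = kummer (1ℚ + x) (1ℚ + y) (3 ℕ.+ e) j
    0≤f : 0ℚ ≤ f
    0≤f = 0≤* (≤-trans 0≤1 (≤-reflexive (sym (trans (+-assoc 1ℚ x (- (2ℚ * y))) (cong (λ t → 1ℚ + t) eq))))) (0≤inv (suc e))
    eq″ : 1ℚ + x - 2ℚ * (1ℚ + y) ≡ ⟦ 0 ⟧ - 1ℚ
    eq″ = trans (solve 2 (λ x y → con 1ℚ :+ x :- con 2ℚ :* (con 1ℚ :+ y) := x :- con 2ℚ :* y :- con 1ℚ) refl x y) (cong (_- 1ℚ) eq)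
    alt = kummer-odd≤even 0 j (1ℚ + x) (1ℚ + y) (3 ℕ.+ e) eq″ z≤n
  kummer-even≤odd (suc k) j x y e eq 2k≤ =
    0≤+ 0≤1 (0≤* 0≤f (proj₁ IH)) , +-monoʳ-≤ 1ℚ (*-mono-≤ 0≤f f≤ (proj₁ IH) (proj₂ IH))
    where
    a = x - 2ℚ * y
    IH = kummer-even≤odd k j x (1ℚ + y) (2 ℕ.+ e) (down x y (trans eq (⟦2+⟧ (twice k))))
      (ℕP.≤-trans (ℕP.≤-trans (ℕP.n≤1+n _) (ℕP.n≤1+n _)) (ℕP.≤-trans 2k≤ (ℕP.≤-trans (ℕP.n≤1+n _) (ℕP.n≤1+n _))))
    f≤ : a * inv e ≤ (1ℚ + x - 2ℚ * y) * inv (suc e)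
    f≤ = ≤-trans (ratio-mono a e (≤-trans (≤-reflexive eq) (⟦⟧-mono 2k≤))) (≤-reflexive (cong (_* inv (suc e)) (sym (+-assoc 1ℚ x (- (2ℚ * y))))))
    0≤f : 0ℚ ≤ a * inv e
    0≤f = 0≤* (≤-trans (0≤⟦⟧ (2 ℕ.+ twice k)) (≤-reflexive (sym eq))) (0≤inv e)

  -- C(2n, n) / 4 ^ n through its ratios (2n + 1) / (2n + 2).
  central : ℕ → ℚ
  central zero    = 1ℚ
  central (suc n) = ⟦ suc (twice n) ⟧ * inv (suc (twice n)) * central n

  0≤central : ∀ n → 0ℚ ≤ central n
  0≤central zero    = 0≤1
  0≤central (suc n) = 0≤* (0≤* (0≤⟦⟧ (suc (twice n))) (0≤inv (suc (twice n)))) (0≤central n)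

  -- V(2n - 1) / V(-1), the product of the recurrence factors (2j + 1) / (2j) for 1 ≤ j ≤ n.
  odd : ℕ → ℚ
  odd n = ⟦ suc (twice n) ⟧ * central n

  0≤odd : ∀ n → 0ℚ ≤ odd n
  0≤odd n = 0≤* (0≤⟦⟧ (suc (twice n))) (0≤central n)

  odd-suc : ∀ n → odd (suc n) ≡ ⟦ suc (twice (suc n)) ⟧ * inv (suc (twice n)) * odd n
  odd-suc n = solve 4 (λ a r b c → a :* (b :* r :* c) := a :* r :* (b :* c)) refl
    ⟦ suc (twice (suc n)) ⟧ (inv (suc (twice n))) ⟦ suc (twice n) ⟧ (central n)

  -- At x = -1 the ratio is -(2y + 1) / (2y + 3), so products of ratios telescope and the term j
  -- places on is ±(2k + 1) / (2(k + j) + 1).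
  kummer-leibniz : ∀ K k e → ⟦ suc e ⟧ ≡ 3ℚ + 2ℚ * ⟦ k ⟧ →
    kummer (0ℚ - 1ℚ) ⟦ k ⟧ e K ≡ (1ℚ + 2ℚ * ⟦ k ⟧) * leibniz k K
  kummer-leibniz zero    k e eq = sym (*-zeroʳ (1ℚ + 2ℚ * ⟦ k ⟧))
  kummer-leibniz (suc K) k e eq = begin
      1ℚ + (0ℚ - 1ℚ - 2ℚ * y) * r * kummer (0ℚ - 1ℚ) (1ℚ + y) (2 ℕ.+ e) K
        ≡⟨ cong (λ t → 1ℚ + (0ℚ - 1ℚ - 2ℚ * y) * r * t) (trans (cong (λ t → kummer (0ℚ - 1ℚ) t (2 ℕ.+ e) K) (sym (⟦suc⟧ k)))
             (kummer-leibniz K (suc k) (2 ℕ.+ e) eq′)) ⟩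
      1ℚ + (0ℚ - 1ℚ - 2ℚ * y) * r * ((1ℚ + 2ℚ * ⟦ suc k ⟧) * L)
        ≡⟨ solve 4 (λ a r b L → con 1ℚ :+ a :* r :* (b :* L) := con 1ℚ :+ a :* L :* (b :* r)) refl (0ℚ - 1ℚ - 2ℚ * y) r (1ℚ + 2ℚ * ⟦ suc k ⟧) L ⟩
      1ℚ + (0ℚ - 1ℚ - 2ℚ * y) * L * ((1ℚ + 2ℚ * ⟦ suc k ⟧) * r)
        ≡⟨ cong (λ t → 1ℚ + (0ℚ - 1ℚ - 2ℚ * y) * L * t) (trans (cong (_* r) (sym e₁)) (⟦⟧-inv e)) ⟩
      1ℚ + (0ℚ - 1ℚ - 2ℚ * y) * L * 1ℚ
        ≡⟨ solve 2 (λ y L → con 1ℚ :+ (con 0ℚ :- con 1ℚ :- con 2ℚ :* y) :* L :* con 1ℚ := con 1ℚ :- (con 1ℚ :+ con 2ℚ :* y) :* L) refl y L ⟩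
      1ℚ - (1ℚ + 2ℚ * y) * L
        ≡⟨ cong (_- (1ℚ + 2ℚ * y) * L) (trans (cong (_* inv (2 ℕ.* k)) e₂) (⟦⟧-inv (2 ℕ.* k))) ⟨
      (1ℚ + 2ℚ * y) * inv (2 ℕ.* k) - (1ℚ + 2ℚ * y) * L
        ≡⟨ solve 3 (λ a i L → a :* i :- a :* L := a :* (i :- L)) refl (1ℚ + 2ℚ * y) (inv (2 ℕ.* k)) L ⟩
      (1ℚ + 2ℚ * y) * (inv (2 ℕ.* k) - L) ∎
    where
    open ≡-Reasoning
    y = ⟦ k ⟧
    r = inv e
    L = leibniz (suc k) K
    e₁ : ⟦ suc e ⟧ ≡ 1ℚ + 2ℚ * ⟦ suc k ⟧
    e₁ = trans eq (trans (solve 1 (λ y → con 3ℚ :+ con 2ℚ :* y := con 1ℚ :+ con 2ℚ :* (con 1ℚ :+ y)) refl y)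
      (cong (λ t → 1ℚ + 2ℚ * t) (sym (⟦suc⟧ k))))
    e₂ : 1ℚ + 2ℚ * y ≡ ⟦ suc (2 ℕ.* k) ⟧
    e₂ = sym (trans (⟦suc⟧ (2 ℕ.* k)) (cong (λ t → 1ℚ + t) (⟦⟧-* 2 k)))
    eq′ : ⟦ suc (2 ℕ.+ e) ⟧ ≡ 3ℚ + 2ℚ * ⟦ suc k ⟧
    eq′ = trans (⟦3+⟧ e e₁) (solve 1 (λ y → con 1ℚ :+ con 2ℚ :* y :+ con 2ℚ := con 3ℚ :+ con 2ℚ :* y) refl ⟦ suc k ⟧)

  oddSum : ℕ → ℕ → ℚ
  oddSum n K = kummer (⟦ twice n ⟧ - 1ℚ) 0ℚ (2 ℕ.+ twice n) K

  start : ∀ n → ⟦ 3 ℕ.+ n ⟧ ≡ ⟦ n ⟧ + 3ℚ + 2ℚ * 0ℚ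
  start n = trans (⟦⟧-+ 3 n) (solve 1 (λ x → con 3ℚ :+ x := x :+ con 3ℚ :+ con 2ℚ :* con 0ℚ) refl ⟦ n ⟧)

  oddSum-suc : ∀ n K → oddSum (suc n) K ≡
    ⟦ suc (twice (suc n)) ⟧ * inv (suc (twice n)) * oddSum n K
      + inv (twice n) * inv (suc (twice n)) * remainder ⟦ twice n ⟧ 0ℚ (2 ℕ.+ twice n) K
  oddSum-suc n K = begin
      V′
        ≡⟨ solve 1 (λ V → V := con 1ℚ :* con 1ℚ :* V) refl V′ ⟩
      1ℚ * 1ℚ * V′
        ≡⟨ cong₂ (λ s t → s * t * V′) h₁ h₂ ⟨
      (x + 1ℚ) * i * ((x + 2ℚ) * j) * V′
        ≡⟨ solve 5 (λ a i b j V → a :* i :* (b :* j) :* V := i :* j :* (a :* b :* V)) refl (x + 1ℚ) i (x + 2ℚ) j V′ ⟩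
      i * j * ((x + 1ℚ) * (x + 2ℚ) * V′)
        ≡⟨ cong (λ t → i * j * ((x + 1ℚ) * (x + 2ℚ) * kummer t 0ℚ (4 ℕ.+ twice n) K))
            (trans (cong (_- 1ℚ) (⟦2+⟧ (twice n))) (solve 1 (λ x → con 2ℚ :+ x :- con 1ℚ := x :+ con 1ℚ) refl x)) ⟩
      i * j * ((x + 1ℚ) * (x + 2ℚ) * kummer (x + 1ℚ) 0ℚ (4 ℕ.+ twice n) K)
        ≡⟨ cong (i * j *_) (kummer-shift K x 0ℚ (2 ℕ.+ twice n) (start (twice n))) ⟩
      i * j * ((x + 1ℚ - 2ℚ * 0ℚ) * (x + 3ℚ + 2ℚ * 0ℚ) * V + 0ℚ * (x + 3ℚ + 2ℚ * 0ℚ) + R)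
        ≡⟨ solve 5 (λ x i j V R →
             i :* j :* ((x :+ con 1ℚ :- con 2ℚ :* con 0ℚ) :* (x :+ con 3ℚ :+ con 2ℚ :* con 0ℚ) :* V :+ con 0ℚ :* (x :+ con 3ℚ :+ con 2ℚ :* con 0ℚ) :+ R)
             := (x :+ con 1ℚ) :* i :* ((con 3ℚ :+ x) :* j :* V) :+ i :* j :* R) refl x i j V R ⟩
      (x + 1ℚ) * i * ((3ℚ + x) * j * V) + i * j * R
        ≡⟨ cong (λ t → t * ((3ℚ + x) * j * V) + i * j * R) h₁ ⟩
      1ℚ * ((3ℚ + x) * j * V) + i * j * R
        ≡⟨ cong (_+ i * j * R) (trans (*-identityˡ _) (cong (λ t → t * j * V) (sym (⟦⟧-+ 3 (twice n))))) ⟩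
      ⟦ suc (twice (suc n)) ⟧ * j * V + i * j * R ∎
    where
    open ≡-Reasoning
    x = ⟦ twice n ⟧
    i = inv (twice n)
    j = inv (suc (twice n))
    V = oddSum n K
    V′ = oddSum (suc n) K
    R = remainder x 0ℚ (2 ℕ.+ twice n) K
    h₁ : (x + 1ℚ) * i ≡ 1ℚ
    h₁ = trans (cong (_* i) (trans (+-comm x 1ℚ) (sym (⟦suc⟧ (twice n))))) (⟦⟧-inv (twice n))
    h₂ : (x + 2ℚ) * j ≡ 1ℚ
    h₂ = trans (cong (_* j) (trans (+-comm x 2ℚ) (sym (⟦2+⟧ (twice n))))) (⟦⟧-inv (suc (twice n)))

  -- In the limit, V(2n - 1) = `odd n` π / 4: truncation spoils each recurrence step only by a null
  -- remainder, and the base case is Leibniz' series itself.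
  oddSum-leibniz : ∀ n → Null (λ K → oddSum n K - odd n * leibniz 0 K)
  oddSum-leibniz zero = null-inv 0 λ K → ≤-trans (≤-reflexive (cong ∣_∣ (trans
      (cong (_- odd 0 * leibniz 0 K) (kummer-leibniz K 0 2 refl)) (+-inverseʳ (1ℚ * leibniz 0 K)))))
    (0≤* (0≤⟦⟧ 1) (0≤inv K))
  oddSum-leibniz (suc n) = null-cong eq (null-+ (null-*ˡ c (oddSum-leibniz n))
      (null-*ˡ d (remainder-null ⟦ twice n ⟧ (2 ℕ.+ twice n) (0≤⟦⟧ (twice n)) (start (twice n)))))
    where
    c = ⟦ suc (twice (suc n)) ⟧ * inv (suc (twice n))
    d = inv (twice n) * inv (suc (twice n))
    R = remainder ⟦ twice n ⟧ 0ℚ (2 ℕ.+ twice n)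
    eq : ∀ K → c * (oddSum n K - odd n * leibniz 0 K) + d * R K ≡ oddSum (suc n) K - odd (suc n) * leibniz 0 K
    eq K = trans (solve 6 (λ c V o L d R → c :* (V :- o :* L) :+ d :* R := c :* V :+ d :* R :- c :* o :* L) refl
        c (oddSum n K) (odd n) (leibniz 0 K) d (R K))
      (cong₂ (λ s t → s - t * leibniz 0 K) (sym (oddSum-suc n K)) (sym (odd-suc n)))

  -- For even `x` the series has ended after `suc n` terms, so this is V(2n) itself and not an
  -- approximation.
  evenSum : ℕ → ℚ
  evenSum n = kummer ⟦ twice n ⟧ 0ℚ (3 ℕ.+ twice n) (suc n)

  ⟦twice⟧ : ∀ n → ⟦ twice n ⟧ ≡ 2ℚ * ⟦ n ⟧
  ⟦twice⟧ zero    = refl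
  ⟦twice⟧ (suc n) = trans (⟦2+⟧ (twice n)) (trans (cong (λ t → 2ℚ + t) (⟦twice⟧ n))
    (trans (solve 1 (λ n → con 2ℚ :+ con 2ℚ :* n := con 2ℚ :* (con 1ℚ :+ n)) refl ⟦ n ⟧) (cong (λ t → 2ℚ * t) (sym (⟦suc⟧ n)))))

  noShift : ∀ x → x - 2ℚ * 0ℚ ≡ x
  noShift = solve 1 (λ x → x :- con 2ℚ :* con 0ℚ := x) refl

  evenSum-suc : ∀ n → ⟦ 3 ℕ.+ twice n ⟧ * evenSum (suc n) ≡ ⟦ 4 ℕ.+ twice n ⟧ * evenSum n
  evenSum-suc n = *-cancelˡ-≡ (begin
      (x + 1ℚ) * (⟦ 3 ℕ.+ twice n ⟧ * evenSum (suc n))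
        ≡⟨ cong₂ (λ s t → (x + 1ℚ) * (s * kummer t 0ℚ (5 ℕ.+ twice n) (2 ℕ.+ n))) e₃ e₂ ⟩
      (x + 1ℚ) * ((x + 2ℚ) * kummer (x + 1ℚ) 0ℚ (5 ℕ.+ twice n) (2 ℕ.+ n))
        ≡⟨ *-assoc (x + 1ℚ) (x + 2ℚ) _ ⟨
      (x + 1ℚ) * (x + 2ℚ) * kummer (x + 1ℚ) 0ℚ (5 ℕ.+ twice n) (2 ℕ.+ n)
        ≡⟨ kummer-shift (2 ℕ.+ n) x 0ℚ (3 ℕ.+ twice n) e₄ ⟩
      (x + 1ℚ - 2ℚ * 0ℚ) * (x + 3ℚ + 2ℚ * 0ℚ) * V + 0ℚ * (x + 3ℚ + 2ℚ * 0ℚ) + R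
        ≡⟨ cong₂ (λ s t → (x + 1ℚ - 2ℚ * 0ℚ) * (x + 3ℚ + 2ℚ * 0ℚ) * s + 0ℚ * (x + 3ℚ + 2ℚ * 0ℚ) + t) V≡ R≡0 ⟩
      (x + 1ℚ - 2ℚ * 0ℚ) * (x + 3ℚ + 2ℚ * 0ℚ) * evenSum n + 0ℚ * (x + 3ℚ + 2ℚ * 0ℚ) + 0ℚ
        ≡⟨ solve 3 (λ x d V → (x :+ con 1ℚ :- con 2ℚ :* con 0ℚ) :* d :* V :+ con 0ℚ :* d :+ con 0ℚ := (x :+ con 1ℚ) :* (d :* V)) refl x (x + 3ℚ + 2ℚ * 0ℚ) (evenSum n) ⟩
      (x + 1ℚ) * ((x + 3ℚ + 2ℚ * 0ℚ) * evenSum n)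
        ≡⟨ cong (λ t → (x + 1ℚ) * (t * evenSum n)) (sym e₄) ⟩
      (x + 1ℚ) * (⟦ 4 ℕ.+ twice n ⟧ * evenSum n) ∎)
    where
    open ≡-Reasoning
    X = ⟦ twice n ⟧
    x = X + 1ℚ
    V = kummer (x - 1ℚ) 0ℚ (3 ℕ.+ twice n) (2 ℕ.+ n)
    R = remainder x 0ℚ (3 ℕ.+ twice n) (2 ℕ.+ n)
    e₃ : ⟦ 3 ℕ.+ twice n ⟧ ≡ x + 2ℚ
    e₃ = trans (⟦⟧-+ 3 (twice n)) (solve 1 (λ x → con 3ℚ :+ x := x :+ con 1ℚ :+ con 2ℚ) refl X)
    e₂ : ⟦ 2 ℕ.+ twice n ⟧ ≡ x + 1ℚ
    e₂ = trans (⟦⟧-+ 2 (twice n)) (solve 1 (λ x → con 2ℚ :+ x := x :+ con 1ℚ :+ con 1ℚ) refl X)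
    e₄ : ⟦ 4 ℕ.+ twice n ⟧ ≡ x + 3ℚ + 2ℚ * 0ℚ
    e₄ = trans (⟦⟧-+ 4 (twice n)) (solve 1 (λ x → con 4ℚ :+ x := x :+ con 1ℚ :+ con 3ℚ :+ con 2ℚ :* con 0ℚ) refl X)
    x-1 : x - 1ℚ ≡ X
    x-1 = solve 1 (λ x → x :+ con 1ℚ :- con 1ℚ := x) refl X
    V≡ : V ≡ evenSum n
    V≡ = trans (cong₂ (λ s t → kummer s 0ℚ (3 ℕ.+ twice n) t) x-1 (cong suc (ℕP.+-comm 1 n)))
      (kummer-stable n 1 X 0ℚ (3 ℕ.+ twice n) (noShift X))
    R≡0 : R ≡ 0ℚ
    R≡0 = trans (cong (remainder x 0ℚ (3 ℕ.+ twice n)) (cong (2 ℕ.+_) (sym (ℕP.+-identityʳ n))))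
      (remainder-vanishes (suc n) 0 x 0ℚ (3 ℕ.+ twice n)
        (trans (noShift (x + 1ℚ)) (sym e₂)))
    *-cancelˡ-≡ : ∀ {p q} → (x + 1ℚ) * p ≡ (x + 1ℚ) * q → p ≡ q
    *-cancelˡ-≡ {p} {q} eq = ≤-antisym (*-cancelˡ {p} {q} 0<x+1 (≤-reflexive eq)) (*-cancelˡ {q} {p} 0<x+1 (≤-reflexive (sym eq)))
      where
      0<x+1 : 0ℚ < x + 1ℚ
      0<x+1 = subst (0ℚ <_) e₂ (0<⟦suc⟧ (suc (twice n)))

  -- The recurrence factors (2n + 4) / (2n + 3) of V(2n) and (2n + 3) / (2n + 2) of `odd` multiply
  -- to (n + 2) / (n + 1).
  evenSum-odd : ∀ n → evenSum n * odd n ≡ ⟦ suc n ⟧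
  evenSum-odd zero    = refl
  evenSum-odd (suc n) = begin
      evenSum (suc n) * odd (suc n)
        ≡⟨ cong (evenSum (suc n) *_) (odd-suc n) ⟩
      evenSum (suc n) * (⟦ 3 ℕ.+ twice n ⟧ * j * odd n)
        ≡⟨ solve 4 (λ E a j o → E :* (a :* j :* o) := j :* o :* (a :* E)) refl (evenSum (suc n)) ⟦ 3 ℕ.+ twice n ⟧ j (odd n) ⟩
      j * odd n * (⟦ 3 ℕ.+ twice n ⟧ * evenSum (suc n))
        ≡⟨ cong (j * odd n *_) (evenSum-suc n) ⟩
      j * odd n * (⟦ 4 ℕ.+ twice n ⟧ * evenSum n)
        ≡⟨ solve 4 (λ E a j o → j :* o :* (a :* E) := j :* a :* (E :* o)) refl (evenSum n) ⟦ 4 ℕ.+ twice n ⟧ j (odd n) ⟩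
      j * ⟦ 4 ℕ.+ twice n ⟧ * (evenSum n * odd n)
        ≡⟨ cong₂ (λ s t → j * s * t) (⟦twice⟧ (2 ℕ.+ n)) (evenSum-odd n) ⟩
      j * (2ℚ * ⟦ 2 ℕ.+ n ⟧) * ⟦ suc n ⟧
        ≡⟨ solve 3 (λ j a b → j :* (con 2ℚ :* a) :* b := con 2ℚ :* b :* j :* a) refl j ⟦ 2 ℕ.+ n ⟧ ⟦ suc n ⟧ ⟩
      2ℚ * ⟦ suc n ⟧ * j * ⟦ 2 ℕ.+ n ⟧
        ≡⟨ cong (_* ⟦ 2 ℕ.+ n ⟧) (trans (cong (_* j) (sym (⟦twice⟧ (suc n)))) (⟦⟧-inv (suc (twice n)))) ⟩
      1ℚ * ⟦ 2 ℕ.+ n ⟧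
        ≡⟨ *-identityˡ ⟦ 2 ℕ.+ n ⟧ ⟩
      ⟦ 2 ℕ.+ n ⟧ ∎
    where
    open ≡-Reasoning
    j = inv (suc (twice n))

  -- Central binomial coefficients and nonnegative ±1 walks.

  module CentralBinomial where
    open import Data.Nat.Base using (⌊_/2⌋; ⌈_/2⌉)
    open import Data.Nat.Combinatorics using (_C_; nCk+nC[k+1]≡[n+1]C[k+1]; nCk≡nC[n∸k]; nCn≡1; k>n⇒nCk≡0)
    open import Data.Nat.Solver using () renaming (module +-*-Solver to ℕ-Solver)

    nC0≡1 : ∀ n → n C 0 ≡ 1
    nC0≡1 n = trans (nCk≡nC[n∸k] {0} {n} z≤n) (nCn≡1 n)

    absorption : ∀ n k → suc k ℕ.* (suc n C suc k) ≡ suc n ℕ.* (n C k)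
    absorption zero    zero    = refl
    absorption zero    (suc k) = trans (cong (suc (suc k) ℕ.*_) (k>n⇒nCk≡0 {1} {2 ℕ.+ k} (s≤s (s≤s z≤n)))) (ℕP.*-zeroʳ (2 ℕ.+ k))
    absorption (suc n) zero    = begin
        1 ℕ.* (suc (suc n) C 1) ≡⟨ cong (1 ℕ.*_) (nCk+nC[k+1]≡[n+1]C[k+1] (suc n) 0) ⟨
        1 ℕ.* (suc n C 0 ℕ.+ suc n C 1) ≡⟨ cong₂ (λ s t → 1 ℕ.* (s ℕ.+ t)) (nC0≡1 (suc n)) (trans (sym (ℕP.*-identityˡ _)) (absorption n 0)) ⟩
        1 ℕ.* (1 ℕ.+ suc n ℕ.* (n C 0)) ≡⟨ cong (λ s → 1 ℕ.* (1 ℕ.+ suc n ℕ.* s)) (nC0≡1 n) ⟩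
        1 ℕ.* (1 ℕ.+ suc n ℕ.* 1) ≡⟨ ℕP.*-identityˡ _ ⟩
        suc (suc n) ℕ.* 1 ≡⟨ cong (suc (suc n) ℕ.*_) (nC0≡1 (suc n)) ⟨
        suc (suc n) ℕ.* (suc n C 0)         ∎
      where open ≡-Reasoning
    absorption (suc n) (suc k) = begin
        (2 ℕ.+ k) ℕ.* (suc (suc n) C suc (suc k)) ≡⟨ cong ((2 ℕ.+ k) ℕ.*_) (nCk+nC[k+1]≡[n+1]C[k+1] (suc n) (suc k)) ⟨
        (2 ℕ.+ k) ℕ.* (a ℕ.+ b) ≡⟨ solve′ 3 (λ k a b → (con′ 2 :+′ k) :*′ (a :+′ b) :=′ (con′ 1 :+′ k) :*′ a :+′ a :+′ (con′ 2 :+′ k) :*′ b) refl k a b ⟩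
        suc k ℕ.* a ℕ.+ a ℕ.+ (2 ℕ.+ k) ℕ.* b ≡⟨ cong₂ (λ s t → s ℕ.+ a ℕ.+ t) (absorption n k) (absorption n (suc k)) ⟩
        suc n ℕ.* (n C k) ℕ.+ a ℕ.+ suc n ℕ.* (n C suc k) ≡⟨ solve′ 4 (λ n p q a → n :*′ p :+′ a :+′ n :*′ q :=′ n :*′ (p :+′ q) :+′ a) refl (suc n) (n C k) (n C suc k) a ⟩
        suc n ℕ.* (n C k ℕ.+ n C suc k) ℕ.+ a ≡⟨ cong (λ t → suc n ℕ.* t ℕ.+ a) (nCk+nC[k+1]≡[n+1]C[k+1] n k) ⟩
        suc n ℕ.* a ℕ.+ a ≡⟨ ℕP.+-comm (suc n ℕ.* a) a ⟩
        suc (suc n) ℕ.* a                           ∎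
      where
      open ≡-Reasoning
      open ℕ-Solver using () renaming (solve to solve′; _:=_ to infix 4 _:=′_; _:+_ to infixl 6 _:+′_; _:*_ to infixl 7 _:*′_; con to con′)
      a = suc n C suc k
      b = suc n C suc (suc k)

    -- With both sides multiplied by `suc n`, `absorption` applies a second time, after C(2n + 1, n)
    -- has been reflected to C(2n + 1, n + 1).
    central-C : ∀ n → suc n ℕ.* (twice (suc n) C suc n) ≡ 2 ℕ.* (suc (twice n) ℕ.* (twice n C n))
    central-C n = ℕP.*-cancelˡ-≡ _ _ (suc n) (begin
        suc n ℕ.* (suc n ℕ.* (twice (suc n) C suc n))
          ≡⟨ cong (suc n ℕ.*_) (absorption (suc (twice n)) n) ⟩
        suc n ℕ.* (suc (suc (twice n)) ℕ.* (suc (twice n) C n))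
          ≡⟨ cong (λ t → suc n ℕ.* (suc (suc (twice n)) ℕ.* t)) symm ⟩
        suc n ℕ.* (suc (suc (twice n)) ℕ.* (suc (twice n) C suc n))
          ≡⟨ cong (λ t → suc n ℕ.* (t ℕ.* (suc (twice n) C suc n))) (twice≡ (suc n)) ⟩
        suc n ℕ.* ((2 ℕ.* suc n) ℕ.* (suc (twice n) C suc n))
          ≡⟨ solve′ 2 (λ n c → n :*′ (con′ 2 :*′ n :*′ c) :=′ n :*′ (con′ 2 :*′ (n :*′ c))) refl (suc n) (suc (twice n) C suc n) ⟩
        suc n ℕ.* (2 ℕ.* (suc n ℕ.* (suc (twice n) C suc n)))
          ≡⟨ cong (λ t → suc n ℕ.* (2 ℕ.* t)) (absorption (twice n) n) ⟩
        suc n ℕ.* (2 ℕ.* (suc (twice n) ℕ.* (twice n C n))) ∎)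
      where
      open ≡-Reasoning
      open ℕ-Solver using () renaming (solve to solve′; _:=_ to infix 4 _:=′_; _:+_ to infixl 6 _:+′_; _:*_ to infixl 7 _:*′_; con to con′)
      twice≡ : ∀ n → twice n ≡ 2 ℕ.* n
      twice≡ zero    = refl
      twice≡ (suc n) = trans (cong (2 ℕ.+_) (twice≡ n)) (sym (ℕP.*-suc 2 n))
      twice≡+ : ∀ n → twice n ≡ n ℕ.+ n
      twice≡+ n = trans (twice≡ n) (cong (n ℕ.+_) (ℕP.+-identityʳ n))
      symm : suc (twice n) C n ≡ suc (twice n) C suc n
      symm = trans (nCk≡nC[n∸k] {n} {suc (twice n)} (subst (n ℕ.≤_) (cong suc (sym (twice≡+ n))) (ℕP.≤-trans (ℕP.m≤m+n n n) (ℕP.n≤1+n _))))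
        (cong (suc (twice n) C_) (trans (cong (λ t → suc t ℕ.∸ n) (twice≡+ n)) (ℕP.m+n∸n≡m (suc n) n)))

    -- paths y N is the number of ±1 walks of length N started from y - 1 that stay
    -- nonnegative, and survival y N the corresponding probability.
    paths : ℕ → ℕ → ℕ
    paths zero    N       = 0
    paths (suc y) zero    = 1
    paths (suc y) (suc N) = paths y N ℕ.+ paths (2 ℕ.+ y) N

    survival : ℕ → ℕ → ℚ
    survival zero    N       = 0ℚ
    survival (suc y) zero    = 1ℚ
    survival (suc y) (suc N) = ½ * (survival y N + survival (2 ℕ.+ y) N)

    C-middle : ∀ N → N C ⌊ suc N /2⌋ ≡ N C ⌊ N /2⌋
    C-middle N = trans (nCk≡nC[n∸k] {⌈ N /2⌉} {N} (ℕP.⌈n/2⌉≤n N))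
      (cong (N C_) (trans (cong (ℕ._∸ ⌈ N /2⌉) (sym (ℕP.⌊n/2⌋+⌈n/2⌉≡n N))) (ℕP.m+n∸n≡m ⌊ N /2⌋ ⌈ N /2⌉)))

    -- Starting one unit higher admits just the additional walks whose minimum has one prescribed
    -- value, and these are counted by a single binomial coefficient. The induction on `N` is
    -- Pascal's rule; `y = 0` yields the closed form of c(N).
    paths-suc : ∀ N y → paths (suc y) N ≡ paths y N ℕ.+ N C ⌊ suc (N ℕ.+ y) /2⌋
    paths-suc zero    zero    = refl
    paths-suc zero    (suc y) = cong (1 ℕ.+_) (sym (k>n⇒nCk≡0 {0} {suc ⌊ y /2⌋} (s≤s z≤n)))
    paths-suc (suc N) zero    = begin
        paths 2 N ≡⟨ paths-suc N 1 ⟩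
        paths 1 N ℕ.+ N C ⌊ suc (N ℕ.+ 1) /2⌋ ≡⟨ cong₂ (λ s t → s ℕ.+ N C ⌊ suc t /2⌋) (paths-suc N 0) (ℕP.+-comm N 1) ⟩
        N C ⌊ suc (N ℕ.+ 0) /2⌋ ℕ.+ N C suc ⌊ N /2⌋ ≡⟨ cong (λ t → N C ⌊ suc t /2⌋ ℕ.+ N C suc ⌊ N /2⌋) (ℕP.+-identityʳ N) ⟩
        N C ⌊ suc N /2⌋ ℕ.+ N C suc ⌊ N /2⌋ ≡⟨ cong (ℕ._+ N C suc ⌊ N /2⌋) (C-middle N) ⟩
        N C ⌊ N /2⌋ ℕ.+ N C suc ⌊ N /2⌋ ≡⟨ nCk+nC[k+1]≡[n+1]C[k+1] N ⌊ N /2⌋ ⟩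
        suc N C suc ⌊ N /2⌋ ≡⟨ cong (λ t → suc N C suc ⌊ t /2⌋) (ℕP.+-identityʳ N) ⟨
        suc N C suc ⌊ N ℕ.+ 0 /2⌋                             ∎
      where open ≡-Reasoning
    paths-suc (suc N) (suc y) = begin
        paths (suc y) N ℕ.+ paths (3 ℕ.+ y) N
          ≡⟨ cong₂ ℕ._+_ (paths-suc N y) (paths-suc N (2 ℕ.+ y)) ⟩
        (paths y N ℕ.+ N C k) ℕ.+ (paths (2 ℕ.+ y) N ℕ.+ N C ⌊ suc (N ℕ.+ (2 ℕ.+ y)) /2⌋)
          ≡⟨ cong (λ t → (paths y N ℕ.+ N C k) ℕ.+ (paths (2 ℕ.+ y) N ℕ.+ N C t)) e ⟩
        (paths y N ℕ.+ N C k) ℕ.+ (paths (2 ℕ.+ y) N ℕ.+ N C suc k)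
          ≡⟨ solve′ 4 (λ a b c d → (a :+′ b) :+′ (c :+′ d) :=′ (a :+′ c) :+′ (b :+′ d)) refl (paths y N) (N C k) (paths (2 ℕ.+ y) N) (N C suc k) ⟩
        (paths y N ℕ.+ paths (2 ℕ.+ y) N) ℕ.+ (N C k ℕ.+ N C suc k)
          ≡⟨ cong (paths (suc y) (suc N) ℕ.+_) (nCk+nC[k+1]≡[n+1]C[k+1] N k) ⟩
        paths (suc y) (suc N) ℕ.+ suc N C suc k
          ≡⟨ cong (λ t → paths (suc y) (suc N) ℕ.+ suc N C suc ⌊ t /2⌋) (ℕP.+-suc N y) ⟨
        paths (suc y) (suc N) ℕ.+ suc N C suc ⌊ N ℕ.+ suc y /2⌋ ∎
      where
      open ≡-Reasoning
      open ℕ-Solver using () renaming (solve to solve′; _:=_ to infix 4 _:=′_; _:+_ to infixl 6 _:+′_)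
      k = ⌊ suc (N ℕ.+ y) /2⌋
      e : ⌊ suc (N ℕ.+ (2 ℕ.+ y)) /2⌋ ≡ suc k
      e = cong (λ t → ⌊ suc t /2⌋) (trans (ℕP.+-suc N (suc y)) (cong suc (ℕP.+-suc N y)))

    survival-paths : ∀ N y → ⟦ 2 ℕ.^ N ⟧ * survival y N ≡ ⟦ paths y N ⟧
    survival-paths zero    zero    = refl
    survival-paths (suc N) zero    = *-zeroʳ ⟦ 2 ℕ.^ suc N ⟧
    survival-paths zero    (suc y) = refl
    survival-paths (suc N) (suc y) = begin
        ⟦ 2 ℕ.* 2 ℕ.^ N ⟧ * (½ * (p + q)) ≡⟨ cong (_* (½ * (p + q))) (⟦⟧-* 2 (2 ℕ.^ N)) ⟩
        2ℚ * t * (½ * (p + q)) ≡⟨ solve 3 (λ t p q → con 2ℚ :* t :* (con ½ :* (p :+ q)) := t :* p :+ t :* q) refl t p q ⟩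
        t * p + t * q ≡⟨ cong₂ _+_ (survival-paths N y) (survival-paths N (2 ℕ.+ y)) ⟩
        ⟦ paths y N ⟧ + ⟦ paths (2 ℕ.+ y) N ⟧ ≡⟨ ⟦⟧-+ (paths y N) (paths (2 ℕ.+ y) N) ⟨
        ⟦ paths y N ℕ.+ paths (2 ℕ.+ y) N ⟧   ∎
      where
      open ≡-Reasoning
      t = ⟦ 2 ℕ.^ N ⟧
      p = survival y N
      q = survival (2 ℕ.+ y) N

    central-paths : ∀ n → ⟦ 2 ℕ.^ twice n ⟧ * central n ≡ ⟦ twice n C n ⟧
    central-paths zero    = refl
    central-paths (suc n) = begin
        ⟦ 2 ℕ.* (2 ℕ.* T) ⟧ * (a * j * c) ≡⟨ cong (_* (a * j * c)) (trans (⟦⟧-* 2 (2 ℕ.* T)) (cong (2ℚ *_) (⟦⟧-* 2 T))) ⟩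
        2ℚ * (2ℚ * ⟦ T ⟧) * (a * j * c) ≡⟨ solve 4 (λ t a j c → con 2ℚ :* (con 2ℚ :* t) :* (a :* j :* c) := con 2ℚ :* j :* (con 2ℚ :* (a :* (t :* c)))) refl ⟦ T ⟧ a j c ⟩
        2ℚ * j * (2ℚ * (a * (⟦ T ⟧ * c))) ≡⟨ cong (λ t → 2ℚ * j * (2ℚ * (a * t))) (central-paths n) ⟩
        2ℚ * j * (2ℚ * (a * ⟦ b ⟧)) ≡⟨ cong (2ℚ * j *_) (trans (⟦⟧-* 2 (suc (twice n) ℕ.* b)) (cong (2ℚ *_) (⟦⟧-* (suc (twice n)) b))) ⟨
        2ℚ * j * ⟦ 2 ℕ.* (suc (twice n) ℕ.* b) ⟧ ≡⟨ cong (λ t → 2ℚ * j * ⟦ t ⟧) (central-C n) ⟨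
        2ℚ * j * ⟦ suc n ℕ.* b′ ⟧ ≡⟨ cong (2ℚ * j *_) (⟦⟧-* (suc n) b′) ⟩
        2ℚ * j * (⟦ suc n ⟧ * ⟦ b′ ⟧) ≡⟨ solve 3 (λ j n b → con 2ℚ :* j :* (n :* b) := con 2ℚ :* n :* j :* b) refl j ⟦ suc n ⟧ ⟦ b′ ⟧ ⟩
        2ℚ * ⟦ suc n ⟧ * j * ⟦ b′ ⟧ ≡⟨ cong (_* ⟦ b′ ⟧) (trans (cong (_* j) (sym (⟦twice⟧ (suc n)))) (⟦⟧-inv (suc (twice n)))) ⟩
        1ℚ * ⟦ b′ ⟧ ≡⟨ *-identityˡ ⟦ b′ ⟧ ⟩
        ⟦ b′ ⟧ ∎
      where
      open ≡-Reasoning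
      T = 2 ℕ.^ twice n
      a = ⟦ suc (twice n) ⟧
      j = inv (suc (twice n))
      c = central n
      b = twice n C n
      b′ = twice (suc n) C suc n

    ⌊twice/2⌋ : ∀ n → ⌊ twice n /2⌋ ≡ n
    ⌊twice/2⌋ zero    = refl
    ⌊twice/2⌋ (suc n) = cong suc (⌊twice/2⌋ n)

    paths-1 : ∀ N → paths 1 N ≡ N C ⌊ suc N /2⌋
    paths-1 N = trans (paths-suc N 0) (cong (λ t → N C ⌊ suc t /2⌋) (ℕP.+-identityʳ N))

    0<⟦2^⟧ : ∀ N → 0ℚ < ⟦ 2 ℕ.^ N ⟧
    0<⟦2^⟧ N with 2 ℕ.^ N | ℕP.m^n>0 2 N
    ... | suc k | _ = 0<⟦suc⟧ k

    cancel-≡ : ∀ {p q} r → 0ℚ < r → r * p ≡ r * q → p ≡ q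
    cancel-≡ {p} {q} r 0<r eq = ≤-antisym (*-cancelˡ {p} {q} {r} 0<r (≤-reflexive eq)) (*-cancelˡ {q} {p} {r} 0<r (≤-reflexive (sym eq)))

    remain : ℕ → ℚ
    remain = survival 1

    remain-even : ∀ n → remain (twice n) ≡ central n
    remain-even n = cancel-≡ ⟦ 2 ℕ.^ twice n ⟧ (0<⟦2^⟧ (twice n)) (trans (survival-paths (twice n) 1) (trans
      (cong ⟦_⟧ (trans (paths-1 (twice n)) (trans (C-middle (twice n)) (cong (twice n C_) (⌊twice/2⌋ n)))))
      (sym (central-paths n))))

    -- Twice C(2n + 1, n) is C(2n + 1, n) + C(2n + 1, n + 1) = C(2n + 2, n + 1), so length 2n + 1
    -- has the same probability as length 2n + 2.
    remain-odd : ∀ n → remain (suc (twice n)) ≡ central (suc n)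
    remain-odd n = cancel-≡ ⟦ 2 ℕ.^ twice (suc n) ⟧ (0<⟦2^⟧ (twice (suc n))) (begin
        ⟦ 2 ℕ.* 2 ℕ.^ N ⟧ * remain N ≡⟨ cong (_* remain N) (⟦⟧-* 2 (2 ℕ.^ N)) ⟩
        2ℚ * ⟦ 2 ℕ.^ N ⟧ * remain N ≡⟨ *-assoc 2ℚ ⟦ 2 ℕ.^ N ⟧ (remain N) ⟩
        2ℚ * (⟦ 2 ℕ.^ N ⟧ * remain N) ≡⟨ cong (2ℚ *_) (survival-paths N 1) ⟩
        2ℚ * ⟦ paths 1 N ⟧ ≡⟨ ⟦⟧-* 2 (paths 1 N) ⟨
        ⟦ 2 ℕ.* paths 1 N ⟧ ≡⟨ cong ⟦_⟧ (trans (cong (paths 1 N ℕ.+_) (ℕP.+-identityʳ (paths 1 N)))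
              (cong₂ ℕ._+_ (trans (paths-1 N) (C-middle N)) (paths-1 N))) ⟩
        ⟦ N C ⌊ N /2⌋ ℕ.+ N C suc ⌊ twice n /2⌋ ⟧ ≡⟨ cong₂ (λ s t → ⟦ N C s ℕ.+ N C suc t ⟧) half (⌊twice/2⌋ n) ⟩
        ⟦ N C n ℕ.+ N C suc n ⟧ ≡⟨ cong ⟦_⟧ (nCk+nC[k+1]≡[n+1]C[k+1] N n) ⟩
        ⟦ twice (suc n) C suc n ⟧ ≡⟨ central-paths (suc n) ⟨
        ⟦ 2 ℕ.^ twice (suc n) ⟧ * central (suc n)  ∎)
      where
      open ≡-Reasoning
      N = suc (twice n)
      half : ⌊ suc (twice n) /2⌋ ≡ n
      half = go n where
        go : ∀ n → ⌊ suc (twice n) /2⌋ ≡ n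
        go zero    = refl
        go (suc n) = cong suc (go n)

    0≤survival : ∀ N y → 0ℚ ≤ survival y N
    0≤survival N       zero    = ≤-refl
    0≤survival zero    (suc y) = 0≤1
    0≤survival (suc N) (suc y) = 0≤* (<⇒≤ (positive⁻¹ ½)) (0≤+ (0≤survival N y) (0≤survival N (2 ℕ.+ y)))

    survival-antitone : ∀ N y → survival y (suc N) ≤ survival y N
    survival-antitone N       zero    = ≤-refl
    survival-antitone zero    (suc zero)    = ≤-slack {survival 1 1} {1ℚ} ½ (<⇒≤ (positive⁻¹ ½)) refl
    survival-antitone zero    (suc (suc y)) = ≤-reflexive refl
    survival-antitone (suc N) (suc y) = *-monoʳ (<⇒≤ (positive⁻¹ ½)) (+-mono-≤ (survival-antitone N y) (survival-antitone N (2 ℕ.+ y)))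

    remain-antitone : ∀ {M N} → M ℕ.≤ N → remain N ≤ remain M
    remain-antitone h = go (ℕP.≤⇒≤′ h)
      where
      go : ∀ {M N} → M ℕ.≤′ N → remain N ≤ remain M
      go ℕ.≤′-refl           = ≤-refl
      go (ℕ.≤′-step {n} h) = ≤-trans (survival-antitone n 1) (go h)

    remain≤1 : ∀ N → remain N ≤ 1ℚ
    remain≤1 N = remain-antitone {0} {N} z≤n

    parity : ∀ N → (∃[ n ] N ≡ twice n) ⊎ (∃[ n ] N ≡ suc (twice n))
    parity zero = inj₁ (0 , refl)
    parity (suc zero) = inj₂ (0 , refl)
    parity (suc (suc N)) with parity N
    ... | inj₁ (n , refl) = inj₁ (suc n , refl)
    ... | inj₂ (n , refl) = inj₂ (suc n , refl)

    central-suc : ∀ n → ⟦ twice (suc n) ⟧ * central (suc n) ≡ odd n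
    central-suc n = trans (solve 4 (λ d a j c → d :* (a :* j :* c) := (d :* j) :* (a :* c)) refl
        ⟦ twice (suc n) ⟧ ⟦ suc (twice n) ⟧ (inv (suc (twice n))) (central n))
      (trans (cong (_* odd n) (⟦⟧-inv (suc (twice n)))) (*-identityˡ (odd n)))

    1≤odd : ∀ n → 1ℚ ≤ odd n
    1≤odd zero    = ≤-refl
    1≤odd (suc n) = ≤-trans (1≤odd n) (≤-trans (≤-reflexive (sym (central-suc n)))
      (*-monoˡ (0≤central (suc n)) (⟦⟧-mono (ℕP.n≤1+n (twice (suc n))))))

    -- `odd n` is at least 1 and equals (2n + 1) c(2n) = (2n + 2) c(2n + 1), one identity for each
    -- parity. This crude bound is what makes s polynomially comparable with S(𝟏) ^ n.
    remain-lower : ∀ N → 1ℚ ≤ ⟦ suc N ⟧ * remain N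
    remain-lower N with parity N
    ... | inj₁ (n , refl) = ≤-trans (1≤odd n) (≤-reflexive (cong (⟦ suc (twice n) ⟧ *_) (sym (remain-even n))))
    ... | inj₂ (n , refl) = ≤-trans (1≤odd n) (≤-reflexive (trans (sym (central-suc n)) (cong (⟦ twice (suc n) ⟧ *_) (sym (remain-odd n)))))

  open CentralBinomial public

  -- Wallis' bounds for the partial sums of Leibniz' series.

  infix 4 _≲_
  -- A record rather than a synonym, so that u and v can be inferred.
  record _≲_ (u v : ℕ → ℚ) : Set where
    constructor mk≲
    field eventually : ∀ ε → 0ℚ < ε → ∃[ N ] ∀ n → N ℕ.≤ n → u n ≤ v n + ε

  open _≲_ public

  ≤⇒≲ : ∀ {u v} → (∀ n → u n ≤ v n) → u ≲ v
  ≤⇒≲ {u} {v} h = mk≲ λ ε 0<ε → 0 , λ n _ → ≤-trans (h n) (≤-slack {v n} {v n + ε} ε (<⇒≤ 0<ε) refl)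

  ≲-trans : ∀ {u v w} → u ≲ v → v ≲ w → u ≲ w
  ≲-trans {u} {v} {w} hu hv = mk≲ λ ε 0<ε →
    let M , hM = eventually hu (½ * ε) (Defs.RationalLemmas.half-pos 0<ε)
        N , hN = eventually hv (½ * ε) (Defs.RationalLemmas.half-pos 0<ε)
    in M ℕ.⊔ N , λ n n≥ → begin
      u n ≤⟨ hM n (ℕP.m⊔n≤o⇒m≤o M N n≥) ⟩
      v n + ½ * ε ≤⟨ +-monoˡ-≤ (½ * ε) (hN n (ℕP.m⊔n≤o⇒n≤o M N n≥)) ⟩
      w n + ½ * ε + ½ * ε ≡⟨ solve 2 (λ w e → w :+ con ½ :* e :+ con ½ :* e := w :+ e) refl (w n) ε ⟩
      w n + ε ∎
    where open ≤-Reasoning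

  ≲-*ˡ : ∀ {u v} r → 0ℚ ≤ r → u ≲ v → (λ n → r * u n) ≲ (λ n → r * v n)
  ≲-*ˡ {u} {v} r 0≤r h = mk≲ λ ε 0<ε →
    let C , r≤C = ≤⟦suc⟧ r
        N , hN  = eventually h (ε * inv C) (*-pos 0<ε (0<inv C))
    in N , λ n n≥ → begin
      r * u n ≤⟨ *-monoʳ 0≤r (hN n n≥) ⟩
      r * (v n + ε * inv C) ≡⟨ *-distribˡ-+ r (v n) (ε * inv C) ⟩
      r * v n + r * (ε * inv C) ≤⟨ +-monoʳ-≤ (r * v n) (*-monoˡ (0≤* (<⇒≤ 0<ε) (0≤inv C)) r≤C) ⟩
      r * v n + ⟦ suc C ⟧ * (ε * inv C) ≡⟨ cong (λ t → r * v n + t) (inv-cancel C ε) ⟩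
      r * v n + ε ∎
    where open ≤-Reasoning

  null-≲ : ∀ {u v} → Null (λ n → u n - v n) → u ≲ v × v ≲ u
  null-≲ {u} {v} h =
    mk≲ (λ ε 0<ε → proj₁ (h ε 0<ε) , λ n n≥ → up ε n (proj₂ (h ε 0<ε) n n≥)) ,
    mk≲ (λ ε 0<ε → proj₁ (h ε 0<ε) , λ n n≥ → lo ε n (proj₂ (h ε 0<ε) n n≥))
    where
    open Defs.RationalLemmas using (∣-∣-unfold; ∣-∣-comm)
    up : ∀ ε n → ∣ u n - v n ∣ ≤ ε → u n ≤ v n + ε
    up ε n hn = ≤-trans (∣-∣-unfold (u n) (v n)) (+-monoʳ-≤ (v n) hn)
    lo : ∀ ε n → ∣ u n - v n ∣ ≤ ε → v n ≤ u n + ε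
    lo ε n hn = ≤-trans (∣-∣-unfold (v n) (u n))
      (+-monoʳ-≤ (u n) (≤-trans (≤-reflexive (∣-∣-comm (v n) (u n))) hn))

  L : ℕ → ℚ
  L = leibniz 0

  0≤L : ∀ K → 0ℚ ≤ L K
  0≤L K = proj₁ (LeibnizLemmas.leibniz-bounds 0 K)

  -- V(2n - 1) ≤ V(2n) multiplied by `odd n`: the left side approximates `odd n` ² π / 4, and the
  -- right side is `suc n` by `evenSum-odd`.
  odd-upper : ∀ n → (λ K → odd n * (odd n * L K)) ≲ (λ _ → ⟦ suc n ⟧)
  odd-upper n = ≲-trans {v = λ _ → odd n * evenSum n}
    (≲-*ˡ (odd n) (0≤odd n) (≲-trans {v = oddSum n} (proj₂ (null-≲ {oddSum n} {λ K → odd n * L K} (oddSum-leibniz n)))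
      (≤⇒≲ {oddSum n} {λ _ → evenSum n} below)))
    (≤⇒≲ λ _ → ≤-reflexive (trans (*-comm (odd n) (evenSum n)) (evenSum-odd n)))
    where
    X = ⟦ twice n ⟧
    below : ∀ K → oddSum n K ≤ evenSum n
    below K = ≤-trans
      (proj₂ (kummer-odd≤even n K (X - 1ℚ) 0ℚ (2 ℕ.+ twice n) (noShift (X - 1ℚ)) (ℕP.m≤n+m (twice n) 3)))
      (≤-reflexive (cong (λ t → kummer t 0ℚ (3 ℕ.+ twice n) (suc n)) (solve 1 (λ x → con 1ℚ :+ (x :- con 1ℚ) := x) refl X)))

  odd-lower : ∀ n → (λ _ → ⟦ suc n ⟧) ≲ (λ K → odd n * (odd (suc n) * L K))
  odd-lower n = ≲-trans {v = λ _ → odd n * evenSum n}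
    (≤⇒≲ λ _ → ≤-reflexive (sym (trans (*-comm (odd n) (evenSum n)) (evenSum-odd n))))
    (≲-*ˡ (odd n) (0≤odd n) (≲-trans {v = oddSum (suc n)} above
      (proj₁ (null-≲ {oddSum (suc n)} {λ K → odd (suc n) * L K} (oddSum-leibniz (suc n))))))
    where
    X = ⟦ twice n ⟧
    above : (λ _ → evenSum n) ≲ oddSum (suc n)
    -- `kummer-even≤odd` compares with sums of at least `suc n` terms, hence this threshold.
    above = mk≲ λ ε 0<ε → suc n , λ K K≥ → ≤-trans
      (proj₂ (kummer-even≤odd n (K ℕ.∸ suc n) X 0ℚ (3 ℕ.+ twice n) (noShift X) (ℕP.m≤n+m (twice n) 4)))
      (≤-trans (≤-reflexive (cong₂ (λ s t → kummer s 0ℚ (4 ℕ.+ twice n) t)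
        (trans (solve 1 (λ x → con 1ℚ :+ x := con 2ℚ :+ x :- con 1ℚ) refl X) (cong (_- 1ℚ) (sym (⟦2+⟧ (twice n)))))
        (ℕP.m+[n∸m]≡n K≥)))
        (≤-slack {oddSum (suc n) K} {oddSum (suc n) K + ε} ε (<⇒≤ 0<ε) refl))

  -- `odd-upper` rewritten through `odd n` = (2n + 1) `central n`; the only loss is 4n(n + 1) ≤ (2n
  -- + 1)².
  central-upper : ∀ n → (λ K → central n * central n * ⟦ twice n ⟧ * (4ℚ * L K)) ≲ (λ _ → 2ℚ)
  central-upper n = ≲-trans {v = λ K → r * (odd n * (odd n * L K))} (≤⇒≲ λ K → ≤-reflexive (e₁ K))
    (≲-trans {v = λ _ → r * ⟦ suc n ⟧} (≲-*ˡ r 0≤r (odd-upper n)) (≤⇒≲ λ _ → e₂))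
    where
    i = inv (twice n)
    t = ⟦ twice n ⟧
    r = 4ℚ * t * (i * i)
    0≤r : 0ℚ ≤ r
    0≤r = 0≤* (0≤* (0≤⟦⟧ 4) (0≤⟦⟧ (twice n))) (0≤* (0≤inv (twice n)) (0≤inv (twice n)))
    hi = ⟦⟧-inv (twice n)
    e₁ : ∀ K → central n * central n * t * (4ℚ * L K) ≡ r * (odd n * (odd n * L K))
    e₁ K = trans (solve 3 (λ c t l → c :* c :* t :* (con 4ℚ :* l) := con 1ℚ :* con 1ℚ :* (con 4ℚ :* t :* (c :* (c :* l)))) refl (central n) t (L K))
      (trans (cong₂ (λ p q → p * q * (4ℚ * t * (central n * (central n * L K)))) (sym hi) (sym hi))
        (solve 5 (λ d i t c l → d :* i :* (d :* i) :* (con 4ℚ :* t :* (c :* (c :* l))) := con 4ℚ :* t :* (i :* i) :* (d :* c :* (d :* c :* l)))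
          refl ⟦ suc (twice n) ⟧ i t (central n) (L K)))
    e₂ : r * ⟦ suc n ⟧ ≤ 2ℚ
    e₂ = begin
      4ℚ * t * (i * i) * ⟦ suc n ⟧
        ≡⟨ cong₂ (λ p q → 4ℚ * p * (i * i) * q) (⟦twice⟧ n) (⟦suc⟧ n) ⟩
      4ℚ * (2ℚ * ⟦ n ⟧) * (i * i) * (1ℚ + ⟦ n ⟧)
        ≤⟨ ≤-slack {4ℚ * (2ℚ * ⟦ n ⟧) * (i * i) * (1ℚ + ⟦ n ⟧)} {2ℚ * ((1ℚ + 2ℚ * ⟦ n ⟧) * i * ((1ℚ + 2ℚ * ⟦ n ⟧) * i))} (2ℚ * (i * i)) (0≤* (0≤⟦⟧ 2) (0≤* (0≤inv (twice n)) (0≤inv (twice n))))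
            (solve 2 (λ n i → con 2ℚ :* ((con 1ℚ :+ con 2ℚ :* n) :* i :* ((con 1ℚ :+ con 2ℚ :* n) :* i))
              := con 4ℚ :* (con 2ℚ :* n) :* (i :* i) :* (con 1ℚ :+ n) :+ con 2ℚ :* (i :* i)) refl ⟦ n ⟧ i) ⟩
      2ℚ * ((1ℚ + 2ℚ * ⟦ n ⟧) * i * ((1ℚ + 2ℚ * ⟦ n ⟧) * i))
        ≡⟨ cong (λ p → 2ℚ * (p * p)) (trans (cong (_* i) (trans (cong (λ s → 1ℚ + s) (sym (⟦twice⟧ n))) (sym (⟦suc⟧ (twice n))))) hi) ⟩
      2ℚ ∎
      where open ≤-Reasoning

  -- Here the only loss is (2n + 1)(2n + 3) ≤ (2n + 2)².
  central-lower : ∀ n → (λ _ → 2ℚ) ≲ (λ K → central n * central n * ⟦ suc (twice n) ⟧ * (4ℚ * L K))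
  central-lower n = ≲-trans {v = λ _ → r * ⟦ suc n ⟧} (≤⇒≲ λ _ → ≤-reflexive e₁)
    (≲-trans {v = λ K → r * (odd n * (odd (suc n) * L K))} (≲-*ˡ r 0≤r (odd-lower n)) (≤⇒≲ e₂))
    where
    m = inv n
    j = inv (suc (twice n))
    c = central n
    a = ⟦ suc (twice n) ⟧
    r = 2ℚ * m
    0≤r : 0ℚ ≤ r
    0≤r = 0≤* (0≤⟦⟧ 2) (0≤inv n)
    e₁ : 2ℚ ≡ r * ⟦ suc n ⟧
    e₁ = sym (trans (solve 2 (λ m n → con 2ℚ :* m :* n := con 2ℚ :* (n :* m)) refl m ⟦ suc n ⟧) (cong (2ℚ *_) (⟦⟧-inv n)))
    m≡2j : m ≡ 2ℚ * j
    m≡2j = cancel-≡ ⟦ suc n ⟧ (0<⟦suc⟧ n) (trans (⟦⟧-inv n) (trans (sym (⟦⟧-inv (suc (twice n))))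
      (trans (cong (_* j) (⟦twice⟧ (suc n))) (solve 2 (λ n j → con 2ℚ :* n :* j := n :* (con 2ℚ :* j)) refl ⟦ suc n ⟧ j))))
    aj≤ : a * ⟦ 3 ℕ.+ twice n ⟧ * (j * j) ≤ 1ℚ
    aj≤ = begin
      a * ⟦ 3 ℕ.+ twice n ⟧ * (j * j)
        ≡⟨ cong₂ (λ p q → p * q * (j * j)) (⟦suc⟧ (twice n)) (⟦⟧-+ 3 (twice n)) ⟩
      (1ℚ + ⟦ twice n ⟧) * (3ℚ + ⟦ twice n ⟧) * (j * j)
        ≤⟨ ≤-slack {(1ℚ + ⟦ twice n ⟧) * (3ℚ + ⟦ twice n ⟧) * (j * j)} {(2ℚ + ⟦ twice n ⟧) * j * ((2ℚ + ⟦ twice n ⟧) * j)} (j * j) (0≤* (0≤inv (suc (twice n))) (0≤inv (suc (twice n))))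
            (solve 2 (λ x j → (con 2ℚ :+ x) :* j :* ((con 2ℚ :+ x) :* j) := (con 1ℚ :+ x) :* (con 3ℚ :+ x) :* (j :* j) :+ j :* j) refl ⟦ twice n ⟧ j) ⟩
      (2ℚ + ⟦ twice n ⟧) * j * ((2ℚ + ⟦ twice n ⟧) * j)
        ≡⟨ cong (λ p → p * p) (trans (cong (_* j) (sym (⟦2+⟧ (twice n)))) (⟦⟧-inv (suc (twice n)))) ⟩
      1ℚ ∎
      where open ≤-Reasoning
    e₂ : ∀ K → r * (odd n * (odd (suc n) * L K)) ≤ c * c * a * (4ℚ * L K)
    e₂ K = begin
      2ℚ * m * (a * c * (⟦ 3 ℕ.+ twice n ⟧ * (a * j * c) * L K))
        ≡⟨ cong (λ p → 2ℚ * p * (a * c * (⟦ 3 ℕ.+ twice n ⟧ * (a * j * c) * L K))) m≡2j ⟩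
      2ℚ * (2ℚ * j) * (a * c * (⟦ 3 ℕ.+ twice n ⟧ * (a * j * c) * L K))
        ≡⟨ solve 5 (λ j a c d l → con 2ℚ :* (con 2ℚ :* j) :* (a :* c :* (d :* (a :* j :* c) :* l)) := c :* c :* a :* (con 4ℚ :* l) :* (a :* d :* (j :* j))) refl j a c ⟦ 3 ℕ.+ twice n ⟧ (L K) ⟩
      c * c * a * (4ℚ * L K) * (a * ⟦ 3 ℕ.+ twice n ⟧ * (j * j))
        ≤⟨ *-monoʳ {r = c * c * a * (4ℚ * L K)} (0≤* (0≤* (0≤* (0≤central n) (0≤central n)) (0≤⟦⟧ (suc (twice n)))) (0≤* (0≤⟦⟧ 4) (0≤L K))) aj≤ ⟩
      c * c * a * (4ℚ * L K) * 1ℚ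
        ≡⟨ *-identityʳ (c * c * a * (4ℚ * L K)) ⟩
      c * c * a * (4ℚ * L K) ∎
      where open ≤-Reasoning

  scaled-mono : ∀ {c d} p q K → 0ℚ ≤ c → c ≡ d → p ℕ.≤ q → c * c * ⟦ p ⟧ * (4ℚ * L K) ≤ d * d * ⟦ q ⟧ * (4ℚ * L K)
  scaled-mono p q K 0≤c refl p≤q = *-monoˡ (0≤* (0≤⟦⟧ 4) (0≤L K)) (*-monoʳ (0≤* 0≤c 0≤c) (⟦⟧-mono p≤q))

  wallis-upper : ∀ N → (λ K → remain N * remain N * ⟦ N ⟧ * (4ℚ * L K)) ≲ (λ _ → 2ℚ)
  wallis-upper N with parity N
  ... | inj₁ (n , refl) = ≲-trans (≤⇒≲ λ K → scaled-mono (twice n) (twice n) K (0≤survival (twice n) 1) (remain-even n) ℕP.≤-refl) (central-upper n)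
  ... | inj₂ (n , refl) = ≲-trans (≤⇒≲ λ K → scaled-mono (suc (twice n)) (twice (suc n)) K (0≤survival (suc (twice n)) 1) (remain-odd n) (ℕP.n≤1+n _)) (central-upper (suc n))

  -- The shift by 2 comes from odd lengths N = 2n + 1, for which c(N) = `central (suc n)` brings the
  -- factor 2(n + 1) + 1 = N + 2.
  wallis-lower : ∀ N → (λ _ → 2ℚ) ≲ (λ K → remain N * remain N * ⟦ 2 ℕ.+ N ⟧ * (4ℚ * L K))
  wallis-lower N with parity N
  ... | inj₁ (n , refl) = ≲-trans (central-lower n) (≤⇒≲ λ K → scaled-mono (suc (twice n)) (2 ℕ.+ twice n) K (0≤central n) (sym (remain-even n)) (ℕP.n≤1+n _))
  ... | inj₂ (n , refl) = ≲-trans (central-lower (suc n)) (≤⇒≲ λ K → scaled-mono (suc (twice (suc n))) (3 ℕ.+ twice n) K (0≤central (suc n)) (sym (remain-odd n)) ℕP.≤-refl)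

  -- Powers, Bernoulli's inequality and exponential tilts.

  0≤^ : ∀ {p} n → 0ℚ ≤ p → 0ℚ ≤ p ^ n
  0≤^ zero    0≤p = 0≤1
  0≤^ (suc n) 0≤p = 0≤* 0≤p (0≤^ n 0≤p)

  ^-mono : ∀ {p q} n → 0ℚ ≤ p → p ≤ q → p ^ n ≤ q ^ n
  ^-mono zero    0≤p p≤q = ≤-refl
  ^-mono (suc n) 0≤p p≤q = *-mono-≤ 0≤p p≤q (0≤^ n 0≤p) (^-mono n 0≤p p≤q)

  1^ : ∀ n → 1ℚ ^ n ≡ 1ℚ
  1^ zero    = refl
  1^ (suc n) = trans (*-identityˡ (1ℚ ^ n)) (1^ n)

  ^≤1 : ∀ {p} n → 0ℚ ≤ p → p ≤ 1ℚ → p ^ n ≤ 1ℚ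
  ^≤1 {p} n 0≤p p≤1 = subst (p ^ n ≤_) (1^ n) (^-mono n 0≤p p≤1)

  1≤^ : ∀ {p} n → 1ℚ ≤ p → 1ℚ ≤ p ^ n
  1≤^ {p} n 1≤p = subst (_≤ p ^ n) (1^ n) (^-mono n 0≤1 1≤p)

  0≤sq : ∀ p → 0ℚ ≤ p * p
  0≤sq p with ≤-total 0ℚ p
  ... | inj₁ 0≤p = 0≤* 0≤p 0≤p
  ... | inj₂ p≤0 = subst (0ℚ ≤_) (solve 1 (λ p → :- p :* :- p := p :* p) refl p) (0≤* (neg-antimono-≤ p≤0) (neg-antimono-≤ p≤0))

  bernoulli : ∀ δ n → 0ℚ ≤ 1ℚ + δ → 1ℚ + ⟦ n ⟧ * δ ≤ (1ℚ + δ) ^ n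
  bernoulli δ zero    0≤ = ≤-reflexive (trans (cong (λ t → 1ℚ + t) (*-zeroˡ δ)) (+-identityʳ 1ℚ))
  bernoulli δ (suc n) 0≤ = ≤-trans
    (≤-slack {1ℚ + ⟦ suc n ⟧ * δ} {(1ℚ + δ) * (1ℚ + ⟦ n ⟧ * δ)} (⟦ n ⟧ * (δ * δ)) (0≤* (0≤⟦⟧ n) (0≤sq δ)) (begin
      (1ℚ + δ) * (1ℚ + ⟦ n ⟧ * δ) ≡⟨ solve 2 (λ d n → (con 1ℚ :+ d) :* (con 1ℚ :+ n :* d) := con 1ℚ :+ (con 1ℚ :+ n) :* d :+ n :* (d :* d)) refl δ ⟦ n ⟧ ⟩
      1ℚ + (1ℚ + ⟦ n ⟧) * δ + ⟦ n ⟧ * (δ * δ) ≡⟨ cong (λ t → 1ℚ + t * δ + ⟦ n ⟧ * (δ * δ)) (⟦suc⟧ n) ⟨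
      1ℚ + ⟦ suc n ⟧ * δ + ⟦ n ⟧ * (δ * δ) ∎))
    (*-monoʳ 0≤ (bernoulli δ n 0≤))
    where open ≡-Reasoning

  -- A second-order converse of Bernoulli's inequality, for `δ` of either sign. The slack of the
  -- induction step is δ²(1 + n(1 - nδ)), which explains the hypothesis on `⟦ n ⟧ * δ`.
  bernoulli-upper : ∀ δ n → 0ℚ ≤ 1ℚ + δ → ⟦ n ⟧ * δ ≤ 1ℚ → (1ℚ + δ) ^ n ≤ 1ℚ + ⟦ n ⟧ * δ + ⟦ n ⟧ * ⟦ n ⟧ * (δ * δ)
  bernoulli-upper δ zero    0≤ _ = ≤-reflexive (solve 1 (λ d → con 1ℚ := con 1ℚ :+ con 0ℚ :* d :+ con 0ℚ :* con 0ℚ :* (d :* d)) refl δ)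
  bernoulli-upper δ (suc n) 0≤ nδ≤1 = ≤-trans
    (*-monoʳ 0≤ (bernoulli-upper δ n 0≤ nδ≤1′))
    (≤-slack {(1ℚ + δ) * (1ℚ + ⟦ n ⟧ * δ + ⟦ n ⟧ * ⟦ n ⟧ * (δ * δ))} {1ℚ + ⟦ suc n ⟧ * δ + ⟦ suc n ⟧ * ⟦ suc n ⟧ * (δ * δ)}
      (δ * δ * (1ℚ + ⟦ n ⟧ * (1ℚ - ⟦ n ⟧ * δ)))
      (0≤* (0≤sq δ) (0≤+ 0≤1 (0≤* (0≤⟦⟧ n) (0≤-diff nδ≤1′))))
      (trans (cong (λ t → 1ℚ + t * δ + t * t * (δ * δ)) (⟦suc⟧ n))
        (solve 2 (λ d n → con 1ℚ :+ (con 1ℚ :+ n) :* d :+ (con 1ℚ :+ n) :* (con 1ℚ :+ n) :* (d :* d)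
          := (con 1ℚ :+ d) :* (con 1ℚ :+ n :* d :+ n :* n :* (d :* d)) :+ d :* d :* (con 1ℚ :+ n :* (con 1ℚ :- n :* d))) refl δ ⟦ n ⟧)))
    where
    nδ≤1′ : ⟦ n ⟧ * δ ≤ 1ℚ
    nδ≤1′ with ≤-total 0ℚ δ
    ... | inj₁ 0≤δ = ≤-trans (*-monoˡ 0≤δ (⟦⟧-mono (ℕP.n≤1+n n))) nδ≤1
    ... | inj₂ δ≤0 = ≤-trans (*-monoʳ (0≤⟦⟧ n) δ≤0) (≤-trans (≤-reflexive (*-zeroʳ ⟦ n ⟧)) 0≤1)

  -- The exponential tilt for a Chernoff bound at slope A/D: the tail weight of a
  -- walk of length n with N nonzero steps is ϑ ^ N * t ^ n, and a walk whose
  -- density of nonzero steps is r/D gains at most a factor σ per step.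
  record Tilt (A D : ℕ) (r : ℚ) : Set where
    field
      κ κ⁻ σ ρ : ℚ
      0<κ      : 0ℚ < κ
      0≤κ⁻     : 0ℚ ≤ κ⁻
      κκ⁻      : κ * κ⁻ ≡ 1ℚ
      0≤ρ      : 0ℚ ≤ ρ
      ρ<1      : ρ < 1ℚ
      gain     : κ⁻ ^ A * σ ≡ ρ
      density  : ⟦ D ⟧ + r * (κ ^ D - 1ℚ) ≤ ⟦ D ⟧ * σ
    ϑ t : ℚ
    ϑ = κ ^ D
    t = κ⁻ ^ A

    0≤ϑ : 0ℚ ≤ ϑ
    0≤ϑ = 0≤^ D (<⇒≤ 0<κ)

    tail : ℕ → ℕ → ℚ
    tail n N = ϑ ^ N * t ^ n

    0≤tail : ∀ n N → 0ℚ ≤ tail n N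
    0≤tail n N = 0≤* (0≤^ N 0≤ϑ) (0≤^ n (0≤^ A 0≤κ⁻))

    -- The tail weight is κ to the power D N - A n. Comparing powers of `κ` instead of exponents
    -- covers both κ ≤ 1, for walks with too few nonzero steps, and κ ≥ 1, for those with too many.
    1≤tail : ∀ n N → κ ^ (A ℕ.* n) ≤ κ ^ (D ℕ.* N) → 1ℚ ≤ tail n N
    1≤tail n N h = begin
        1ℚ ≡⟨ 1^ (A ℕ.* n) ⟨
        1ℚ ^ (A ℕ.* n) ≡⟨ cong (_^ (A ℕ.* n)) κκ⁻ ⟨
        (κ * κ⁻) ^ (A ℕ.* n) ≡⟨ ^-distrib-* κ κ⁻ (A ℕ.* n) ⟩
        κ ^ (A ℕ.* n) * κ⁻ ^ (A ℕ.* n) ≤⟨ *-monoˡ (0≤^ (A ℕ.* n) 0≤κ⁻) h ⟩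
        κ ^ (D ℕ.* N) * κ⁻ ^ (A ℕ.* n) ≡⟨ cong₂ _*_ (^-assocʳ κ D N) (^-assocʳ κ⁻ A n) ⟨
        tail n N ∎
      where open ≤-Reasoning

  ^-antitone : ∀ {p m n} → 0ℚ ≤ p → p ≤ 1ℚ → m ℕ.≤ n → p ^ n ≤ p ^ m
  ^-antitone {p} {m} {n} 0≤p p≤1 m≤n = begin
      p ^ n ≡⟨ cong (p ^_) (ℕP.m+[n∸m]≡n m≤n) ⟨
      p ^ (m ℕ.+ (n ℕ.∸ m)) ≡⟨ ^-homo-* p m (n ℕ.∸ m) ⟩
      p ^ m * p ^ (n ℕ.∸ m) ≤⟨ *-monoʳ (0≤^ m 0≤p) (^≤1 (n ℕ.∸ m) 0≤p p≤1) ⟩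
      p ^ m * 1ℚ ≡⟨ *-identityʳ (p ^ m) ⟩
      p ^ m ∎
    where open ≤-Reasoning

  ^-monotone : ∀ {p m n} → 1ℚ ≤ p → m ℕ.≤ n → p ^ m ≤ p ^ n
  ^-monotone {p} {m} {n} 1≤p m≤n = begin
      p ^ m ≡⟨ *-identityʳ (p ^ m) ⟨
      p ^ m * 1ℚ ≤⟨ *-monoʳ (0≤^ m (≤-trans 0≤1 1≤p)) (1≤^ (n ℕ.∸ m) 1≤p) ⟩
      p ^ m * p ^ (n ℕ.∸ m) ≡⟨ ^-homo-* p m (n ℕ.∸ m) ⟨
      p ^ (m ℕ.+ (n ℕ.∸ m)) ≡⟨ cong (p ^_) (ℕP.m+[n∸m]≡n m≤n) ⟩
      p ^ n ∎
    where open ≤-Reasoning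

  quotient : ∀ {p q} → 0ℚ ≤ p → 0ℚ < q → p < q → ∃[ ρ ] 0ℚ ≤ ρ × ρ < 1ℚ × p ≡ ρ * q
  quotient {p} {q} 0≤p 0<q p<q = p * i , 0≤* 0≤p (<⇒≤ 0<i) , ρ<1 , eq
    where
    instance
      q≢0 : NonZero q
      q≢0 = >-nonZero 0<q
    i = 1/ q
    0<i : 0ℚ < i
    0<i = 1/-pos 0<q
    eq : p ≡ p * i * q
    eq = sym (trans (*-assoc p i q) (trans (cong (p *_) (*-inverseˡ q)) (*-identityʳ p)))
    ρ<1 : p * i < 1ℚ
    ρ<1 = subst (p * i <_) (*-inverseʳ q) (*-monoˡ-<-pos i {{positive 0<i}} p<q)

  -- With κ = 1 + δ, Bernoulli bounds κ ^ A below by `q` = 1 + Aδ, and the converse bounds D + r(κ ^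
  -- D - 1) above by D `p` with `p` = 1 + rδ + rDδ². The rate `ρ` is p / q, and the last hypothesis
  -- is q - p > 0: the first-order term (A - r)δ must outweigh the second-order one.
  tilt : ∀ δ A D r → 0ℚ < 1ℚ + δ → ⟦ D ⟧ * δ ≤ 1ℚ → 0ℚ ≤ r → 0ℚ ≤ 1ℚ + r * δ → 0ℚ < 1ℚ + ⟦ A ⟧ * δ →
    0ℚ < ((⟦ A ⟧ - r) - r * ⟦ D ⟧ * δ) * δ → ∃[ T ] Tilt.κ {A} {D} {r} T ≡ 1ℚ + δ
  tilt δ A D r 0<κ Dδ≤1 0≤r 0≤1+rδ 0<q gap = record
    { κ = κ ; κ⁻ = 1/ κ ; σ = ρ * κ ^ A ; ρ = ρ
    ; 0<κ = 0<κ ; 0≤κ⁻ = <⇒≤ (1/-pos 0<κ) ; κκ⁻ = *-inverseʳ κ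
    ; 0≤ρ = 0≤ρ ; ρ<1 = ρ<1
    ; gain = begin
        (1/ κ) ^ A * (ρ * κ ^ A) ≡⟨ solve 3 (λ a b c → a :* (b :* c) := c :* a :* b) refl ((1/ κ) ^ A) ρ (κ ^ A) ⟩
        κ ^ A * (1/ κ) ^ A * ρ ≡⟨ cong (_* ρ) (trans (sym (^-distrib-* κ (1/ κ) A)) (trans (cong (_^ A) (*-inverseʳ κ)) (1^ A))) ⟩
        1ℚ * ρ ≡⟨ *-identityˡ ρ ⟩
        ρ ∎
    ; density = density
    } , refl
    where
    open ≡-Reasoning
    κ = 1ℚ + δ
    instance
      κ≢0 : NonZero κ
      κ≢0 = >-nonZero 0<κ
    d = ⟦ D ⟧
    p = 1ℚ + r * δ + r * d * (δ * δ)
    q = 1ℚ + ⟦ A ⟧ * δ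
    0≤p : 0ℚ ≤ p
    0≤p = 0≤+ 0≤1+rδ (0≤* (0≤* 0≤r (0≤⟦⟧ D)) (0≤sq δ))
    p<q : p < q
    p<q = <-slack {p} {q} (((⟦ A ⟧ - r) - r * d * δ) * δ) gap
      (solve 4 (λ A r d x → con 1ℚ :+ A :* x := con 1ℚ :+ r :* x :+ r :* d :* (x :* x) :+ ((A :- r) :- r :* d :* x) :* x) refl ⟦ A ⟧ r d δ)
    Q = quotient 0≤p 0<q p<q
    ρ = proj₁ Q
    0≤ρ = proj₁ (proj₂ Q)
    ρ<1 = proj₁ (proj₂ (proj₂ Q))
    density : d + r * (κ ^ D - 1ℚ) ≤ d * (ρ * κ ^ A)
    density = ≤-trans (+-monoʳ-≤ d (*-monoʳ 0≤r (+-monoˡ-≤ (- 1ℚ) (bernoulli-upper δ D (<⇒≤ 0<κ) Dδ≤1))))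
      (≤-trans (≤-reflexive (trans
          (solve 3 (λ d r x → d :+ r :* (con 1ℚ :+ d :* x :+ d :* d :* (x :* x) :- con 1ℚ) := d :* (con 1ℚ :+ r :* x :+ r :* d :* (x :* x))) refl d r δ)
          (cong (d *_) (proj₂ (proj₂ (proj₂ Q))))))
        (*-monoʳ (0≤⟦⟧ D) (*-monoʳ 0≤ρ (bernoulli δ A (<⇒≤ 0<κ)))))

  module _ (a D : ℕ) where
    private
      -- At least (a + 1)D, a + 1, D and 1, so that each of these times `h` is below 1 and every
      -- smallness condition of `tilt` holds.
      m = suc (suc a ℕ.* D ℕ.+ suc a ℕ.+ D)
      h = inv m
      below : ∀ k → k ℕ.≤ m → ⟦ k ⟧ * h < 1ℚ
      below k k≤m = <-≤-trans (*-monoˡ-<-pos h {{positive (0<inv m)}} (<-slack {⟦ k ⟧} {1ℚ + ⟦ k ⟧} 1ℚ (positive⁻¹ 1ℚ) (+-comm 1ℚ ⟦ k ⟧)))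
        (≤-trans (≤-reflexive (cong (_* h) (sym (⟦suc⟧ k)))) (≤-trans (*-monoˡ (0≤inv m) (⟦⟧-mono (s≤s k≤m))) (≤-reflexive (⟦⟧-inv m))))
      belowAD : ⟦ suc a ⟧ * ⟦ D ⟧ * h < 1ℚ
      belowAD = subst (λ t → t * h < 1ℚ) (⟦⟧-* (suc a) D) (below (suc a ℕ.* D) (ℕP.≤-trans (ℕP.m≤m+n _ (suc a)) (ℕP.≤-trans (ℕP.m≤m+n _ D) (ℕP.n≤1+n _))))
      belowA : ⟦ suc a ⟧ * h < 1ℚ
      belowA = below (suc a) (ℕP.≤-trans (ℕP.m≤n+m (suc a) (suc a ℕ.* D)) (ℕP.≤-trans (ℕP.m≤m+n _ D) (ℕP.n≤1+n _)))
      belowD : ⟦ D ⟧ * h < 1ℚ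
      belowD = below D (ℕP.≤-trans (ℕP.m≤n+m D _) (ℕP.n≤1+n _))
      below1 : h < 1ℚ
      below1 = subst (_< 1ℚ) (*-identityˡ h) (below 1 (s≤s z≤n))
      below-a : ⟦ a ⟧ * h < 1ℚ
      below-a = ≤-<-trans (*-monoˡ (0≤inv m) (⟦⟧-mono (ℕP.n≤1+n a))) belowA
      below-aD : ⟦ a ⟧ * ⟦ D ⟧ * h < 1ℚ
      below-aD = ≤-<-trans (*-monoˡ (0≤inv m) (*-monoˡ (0≤⟦⟧ D) (⟦⟧-mono (ℕP.n≤1+n a)))) belowAD
      flip : ∀ x → 1ℚ - x * h ≡ 1ℚ + x * - h
      flip x = solve 2 (λ x h → con 1ℚ :- x :* h := con 1ℚ :+ x :* :- h) refl x h

    abstract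
      -- Density (a + 1) / D against slope a / D: here A - r = -1, so a negative δ makes the gap
      -- positive. The price is one unit in the numerator of the slope; `upper-tilt` pays the same
      -- with the signs reversed.
      lower-tilt : ∃[ T ] Tilt.κ {a} {D} {⟦ suc a ⟧} T ≤ 1ℚ
      lower-tilt = proj₁ T , ≤-trans (≤-reflexive (proj₂ T)) (≤-slack {1ℚ + - h} {1ℚ} h (0≤inv m) (solve 1 (λ h → con 1ℚ := con 1ℚ :+ :- h :+ h) refl h))
        where
        T : ∃[ T ] Tilt.κ {a} {D} {⟦ suc a ⟧} T ≡ 1ℚ + - h
        T = tilt (- h) a D ⟦ suc a ⟧ (0<-diff below1)
          (≤-trans (≤-slack {⟦ D ⟧ * - h} {0ℚ} (⟦ D ⟧ * h) (0≤* (0≤⟦⟧ D) (0≤inv m)) (solve 2 (λ d h → con 0ℚ := d :* :- h :+ d :* h) refl ⟦ D ⟧ h)) 0≤1)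
          (0≤⟦⟧ (suc a))
          (subst (0ℚ ≤_) (flip ⟦ suc a ⟧) (0≤-diff (<⇒≤ belowA)))
          (subst (0ℚ <_) (flip ⟦ a ⟧) (0<-diff below-a))
          (subst (0ℚ <_) (trans (solve 4 (λ x a d h → (con 1ℚ :- x :* d :* h) :* h := ((a :- (con 1ℚ :+ a)) :- x :* d :* :- h) :* :- h) refl ⟦ suc a ⟧ ⟦ a ⟧ ⟦ D ⟧ h)
            (cong (λ t → ((⟦ a ⟧ - t) - ⟦ suc a ⟧ * ⟦ D ⟧ * - h) * - h) (sym (⟦suc⟧ a))))
            (*-pos (0<-diff belowAD) (0<inv m)))

      upper-tilt : ∃[ T ] 1ℚ ≤ Tilt.κ {suc a} {D} {⟦ a ⟧} T
      upper-tilt = proj₁ T , ≤-trans (≤-slack {1ℚ} {1ℚ + h} h (0≤inv m) refl) (≤-reflexive (sym (proj₂ T)))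
        where
        T : ∃[ T ] Tilt.κ {suc a} {D} {⟦ a ⟧} T ≡ 1ℚ + h
        T = tilt h (suc a) D ⟦ a ⟧ (Defs.RationalLemmas.+-pos (positive⁻¹ 1ℚ) (0<inv m))
          (<⇒≤ belowD)
          (0≤⟦⟧ a)
          (0≤+ 0≤1 (0≤* (0≤⟦⟧ a) (0≤inv m)))
          (+-mono-<-≤ (positive⁻¹ 1ℚ) (0≤* (0≤⟦⟧ (suc a)) (0≤inv m)))
          (subst (0ℚ <_) (trans (solve 4 (λ x a d h → (con 1ℚ :- a :* d :* h) :* h := (((con 1ℚ :+ a) :- a) :- a :* d :* h) :* h) refl ⟦ suc a ⟧ ⟦ a ⟧ ⟦ D ⟧ h)
            (cong (λ t → ((t - ⟦ a ⟧) - ⟦ a ⟧ * ⟦ D ⟧ * h) * h) (sym (⟦suc⟧ a))))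
            (*-pos (0<-diff below-aD) (0<inv m)))

  -- The geometric sum (1 - μ ^ (n + 1)) / (1 - μ) has n + 1 terms, each at least μ ^ n.
  ^-linear : ∀ {μ} → 0ℚ ≤ μ → μ ≤ 1ℚ → ∀ n → (1ℚ - μ) * (μ ^ n * ⟦ suc n ⟧) ≤ 1ℚ - μ ^ suc n
  ^-linear {μ} 0≤μ μ≤1 zero = ≤-reflexive (solve 1 (λ m → (con 1ℚ :- m) :* (con 1ℚ :* con 1ℚ) := con 1ℚ :- m :* con 1ℚ) refl μ)
  ^-linear {μ} 0≤μ μ≤1 (suc n) = begin
      (1ℚ - μ) * (μ * x * ⟦ suc (suc n) ⟧)
        ≡⟨ cong (λ t → (1ℚ - μ) * (μ * x * t)) (⟦suc⟧ (suc n)) ⟩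
      (1ℚ - μ) * (μ * x * (1ℚ + s))
        ≡⟨ solve 3 (λ m x s → (con 1ℚ :- m) :* (m :* x :* (con 1ℚ :+ s)) := m :* ((con 1ℚ :- m) :* (x :* s)) :+ (con 1ℚ :- m) :* (m :* x)) refl μ x s ⟩
      μ * ((1ℚ - μ) * (x * s)) + (1ℚ - μ) * (μ * x)
        ≤⟨ +-monoˡ-≤ ((1ℚ - μ) * (μ * x)) (*-monoʳ 0≤μ (^-linear 0≤μ μ≤1 n)) ⟩
      μ * (1ℚ - μ * x) + (1ℚ - μ) * (μ * x)
        ≤⟨ ≤-slack {μ * (1ℚ - μ * x) + (1ℚ - μ) * (μ * x)} {1ℚ - μ * (μ * x)} ((1ℚ - μ) * (1ℚ - μ * x))
             (0≤* (0≤-diff μ≤1) (0≤-diff (^≤1 (suc n) 0≤μ μ≤1)))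
             (solve 2 (λ m x → con 1ℚ :- m :* (m :* x) := m :* (con 1ℚ :- m :* x) :+ (con 1ℚ :- m) :* (m :* x) :+ (con 1ℚ :- m) :* (con 1ℚ :- m :* x)) refl μ x) ⟩
      1ℚ - μ * (μ * x) ∎
    where
    open ≤-Reasoning
    x = μ ^ n
    s = ⟦ suc n ⟧

  -- With μ the mean of 1 and ρ, ρ ≤ μ² by the inequality of arithmetic and geometric means. One
  -- copy of μ ^ n absorbs a factor n + 1 by `^-linear`, the other goes into the induction on the
  -- degree.
  ^-poly-bounded : ∀ d {ρ} → 0ℚ ≤ ρ → ρ < 1ℚ → ∃[ B ] 0ℚ ≤ B × ∀ n → ρ ^ n * ⟦ suc n ⟧ ^ d ≤ B
  ^-poly-bounded zero    {ρ} 0≤ρ ρ<1 = 1ℚ , 0≤1 , λ n → ≤-trans (≤-reflexive (*-identityʳ (ρ ^ n))) (^≤1 n 0≤ρ (<⇒≤ ρ<1))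
  ^-poly-bounded (suc d) {ρ} 0≤ρ ρ<1 = i * B , 0≤* (<⇒≤ 0<i) 0≤B , bound
    where
    open ≤-Reasoning
    μ = ½ * (1ℚ + ρ)
    e : 1ℚ - μ ≡ ½ * (1ℚ - ρ)
    e = solve 1 (λ r → con 1ℚ :- con ½ :* (con 1ℚ :+ r) := con ½ :* (con 1ℚ :- r)) refl ρ
    0<1-μ : 0ℚ < 1ℚ - μ
    0<1-μ = subst (0ℚ <_) (sym e) (*-pos (positive⁻¹ ½) (0<-diff ρ<1))
    0≤μ : 0ℚ ≤ μ
    0≤μ = 0≤* (<⇒≤ (positive⁻¹ ½)) (0≤+ 0≤1 0≤ρ)
    μ<1 : μ < 1ℚ
    μ<1 = <-slack {μ} {1ℚ} (1ℚ - μ) 0<1-μ (solve 1 (λ m → con 1ℚ := m :+ (con 1ℚ :- m)) refl μ)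
    ρ≤μ² : ρ ≤ μ * μ
    ρ≤μ² = ≤-slack {ρ} {μ * μ} ((½ * (1ℚ - ρ)) * (½ * (1ℚ - ρ))) (0≤sq (½ * (1ℚ - ρ)))
      (solve 1 (λ r → con ½ :* (con 1ℚ :+ r) :* (con ½ :* (con 1ℚ :+ r)) := r :+ (con ½ :* (con 1ℚ :- r)) :* (con ½ :* (con 1ℚ :- r))) refl ρ)
    IH = ^-poly-bounded d {μ} 0≤μ μ<1
    B = proj₁ IH
    0≤B = proj₁ (proj₂ IH)
    instance
      nz : NonZero (1ℚ - μ)
      nz = >-nonZero 0<1-μ
    i = 1/ (1ℚ - μ)
    0<i : 0ℚ < i
    0<i = 1/-pos 0<1-μ
    linear : ∀ n → μ ^ n * ⟦ suc n ⟧ ≤ i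
    linear n = begin
      μ ^ n * ⟦ suc n ⟧ ≡⟨ *-identityˡ (μ ^ n * ⟦ suc n ⟧) ⟨
      1ℚ * (μ ^ n * ⟦ suc n ⟧) ≡⟨ cong (_* (μ ^ n * ⟦ suc n ⟧)) (*-inverseˡ (1ℚ - μ)) ⟨
      i * (1ℚ - μ) * (μ ^ n * ⟦ suc n ⟧) ≡⟨ *-assoc i (1ℚ - μ) (μ ^ n * ⟦ suc n ⟧) ⟩
      i * ((1ℚ - μ) * (μ ^ n * ⟦ suc n ⟧)) ≤⟨ *-monoʳ (<⇒≤ 0<i) (≤-trans (^-linear 0≤μ (<⇒≤ μ<1) n)
          (≤-slack {1ℚ - μ ^ suc n} {1ℚ} (μ ^ suc n) (0≤^ (suc n) 0≤μ) (solve 1 (λ m → con 1ℚ := con 1ℚ :- m :+ m) refl (μ ^ suc n)))) ⟩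
      i * 1ℚ ≡⟨ *-identityʳ i ⟩
      i ∎
    bound : ∀ n → ρ ^ n * ⟦ suc n ⟧ ^ suc d ≤ i * B
    bound n = begin
      ρ ^ n * (⟦ suc n ⟧ * ⟦ suc n ⟧ ^ d)
        ≤⟨ *-monoˡ (0≤* (0≤⟦⟧ (suc n)) (0≤^ d (0≤⟦⟧ (suc n)))) (≤-trans (^-mono n 0≤ρ ρ≤μ²) (≤-reflexive (^-distrib-* μ μ n))) ⟩
      μ ^ n * μ ^ n * (⟦ suc n ⟧ * ⟦ suc n ⟧ ^ d)
        ≡⟨ solve 3 (λ m s d → m :* m :* (s :* d) := (m :* s) :* (m :* d)) refl (μ ^ n) ⟦ suc n ⟧ (⟦ suc n ⟧ ^ d) ⟩
      (μ ^ n * ⟦ suc n ⟧) * (μ ^ n * ⟦ suc n ⟧ ^ d)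
        ≤⟨ *-mono-≤ (0≤* (0≤^ n 0≤μ) (0≤⟦⟧ (suc n))) (linear n) (0≤* (0≤^ n 0≤μ) (0≤^ d (0≤⟦⟧ (suc n)))) (proj₂ (proj₂ IH) n) ⟩
      i * B ∎

  -- The bound for degree d + 1, divided by n + 1.
  ^-poly-null : ∀ d {ρ η} → 0ℚ ≤ ρ → ρ < 1ℚ → 0ℚ < η → ∃[ N ] ∀ n → N ℕ.≤ n → ρ ^ n * ⟦ suc n ⟧ ^ d ≤ η
  ^-poly-null d {ρ} {η} 0≤ρ ρ<1 0<η = proj₁ arch , small
    where
    open ≤-Reasoning
    bd = ^-poly-bounded (suc d) 0≤ρ ρ<1
    C = proj₁ (≤⟦suc⟧ (proj₁ bd))
    arch = archimedean (*-pos 0<η (0<inv C))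
    small : ∀ n → proj₁ arch ℕ.≤ n → ρ ^ n * ⟦ suc n ⟧ ^ d ≤ η
    small n n≥ = begin
      ρ ^ n * ⟦ suc n ⟧ ^ d ≡⟨ solve 2 (λ r s → r :* s := con 1ℚ :* (r :* s)) refl (ρ ^ n) (⟦ suc n ⟧ ^ d) ⟩
      1ℚ * (ρ ^ n * ⟦ suc n ⟧ ^ d) ≡⟨ cong (_* (ρ ^ n * ⟦ suc n ⟧ ^ d)) (⟦⟧-inv n) ⟨
      ⟦ suc n ⟧ * inv n * (ρ ^ n * ⟦ suc n ⟧ ^ d) ≡⟨ solve 4 (λ s i r t → s :* i :* (r :* t) := (r :* (s :* t)) :* i) refl ⟦ suc n ⟧ (inv n) (ρ ^ n) (⟦ suc n ⟧ ^ d) ⟩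
      ρ ^ n * ⟦ suc n ⟧ ^ suc d * inv n ≤⟨ *-monoˡ (0≤inv n) (≤-trans (proj₂ (proj₂ bd) n) (proj₂ (≤⟦suc⟧ (proj₁ bd)))) ⟩
      ⟦ suc C ⟧ * inv n ≤⟨ *-monoʳ (0≤⟦⟧ (suc C)) (<⇒≤ (proj₂ arch n n≥)) ⟩
      ⟦ suc C ⟧ * (η * inv C) ≡⟨ inv-cancel C η ⟩
      η ∎

-- Weighted walks over an abstract ordered algebra.

module Walk where
  open import Data.Nat.DivMod using (m/n*n≤m; m≡m%n+[m/n]*n; m%n<n)
  open import Data.Vec.Base as Vec using (Vec; []; _∷_; head; tail; map; lookup; updateAt)
  open import Relation.Binary.Bundles using (Preorder)
  open Defs using (Coord; back; stay; forth; Step; negate; _≟_; toℤ; move; StaysInOrthant; staysInOrthant?; origin; walks)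
  open Rat using (⟦_⟧; 2ℚ; survival; remain; Tilt; module Tilt)
  open ℚ-Solver using () renaming (solve to solve′; _:=_ to infix 4 _:=′_; _:*_ to infixl 7 _:*′_; _:-_ to infixl 6 _:-′_; _:+_ to infixl 6 _:+′_; con to con′)

  -- An axiomatisation of what the argument takes from the reals. `+-cancelʳ-≤` stands in for
  -- subtraction and `ι` of a reciprocal for division; the order is a preorder compatible with
  -- `_≈_`, since that of Cauchy sequences cannot be decided.
  record OrderedAlgebra : Set₁ where
    field
      semiring : CommutativeSemiring 0ℓ 0ℓ
    open CommutativeSemiring semiring public using
      (Carrier; _≈_; _+_; _*_; 0#; 1#; refl; sym; trans; reflexive; isEquivalence; +-cong; +-congˡ; +-congʳ; *-cong; *-congˡ; *-congʳ;
       +-assoc; +-comm; *-assoc; *-comm; *-identityˡ; *-identityʳ; +-identityˡ; +-identityʳ; zeroˡ; zeroʳ; distribˡ; distribʳ)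
    infix 4 _≤_
    field
      _≤_         : Carrier → Carrier → Set
      ≤-reflexive : ∀ {x y} → x ≈ y → x ≤ y
      ≤-trans     : ∀ {x y z} → x ≤ y → y ≤ z → x ≤ z
      +-mono-≤    : ∀ {x y u v} → x ≤ y → u ≤ v → x + u ≤ y + v
      +-cancelʳ-≤ : ∀ x y z → x + z ≤ y + z → x ≤ y
      *-monoˡ-≤   : ∀ {x y z} → 0# ≤ z → x ≤ y → z * x ≤ z * y
      ι           : ℚ → Carrier
      ι-0         : ι 0ℚ ≈ 0#
      ι-1         : ι 1ℚ ≈ 1#
      ι-+         : ∀ p q → ι (p ℚ.+ q) ≈ ι p + ι q
      ι-*         : ∀ p q → ι (p ℚ.* q) ≈ ι p * ι q
      ι-mono      : ∀ {p q} → p ℚ.≤ q → ι p ≤ ι q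

  module OrderedAlgebraProperties (F : OrderedAlgebra) where
    open OrderedAlgebra F public
    open Exp semiring public using (_^_; ^-distrib-*; ^-congˡ)
    open Solver semiring public using (solve; _:=_; _:+_; _:*_; con)

    ≤-preorder : Preorder 0ℓ 0ℓ 0ℓ
    ≤-preorder = record
      { Carrier = Carrier ; _≈_ = _≈_ ; _≲_ = _≤_
      ; isPreorder = record { isEquivalence = isEquivalence ; reflexive = ≤-reflexive ; trans = ≤-trans } }

    open import Relation.Binary.Reasoning.Preorder ≤-preorder public

    ≤-refl : ∀ {x} → x ≤ x
    ≤-refl = ≤-reflexive refl

    ≈⇒≥ : ∀ {x y} → x ≈ y → y ≤ x
    ≈⇒≥ eq = ≤-reflexive (sym eq)

    0≤+ : ∀ {x y} → 0# ≤ x → 0# ≤ y → 0# ≤ x + y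
    0≤+ h k = ≤-trans (≈⇒≥ (+-identityˡ 0#)) (+-mono-≤ h k)

    0≤* : ∀ {x y} → 0# ≤ x → 0# ≤ y → 0# ≤ x * y
    0≤* {x} h k = ≤-trans (≈⇒≥ (zeroʳ x)) (*-monoˡ-≤ h k)

    *-monoʳ-≤ : ∀ {x y z} → 0# ≤ z → x ≤ y → x * z ≤ y * z
    *-monoʳ-≤ {x} {y} {z} h k = ≤-trans (≤-reflexive (*-comm x z)) (≤-trans (*-monoˡ-≤ h k) (≤-reflexive (*-comm z y)))

    *-mono-≤ : ∀ {x y u v} → 0# ≤ x → x ≤ y → 0# ≤ u → u ≤ v → x * u ≤ y * v
    *-mono-≤ h k l m = ≤-trans (*-monoˡ-≤ h m) (*-monoʳ-≤ (≤-trans l m) k)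

    +-monoˡ-≤ : ∀ {x y} z → x ≤ y → x + z ≤ y + z
    +-monoˡ-≤ z h = +-mono-≤ h ≤-refl

    +-monoʳ-≤ : ∀ {x y} z → x ≤ y → z + x ≤ z + y
    +-monoʳ-≤ z h = +-mono-≤ ≤-refl h

    0≤ι : ∀ {p} → 0ℚ ℚ.≤ p → 0# ≤ ι p
    0≤ι h = ≤-trans (≈⇒≥ ι-0) (ι-mono h)

    ι-cong : ∀ {p q} → p ≡ q → ι p ≈ ι q
    ι-cong eq = reflexive (cong ι eq)

    ι-^ : ∀ p n → ι (p Rat.^ n) ≈ ι p ^ n
    ι-^ p zero    = ι-1
    ι-^ p (suc n) = trans (ι-* p (p Rat.^ n)) (*-congˡ (ι-^ p n))

    0≤1# : 0# ≤ 1#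
    0≤1# = ≤-trans (0≤ι Rat.0≤1) (≤-reflexive ι-1)

    0≤^ : ∀ {x} n → 0# ≤ x → 0# ≤ x ^ n
    0≤^ zero    h = 0≤1#
    0≤^ (suc n) h = 0≤* h (0≤^ n h)

    ^-mono-≤ : ∀ {x y} n → 0# ≤ x → x ≤ y → x ^ n ≤ y ^ n
    ^-mono-≤ zero    h k = ≤-refl
    ^-mono-≤ (suc n) h k = *-mono-≤ h k (0≤^ n h) (^-mono-≤ n h k)

    ι-inverse : ∀ {p} (0<p : 0ℚ ℚ.< p) x → ι ((ℚ.1/ p) {{ℚ.>-nonZero 0<p}}) * (ι p * x) ≈ x
    ι-inverse {p} 0<p x = trans (sym (*-assoc _ _ _)) (trans (*-congʳ (trans (sym (ι-* _ p))
      (trans (ι-cong (ℚP.*-inverseˡ p {{ℚ.>-nonZero 0<p}})) ι-1))) (*-identityˡ x))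

    ι-cancelˡ : ∀ {p x y} → 0ℚ ℚ.< p → ι p * x ≤ ι p * y → x ≤ y
    ι-cancelˡ {p} {x} {y} 0<p h = ≤-trans (≈⇒≥ (ι-inverse 0<p x))
      (≤-trans (*-monoˡ-≤ (0≤ι (ℚP.<⇒≤ (Rat.1/-pos 0<p))) h) (≤-reflexive (ι-inverse 0<p y)))

  # : ∀ {n} → Vec Coord n → ℕ
  # []           = 0
  # (back  ∷ cs) = suc (# cs)
  # (stay  ∷ cs) = # cs
  # (forth ∷ cs) = suc (# cs)

  #≤ : ∀ {n} (cs : Vec Coord n) → # cs ℕ.≤ n
  #≤ []           = z≤n
  #≤ (back  ∷ cs) = s≤s (#≤ cs)
  #≤ (stay  ∷ cs) = ℕP.m≤n⇒m≤1+n (#≤ cs)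
  #≤ (forth ∷ cs) = s≤s (#≤ cs)

  -- stays y is the indicator of walks from y - 1 that stay nonnegative.
  stays : ∀ {n} → ℕ → Vec Coord n → ℚ
  stays zero    _            = 0ℚ
  stays (suc y) []           = 1ℚ
  stays (suc y) (back  ∷ cs) = stays y cs
  stays (suc y) (stay  ∷ cs) = stays (suc y) cs
  stays (suc y) (forth ∷ cs) = stays (2 ℕ.+ y) cs

  -- A product of one condition per coordinate, so that the first coordinate can be split off and
  -- treated alone.
  staysInOrthant : ∀ {d n} → Vec (Step d) n → ℚ
  staysInOrthant {zero}  u = 1ℚ
  staysInOrthant {suc d} u = stays 1 (map head u) ℚ.* staysInOrthant (map tail u)

  0≤stays : ∀ {n} y (cs : Vec Coord n) → 0ℚ ℚ.≤ stays y cs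
  0≤stays zero    cs           = ℚP.≤-refl
  0≤stays (suc y) []           = Rat.0≤1
  0≤stays (suc y) (back  ∷ cs) = 0≤stays y cs
  0≤stays (suc y) (stay  ∷ cs) = 0≤stays (suc y) cs
  0≤stays (suc y) (forth ∷ cs) = 0≤stays (2 ℕ.+ y) cs

  stays≤1 : ∀ {n} y (cs : Vec Coord n) → stays y cs ℚ.≤ 1ℚ
  stays≤1 zero    cs           = Rat.0≤1
  stays≤1 (suc y) []           = ℚP.≤-refl
  stays≤1 (suc y) (back  ∷ cs) = stays≤1 y cs
  stays≤1 (suc y) (stay  ∷ cs) = stays≤1 (suc y) cs
  stays≤1 (suc y) (forth ∷ cs) = stays≤1 (2 ℕ.+ y) cs

  0≤staysInOrthant : ∀ {d n} (u : Vec (Step d) n) → 0ℚ ℚ.≤ staysInOrthant u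
  0≤staysInOrthant {zero}  u = Rat.0≤1
  0≤staysInOrthant {suc d} u = Rat.0≤* (0≤stays 1 (map head u)) (0≤staysInOrthant (map tail u))

  staysInOrthant≤1 : ∀ {d n} (u : Vec (Step d) n) → staysInOrthant u ℚ.≤ 1ℚ
  staysInOrthant≤1 {zero}  u = ℚP.≤-refl
  staysInOrthant≤1 {suc d} u = Rat.*-mono-≤ (0≤stays 1 (map head u)) (stays≤1 1 (map head u)) (0≤staysInOrthant (map tail u)) (staysInOrthant≤1 (map tail u))

  module Walks (F : OrderedAlgebra) where
    open OrderedAlgebraProperties F

    -- Runs over all 3 ^ d vectors, those outside the step set having weight 0, so that marginals
    -- are plain sums and no list entries have to be merged.
    sum : ∀ {d} → (Step d → Carrier) → Carrier
    sum {zero}  f = f []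
    sum {suc d} f = sum (λ v → f (back ∷ v) + (f (stay ∷ v) + f (forth ∷ v)))

    sum-cong : ∀ {d} {f g : Step d → Carrier} → (∀ v → f v ≈ g v) → sum f ≈ sum g
    sum-cong {zero}  h = h []
    sum-cong {suc d} h = sum-cong λ v → +-cong (h (back ∷ v)) (+-cong (h (stay ∷ v)) (h (forth ∷ v)))

    sum-mono : ∀ {d} {f g : Step d → Carrier} → (∀ v → f v ≤ g v) → sum f ≤ sum g
    sum-mono {zero}  h = h []
    sum-mono {suc d} h = sum-mono λ v → +-mono-≤ (h (back ∷ v)) (+-mono-≤ (h (stay ∷ v)) (h (forth ∷ v)))

    0≤sum : ∀ {d} {f : Step d → Carrier} → (∀ v → 0# ≤ f v) → 0# ≤ sum f
    0≤sum {zero}  h = h []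
    0≤sum {suc d} h = 0≤sum λ v → 0≤+ (h (back ∷ v)) (0≤+ (h (stay ∷ v)) (h (forth ∷ v)))

    sum-+ : ∀ {d} (f g : Step d → Carrier) → sum (λ v → f v + g v) ≈ sum f + sum g
    sum-+ {zero}  f g = refl
    sum-+ {suc d} f g = trans
      (sum-cong λ v → solve 6 (λ a b c x y z → (a :+ x) :+ ((b :+ y) :+ (c :+ z)) := (a :+ (b :+ c)) :+ (x :+ (y :+ z))) refl
        (f (back ∷ v)) (f (stay ∷ v)) (f (forth ∷ v)) (g (back ∷ v)) (g (stay ∷ v)) (g (forth ∷ v)))
      (sum-+ (λ v → f (back ∷ v) + (f (stay ∷ v) + f (forth ∷ v))) (λ v → g (back ∷ v) + (g (stay ∷ v) + g (forth ∷ v))))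

    sum-*ˡ : ∀ {d} c (f : Step d → Carrier) → sum (λ v → c * f v) ≈ c * sum f
    sum-*ˡ {zero}  c f = refl
    sum-*ˡ {suc d} c f = trans
      (sum-cong λ v → solve 4 (λ c x y z → c :* x :+ (c :* y :+ c :* z) := c :* (x :+ (y :+ z))) refl c (f (back ∷ v)) (f (stay ∷ v)) (f (forth ∷ v)))
      (sum-*ˡ c (λ v → f (back ∷ v) + (f (stay ∷ v) + f (forth ∷ v))))

    sum-*ʳ : ∀ {d} c (f : Step d → Carrier) → sum (λ v → f v * c) ≈ sum f * c
    sum-*ʳ c f = trans (sum-cong λ v → *-comm (f v) c) (trans (sum-*ˡ c f) (*-comm c (sum f)))

    -- `sum ω` unfolds to `sum (marginal ω)`, so S(𝟏) is literally unchanged when a coordinate is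
    -- dropped.
    marginal : ∀ {d} → (Step (suc d) → Carrier) → Step d → Carrier
    marginal ω v = ω (back ∷ v) + (ω (stay ∷ v) + ω (forth ∷ v))

    0≤marginal : ∀ {d} {ω : Step (suc d) → Carrier} → (∀ v → 0# ≤ ω v) → ∀ v → 0# ≤ marginal ω v
    0≤marginal h v = 0≤+ (h (back ∷ v)) (0≤+ (h (stay ∷ v)) (h (forth ∷ v)))

    walkSum : ∀ {d} → (Step d → Carrier) → (n : ℕ) → (Vec (Step d) n → Carrier) → Carrier
    walkSum ω zero    Φ = Φ []
    walkSum ω (suc n) Φ = sum λ v → ω v * walkSum ω n (λ u → Φ (v ∷ u))

    walkSum-cong : ∀ {d} (ω : Step d → Carrier) n {Φ Ψ} → (∀ u → Φ u ≈ Ψ u) → walkSum ω n Φ ≈ walkSum ω n Ψ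
    walkSum-cong ω zero    h = h []
    walkSum-cong ω (suc n) h = sum-cong λ v → *-congˡ (walkSum-cong ω n λ u → h (v ∷ u))

    walkSum-mono : ∀ {d} {ω : Step d → Carrier} → (∀ v → 0# ≤ ω v) → ∀ n {Φ Ψ} → (∀ u → Φ u ≤ Ψ u) → walkSum ω n Φ ≤ walkSum ω n Ψ
    walkSum-mono 0≤ω zero    h = h []
    walkSum-mono 0≤ω (suc n) h = sum-mono λ v → *-monoˡ-≤ (0≤ω v) (walkSum-mono 0≤ω n λ u → h (v ∷ u))

    0≤walkSum : ∀ {d} {ω : Step d → Carrier} → (∀ v → 0# ≤ ω v) → ∀ n {Φ} → (∀ u → 0# ≤ Φ u) → 0# ≤ walkSum ω n Φ
    0≤walkSum 0≤ω zero    h = h []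
    0≤walkSum 0≤ω (suc n) h = 0≤sum λ v → 0≤* (0≤ω v) (0≤walkSum 0≤ω n λ u → h (v ∷ u))

    walkSum-+ : ∀ {d} (ω : Step d → Carrier) n Φ Ψ → walkSum ω n (λ u → Φ u + Ψ u) ≈ walkSum ω n Φ + walkSum ω n Ψ
    walkSum-+ ω zero    Φ Ψ = refl
    walkSum-+ ω (suc n) Φ Ψ = trans
      (sum-cong λ v → trans (*-congˡ (walkSum-+ ω n (λ u → Φ (v ∷ u)) (λ u → Ψ (v ∷ u)))) (distribˡ _ _ _))
      (sum-+ (λ v → ω v * walkSum ω n (λ u → Φ (v ∷ u))) (λ v → ω v * walkSum ω n (λ u → Ψ (v ∷ u))))

    walkSum-*ˡ : ∀ {d} (ω : Step d → Carrier) n c Φ → walkSum ω n (λ u → c * Φ u) ≈ c * walkSum ω n Φ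
    walkSum-*ˡ ω zero    c Φ = refl
    walkSum-*ˡ ω (suc n) c Φ = trans
      (sum-cong λ v → trans (*-congˡ (walkSum-*ˡ ω n c (λ u → Φ (v ∷ u))))
        (solve 3 (λ w c x → w :* (c :* x) := c :* (w :* x)) refl (ω v) c (walkSum ω n (λ u → Φ (v ∷ u)))))
      (sum-*ˡ c (λ v → ω v * walkSum ω n (λ u → Φ (v ∷ u))))

    walkSum-tail : ∀ {d} (ω : Step (suc d) → Carrier) n Φ → walkSum ω n (λ u → Φ (map tail u)) ≈ walkSum (marginal ω) n Φ
    walkSum-tail ω zero    Φ = refl
    walkSum-tail ω (suc n) Φ = sum-cong λ v → let IH = walkSum-tail ω n (λ u → Φ (v ∷ u)) in
      trans (+-cong (*-congˡ IH) (+-cong (*-congˡ IH) (*-congˡ IH)))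
        (solve 4 (λ x y z w → x :* w :+ (y :* w :+ z :* w) := (x :+ (y :+ z)) :* w) refl
          (ω (back ∷ v)) (ω (stay ∷ v)) (ω (forth ∷ v)) (walkSum (marginal ω) n (λ u → Φ (v ∷ u))))

    walkSum-1 : ∀ {d} (ω : Step d → Carrier) n → walkSum ω n (λ _ → 1#) ≈ sum ω ^ n
    walkSum-1 ω zero    = refl
    walkSum-1 ω (suc n) = trans (sum-*ʳ (walkSum ω n (λ _ → 1#)) ω) (*-congˡ (walkSum-1 ω n))

    FirstSymmetric : ∀ {d} → (Step (suc d) → Carrier) → Set
    FirstSymmetric ω = ∀ v → ω (back ∷ v) ≈ ω (forth ∷ v)

    -- Every start `y` and every functional `Φ` of the other coordinates are allowed, so that
    -- induction on `n` goes through. The two nonzero first coordinates have equal weight and share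
    -- the other coordinates, so their joint contribution may be divided equally between them; the
    -- average is the recursion of `survival`.
    symmetrise : ∀ {d} (ω : Step (suc d) → Carrier) → FirstSymmetric ω → ∀ n y Φ →
      walkSum ω n (λ u → ι (stays y (map head u)) * Φ (map tail u)) ≈
      walkSum ω n (λ u → ι (survival y (# (map head u))) * Φ (map tail u))
    symmetrise ω sym-ω n       zero    Φ = refl
    symmetrise ω sym-ω zero    (suc y) Φ = refl
    symmetrise {d} ω sym-ω (suc n) (suc y) Φ = sum-cong step
      where
      X : ℕ → Step d → Carrier
      X y v = walkSum ω n (λ u → ι (survival y (# (map head u))) * Φ (v ∷ map tail u))
      Z : Step d → Carrier
      Z v = walkSum ω n (λ u → ι (survival (suc y) (suc (# (map head u)))) * Φ (v ∷ map tail u))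
      Z≈ : ∀ v → Z v ≈ ι ½ * (X y v + X (2 ℕ.+ y) v)
      Z≈ v = trans (walkSum-cong ω n λ u → trans
          (*-congʳ (trans (ι-* ½ _) (*-congˡ (ι-+ _ _))))
          (solve 4 (λ h p q x → h :* (p :+ q) :* x := h :* (p :* x :+ q :* x)) refl (ι ½) _ _ _))
        (trans (walkSum-*ˡ ω n (ι ½) _) (*-congˡ (walkSum-+ ω n _ _)))
      halves : ι ½ + ι ½ ≈ 1#
      halves = trans (sym (ι-+ ½ ½)) ι-1
      step : ∀ v → _
      step v =
        trans (+-cong (*-congˡ (symmetrise ω sym-ω n y (λ u → Φ (v ∷ u))))
          (+-cong (*-congˡ (symmetrise ω sym-ω n (suc y) (λ u → Φ (v ∷ u))))
            (*-cong (sym (sym-ω v)) (symmetrise ω sym-ω n (2 ℕ.+ y) (λ u → Φ (v ∷ u))))))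
        (trans (trans (trans (solve 4 (λ a x z s → a :* x :+ (s :+ a :* z) := con 1 :* (a :* (x :+ z)) :+ s) refl
              (ω (back ∷ v)) (X y v) (X (2 ℕ.+ y) v) (ω (stay ∷ v) * X (suc y) v))
            -- Splitting 1 as ½ + ½ gives each of the two steps the average of both continuations.
            (+-congʳ (*-congʳ (sym halves))))
          (solve 5 (λ a x z s h → (h :+ h) :* (a :* (x :+ z)) :+ s := a :* (h :* (x :+ z)) :+ (s :+ a :* (h :* (x :+ z)))) refl
            (ω (back ∷ v)) (X y v) (X (2 ℕ.+ y) v) (ω (stay ∷ v) * X (suc y) v) (ι ½)))
        (+-cong (*-congˡ (sym (Z≈ v))) (+-congˡ (*-cong (sym-ω v) (sym (Z≈ v))))))

    total : ∀ {d} → (Step d → Carrier) → ℕ → Carrier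
    total ω n = walkSum ω n (λ u → ι (staysInOrthant u))

    0≤total : ∀ {d} {ω : Step d → Carrier} → (∀ v → 0# ≤ ω v) → ∀ n → 0# ≤ total ω n
    0≤total 0≤ω n = 0≤walkSum 0≤ω n λ u → 0≤ι (0≤staysInOrthant u)

    -- With `remain` for `f` this is the total, by symmetry; with a constant it is a multiple of the
    -- marginal total. The estimates pass from one to the other by comparing the two functions of N.
    folded : ∀ {d} (ω : Step (suc d) → Carrier) n → (ℕ → ℚ) → Carrier
    folded ω n f = walkSum ω n (λ u → ι (f (# (map head u)) ℚ.* staysInOrthant (map tail u)))

    total-folded : ∀ {d} (ω : Step (suc d) → Carrier) → FirstSymmetric ω → ∀ n → total ω n ≈ folded ω n remain
    total-folded ω sym-ω n = trans (walkSum-cong ω n λ u → ι-* _ _)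
      (trans (symmetrise ω sym-ω n 1 (λ u → ι (staysInOrthant u))) (walkSum-cong ω n λ u → sym (ι-* _ _)))

    folded-const : ∀ {d} (ω : Step (suc d) → Carrier) n c → folded ω n (λ _ → c) ≈ ι c * total (marginal ω) n
    folded-const ω n c = trans (walkSum-cong ω n λ u → ι-* c _)
      (trans (walkSum-*ˡ ω n (ι c) _) (*-congˡ (walkSum-tail ω n (λ u → ι (staysInOrthant u)))))

    module _ {d : ℕ} (ω : Step (suc d) → Carrier) where
      private
        f₊ f₀ : Step d → Carrier
        f₊ v = ω (forth ∷ v)
        f₀ v = ω (stay ∷ v)

      forward standing double : Carrier
      forward  = sum f₊
      standing = sum f₀
      double   = forward + forward

      -- The weight of one step when a nonzero first coordinate counts ϑ-fold, that is, the
      -- exponential moment of the Chernoff bound.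
      moment : ℚ → Carrier
      moment ϑ = standing + double * ι ϑ

      walkSum-^ : FirstSymmetric ω → ∀ ϑ n → walkSum ω n (λ u → ι (ϑ Rat.^ # (map head u))) ≈ moment ϑ ^ n
      walkSum-^ sym-ω ϑ zero    = ι-1
      walkSum-^ sym-ω ϑ (suc n) = trans (trans (sum-cong step) (sum-*ʳ P W)) (*-cong weight (walkSum-^ sym-ω ϑ n))
        where
        W = λ v → ω (stay ∷ v) + (ω (forth ∷ v) + ω (forth ∷ v)) * ι ϑ
        P = walkSum ω n (λ u → ι (ϑ Rat.^ # (map head u)))
        moved : walkSum ω n (λ u → ι (ϑ Rat.^ suc (# (map head u)))) ≈ ι ϑ * P
        moved = trans (walkSum-cong ω n λ u → ι-* ϑ _) (walkSum-*ˡ ω n (ι ϑ) _)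
        step : ∀ v → ω (back ∷ v) * walkSum ω n (λ u → ι (ϑ Rat.^ suc (# (map head u)))) + (ω (stay ∷ v) * P +
          ω (forth ∷ v) * walkSum ω n (λ u → ι (ϑ Rat.^ suc (# (map head u))))) ≈ W v * P
        step v = trans (+-cong (*-cong (sym-ω v) moved) (+-congˡ (*-congˡ moved)))
          (solve 4 (λ s f t p → f :* (t :* p) :+ (s :* p :+ f :* (t :* p)) := (s :+ (f :+ f) :* t) :* p) refl
            (ω (stay ∷ v)) (ω (forth ∷ v)) (ι ϑ) P)
        weight : sum W ≈ moment ϑ
        weight = trans (sum-+ f₀ (λ v → (f₊ v + f₊ v) * ι ϑ)) (+-congˡ (trans (sum-*ʳ (ι ϑ) (λ v → f₊ v + f₊ v)) (*-congʳ (sum-+ f₊ f₊))))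

      sum-split : FirstSymmetric ω → sum ω ≈ standing + double
      sum-split sym-ω = trans (sum-cong λ v → trans (+-congʳ (sym-ω v))
          (solve 2 (λ f s → f :+ (s :+ f) := s :+ (f :+ f)) refl (ω (forth ∷ v)) (ω (stay ∷ v))))
        (trans (sum-+ f₀ (λ v → f₊ v + f₊ v)) (+-congˡ (sum-+ f₊ f₊)))

  -- p and q are probabilities c(N) and c(L), which are ordered for typical N; the
  -- Chernoff weight w is at least 1 for the other N.
  ≤-or-tail : ∀ {p q w} x → 0ℚ ℚ.≤ x → x ℚ.≤ 1ℚ → 0ℚ ℚ.≤ w → (p ℚ.≤ q) ⊎ (p ℚ.≤ 1ℚ × 0ℚ ℚ.≤ q × 1ℚ ℚ.≤ w) → p ℚ.* x ℚ.≤ q ℚ.* x ℚ.+ w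
  ≤-or-tail {p} {q} {w} x 0≤x x≤1 0≤w (inj₁ p≤q) =
    ℚP.≤-trans (Rat.*-monoˡ 0≤x p≤q) (Rat.≤-slack {q ℚ.* x} {q ℚ.* x ℚ.+ w} w 0≤w ≡.refl)
  ≤-or-tail {p} {q} {w} x 0≤x x≤1 0≤w (inj₂ (p≤1 , 0≤q , 1≤w)) =
    ℚP.≤-trans (Rat.*-monoˡ 0≤x p≤1) (ℚP.≤-trans (ℚP.≤-reflexive (ℚP.*-identityˡ x)) (ℚP.≤-trans x≤1 (ℚP.≤-trans 1≤w
      (Rat.≤-slack {w} {q ℚ.* x ℚ.+ w} (q ℚ.* x) (Rat.0≤* 0≤q 0≤x) (ℚP.+-comm (q ℚ.* x) w)))))

  module WalkBounds (F : OrderedAlgebra) where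
    open OrderedAlgebraProperties F
    open Walks F

    -- Each coordinate is examined only after the earlier ones are summed out. For the last one,
    -- symmetry then means no more than A(𝟏) = B(𝟏).
    Symmetric : ∀ {d} → (Step d → Carrier) → Set
    Symmetric {zero}  ω = ⊤
    Symmetric {suc d} ω = FirstSymmetric ω × Symmetric (marginal ω)

    marginal-total : ∀ {d} {ω : Step (suc d) → Carrier} → (∀ v → 0# ≤ ω v) → FirstSymmetric ω → ∀ n →
      total (marginal ω) n ≤ ι ⟦ suc n ⟧ * total ω n
    marginal-total {ω = ω} 0≤ω sym-ω n = begin
        total (marginal ω) n ≈⟨ trans (folded-const ω n 1ℚ) (trans (*-congʳ ι-1) (*-identityˡ _)) ⟨
        folded ω n (λ _ → 1ℚ) ∼⟨ walkSum-mono 0≤ω n (λ u → ι-mono (pointwise u)) ⟩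
        walkSum ω n (λ u → ι (⟦ suc n ⟧ ℚ.* (remain (# (map head u)) ℚ.* staysInOrthant (map tail u))))
          ≈⟨ trans (walkSum-cong ω n λ u → ι-* ⟦ suc n ⟧ _) (walkSum-*ˡ ω n (ι ⟦ suc n ⟧) _) ⟩
        ι ⟦ suc n ⟧ * folded ω n remain ≈⟨ *-congˡ (total-folded ω sym-ω n) ⟨
        ι ⟦ suc n ⟧ * total ω n ∎
      where
      pointwise : ∀ u → 1ℚ ℚ.* staysInOrthant (map tail u) ℚ.≤ ⟦ suc n ⟧ ℚ.* (remain (# (map head u)) ℚ.* staysInOrthant (map tail u))
      pointwise u = ℚP.≤-trans (Rat.*-monoˡ (0≤staysInOrthant (map tail u)) (ℚP.≤-trans (Rat.remain-lower N)
          (Rat.*-monoˡ (Rat.0≤survival N 1) (Rat.⟦⟧-mono (s≤s (#≤ (map head u)))))))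
        (ℚP.≤-reflexive (ℚP.*-assoc ⟦ suc n ⟧ (remain N) (staysInOrthant (map tail u))))
        where N = # (map head u)

    -- Each dropped coordinate costs a factor n + 1 by `marginal-total`. This is the polynomial
    -- lower bound on the total against which ρ ^ n becomes negligible.
    growth : ∀ {d} {ω : Step d → Carrier} → (∀ v → 0# ≤ ω v) → Symmetric ω → ∀ n →
      sum ω ^ n ≤ ι (⟦ suc n ⟧ Rat.^ d) * total ω n
    growth {zero}  {ω} 0≤ω _ n = ≤-reflexive (trans (sym (walkSum-1 ω n)) (trans (walkSum-cong ω n λ _ → sym ι-1)
      (sym (trans (*-congʳ ι-1) (*-identityˡ _)))))
    growth {suc d} {ω} 0≤ω (first , rest) n = begin
        sum ω ^ n ∼⟨ growth (0≤marginal 0≤ω) rest n ⟩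
        ι (⟦ suc n ⟧ Rat.^ d) * total (marginal ω) n ∼⟨ *-monoˡ-≤ (0≤ι (Rat.0≤^ d (Rat.0≤⟦⟧ (suc n)))) (marginal-total 0≤ω first n) ⟩
        ι (⟦ suc n ⟧ Rat.^ d) * (ι ⟦ suc n ⟧ * total ω n) ≈⟨ solve 3 (λ a b c → a :* (b :* c) := b :* a :* c) refl _ _ _ ⟩
        ι ⟦ suc n ⟧ * ι (⟦ suc n ⟧ Rat.^ d) * total ω n ≈⟨ *-congʳ (ι-* ⟦ suc n ⟧ (⟦ suc n ⟧ Rat.^ d)) ⟨
        ι (⟦ suc n ⟧ Rat.^ suc d) * total ω n ∎

    0≤moment : ∀ {d} {ω : Step (suc d) → Carrier} → (∀ v → 0# ≤ ω v) → ∀ {ϑ} → 0ℚ ℚ.≤ ϑ → 0# ≤ moment ω ϑ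
    0≤moment 0≤ω 0≤ϑ = 0≤+ (0≤sum λ v → 0≤ω (stay ∷ v)) (0≤* (0≤+ (0≤sum λ v → 0≤ω (forth ∷ v)) (0≤sum λ v → 0≤ω (forth ∷ v))) (0≤ι 0≤ϑ))

    module _ {d A D : ℕ} {r : ℚ} (ω : Step (suc d) → Carrier) (0≤ω : ∀ v → 0# ≤ ω v) (symω : Symmetric ω) (T : Tilt A (suc D) r)
             (tilted : moment ω (Tilt.ϑ T) ≤ ι (Tilt.σ T) * sum ω) where
      open Tilt T using (ϑ; t; σ; ρ)

      -- Independence of the steps turns the left side into t ^ n times the n-th power of the
      -- moment, at most (tσ) ^ n S ^ n = ρ ^ n S ^ n; `growth` trades S ^ n for the total. The
      -- error thus becomes a multiple of the quantity being estimated.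
      tail-bound : ∀ n → walkSum ω n (λ u → ι (Tilt.tail T n (# (map head u)))) ≤ ι (ρ Rat.^ n ℚ.* ⟦ suc n ⟧ Rat.^ suc d) * total ω n
      tail-bound n = begin
          walkSum ω n (λ u → ι (ϑ Rat.^ # (map head u) ℚ.* t Rat.^ n))
            ≈⟨ walkSum-cong ω n (λ u → trans (ι-* _ _) (*-comm _ _)) ⟩
          walkSum ω n (λ u → ι (t Rat.^ n) * ι (ϑ Rat.^ # (map head u)))
            ≈⟨ trans (walkSum-*ˡ ω n (ι (t Rat.^ n)) _) (*-congˡ (walkSum-^ ω (proj₁ symω) ϑ n)) ⟩
          ι (t Rat.^ n) * moment ω ϑ ^ n
            ∼⟨ *-monoˡ-≤ (0≤ι (Rat.0≤^ n (Rat.0≤^ A (Tilt.0≤κ⁻ T)))) (^-mono-≤ n (0≤moment 0≤ω (Tilt.0≤ϑ T)) tilted) ⟩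
          ι (t Rat.^ n) * (ι σ * sum ω) ^ n
            ≈⟨ trans (*-cong (ι-^ t n) (^-distrib-* (ι σ) (sum ω) n)) (sym (*-assoc _ _ _)) ⟩
          ι t ^ n * ι σ ^ n * sum ω ^ n
            ≈⟨ *-congʳ (trans (sym (^-distrib-* (ι t) (ι σ) n)) (trans (^-congˡ n (trans (sym (ι-* t σ)) (ι-cong (Tilt.gain T)))) (sym (ι-^ ρ n)))) ⟩
          ι (ρ Rat.^ n) * sum ω ^ n
            ∼⟨ *-monoˡ-≤ (0≤ι (Rat.0≤^ n (Tilt.0≤ρ T))) (growth 0≤ω symω n) ⟩
          ι (ρ Rat.^ n) * (ι (⟦ suc n ⟧ Rat.^ suc d) * total ω n)
            ≈⟨ trans (sym (*-assoc _ _ _)) (*-congʳ (sym (ι-* _ _))) ⟩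
          ι (ρ Rat.^ n ℚ.* ⟦ suc n ⟧ Rat.^ suc d) * total ω n ∎

      compare : ∀ n (f g : ℕ → ℚ) → (∀ N → (f N ℚ.≤ g N) ⊎ (f N ℚ.≤ 1ℚ × 0ℚ ℚ.≤ g N × 1ℚ ℚ.≤ Tilt.tail T n N)) →
        folded ω n f ≤ folded ω n g + ι (ρ Rat.^ n ℚ.* ⟦ suc n ⟧ Rat.^ suc d) * total ω n
      compare n f g h = begin
          folded ω n f
            ∼⟨ walkSum-mono 0≤ω n (λ u → ι-mono (≤-or-tail (staysInOrthant (map tail u)) (0≤staysInOrthant (map tail u)) (staysInOrthant≤1 (map tail u))
                 (Tilt.0≤tail T n (# (map head u))) (h (# (map head u))))) ⟩
          walkSum ω n (λ u → ι (g (# (map head u)) ℚ.* staysInOrthant (map tail u) ℚ.+ Tilt.tail T n (# (map head u))))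
            ≈⟨ trans (walkSum-cong ω n λ u → ι-+ _ _) (walkSum-+ ω n _ _) ⟩
          folded ω n g + walkSum ω n (λ u → ι (Tilt.tail T n (# (map head u))))
            ∼⟨ +-monoʳ-≤ _ (tail-bound n) ⟩
          folded ω n g + ι (ρ Rat.^ n ℚ.* ⟦ suc n ⟧ Rat.^ suc d) * total ω n ∎

    -- As ϑ ≤ 1, the moment decreases in the density of nonzero steps, so a density of at least r /
    -- δ leaves at most 1 + (r / δ)(ϑ - 1) ≤ σ per unit of weight.
    lower-tilted : ∀ {d a D} (ω : Step (suc d) → Carrier) → FirstSymmetric ω → 0# ≤ sum ω →
      (T : Tilt a (suc D) ⟦ suc a ⟧) → Tilt.κ T ℚ.≤ 1ℚ →
      ι ⟦ suc a ⟧ * sum ω ≤ ι ⟦ suc D ⟧ * double ω → moment ω (Tilt.ϑ T) ≤ ι (Tilt.σ T) * sum ω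
    -- The term with `w` = 1 - ϑ is added to both sides and cancelled, which avoids the negative ϑ -
    -- 1.
    lower-tilted {d} {a} {D} ω sym-ω 0≤S T κ≤1 slope = ι-cancelˡ (Rat.0<⟦suc⟧ D) (+-cancelʳ-≤ _ _ (ι (r ℚ.* w) * sum ω) (begin
        ι δ * moment ω ϑ + ι (r ℚ.* w) * sum ω
          ≈⟨ +-congˡ (trans (*-congʳ (trans (ι-* r w) (*-comm _ _))) (*-assoc _ _ _)) ⟩
        ι δ * moment ω ϑ + ι w * (ι r * sum ω)
          ∼⟨ +-monoʳ-≤ _ (*-monoˡ-≤ (0≤ι 0≤w) slope) ⟩
        ι δ * (standing ω + double ω * ι ϑ) + ι w * (ι δ * double ω)
          ≈⟨ solve 5 (λ d z b x w → d :* (z :+ b :* x) :+ w :* (d :* b) := d :* (z :+ b :* (x :+ w))) refl (ι δ) (standing ω) (double ω) (ι ϑ) (ι w) ⟩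
        ι δ * (standing ω + double ω * (ι ϑ + ι w))
          ≈⟨ *-congˡ (trans (+-congˡ (trans (*-congˡ (trans (sym (ι-+ ϑ w)) (trans (ι-cong ϑ+w) ι-1))) (*-identityʳ _))) (sym (sum-split ω sym-ω))) ⟩
        ι δ * sum ω
          ∼⟨ *-monoʳ-≤ 0≤S (ι-mono density) ⟩
        ι (δ ℚ.* σ ℚ.+ r ℚ.* w) * sum ω
          ≈⟨ trans (*-congʳ (trans (ι-+ _ _) (+-congʳ (ι-* δ σ)))) (trans (distribʳ _ _ _) (+-congʳ (*-assoc _ _ _))) ⟩
        ι δ * (ι σ * sum ω) + ι (r ℚ.* w) * sum ω ∎))
      where
      open Tilt T using (ϑ; σ; κ)
      δ = ⟦ suc D ⟧
      r = ⟦ suc a ⟧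
      w = 1ℚ ℚ.- ϑ
      0≤w : 0ℚ ℚ.≤ w
      0≤w = Rat.0≤-diff (Rat.^≤1 (suc D) (ℚP.<⇒≤ (Tilt.0<κ T)) κ≤1)
      ϑ+w : ϑ ℚ.+ w ≡ 1ℚ
      ϑ+w = solve′ 1 (λ x → x :+′ (con′ 1ℚ :-′ x) :=′ con′ 1ℚ) ≡.refl ϑ
      density : δ ℚ.≤ δ ℚ.* σ ℚ.+ r ℚ.* w
      density = Rat.diff-≤ {δ} {δ ℚ.* σ ℚ.+ r ℚ.* w} (≡.subst (0ℚ ℚ.≤_)
        (solve′ 4 (λ d s r x → d :*′ s :-′ (d :+′ r :*′ (x :-′ con′ 1ℚ))
          :=′ d :*′ s :+′ r :*′ (con′ 1ℚ :-′ x) :-′ d) ≡.refl δ σ r ϑ)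
        (Rat.0≤-diff (Tilt.density T)))

    upper-tilted : ∀ {d a D} (ω : Step (suc d) → Carrier) → FirstSymmetric ω → 0# ≤ sum ω →
      (T : Tilt (suc a) (suc D) ⟦ a ⟧) → 1ℚ ℚ.≤ Tilt.κ T →
      ι ⟦ suc D ⟧ * double ω ≤ ι ⟦ a ⟧ * sum ω → moment ω (Tilt.ϑ T) ≤ ι (Tilt.σ T) * sum ω
    upper-tilted {d} {a} {D} ω sym-ω 0≤S T 1≤κ slope = ι-cancelˡ (Rat.0<⟦suc⟧ D) (begin
        ι δ * (standing ω + double ω * ι ϑ)
          ≈⟨ *-congˡ (+-congˡ (*-congˡ (trans (ι-cong ϑ≡) (trans (ι-+ 1ℚ w) (+-congʳ ι-1))))) ⟩
        ι δ * (standing ω + double ω * (1# + ι w))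
          ≈⟨ solve 4 (λ d z b w → d :* (z :+ b :* (con 1 :+ w)) := d :* (z :+ b) :+ w :* (d :* b)) refl (ι δ) (standing ω) (double ω) (ι w) ⟩
        ι δ * (standing ω + double ω) + ι w * (ι δ * double ω)
          ∼⟨ +-mono-≤ (≤-reflexive (*-congˡ (sym (sum-split ω sym-ω)))) (*-monoˡ-≤ (0≤ι 0≤w) slope) ⟩
        ι δ * sum ω + ι w * (ι r * sum ω)
          ≈⟨ trans (+-congˡ (trans (sym (*-assoc _ _ _)) (*-congʳ (trans (*-comm _ _) (sym (ι-* r w)))))) (trans (sym (distribʳ _ _ _)) (*-congʳ (sym (ι-+ _ _)))) ⟩
        ι (δ ℚ.+ r ℚ.* w) * sum ω
          ∼⟨ *-monoʳ-≤ 0≤S (ι-mono (Tilt.density T)) ⟩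
        ι (δ ℚ.* σ) * sum ω
          ≈⟨ trans (*-congʳ (ι-* δ σ)) (*-assoc _ _ _) ⟩
        ι δ * (ι σ * sum ω) ∎)
      where
      open Tilt T using (ϑ; σ; κ)
      δ = ⟦ suc D ⟧
      r = ⟦ a ⟧
      w = ϑ ℚ.- 1ℚ
      0≤w : 0ℚ ℚ.≤ w
      0≤w = Rat.0≤-diff (Rat.1≤^ (suc D) 1≤κ)
      ϑ≡ : ϑ ≡ 1ℚ ℚ.+ w
      ϑ≡ = solve′ 1 (λ x → x :=′ con′ 1ℚ :+′ (x :-′ con′ 1ℚ)) ≡.refl ϑ

    -- By monotonicity, walks with at least `L` nonzero first coordinates survive with probability
    -- at most c(L). The choice of `L` keeps it below the slope a / (D + 1), so that all other walks
    -- fall under the tilt.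
    step-upper : ∀ {d a D} (ω : Step (suc d) → Carrier) → (∀ v → 0# ≤ ω v) → Symmetric ω →
      ι ⟦ suc a ⟧ * sum ω ≤ ι ⟦ suc D ⟧ * double ω → ∃[ ρ ] 0ℚ ℚ.≤ ρ × ρ ℚ.< 1ℚ ×
      ∀ n L → suc D ℕ.* L ℕ.≤ a ℕ.* n →
      total ω n ≤ ι (remain L) * total (marginal ω) n + ι (ρ Rat.^ n ℚ.* ⟦ suc n ⟧ Rat.^ suc d) * total ω n
    step-upper {d} {a} {D} ω 0≤ω symω slope = Tilt.ρ T , Tilt.0≤ρ T , Tilt.ρ<1 T , λ n L DL≤an →
        ≤-trans (≤-reflexive (total-folded ω (proj₁ symω) n))
          (≤-trans (compare ω 0≤ω symω T tilted n remain (λ _ → remain L) (cases n L DL≤an))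
            (+-monoˡ-≤ _ (≤-reflexive (folded-const ω n (remain L)))))
      where
      T = proj₁ (Rat.lower-tilt a (suc D))
      κ≤1 = proj₂ (Rat.lower-tilt a (suc D))
      tilted = lower-tilted ω (proj₁ symω) (0≤sum 0≤ω) T κ≤1 slope
      cases : ∀ n L → suc D ℕ.* L ℕ.≤ a ℕ.* n → ∀ N →
        (remain N ℚ.≤ remain L) ⊎ (remain N ℚ.≤ 1ℚ × 0ℚ ℚ.≤ remain L × 1ℚ ℚ.≤ Tilt.tail T n N)
      cases n L DL≤an N with ℕP.≤-total L N
      ... | inj₁ L≤N = inj₁ (Rat.remain-antitone L≤N)
      ... | inj₂ N≤L = inj₂ (Rat.remain≤1 N , Rat.0≤survival L 1 , Tilt.1≤tail T n N
        (Rat.^-antitone (ℚP.<⇒≤ (Tilt.0<κ T)) κ≤1 (ℕP.≤-trans (ℕP.*-monoʳ-≤ (suc D) N≤L) DL≤an)))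

    step-lower : ∀ {d a D} (ω : Step (suc d) → Carrier) → (∀ v → 0# ≤ ω v) → Symmetric ω →
      ι ⟦ suc D ⟧ * double ω ≤ ι ⟦ a ⟧ * sum ω → ∃[ ρ ] 0ℚ ℚ.≤ ρ × ρ ℚ.< 1ℚ ×
      ∀ n U → suc a ℕ.* n ℕ.≤ suc D ℕ.* U →
      ι (remain U) * total (marginal ω) n ≤ total ω n + ι (ρ Rat.^ n ℚ.* ⟦ suc n ⟧ Rat.^ suc d) * total ω n
    step-lower {d} {a} {D} ω 0≤ω symω slope = Tilt.ρ T , Tilt.0≤ρ T , Tilt.ρ<1 T , λ n U an≤DU →
        ≤-trans (≈⇒≥ (folded-const ω n (remain U)))
          (≤-trans (compare ω 0≤ω symω T tilted n (λ _ → remain U) remain (cases n U an≤DU))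
            (+-monoˡ-≤ _ (≈⇒≥ (total-folded ω (proj₁ symω) n))))
      where
      T = proj₁ (Rat.upper-tilt a (suc D))
      1≤κ = proj₂ (Rat.upper-tilt a (suc D))
      tilted = upper-tilted ω (proj₁ symω) (0≤sum 0≤ω) T 1≤κ slope
      cases : ∀ n U → suc a ℕ.* n ℕ.≤ suc D ℕ.* U → ∀ N →
        (remain U ℚ.≤ remain N) ⊎ (remain U ℚ.≤ 1ℚ × 0ℚ ℚ.≤ remain N × 1ℚ ℚ.≤ Tilt.tail T n N)
      cases n U an≤DU N with ℕP.≤-total N U
      ... | inj₁ N≤U = inj₁ (Rat.remain-antitone N≤U)
      ... | inj₂ U≤N = inj₂ (Rat.remain≤1 U , Rat.0≤survival N 1 , Tilt.1≤tail T n N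
        (Rat.^-monotone 1≤κ (ℕP.≤-trans an≤DU (ℕP.*-monoʳ-≤ (suc D) U≤N))))

  1≤⇒≤* : ∀ {p} q → 0ℚ ℚ.≤ q → 1ℚ ℚ.≤ p → q ℚ.≤ p ℚ.* q
  1≤⇒≤* {p} q 0≤q 1≤p = ℚP.≤-trans (ℚP.≤-reflexive (≡.sym (ℚP.*-identityˡ q))) (Rat.*-monoˡ 0≤q 1≤p)

  0<1+ : ∀ {p} → 1ℚ ℚ.< p → 0ℚ ℚ.< p
  0<1+ = ℚP.<-trans (ℚP.positive⁻¹ 1ℚ)

  -- Multiplicative tolerances are divided by roots as additive ones are by halving. With x the
  -- smaller of p - 1 and 1, the witness is 1 + x / 3, since (1 + x / 3)² ≤ 1 + x for 0 ≤ x ≤ 1.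
  square-root : ∀ {p} → 1ℚ ℚ.< p → ∃[ q ] 1ℚ ℚ.< q × q ℚ.* q ℚ.≤ p
  square-root {p} 1<p = from (ℚP.≤-total (p ℚ.- 1ℚ) 1ℚ)
    where
    third : ℚ
    third = Rat.inv 2
    small : ∀ x → 0ℚ ℚ.< x → x ℚ.≤ 1ℚ → x ℚ.≤ p ℚ.- 1ℚ → ∃[ q ] 1ℚ ℚ.< q × q ℚ.* q ℚ.≤ p
    small x 0<x x≤1 x≤ = 1ℚ ℚ.+ third ℚ.* x
      , Rat.<-slack {1ℚ} {1ℚ ℚ.+ third ℚ.* x} (third ℚ.* x) (Rat.*-pos (Rat.0<inv 2) 0<x) ≡.refl
      , ℚP.≤-trans (Rat.≤-slack {(1ℚ ℚ.+ third ℚ.* x) ℚ.* (1ℚ ℚ.+ third ℚ.* x)} {1ℚ ℚ.+ x} (third ℚ.* third ℚ.* x ℚ.* (1ℚ ℚ.- x) ℚ.+ 2ℚ ℚ.* third ℚ.* third ℚ.* x)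
          (Rat.0≤+ (Rat.0≤* (Rat.0≤* 0≤⅑ (ℚP.<⇒≤ 0<x)) (Rat.0≤-diff x≤1)) (Rat.0≤* (Rat.0≤* (Rat.0≤* (Rat.0≤⟦⟧ 2) (Rat.0≤inv 2)) (Rat.0≤inv 2)) (ℚP.<⇒≤ 0<x)))
          (solve′ 1 (λ x → con′ 1ℚ :+′ x :=′ (con′ 1ℚ :+′ con′ third :*′ x) :*′ (con′ 1ℚ :+′ con′ third :*′ x)
            :+′ (con′ third :*′ con′ third :*′ x :*′ (con′ 1ℚ :-′ x) :+′ con′ 2ℚ :*′ con′ third :*′ con′ third :*′ x)) ≡.refl x))
        (ℚP.≤-trans (ℚP.+-monoʳ-≤ 1ℚ x≤) (ℚP.≤-reflexive (solve′ 1 (λ p → con′ 1ℚ :+′ (p :-′ con′ 1ℚ) :=′ p) ≡.refl p)))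
      where
      0≤⅑ : 0ℚ ℚ.≤ third ℚ.* third
      0≤⅑ = Rat.0≤* (Rat.0≤inv 2) (Rat.0≤inv 2)
    from : (p ℚ.- 1ℚ ℚ.≤ 1ℚ) ⊎ (1ℚ ℚ.≤ p ℚ.- 1ℚ) → ∃[ q ] 1ℚ ℚ.< q × q ℚ.* q ℚ.≤ p
    from (inj₁ h) = small (p ℚ.- 1ℚ) (Rat.0<-diff 1<p) h ℚP.≤-refl
    from (inj₂ h) = small 1ℚ (ℚP.positive⁻¹ 1ℚ) ℚP.≤-refl h

  fourth-root : ∀ {p} → 1ℚ ℚ.< p → ∃[ q ] 1ℚ ℚ.< q × (q ℚ.* q) ℚ.* (q ℚ.* q) ℚ.≤ p
  fourth-root 1<p with q , 1<q , q²≤ ← square-root 1<p with r , 1<r , r²≤ ← square-root 1<q =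
    r , 1<r , ℚP.≤-trans (Rat.*-mono-≤ 0≤r² r²≤ 0≤r² r²≤) q²≤
    where 0≤r² = Rat.0≤* (ℚP.<⇒≤ (0<1+ 1<r)) (ℚP.<⇒≤ (0<1+ 1<r))

  -- Rounding and the shift in Wallis' lower bound change counts by a constant, which any tolerance
  -- μ > 1 eventually covers.
  absorb-constant : ∀ c {μ} → 1ℚ ℚ.< μ → ∃[ K ] ∀ k → K ℕ.≤ k → ⟦ suc c ℕ.+ k ⟧ ℚ.≤ μ ℚ.* ⟦ k ⟧
  absorb-constant c {μ} 1<μ = suc N , absorb
    where
    arch = Rat.archimedean (Rat.*-pos (Rat.0<-diff 1<μ) (Rat.0<inv c))
    N = proj₁ arch
    open ℚP.≤-Reasoning
    absorb : ∀ k → suc N ℕ.≤ k → ⟦ suc c ℕ.+ k ⟧ ℚ.≤ μ ℚ.* ⟦ k ⟧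
    absorb (suc n) (s≤s n≥) = begin
      ⟦ suc c ℕ.+ suc n ⟧ ≡⟨ Rat.⟦⟧-+ (suc c) (suc n) ⟩
      C ℚ.+ k ≡⟨ solve′ 2 (λ c k → c :+′ k :=′ c :*′ con′ 1ℚ :+′ k) ≡.refl C k ⟩
      C ℚ.* 1ℚ ℚ.+ k ≡⟨ cong (λ t → C ℚ.* t ℚ.+ k) (Rat.⟦⟧-inv n) ⟨
      C ℚ.* (k ℚ.* Rat.inv n) ℚ.+ k ≤⟨ ℚP.+-monoˡ-≤ k (Rat.*-monoʳ (Rat.0≤⟦⟧ (suc c)) (Rat.*-monoʳ (Rat.0≤⟦⟧ (suc n)) (ℚP.<⇒≤ (proj₂ arch n n≥)))) ⟩
      C ℚ.* (k ℚ.* ((μ ℚ.- 1ℚ) ℚ.* Rat.inv c)) ℚ.+ k ≡⟨ solve′ 4 (λ c k m i → c :*′ (k :*′ ((m :-′ con′ 1ℚ) :*′ i)) :+′ k :=′ (c :*′ i) :*′ ((m :-′ con′ 1ℚ) :*′ k) :+′ k) ≡.refl C k μ (Rat.inv c) ⟩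
      (C ℚ.* Rat.inv c) ℚ.* ((μ ℚ.- 1ℚ) ℚ.* k) ℚ.+ k ≡⟨ cong (λ t → t ℚ.* ((μ ℚ.- 1ℚ) ℚ.* k) ℚ.+ k) (Rat.⟦⟧-inv c) ⟩
      1ℚ ℚ.* ((μ ℚ.- 1ℚ) ℚ.* k) ℚ.+ k ≡⟨ solve′ 2 (λ m k → con′ 1ℚ :*′ ((m :-′ con′ 1ℚ) :*′ k) :+′ k :=′ m :*′ k) ≡.refl μ k ⟩
      μ ℚ.* k ∎
      where
      C = ⟦ suc c ⟧
      k = ⟦ suc n ⟧

  -- A tilt costs one unit of the numerator, so the fraction is expanded by `2 + K`, after which one
  -- unit costs at most a factor μ. The shape `2 ℕ.+ a` leaves room to subtract that unit.
  large-fraction : ∀ {p μ} → 0ℚ ℚ.< p → 1ℚ ℚ.< μ → ∃[ a ] ∃[ D ]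
    ⟦ suc D ⟧ ℚ.* p ≡ ⟦ 2 ℕ.+ a ⟧ × (∀ k → a ℕ.≤ k → ⟦ suc k ⟧ ℚ.≤ μ ℚ.* ⟦ k ⟧)
  large-fraction {p} {μ} 0<p 1<μ = e ℕ.* (2 ℕ.+ K) ℕ.+ K , f ℕ.* (2 ℕ.+ K) ℕ.+ suc K , eq ,
      λ k a≤k → proj₂ large k (ℕP.≤-trans (ℕP.m≤n+m K _) a≤k)
    where
    fr = Rat.fraction 0<p
    e = proj₁ fr
    f = proj₁ (proj₂ fr)
    large = absorb-constant 0 1<μ
    K = proj₁ large
    M = 2 ℕ.+ K
    expand : ∀ x → suc x ℕ.* M ≡ 2 ℕ.+ (x ℕ.* M ℕ.+ K)
    expand x = cong (2 ℕ.+_) (ℕP.+-comm K (x ℕ.* M))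
    open ≡.≡-Reasoning
    eq : ⟦ suc (f ℕ.* M ℕ.+ suc K) ⟧ ℚ.* p ≡ ⟦ 2 ℕ.+ (e ℕ.* M ℕ.+ K) ⟧
    eq = begin
      ⟦ suc (f ℕ.* M ℕ.+ suc K) ⟧ ℚ.* p ≡⟨ cong (λ t → ⟦ t ⟧ ℚ.* p) (≡.trans (cong suc (ℕP.+-suc (f ℕ.* M) K)) (≡.sym (expand f))) ⟩
      ⟦ suc f ℕ.* M ⟧ ℚ.* p ≡⟨ cong (ℚ._* p) (Rat.⟦⟧-* (suc f) M) ⟩
      ⟦ suc f ⟧ ℚ.* ⟦ M ⟧ ℚ.* p ≡⟨ solve′ 3 (λ f m p → f :*′ m :*′ p :=′ f :*′ p :*′ m) ≡.refl ⟦ suc f ⟧ ⟦ M ⟧ p ⟩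
      ⟦ suc f ⟧ ℚ.* p ℚ.* ⟦ M ⟧ ≡⟨ cong (ℚ._* ⟦ M ⟧) (proj₂ (proj₂ fr)) ⟩
      ⟦ suc e ⟧ ℚ.* ⟦ M ⟧ ≡⟨ Rat.⟦⟧-* (suc e) M ⟨
      ⟦ suc e ℕ.* M ⟧ ≡⟨ cong ⟦_⟧ (expand e) ⟩
      ⟦ 2 ℕ.+ (e ℕ.* M ℕ.+ K) ⟧ ∎

  floor : ∀ m d → ∃[ q ] suc d ℕ.* q ℕ.≤ m × m ℕ.≤ suc d ℕ.* suc q
  floor m d = q , ℕP.≤-trans (ℕP.≤-reflexive (ℕP.*-comm (suc d) q)) (m/n*n≤m m (suc d)) , (begin
      m ≡⟨ m≡m%n+[m/n]*n m (suc d) ⟩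
      m ℕ.% suc d ℕ.+ q ℕ.* suc d ≤⟨ ℕP.+-monoˡ-≤ (q ℕ.* suc d) (ℕP.<⇒≤ (m%n<n m (suc d))) ⟩
      suc q ℕ.* suc d ≡⟨ ℕP.*-comm (suc q) (suc d) ⟩
      suc d ℕ.* suc q ∎)
    where
    open ℕP.≤-Reasoning
    q = m ℕ./ suc d

  record WallisConstant (F : OrderedAlgebra) : Set where
    open OrderedAlgebra F
    field
      π            : Carrier
      0≤π          : 0# ≤ π
      wallis-upper : ∀ N → ι (remain N ℚ.* remain N ℚ.* ⟦ N ⟧) * π ≤ ι 2ℚ
      wallis-lower : ∀ N → ι 2ℚ ≤ ι (remain N ℚ.* remain N ℚ.* ⟦ 2 ℕ.+ N ⟧) * π

  -- Comparison up to rational factors.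

  module Asymptotics (F : OrderedAlgebra) (Π : WallisConstant F) where
    open OrderedAlgebraProperties F
    open Walks F
    open WalkBounds F
    open WallisConstant Π

    infix 4 _≾_
    -- Asymptotic domination with constant 1; the two directions together express a ratio tending to
    -- 1 without a division.
    record _≾_ (u v : ℕ → Carrier) : Set where
      constructor mk≾
      field eventually : ∀ {μ} → 1ℚ ℚ.< μ → ∃[ N ] ∀ n → N ℕ.≤ n → u n ≤ ι μ * v n

    open _≾_ public

    -- for positive reals, this holds by density of ℚ
    record Approximable (x : Carrier) : Set where
      constructor mkApproximable
      field approximate : ∀ {μ} → 1ℚ ℚ.< μ → ∃[ q ] 0ℚ ℚ.< q × ι q ≤ ι μ * x × x ≤ ι μ * ι q

    open Approximable public

    0≤ι⟦⟧ : ∀ n → 0# ≤ ι ⟦ n ⟧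
    0≤ι⟦⟧ n = 0≤ι (Rat.0≤⟦⟧ n)

    1<⇒0≤ι : ∀ {μ} → 1ℚ ℚ.< μ → 0# ≤ ι μ
    1<⇒0≤ι h = 0≤ι (ℚP.<⇒≤ (0<1+ h))

    approximable-≥0 : ∀ {x} → Approximable x → 0# ≤ x
    approximable-≥0 {x} ax with q , 0<q , q≤ , _ ← approximate ax {2ℚ} (Rat.<-slack {1ℚ} {2ℚ} 1ℚ (ℚP.positive⁻¹ 1ℚ) ≡.refl) =
      ι-cancelˡ (Rat.0<⟦suc⟧ 1) (≤-trans (≤-reflexive (zeroʳ (ι 2ℚ))) (≤-trans (0≤ι (ℚP.<⇒≤ 0<q)) q≤))

    approximable-ratio : ∀ {x y μ} → 1ℚ ℚ.< μ → Approximable x → Approximable y →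
      ∃[ q ] 0ℚ ℚ.< q × ι q * y ≤ ι (μ ℚ.* μ) * x × x ≤ ι (μ ℚ.* μ) * (ι q * y)
    approximable-ratio {x} {y} {μ} 1<μ ax ay
      with p , 0<p , p≤ , ≤p ← approximate ax 1<μ | r , 0<r , r≤ , ≤r ← approximate ay 1<μ =
      q , 0<q ,
      (begin
        ι q * y ∼⟨ *-monoˡ-≤ (0≤ι (ℚP.<⇒≤ 0<q)) ≤r ⟩
        ι q * (ι μ * ι r) ≈⟨ solve 3 (λ q m r → q :* (m :* r) := m :* (q :* r)) refl (ι q) (ι μ) (ι r) ⟩
        ι μ * (ι q * ι r) ≈⟨ *-congˡ qr≈p ⟩
        ι μ * ι p ∼⟨ *-monoˡ-≤ 0≤μ p≤ ⟩
        ι μ * (ι μ * x) ≈⟨ trans (sym (*-assoc _ _ _)) (*-congʳ (sym (ι-* μ μ))) ⟩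
        ι (μ ℚ.* μ) * x ∎) ,
      (begin
        x ∼⟨ ≤p ⟩
        ι μ * ι p ≈⟨ *-congˡ qr≈p ⟨
        ι μ * (ι q * ι r) ∼⟨ *-monoˡ-≤ 0≤μ (*-monoˡ-≤ (0≤ι (ℚP.<⇒≤ 0<q)) r≤) ⟩
        ι μ * (ι q * (ι μ * y)) ≈⟨ solve 3 (λ q m y → m :* (q :* (m :* y)) := m :* m :* (q :* y)) refl (ι q) (ι μ) y ⟩
        ι μ * ι μ * (ι q * y) ≈⟨ *-congʳ (ι-* μ μ) ⟨
        ι (μ ℚ.* μ) * (ι q * y) ∎)
      where
      0≤μ = 1<⇒0≤ι 1<μ
      instance
        r≢0 : ℚ.NonZero r
        r≢0 = ℚ.>-nonZero 0<r
      q = p ℚ.* ℚ.1/ r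
      0<q : 0ℚ ℚ.< q
      0<q = Rat.*-pos 0<p (Rat.1/-pos 0<r)
      qr≈p : ι q * ι r ≈ ι p
      qr≈p = trans (sym (ι-* q r)) (ι-cong (≡.trans (ℚP.*-assoc p (ℚ.1/ r) r) (≡.trans (cong (p ℚ.*_) (ℚP.*-inverseˡ r)) (ℚP.*-identityʳ p))))

    module _ {x y : Carrier} (ax : Approximable x) (ay : Approximable y) {lam : ℚ} (1<lam : 1ℚ ℚ.< lam) where
      private
        -- The losses below amount to ννμ = μ ^ 5; since μ² ≤ μ₁ and μ₁ ^ 4 ≤ lam, even μ ^ 8 is
        -- within the tolerance.
        root = fourth-root 1<lam
        μ₁ = proj₁ root
        1<μ₁ = proj₁ (proj₂ root)
        root₂ = square-root 1<μ₁
        μ = proj₁ root₂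
        1<μ = proj₁ (proj₂ root₂)
        ν = μ ℚ.* μ
        0<μ = 0<1+ 1<μ
        0<ν : 0ℚ ℚ.< ν
        0<ν = Rat.*-pos 0<μ 0<μ
        ratio = approximable-ratio 1<μ ax ay
        q = proj₁ ratio
        0<q = proj₁ (proj₂ ratio)
        q≤ = proj₁ (proj₂ (proj₂ ratio))
        ≤q = proj₂ (proj₂ (proj₂ ratio))
        0≤y = approximable-≥0 ay
        ννμ≤ : ν ℚ.* ν ℚ.* μ ℚ.≤ lam
        ννμ≤ = ℚP.≤-trans (Rat.*-mono-≤ (Rat.0≤* (ℚP.<⇒≤ 0<ν) (ℚP.<⇒≤ 0<ν)) (Rat.*-mono-≤ (ℚP.<⇒≤ 0<ν) ν≤ (ℚP.<⇒≤ 0<ν) ν≤) (ℚP.<⇒≤ 0<μ) μ≤)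
            (proj₂ (proj₂ root))
          where
          ν≤ : ν ℚ.≤ μ₁
          ν≤ = proj₂ (proj₂ root₂)
          μ≤ : μ ℚ.≤ μ₁ ℚ.* μ₁
          μ≤ = ℚP.≤-trans (1≤⇒≤* μ (ℚP.<⇒≤ 0<μ) (ℚP.<⇒≤ 1<μ)) (ℚP.≤-trans ν≤ (1≤⇒≤* μ₁ (ℚP.<⇒≤ (0<1+ 1<μ₁)) (ℚP.<⇒≤ 1<μ₁)))

      -- Applied to x = 2b and y = S: the slope (2 + a) / (D + 1) lies safely below x / y, and the
      -- slope (1 + a) / (D + 1) that the tilt leaves is still within `lam` of it. `slope-above` is
      -- the mirror image.
      slope-below : ∃[ a ] ∃[ D ] ι ⟦ 2 ℕ.+ a ⟧ * y ≤ ι ⟦ suc D ⟧ * x × ι ⟦ suc D ⟧ * x ≤ ι lam * (ι ⟦ suc a ⟧ * y)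
      slope-below = a , D , below , above
        where
        instance
          ν≢0 : ℚ.NonZero ν
          ν≢0 = ℚ.>-nonZero 0<ν
        lf = large-fraction (Rat.*-pos 0<q (Rat.1/-pos 0<ν)) 1<μ
        a = proj₁ lf
        D = proj₁ (proj₂ lf)
        eq : ⟦ suc D ⟧ ℚ.* q ≡ ⟦ 2 ℕ.+ a ⟧ ℚ.* ν
        eq = ≡.trans (≡.sym (≡.trans (cong (λ t → ⟦ suc D ⟧ ℚ.* t) (≡.trans (ℚP.*-assoc q (ℚ.1/ ν) ν) (≡.trans (cong (q ℚ.*_) (ℚP.*-inverseˡ ν)) (ℚP.*-identityʳ q)))) ≡.refl))
          (≡.trans (≡.sym (ℚP.*-assoc ⟦ suc D ⟧ (q ℚ.* ℚ.1/ ν) ν)) (cong (ℚ._* ν) (proj₁ (proj₂ (proj₂ lf)))))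
        below : ι ⟦ 2 ℕ.+ a ⟧ * y ≤ ι ⟦ suc D ⟧ * x
        below = ι-cancelˡ 0<ν (begin
          ι ν * (ι ⟦ 2 ℕ.+ a ⟧ * y) ≈⟨ trans (solve 3 (λ n a y → n :* (a :* y) := a :* n :* y) refl _ _ _) (*-congʳ (sym (ι-* _ _))) ⟩
          ι (⟦ 2 ℕ.+ a ⟧ ℚ.* ν) * y ≈⟨ trans (*-congʳ (trans (ι-cong (≡.sym eq)) (ι-* _ _))) (*-assoc _ _ _) ⟩
          ι ⟦ suc D ⟧ * (ι q * y) ∼⟨ *-monoˡ-≤ (0≤ι⟦⟧ (suc D)) q≤ ⟩
          ι ⟦ suc D ⟧ * (ι ν * x) ≈⟨ solve 3 (λ d n x → d :* (n :* x) := n :* (d :* x)) refl _ _ _ ⟩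
          ι ν * (ι ⟦ suc D ⟧ * x) ∎)
        above : ι ⟦ suc D ⟧ * x ≤ ι lam * (ι ⟦ suc a ⟧ * y)
        above = begin
          ι ⟦ suc D ⟧ * x ∼⟨ *-monoˡ-≤ (0≤ι⟦⟧ (suc D)) ≤q ⟩
          ι ⟦ suc D ⟧ * (ι ν * (ι q * y)) ≈⟨ solve 4 (λ d n q y → d :* (n :* (q :* y)) := n :* (d :* q) :* y) refl _ _ _ _ ⟩
          ι ν * (ι ⟦ suc D ⟧ * ι q) * y ≈⟨ *-congʳ (trans (*-congˡ (trans (sym (ι-* _ _)) (ι-cong eq))) (sym (ι-* _ _))) ⟩
          ι (ν ℚ.* (⟦ 2 ℕ.+ a ⟧ ℚ.* ν)) * y ∼⟨ *-monoʳ-≤ 0≤y (ι-mono bound) ⟩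
          ι (lam ℚ.* ⟦ suc a ⟧) * y ≈⟨ trans (*-congʳ (ι-* _ _)) (*-assoc _ _ _) ⟩
          ι lam * (ι ⟦ suc a ⟧ * y) ∎
          where
          bound : ν ℚ.* (⟦ 2 ℕ.+ a ⟧ ℚ.* ν) ℚ.≤ lam ℚ.* ⟦ suc a ⟧
          bound = ℚP.≤-trans (Rat.*-monoʳ (ℚP.<⇒≤ 0<ν) (Rat.*-monoˡ (ℚP.<⇒≤ 0<ν) (proj₂ (proj₂ (proj₂ lf)) (suc a) (ℕP.n≤1+n a))))
            (ℚP.≤-trans (ℚP.≤-reflexive (solve′ 3 (λ n m a → n :*′ (m :*′ a :*′ n) :=′ n :*′ n :*′ m :*′ a) ≡.refl ν μ ⟦ suc a ⟧))
              (Rat.*-monoˡ (Rat.0≤⟦⟧ (suc a)) ννμ≤))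

      slope-above : ∃[ a ] ∃[ D ] ι ⟦ suc D ⟧ * x ≤ ι ⟦ 2 ℕ.+ a ⟧ * y × ι ⟦ 3 ℕ.+ a ⟧ * y ≤ ι lam * (ι ⟦ suc D ⟧ * x)
      slope-above = a , D , below , above
        where
        lf = large-fraction (Rat.*-pos 0<q 0<ν) 1<μ
        a = proj₁ lf
        D = proj₁ (proj₂ lf)
        eq : ⟦ suc D ⟧ ℚ.* (q ℚ.* ν) ≡ ⟦ 2 ℕ.+ a ⟧
        eq = proj₁ (proj₂ (proj₂ lf))
        below : ι ⟦ suc D ⟧ * x ≤ ι ⟦ 2 ℕ.+ a ⟧ * y
        below = begin
          ι ⟦ suc D ⟧ * x ∼⟨ *-monoˡ-≤ (0≤ι⟦⟧ (suc D)) ≤q ⟩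
          ι ⟦ suc D ⟧ * (ι ν * (ι q * y)) ≈⟨ solve 4 (λ d n q y → d :* (n :* (q :* y)) := d :* (q :* n) :* y) refl _ _ _ _ ⟩
          ι ⟦ suc D ⟧ * (ι q * ι ν) * y ≈⟨ *-congʳ (trans (*-congˡ (sym (ι-* q ν))) (trans (sym (ι-* _ _)) (ι-cong eq))) ⟩
          ι ⟦ 2 ℕ.+ a ⟧ * y ∎
        above : ι ⟦ 3 ℕ.+ a ⟧ * y ≤ ι lam * (ι ⟦ suc D ⟧ * x)
        above = begin
          ι ⟦ 3 ℕ.+ a ⟧ * y ∼⟨ *-monoʳ-≤ 0≤y (ι-mono (proj₂ (proj₂ (proj₂ lf)) (2 ℕ.+ a) (ℕP.m≤n+m a 2))) ⟩
          ι (μ ℚ.* ⟦ 2 ℕ.+ a ⟧) * y ≈⟨ *-congʳ (trans (ι-cong (cong (μ ℚ.*_) (≡.sym eq))) (trans (ι-* _ _) (*-congˡ (trans (ι-* _ _) (*-congˡ (ι-* q ν)))))) ⟩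
          ι μ * (ι ⟦ suc D ⟧ * (ι q * ι ν)) * y ≈⟨ solve 5 (λ m d q n y → m :* (d :* (q :* n)) :* y := m :* n :* (d :* (q :* y))) refl _ _ _ _ _ ⟩
          ι μ * ι ν * (ι ⟦ suc D ⟧ * (ι q * y)) ∼⟨ *-monoˡ-≤ (0≤* (0≤ι (ℚP.<⇒≤ 0<μ)) (0≤ι (ℚP.<⇒≤ 0<ν))) (*-monoˡ-≤ (0≤ι⟦⟧ (suc D)) q≤) ⟩
          ι μ * ι ν * (ι ⟦ suc D ⟧ * (ι ν * x)) ≈⟨ trans (solve 4 (λ m n d x → m :* n :* (d :* (n :* x)) := n :* n :* m :* (d :* x)) refl _ _ _ _)
                                                       (*-congʳ (trans (*-congʳ (sym (ι-* ν ν))) (sym (ι-* _ _)))) ⟩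
          ι (ν ℚ.* ν ℚ.* μ) * (ι ⟦ suc D ⟧ * x) ∼⟨ *-monoʳ-≤ (0≤* (0≤ι⟦⟧ (suc D)) (approximable-≥0 ax)) (ι-mono ννμ≤) ⟩
          ι lam * (ι ⟦ suc D ⟧ * x) ∎

    approximable-double : ∀ {x} → Approximable x → Approximable (x + x)
    approximable-double {x} ax = mkApproximable λ {μ} 1<μ → let q , 0<q , q≤ , ≤q = approximate ax 1<μ in
      q ℚ.+ q , Rat.<-slack {0ℚ} {q ℚ.+ q} (q ℚ.+ q) (ℚP.+-mono-< 0<q 0<q) (≡.sym (ℚP.+-identityˡ (q ℚ.+ q))) ,
      ≤-trans (≤-reflexive (ι-+ q q)) (≤-trans (+-mono-≤ q≤ q≤) (≈⇒≥ (distribˡ (ι μ) x x))) ,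
      ≤-trans (+-mono-≤ ≤q ≤q) (≤-reflexive (trans (sym (distribˡ (ι μ) (ι q) (ι q))) (*-congˡ (sym (ι-+ q q)))))

    -- Solves x ≤ y + εx for x: 1 - ε is at least 1 / μ as soon as ε ≤ 1 - 1 / μ = η. The threshold
    -- η precedes ε because it decides how large n has to be.
    absorb-upper : ∀ {x y μ} → 1ℚ ℚ.< μ → (∃[ η ] 0ℚ ℚ.< η × ∀ ε → ε ℚ.≤ η → 0# ≤ x → x ≤ y + ι ε * x → x ≤ ι μ * y)
    absorb-upper {x} {y} {μ} 1<μ = η , 0<η , λ ε ε≤ 0≤x h → begin
        x ≈⟨ trans (sym (*-identityˡ x)) (*-congʳ (trans (sym ι-1) (trans (ι-cong (≡.sym (ℚP.*-inverseʳ μ))) (ι-* _ _)))) ⟩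
        ι μ * ι (ℚ.1/ μ) * x ≈⟨ *-assoc _ _ _ ⟩
        ι μ * (ι (ℚ.1/ μ) * x) ∼⟨ *-monoˡ-≤ (1<⇒0≤ι 1<μ) (+-cancelʳ-≤ _ _ (ι η * x) (begin
            ι (ℚ.1/ μ) * x + ι η * x ≈⟨ trans (sym (distribʳ _ _ _)) (trans (*-congʳ (trans (sym (ι-+ _ _)) (trans (ι-cong sum≡1) ι-1))) (*-identityˡ x)) ⟩
            x ∼⟨ h ⟩
            y + ι ε * x ∼⟨ +-monoʳ-≤ y (*-monoʳ-≤ 0≤x (ι-mono ε≤)) ⟩
            y + ι η * x ∎)) ⟩
        ι μ * y ∎
      where
      instance
        μ≢0 : ℚ.NonZero μ
        μ≢0 = ℚ.>-nonZero (0<1+ 1<μ)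
      η = (μ ℚ.- 1ℚ) ℚ.* ℚ.1/ μ
      0<η : 0ℚ ℚ.< η
      0<η = Rat.*-pos (Rat.0<-diff 1<μ) (Rat.1/-pos (0<1+ 1<μ))
      sum≡1 : ℚ.1/ μ ℚ.+ η ≡ 1ℚ
      sum≡1 = ≡.trans (solve′ 2 (λ m i → i :+′ (m :-′ con′ 1ℚ) :*′ i :=′ m :*′ i) ≡.refl μ (ℚ.1/ μ)) (ℚP.*-inverseʳ μ)

    absorb-lower : ∀ {x y μ} → 1ℚ ℚ.< μ → (∃[ η ] 0ℚ ℚ.< η × ∀ ε → ε ℚ.≤ η → 0# ≤ x → y ≤ x + ι ε * x → y ≤ ι μ * x)
    absorb-lower {x} {y} {μ} 1<μ = μ ℚ.- 1ℚ , Rat.0<-diff 1<μ , λ ε ε≤ 0≤x h → begin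
        y ∼⟨ h ⟩
        x + ι ε * x ∼⟨ +-mono-≤ (≈⇒≥ (trans (*-congʳ ι-1) (*-identityˡ x))) (*-monoʳ-≤ 0≤x (ι-mono ε≤)) ⟩
        ι 1ℚ * x + ι (μ ℚ.- 1ℚ) * x ≈⟨ trans (sym (distribʳ _ _ _)) (*-congʳ (trans (sym (ι-+ _ _))
             (ι-cong (solve′ 1 (λ m → con′ 1ℚ :+′ (m :-′ con′ 1ℚ) :=′ m) ≡.refl μ)))) ⟩
        ι μ * x ∎

  open import Data.Fin.Base using (Fin; zero; suc; inject₁; fromℕ)

  -- Removing one coordinate, and the induction on the dimension.

  module Theorem (F : OrderedAlgebra) (Π : WallisConstant F) where
    open OrderedAlgebraProperties F
    open Walks F
    open WalkBounds F
    open WallisConstant Π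
    open Asymptotics F Π

    double-ι : ∀ δ → ι (2ℚ ℚ.* ⟦ δ ⟧) ≈ (1# + 1#) * ι ⟦ δ ⟧
    double-ι δ = trans (ι-* 2ℚ ⟦ δ ⟧) (*-congʳ (trans (ι-+ 1ℚ 1ℚ) (+-cong ι-1 ι-1)))

    module _ {d : ℕ} (ω : Step (suc d) → Carrier) (0≤ω : ∀ v → 0# ≤ ω v) (symω : Symmetric ω)
             (aS : Approximable (sum ω)) (ab : Approximable (forward ω)) where
      private
        s s′ : ℕ → Carrier
        s  = total ω
        s′ = total (marginal ω)
        S = sum ω
        b = forward ω
        0≤s : ∀ n → 0# ≤ s n
        0≤s = 0≤total 0≤ω
        0≤s′ : ∀ n → 0# ≤ s′ n
        0≤s′ = 0≤total (0≤marginal 0≤ω)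
        0≤S = approximable-≥0 aS
        0≤b = approximable-≥0 ab
        scale : ℕ → Carrier
        scale n = ι ⟦ n ⟧ * π * b
        0≤scale : ∀ n → 0# ≤ scale n
        0≤scale n = 0≤* (0≤* (0≤ι⟦⟧ n) 0≤π) 0≤b

      -- Wallis' c(L)² L π ≤ 2 with L close to 2bn / S amounts to c(L)² nπb ≤ S. Of the four factors
      -- μ, two come from squaring the estimate of s(n), one from the slope and one from rounding L.
      upper-estimate : ∀ {μ lam} a D n L → 1ℚ ℚ.< μ → (μ ℚ.* μ) ℚ.* (μ ℚ.* μ) ℚ.≤ lam →
        ι ⟦ suc D ⟧ * (b + b) ≤ ι μ * (ι ⟦ a ⟧ * S) → a ℕ.* n ℕ.≤ suc D ℕ.* suc L → ⟦ suc L ⟧ ℚ.≤ μ ℚ.* ⟦ L ⟧ →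
        s n ≤ ι μ * (ι (remain L) * s′ n) → s n * s n * scale n ≤ ι lam * (S * (s′ n * s′ n))
      upper-estimate {μ} {lam} a D n L 1<μ μ⁴≤ slope an≤δL L≤ s≤ = begin
              s n * s n * scale n
                ∼⟨ *-monoʳ-≤ (0≤scale n) (*-mono-≤ (0≤s n) s≤ (0≤s n) s≤) ⟩
              ι μ * (ι c * s′ n) * (ι μ * (ι c * s′ n)) * scale n
                ≈⟨ solve 4 (λ m c s k → m :* (c :* s) :* (m :* (c :* s)) :* k := m :* m :* (c :* c :* k) :* (s :* s)) refl (ι μ) (ι c) (s′ n) (scale n) ⟩
              ι μ * ι μ * (ι c * ι c * scale n) * (s′ n * s′ n)
                ∼⟨ *-monoʳ-≤ (0≤* (0≤s′ n) (0≤s′ n)) (*-monoˡ-≤ (0≤* 0≤μ 0≤μ) main) ⟩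
              ι μ * ι μ * (ι μ * ι μ * S) * (s′ n * s′ n)
                ≈⟨ solve 3 (λ m S t → m :* m :* (m :* m :* S) :* t := m :* m :* (m :* m) :* (S :* t)) refl (ι μ) S (s′ n * s′ n) ⟩
              ι μ * ι μ * (ι μ * ι μ) * (S * (s′ n * s′ n))
                ≈⟨ *-congʳ (trans (*-cong (sym (ι-* μ μ)) (sym (ι-* μ μ))) (sym (ι-* (μ ℚ.* μ) (μ ℚ.* μ)))) ⟩
              ι ((μ ℚ.* μ) ℚ.* (μ ℚ.* μ)) * (S * (s′ n * s′ n))
                ∼⟨ *-monoʳ-≤ (0≤* 0≤S (0≤* (0≤s′ n) (0≤s′ n))) (ι-mono μ⁴≤) ⟩
              ι lam * (S * (s′ n * s′ n)) ∎
            where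
            δ = suc D
            c = remain L
            0≤c = Rat.0≤survival L 1
            0≤μ = 1<⇒0≤ι 1<μ
            0<2δ : 0ℚ ℚ.< 2ℚ ℚ.* ⟦ δ ⟧
            0<2δ = Rat.*-pos (Rat.0<⟦suc⟧ 1) (Rat.0<⟦suc⟧ D)
            an≤ : ι ⟦ a ⟧ * ι ⟦ n ⟧ ≤ ι ⟦ δ ⟧ * (ι μ * ι ⟦ L ⟧)
            an≤ = begin
              ι ⟦ a ⟧ * ι ⟦ n ⟧ ≈⟨ trans (ι-cong (Rat.⟦⟧-* a n)) (ι-* _ _) ⟨
              ι ⟦ a ℕ.* n ⟧ ∼⟨ ι-mono (Rat.⟦⟧-mono an≤δL) ⟩
              ι ⟦ δ ℕ.* suc L ⟧ ≈⟨ trans (ι-cong (Rat.⟦⟧-* δ (suc L))) (ι-* _ _) ⟩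
              ι ⟦ δ ⟧ * ι ⟦ suc L ⟧ ∼⟨ *-monoˡ-≤ (0≤ι⟦⟧ δ) (≤-trans (ι-mono L≤) (≤-reflexive (ι-* _ _))) ⟩
              ι ⟦ δ ⟧ * (ι μ * ι ⟦ L ⟧) ∎
            main : ι c * ι c * scale n ≤ ι μ * ι μ * S
            main = ι-cancelˡ 0<2δ (begin
              ι (2ℚ ℚ.* ⟦ δ ⟧) * (ι c * ι c * (ι ⟦ n ⟧ * π * b))
                ≈⟨ *-congʳ (double-ι δ) ⟩
              (1# + 1#) * ι ⟦ δ ⟧ * (ι c * ι c * (ι ⟦ n ⟧ * π * b))
                ≈⟨ solve 5 (λ d c n p b → (con 1 :+ con 1) :* d :* (c :* c :* (n :* p :* b)) := c :* c :* (n :* p) :* (d :* (b :+ b))) refl (ι ⟦ δ ⟧) (ι c) (ι ⟦ n ⟧) π b ⟩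
              ι c * ι c * (ι ⟦ n ⟧ * π) * (ι ⟦ δ ⟧ * (b + b))
                ∼⟨ *-monoˡ-≤ (0≤* (0≤* (0≤ι 0≤c) (0≤ι 0≤c)) (0≤* (0≤ι⟦⟧ n) 0≤π)) slope ⟩
              ι c * ι c * (ι ⟦ n ⟧ * π) * (ι μ * (ι ⟦ a ⟧ * S))
                ≈⟨ solve 6 (λ c n p m a S → c :* c :* (n :* p) :* (m :* (a :* S)) := m :* (c :* c) :* p :* S :* (a :* n)) refl (ι c) (ι ⟦ n ⟧) π (ι μ) (ι ⟦ a ⟧) S ⟩
              ι μ * (ι c * ι c) * π * S * (ι ⟦ a ⟧ * ι ⟦ n ⟧)
                ∼⟨ *-monoˡ-≤ (0≤* (0≤* (0≤* 0≤μ (0≤* (0≤ι 0≤c) (0≤ι 0≤c))) 0≤π) 0≤S) an≤ ⟩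
              ι μ * (ι c * ι c) * π * S * (ι ⟦ δ ⟧ * (ι μ * ι ⟦ L ⟧))
                ≈⟨ solve 6 (λ m c p S d l → m :* (c :* c) :* p :* S :* (d :* (m :* l)) := m :* m :* S :* d :* (c :* c :* l :* p)) refl (ι μ) (ι c) π S (ι ⟦ δ ⟧) (ι ⟦ L ⟧) ⟩
              ι μ * ι μ * S * ι ⟦ δ ⟧ * (ι c * ι c * ι ⟦ L ⟧ * π)
                ∼⟨ *-monoˡ-≤ (0≤* (0≤* (0≤* 0≤μ 0≤μ) 0≤S) (0≤ι⟦⟧ δ)) (≤-trans (≈⇒≥ (*-congʳ (trans (ι-* _ _) (*-congʳ (ι-* c c))))) (wallis-upper L)) ⟩
              ι μ * ι μ * S * ι ⟦ δ ⟧ * ι 2ℚ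
                ≈⟨ trans (solve 4 (λ m S d t → m :* m :* S :* d :* t := t :* d :* (m :* m :* S)) refl (ι μ) S (ι ⟦ δ ⟧) (ι 2ℚ)) (*-congʳ (sym (ι-* _ _))) ⟩
              ι (2ℚ ℚ.* ⟦ δ ⟧) * (ι μ * ι μ * S) ∎)

      coordinate-upper : (λ n → s n * s n * scale n) ≾ (λ n → S * (s′ n * s′ n))
      coordinate-upper = mk≾ λ {lam} 1<lam → at lam (fourth-root 1<lam)
        where
        Goal : ℚ → Set
        Goal lam = ∃[ N ] ∀ n → N ℕ.≤ n → s n * s n * scale n ≤ ι lam * (S * (s′ n * s′ n))
        at : ∀ lam → (∃[ μ ] 1ℚ ℚ.< μ × (μ ℚ.* μ) ℚ.* (μ ℚ.* μ) ℚ.≤ lam) → Goal lam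
        at lam (μ , 1<μ , μ⁴≤) = at-slope (slope-below (approximable-double ab) aS 1<μ)
          where
          at-slope : (∃[ a ] ∃[ D ] ι ⟦ 2 ℕ.+ a ⟧ * S ≤ ι ⟦ suc D ⟧ * (b + b) × ι ⟦ suc D ⟧ * (b + b) ≤ ι μ * (ι ⟦ suc a ⟧ * S)) → Goal lam
          at-slope (a , D , below , above) = at-rate (step-upper {a = suc a} {D = D} ω 0≤ω symω below)
            where
            at-rate : (∃[ ρ ] 0ℚ ℚ.≤ ρ × ρ ℚ.< 1ℚ × ∀ n L → suc D ℕ.* L ℕ.≤ suc a ℕ.* n →
              s n ≤ ι (remain L) * s′ n + ι (ρ Rat.^ n ℚ.* ⟦ suc n ⟧ Rat.^ suc d) * s n) → Goal lam
            at-rate (ρ , 0≤ρ , ρ<1 , step) = N₁ ℕ.⊔ N₂ , λ n n≥ →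
                at-floor n (ℕP.m⊔n≤o⇒m≤o N₁ N₂ n≥) (ℕP.m⊔n≤o⇒n≤o N₁ N₂ n≥) (floor (suc a ℕ.* n) D)
              where
              -- The threshold η depends on `μ` alone, so it may be read off from an instance with
              -- dummy arguments.
              small = Rat.^-poly-null (suc d) 0≤ρ ρ<1 (proj₁ (proj₂ (absorb-upper {0#} {0#} 1<μ)))
              large = absorb-constant 0 1<μ
              N₁ = proj₁ small
              -- As n ≤ suc D * suc L, this forces `L` past the threshold of `absorb-constant`.
              N₂ = suc D ℕ.* suc (proj₁ large)
              at-floor : ∀ n → N₁ ℕ.≤ n → N₂ ℕ.≤ n → (∃[ L ] suc D ℕ.* L ℕ.≤ suc a ℕ.* n × suc a ℕ.* n ℕ.≤ suc D ℕ.* suc L) →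
                s n * s n * scale n ≤ ι lam * (S * (s′ n * s′ n))
              at-floor n n≥N₁ n≥N₂ (L , L≤ , ≤L) = upper-estimate (suc a) D n L 1<μ μ⁴≤ above ≤L
                (proj₂ large L (ℕ.s≤s⁻¹ (ℕP.*-cancelˡ-≤ (suc D) (ℕP.≤-trans n≥N₂ (ℕP.≤-trans (ℕP.m≤m+n n (a ℕ.* n)) ≤L)))))
                (proj₂ (proj₂ (absorb-upper 1<μ)) _ (proj₂ small n n≥N₁) (0≤s n) (step n L L≤))

      lower-estimate : ∀ {μ lam} a D n U → 1ℚ ℚ.< μ → (μ ℚ.* μ) ℚ.* (μ ℚ.* μ) ℚ.≤ lam →
        ι ⟦ a ⟧ * S ≤ ι μ * (ι ⟦ suc D ⟧ * (b + b)) → ⟦ suc D ℕ.* (2 ℕ.+ U) ⟧ ℚ.≤ μ ℚ.* ⟦ a ℕ.* n ⟧ →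
        ι (remain U) * s′ n ≤ ι μ * s n → S * (s′ n * s′ n) ≤ ι lam * (s n * s n * scale n)
      lower-estimate {μ} {lam} a D n U 1<μ μ⁴≤ slope U≤ cs′≤ = begin
              S * (s′ n * s′ n)
                ∼⟨ *-monoʳ-≤ (0≤* (0≤s′ n) (0≤s′ n)) main ⟩
              ι μ * ι μ * (ι c * ι c * scale n) * (s′ n * s′ n)
                ≈⟨ solve 4 (λ m c s k → m :* m :* (c :* c :* k) :* (s :* s) := m :* m :* k :* (c :* s :* (c :* s))) refl (ι μ) (ι c) (s′ n) (scale n) ⟩
              ι μ * ι μ * scale n * (ι c * s′ n * (ι c * s′ n))
                ∼⟨ *-monoˡ-≤ (0≤* (0≤* 0≤μ 0≤μ) (0≤scale n)) (*-mono-≤ 0≤cs′ cs′≤ 0≤cs′ cs′≤) ⟩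
              ι μ * ι μ * scale n * (ι μ * s n * (ι μ * s n))
                ≈⟨ solve 3 (λ m k s → m :* m :* k :* (m :* s :* (m :* s)) := m :* m :* (m :* m) :* (s :* s :* k)) refl (ι μ) (scale n) (s n) ⟩
              ι μ * ι μ * (ι μ * ι μ) * (s n * s n * scale n)
                ≈⟨ *-congʳ (trans (*-cong (sym (ι-* μ μ)) (sym (ι-* μ μ))) (sym (ι-* (μ ℚ.* μ) (μ ℚ.* μ)))) ⟩
              ι ((μ ℚ.* μ) ℚ.* (μ ℚ.* μ)) * (s n * s n * scale n)
                ∼⟨ *-monoʳ-≤ (0≤* (0≤* (0≤s n) (0≤s n)) (0≤scale n)) (ι-mono μ⁴≤) ⟩
              ι lam * (s n * s n * scale n) ∎
            where
            δ = suc D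
            c = remain U
            0≤c = Rat.0≤survival U 1
            0≤μ = 1<⇒0≤ι 1<μ
            0<2δ : 0ℚ ℚ.< 2ℚ ℚ.* ⟦ δ ⟧
            0<2δ = Rat.*-pos (Rat.0<⟦suc⟧ 1) (Rat.0<⟦suc⟧ D)
            0≤cs′ : 0# ≤ ι c * s′ n
            0≤cs′ = 0≤* (0≤ι 0≤c) (0≤s′ n)
            U≤′ : ι ⟦ δ ⟧ * ι ⟦ 2 ℕ.+ U ⟧ ≤ ι μ * (ι ⟦ a ⟧ * ι ⟦ n ⟧)
            U≤′ = begin
              ι ⟦ δ ⟧ * ι ⟦ 2 ℕ.+ U ⟧ ≈⟨ trans (ι-cong (Rat.⟦⟧-* δ (2 ℕ.+ U))) (ι-* _ _) ⟨
              ι ⟦ δ ℕ.* (2 ℕ.+ U) ⟧ ∼⟨ ι-mono U≤ ⟩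
              ι (μ ℚ.* ⟦ a ℕ.* n ⟧) ≈⟨ trans (ι-* _ _) (*-congˡ (trans (ι-cong (Rat.⟦⟧-* a n)) (ι-* _ _))) ⟩
              ι μ * (ι ⟦ a ⟧ * ι ⟦ n ⟧) ∎
            main : S ≤ ι μ * ι μ * (ι c * ι c * scale n)
            main = ι-cancelˡ 0<2δ (begin
              ι (2ℚ ℚ.* ⟦ δ ⟧) * S
                ≈⟨ trans (*-congʳ (ι-* _ _)) (solve 3 (λ t d S → t :* d :* S := d :* S :* t) refl (ι 2ℚ) (ι ⟦ δ ⟧) S) ⟩
              ι ⟦ δ ⟧ * S * ι 2ℚ
                ∼⟨ *-monoˡ-≤ (0≤* (0≤ι⟦⟧ δ) 0≤S) (≤-trans (wallis-lower U) (≤-reflexive (*-congʳ (trans (ι-* _ _) (*-congʳ (ι-* c c)))))) ⟩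
              ι ⟦ δ ⟧ * S * (ι c * ι c * ι ⟦ 2 ℕ.+ U ⟧ * π)
                ≈⟨ solve 5 (λ d S c u p → d :* S :* (c :* c :* u :* p) := c :* c :* p :* S :* (d :* u)) refl (ι ⟦ δ ⟧) S (ι c) (ι ⟦ 2 ℕ.+ U ⟧) π ⟩
              ι c * ι c * π * S * (ι ⟦ δ ⟧ * ι ⟦ 2 ℕ.+ U ⟧)
                ∼⟨ *-monoˡ-≤ (0≤* (0≤* (0≤* (0≤ι 0≤c) (0≤ι 0≤c)) 0≤π) 0≤S) U≤′ ⟩
              ι c * ι c * π * S * (ι μ * (ι ⟦ a ⟧ * ι ⟦ n ⟧))
                ≈⟨ solve 6 (λ c p S m a n → c :* c :* p :* S :* (m :* (a :* n)) := m :* (c :* c) :* (n :* p) :* (a :* S)) refl (ι c) π S (ι μ) (ι ⟦ a ⟧) (ι ⟦ n ⟧) ⟩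
              ι μ * (ι c * ι c) * (ι ⟦ n ⟧ * π) * (ι ⟦ a ⟧ * S)
                ∼⟨ *-monoˡ-≤ (0≤* (0≤* 0≤μ (0≤* (0≤ι 0≤c) (0≤ι 0≤c))) (0≤* (0≤ι⟦⟧ n) 0≤π)) slope ⟩
              ι μ * (ι c * ι c) * (ι ⟦ n ⟧ * π) * (ι μ * (ι ⟦ δ ⟧ * (b + b)))
                ≈⟨ solve 6 (λ m c n p d b → m :* (c :* c) :* (n :* p) :* (m :* (d :* (b :+ b))) := (con 1 :+ con 1) :* d :* (m :* m :* (c :* c :* (n :* p :* b)))) refl (ι μ) (ι c) (ι ⟦ n ⟧) π (ι ⟦ δ ⟧) b ⟩
              (1# + 1#) * ι ⟦ δ ⟧ * (ι μ * ι μ * (ι c * ι c * scale n))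
                ≈⟨ *-congʳ (double-ι δ) ⟨
              ι (2ℚ ℚ.* ⟦ δ ⟧) * (ι μ * ι μ * (ι c * ι c * scale n)) ∎)

      coordinate-lower : (λ n → S * (s′ n * s′ n)) ≾ (λ n → s n * s n * scale n)
      coordinate-lower = mk≾ λ {lam} 1<lam → at lam (fourth-root 1<lam)
        where
        Goal : ℚ → Set
        Goal lam = ∃[ N ] ∀ n → N ℕ.≤ n → S * (s′ n * s′ n) ≤ ι lam * (s n * s n * scale n)
        at : ∀ lam → (∃[ μ ] 1ℚ ℚ.< μ × (μ ℚ.* μ) ℚ.* (μ ℚ.* μ) ℚ.≤ lam) → Goal lam
        at lam (μ , 1<μ , μ⁴≤) = at-slope (slope-above (approximable-double ab) aS 1<μ)
          where
          at-slope : (∃[ a ] ∃[ D ] ι ⟦ suc D ⟧ * (b + b) ≤ ι ⟦ 2 ℕ.+ a ⟧ * S × ι ⟦ 3 ℕ.+ a ⟧ * S ≤ ι μ * (ι ⟦ suc D ⟧ * (b + b))) → Goal lam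
          at-slope (a , D , below , above) = at-rate (step-lower {a = 2 ℕ.+ a} {D = D} ω 0≤ω symω below)
            where
            δ = suc D
            at-rate : (∃[ ρ ] 0ℚ ℚ.≤ ρ × ρ ℚ.< 1ℚ × ∀ n U → (3 ℕ.+ a) ℕ.* n ℕ.≤ suc D ℕ.* U →
              ι (remain U) * s′ n ≤ s n + ι (ρ Rat.^ n ℚ.* ⟦ suc n ⟧ Rat.^ suc d) * s n) → Goal lam
            at-rate (ρ , 0≤ρ , ρ<1 , step) = N₁ ℕ.⊔ N₂ , λ n n≥ →
                at-floor n (ℕP.m⊔n≤o⇒m≤o N₁ N₂ n≥) (ℕP.m⊔n≤o⇒n≤o N₁ N₂ n≥) (floor ((3 ℕ.+ a) ℕ.* n) D)
              where
              small = Rat.^-poly-null (suc d) 0≤ρ ρ<1 (proj₁ (proj₂ (absorb-lower {0#} {0#} 1<μ)))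
              -- With U = q + 1 and the shift by 2 in Wallis' bound, δ(2 + U) exceeds δq by 3δ, the
              -- successor of this argument.
              large = absorb-constant (D ℕ.+ (δ ℕ.+ δ)) 1<μ
              N₁ = proj₁ small
              N₂ = proj₁ large
              at-floor : ∀ n → N₁ ℕ.≤ n → N₂ ℕ.≤ n → (∃[ q ] δ ℕ.* q ℕ.≤ (3 ℕ.+ a) ℕ.* n × (3 ℕ.+ a) ℕ.* n ℕ.≤ δ ℕ.* suc q) →
                S * (s′ n * s′ n) ≤ ι lam * (s n * s n * scale n)
              at-floor n n≥N₁ n≥N₂ (q , q≤ , ≤q) = lower-estimate (3 ℕ.+ a) D n (suc q) 1<μ μ⁴≤ above
                  (ℚP.≤-trans (Rat.⟦⟧-mono U≤) (proj₂ large ((3 ℕ.+ a) ℕ.* n) (ℕP.≤-trans n≥N₂ (ℕP.m≤m+n n _))))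
                  (proj₂ (proj₂ (absorb-lower 1<μ)) _ (proj₂ small n n≥N₁) (0≤s n) (step n (suc q) ≤q))
                where
                U≤ : δ ℕ.* (3 ℕ.+ q) ℕ.≤ δ ℕ.+ (δ ℕ.+ δ) ℕ.+ (3 ℕ.+ a) ℕ.* n
                U≤ = ℕP.≤-trans (ℕP.≤-reflexive (≡.trans (ℕP.*-distribˡ-+ δ 3 q) (cong (ℕ._+ δ ℕ.* q)
                    (≡.trans (ℕP.*-comm δ 3) (cong (λ t → δ ℕ.+ (δ ℕ.+ t)) (ℕP.+-identityʳ δ))))))
                  (ℕP.+-monoʳ-≤ (δ ℕ.+ (δ ℕ.+ δ)) q≤)

    forwardIn : ∀ {d} → (Step d → Carrier) → Fin d → Carrier
    forwardIn ω zero    = forward ω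
    forwardIn ω (suc k) = forwardIn (marginal ω) k

    scaling : ∀ {d} → (Step d → Carrier) → ℕ → Carrier
    scaling {zero}  ω n = 1#
    scaling {suc d} ω n = ι ⟦ n ⟧ * π * forward ω * scaling (marginal ω) n

    total² target : ∀ {d} → (Step d → Carrier) → ℕ → Carrier
    total² ω n = total ω n * total ω n * scaling ω n
    target {d} ω n = sum ω ^ n * sum ω ^ n * sum ω ^ d

    0≤scaling : ∀ {d} (ω : Step d → Carrier) → (∀ k → Approximable (forwardIn ω k)) → ∀ n → 0# ≤ scaling ω n
    0≤scaling {zero}  ω ab n = 0≤1#
    0≤scaling {suc d} ω ab n = 0≤* (0≤* (0≤* (0≤ι⟦⟧ n) 0≤π) (approximable-≥0 (ab zero))) (0≤scaling (marginal ω) (λ k → ab (suc k)) n)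

    -- In dimension 0 the total is S ^ n exactly. Each coordinate contributes nπb to the scaling and
    -- one factor S to the target; the tolerance is split between that coordinate and the marginal.
    asymptotics : ∀ {d} (ω : Step d → Carrier) → (∀ v → 0# ≤ ω v) → Symmetric ω →
      Approximable (sum ω) → (∀ k → Approximable (forwardIn ω k)) → total² ω ≾ target ω × target ω ≾ total² ω
    asymptotics {zero} ω 0≤ω symω aS ab =
      mk≾ (λ {μ} 1<μ → 0 , λ n _ → ≤-trans (≤-reflexive (total≈ n)) (enlarge 1<μ (0≤target n))) ,
      mk≾ (λ {μ} 1<μ → 0 , λ n _ → ≤-trans (enlarge 1<μ (0≤target n)) (*-monoˡ-≤ (1<⇒0≤ι 1<μ) (≈⇒≥ (total≈ n))))
      where
      total≈ : ∀ n → total² ω n ≈ target ω n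
      total≈ n = *-congʳ (*-cong e e)
        where
        e : total ω n ≈ sum ω ^ n
        e = trans (walkSum-cong ω n λ _ → ι-1) (walkSum-1 ω n)
      0≤target : ∀ n → 0# ≤ target ω n
      0≤target n = 0≤* (0≤* (0≤^ n (0≤ω [])) (0≤^ n (0≤ω []))) 0≤1#
      enlarge : ∀ {x μ} → 1ℚ ℚ.< μ → 0# ≤ x → x ≤ ι μ * x
      enlarge {x} 1<μ 0≤x = ≤-trans (≈⇒≥ (trans (*-congʳ ι-1) (*-identityˡ x))) (*-monoʳ-≤ 0≤x (ι-mono (ℚP.<⇒≤ 1<μ)))
    asymptotics {suc d} ω 0≤ω symω aS ab =
      mk≾ (λ {lam} 1<lam → upper lam (square-root 1<lam)) , mk≾ (λ {lam} 1<lam → lower lam (square-root 1<lam))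
      where
      ω′ = marginal ω
      S = sum ω
      s = total ω
      s′ = total ω′
      IH = asymptotics ω′ (0≤marginal 0≤ω) (proj₂ symω) aS (λ k → ab (suc k))
      0≤S = approximable-≥0 aS
      scale : ℕ → Carrier
      scale n = ι ⟦ n ⟧ * π * forward ω
      0≤N = 0≤scaling ω′ (λ k → ab (suc k))
      upper : ∀ lam → (∃[ μ ] 1ℚ ℚ.< μ × μ ℚ.* μ ℚ.≤ lam) → ∃[ N ] ∀ n → N ℕ.≤ n → total² ω n ≤ ι lam * target ω n
      upper lam (μ , 1<μ , μ²≤) = M ℕ.⊔ N , λ n n≥ → begin
          s n * s n * (scale n * scaling ω′ n)
            ≈⟨ *-assoc _ _ _ ⟨
          s n * s n * scale n * scaling ω′ n
            ∼⟨ *-monoʳ-≤ (0≤N n) (proj₂ step n (ℕP.m⊔n≤o⇒m≤o M N n≥)) ⟩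
          ι μ * (S * (s′ n * s′ n)) * scaling ω′ n
            ≈⟨ solve 4 (λ m S x k → m :* (S :* x) :* k := m :* S :* (x :* k)) refl (ι μ) S (s′ n * s′ n) (scaling ω′ n) ⟩
          ι μ * S * total² ω′ n
            ∼⟨ *-monoˡ-≤ (0≤* (1<⇒0≤ι 1<μ) 0≤S) (proj₂ rest n (ℕP.m⊔n≤o⇒n≤o M N n≥)) ⟩
          ι μ * S * (ι μ * (S ^ n * S ^ n * S ^ d))
            ≈⟨ trans (solve 4 (λ m S x k → m :* S :* (m :* (x :* k)) := m :* m :* (x :* (S :* k))) refl (ι μ) S (S ^ n * S ^ n) (S ^ d)) (*-congʳ (sym (ι-* μ μ))) ⟩
          ι (μ ℚ.* μ) * target ω n
            ∼⟨ *-monoʳ-≤ (0≤* (0≤* (0≤^ n 0≤S) (0≤^ n 0≤S)) (0≤^ (suc d) 0≤S)) (ι-mono μ²≤) ⟩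
          ι lam * target ω n ∎
        where
        step = eventually (coordinate-upper ω 0≤ω symω aS (ab zero)) 1<μ
        rest = eventually (proj₁ IH) 1<μ
        M = proj₁ step
        N = proj₁ rest
      lower : ∀ lam → (∃[ μ ] 1ℚ ℚ.< μ × μ ℚ.* μ ℚ.≤ lam) → ∃[ N ] ∀ n → N ℕ.≤ n → target ω n ≤ ι lam * total² ω n
      lower lam (μ , 1<μ , μ²≤) = M ℕ.⊔ N , λ n n≥ → begin
          S ^ n * S ^ n * (S * S ^ d)
            ≈⟨ solve 3 (λ x S k → x :* (S :* k) := S :* (x :* k)) refl (S ^ n * S ^ n) S (S ^ d) ⟩
          S * (S ^ n * S ^ n * S ^ d)
            ∼⟨ *-monoˡ-≤ 0≤S (proj₂ rest n (ℕP.m⊔n≤o⇒n≤o M N n≥)) ⟩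
          S * (ι μ * total² ω′ n)
            ≈⟨ solve 4 (λ m S x k → S :* (m :* (x :* k)) := m :* (S :* x) :* k) refl (ι μ) S (s′ n * s′ n) (scaling ω′ n) ⟩
          ι μ * (S * (s′ n * s′ n)) * scaling ω′ n
            ∼⟨ *-monoʳ-≤ (0≤N n) (*-monoˡ-≤ (1<⇒0≤ι 1<μ) (proj₂ step n (ℕP.m⊔n≤o⇒m≤o M N n≥))) ⟩
          ι μ * (ι μ * (s n * s n * scale n)) * scaling ω′ n
            ≈⟨ trans (solve 4 (λ m x a k → m :* (m :* (x :* a)) :* k := m :* m :* (x :* (a :* k))) refl (ι μ) (s n * s n) (scale n) (scaling ω′ n)) (*-congʳ (sym (ι-* μ μ))) ⟩
          ι (μ ℚ.* μ) * total² ω n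
            ∼⟨ *-monoʳ-≤ (0≤* (0≤* (0≤total 0≤ω n) (0≤total 0≤ω n)) (0≤scaling ω ab n)) (ι-mono μ²≤) ⟩
          ι lam * total² ω n ∎
        where
        step = eventually (coordinate-lower ω 0≤ω symω aS (ab zero)) 1<μ
        rest = eventually (proj₂ IH) 1<μ
        M = proj₁ step
        N = proj₁ rest

  open import Data.Empty using (⊥-elim)
  open import Data.Integer.Base as ℤ using (ℤ; +_; -[1+_]; +≤+)
  open import Data.List.Base as List using (List; []; _∷_; _++_)
  open import Data.List.Membership.Propositional using (_∈_; _∉_)
  open import Data.List.Relation.Unary.Any using (here; there; any?)
  import Data.List.Relation.Unary.All as LAll
  open import Data.List.Relation.Unary.AllPairs.Core using (_∷_; [])
  open import Data.List.Relation.Unary.Unique.Propositional using (Unique)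
  open import Data.Vec.Properties using (≡-dec)
  open import Data.Vec.Relation.Unary.All using ([]; _∷_)
  open import Relation.Nullary.Decidable using (Dec; yes; no)
  open import Relation.Nullary.Negation using (¬_)

  -- Step lists and enumerated walks as weight functions.

  indicator : ∀ {P : Set} → Dec P → ℚ
  indicator (yes _) = 1ℚ
  indicator (no _)  = 0ℚ

  -- y stands for the coordinate y - 1, so that 0 is the first forbidden position.
  position : ℕ → ℤ
  position zero    = -[1+ 0 ]
  position (suc y) = + y

  shift : ℕ → Coord → ℕ
  shift y back  = y
  shift y stay  = suc y
  shift y forth = 2 ℕ.+ y

  position-shift : ∀ y c → position (suc y) ℤ.+ toℤ c ≡ position (shift y c)
  position-shift zero    back  = ≡.refl
  position-shift (suc y) back  = ≡.refl
  position-shift y       stay  = cong +_ (ℕP.+-identityʳ y)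
  position-shift y       forth = cong +_ (ℕP.+-comm y 1)

  stays-shift : ∀ {n} y c (cs : Vec Coord n) → stays (suc y) (c ∷ cs) ≡ stays (shift y c) cs
  stays-shift y back  cs = ≡.refl
  stays-shift y stay  cs = ≡.refl
  stays-shift y forth cs = ≡.refl

  stays-0∨1 : ∀ {n} y (cs : Vec Coord n) → stays y cs ≡ 0ℚ ⊎ stays y cs ≡ 1ℚ
  stays-0∨1 zero    cs           = inj₁ ≡.refl
  stays-0∨1 (suc y) []           = inj₂ ≡.refl
  stays-0∨1 (suc y) (back  ∷ cs) = stays-0∨1 y cs
  stays-0∨1 (suc y) (stay  ∷ cs) = stays-0∨1 (suc y) cs
  stays-0∨1 (suc y) (forth ∷ cs) = stays-0∨1 (2 ℕ.+ y) cs

  module _ {d : ℕ} where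
    staysInOrthant-∷⁻ : ∀ {n} y (p : Vec ℤ d) (u : Vec (Step (suc d)) n) →
      StaysInOrthant (position y ∷ p) u → stays y (map head u) ≡ 1ℚ × StaysInOrthant p (map tail u)
    staysInOrthant-∷⁻ zero    p []            (() ∷ _)
    staysInOrthant-∷⁻ (suc y) p []            (_ ∷ o) = ≡.refl , o
    staysInOrthant-∷⁻ zero    p ((c ∷ v) ∷ u) ((() ∷ _) , _)
    staysInOrthant-∷⁻ (suc y) p ((c ∷ v) ∷ u) ((_ ∷ o) , s)
      with eq , s′ ← staysInOrthant-∷⁻ (shift y c) (move p v) u
        (subst (λ x → StaysInOrthant (x ∷ move p v) u) (position-shift y c) s) =
      ≡.trans (stays-shift y c (map head u)) eq , o , s′

    staysInOrthant-∷⁺ : ∀ {n} y (p : Vec ℤ d) (u : Vec (Step (suc d)) n) →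
      stays y (map head u) ≡ 1ℚ → StaysInOrthant p (map tail u) → StaysInOrthant (position y ∷ p) u
    staysInOrthant-∷⁺ (suc y) p []            eq o       = +≤+ z≤n ∷ o
    staysInOrthant-∷⁺ (suc y) p ((c ∷ v) ∷ u) eq (o , s) = (+≤+ z≤n ∷ o) ,
      subst (λ x → StaysInOrthant (x ∷ move p v) u) (≡.sym (position-shift y c))
        (staysInOrthant-∷⁺ (shift y c) (move p v) u (≡.trans (≡.sym (stays-shift y c (map head u))) eq) s)

  staysInOrthant-[] : ∀ {n} (u : Vec (Step 0) n) → StaysInOrthant [] u
  staysInOrthant-[] []       = []
  staysInOrthant-[] ([] ∷ u) = [] , staysInOrthant-[] u

  staysInOrthant-true : ∀ {d n} (u : Vec (Step d) n) → StaysInOrthant origin u → staysInOrthant u ≡ 1ℚ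
  staysInOrthant-true {zero}  u s = ≡.refl
  staysInOrthant-true {suc d} u s with eq , s′ ← staysInOrthant-∷⁻ 1 origin u s =
    cong₂ ℚ._*_ eq (staysInOrthant-true (map tail u) s′)

  staysInOrthant-false : ∀ {d n} (u : Vec (Step d) n) → ¬ StaysInOrthant origin u → staysInOrthant u ≡ 0ℚ
  staysInOrthant-false {zero}  u ¬s = ⊥-elim (¬s (staysInOrthant-[] u))
  staysInOrthant-false {suc d} u ¬s with stays-0∨1 1 (map head u)
  ... | inj₁ eq = ≡.trans (cong (ℚ._* staysInOrthant (map tail u)) eq) (ℚP.*-zeroˡ (staysInOrthant (map tail u)))
  ... | inj₂ eq = ≡.trans (cong (stays 1 (map head u) ℚ.*_) (staysInOrthant-false (map tail u) λ s → ¬s (staysInOrthant-∷⁺ 1 origin u eq s)))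
    (ℚP.*-zeroʳ (stays 1 (map head u)))

  indicator-staysInOrthant : ∀ {d n} (u : Vec (Step d) n) → indicator (staysInOrthant? origin u) ≡ staysInOrthant u
  indicator-staysInOrthant u with staysInOrthant? origin u
  ... | yes s = ≡.sym (staysInOrthant-true u s)
  ... | no ¬s = ≡.sym (staysInOrthant-false u ¬s)

  flip : ∀ {d} → Step d → Fin d → Step d
  flip v k = updateAt v k negate

  negate-involutive : ∀ c → negate (negate c) ≡ c
  negate-involutive back  = ≡.refl
  negate-involutive stay  = ≡.refl
  negate-involutive forth = ≡.refl

  flip-involutive : ∀ {d} (v : Step d) k → flip (flip v k) k ≡ v
  flip-involutive (c ∷ v) zero    = cong (_∷ v) (negate-involutive c)
  flip-involutive (c ∷ v) (suc k) = cong (c ∷_) (flip-involutive v k)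

  module StepLists (F : OrderedAlgebra) where
    open OrderedAlgebraProperties F
    open Walks F
    open WalkBounds F

    χ : ∀ {P : Set} → Dec P → Carrier
    χ P? = ι (indicator P?)

    lsum : ∀ {A : Set} → (A → Carrier) → List A → Carrier
    lsum f []       = 0#
    lsum f (x ∷ xs) = f x + lsum f xs

    lsum-cong : ∀ {A : Set} {f g : A → Carrier} → (∀ x → f x ≈ g x) → ∀ xs → lsum f xs ≈ lsum g xs
    lsum-cong h []       = refl
    lsum-cong h (x ∷ xs) = +-cong (h x) (lsum-cong h xs)

    lsum-*ˡ : ∀ {A : Set} c (f : A → Carrier) xs → lsum (λ x → c * f x) xs ≈ c * lsum f xs
    lsum-*ˡ c f []       = sym (zeroʳ c)
    lsum-*ˡ c f (x ∷ xs) = trans (+-congˡ (lsum-*ˡ c f xs)) (sym (distribˡ c (f x) (lsum f xs)))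

    lsum-map : ∀ {A B : Set} (f : B → Carrier) (g : A → B) xs → lsum f (List.map g xs) ≡ lsum (λ x → f (g x)) xs
    lsum-map f g []       = ≡.refl
    lsum-map f g (x ∷ xs) = cong (λ t → f (g x) + t) (lsum-map f g xs)

    lsum-++ : ∀ {A : Set} (f : A → Carrier) xs ys → lsum f (xs ++ ys) ≈ lsum f xs + lsum f ys
    lsum-++ f []       ys = sym (+-identityˡ _)
    lsum-++ f (x ∷ xs) ys = trans (+-congˡ (lsum-++ f xs ys)) (sym (+-assoc _ _ _))

    lsum-filter : ∀ {A : Set} {P : A → Set} (P? : ∀ x → Dec (P x)) (f : A → Carrier) xs →
      lsum f (List.filter P? xs) ≈ lsum (λ x → f x * χ (P? x)) xs
    lsum-filter P? f []       = refl
    lsum-filter P? f (x ∷ xs) with P? x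
    ... | yes _ = +-cong (sym (trans (*-congˡ ι-1) (*-identityʳ (f x)))) (lsum-filter P? f xs)
    ... | no _  = trans (lsum-filter P? f xs) (sym (trans (+-congʳ (trans (*-congˡ ι-0) (zeroʳ (f x)))) (+-identityˡ _)))

    lsum-cartesian : ∀ {d n} (f : Vec (Step d) (suc n) → Carrier) xs ys →
      lsum f (List.cartesianProductWith _∷_ xs ys) ≈ lsum (λ x → lsum (λ y → f (x ∷ y)) ys) xs
    lsum-cartesian f []       ys = refl
    lsum-cartesian f (x ∷ xs) ys = trans (lsum-++ f (List.map (x ∷_) ys) _)
      (+-cong (reflexive (lsum-map f (x ∷_) ys)) (lsum-cartesian f xs ys))

    δᶜ : Coord → Coord → Carrier
    δᶜ back  back  = 1#
    δᶜ stay  stay  = 1#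
    δᶜ forth forth = 1#
    δᶜ _     _     = 0#

    δ : ∀ {d} → Step d → Step d → Carrier
    δ []      []       = 1#
    δ (c ∷ i) (c′ ∷ v) = δᶜ c c′ * δ i v

    0≤δᶜ : ∀ c c′ → 0# ≤ δᶜ c c′
    0≤δᶜ back  back  = 0≤1#
    0≤δᶜ back  stay  = ≤-refl
    0≤δᶜ back  forth = ≤-refl
    0≤δᶜ stay  back  = ≤-refl
    0≤δᶜ stay  stay  = 0≤1#
    0≤δᶜ stay  forth = ≤-refl
    0≤δᶜ forth back  = ≤-refl
    0≤δᶜ forth stay  = ≤-refl
    0≤δᶜ forth forth = 0≤1#

    0≤δ : ∀ {d} (i v : Step d) → 0# ≤ δ i v
    0≤δ []      []       = 0≤1#
    0≤δ (c ∷ i) (c′ ∷ v) = 0≤* (0≤δᶜ c c′) (0≤δ i v)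

    δᶜ-refl : ∀ c → δᶜ c c ≡ 1#
    δᶜ-refl back  = ≡.refl
    δᶜ-refl stay  = ≡.refl
    δᶜ-refl forth = ≡.refl

    δ-refl : ∀ {d} (i : Step d) → δ i i ≈ 1#
    δ-refl []      = refl
    δ-refl (c ∷ i) = trans (*-cong (reflexive (δᶜ-refl c)) (δ-refl i)) (*-identityˡ 1#)

    δᶜ-≢ : ∀ c c′ → c ≡ c′ ⊎ δᶜ c c′ ≡ 0#
    δᶜ-≢ back  back  = inj₁ ≡.refl
    δᶜ-≢ back  stay  = inj₂ ≡.refl
    δᶜ-≢ back  forth = inj₂ ≡.refl
    δᶜ-≢ stay  back  = inj₂ ≡.refl
    δᶜ-≢ stay  stay  = inj₁ ≡.refl
    δᶜ-≢ stay  forth = inj₂ ≡.refl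
    δᶜ-≢ forth back  = inj₂ ≡.refl
    δᶜ-≢ forth stay  = inj₂ ≡.refl
    δᶜ-≢ forth forth = inj₁ ≡.refl

    δ-≢ : ∀ {d} (i v : Step d) → ¬ i ≡ v → δ i v ≈ 0#
    δ-≢ []      []       i≢v = ⊥-elim (i≢v ≡.refl)
    δ-≢ (c ∷ i) (c′ ∷ v) i≢v with δᶜ-≢ c c′
    ... | inj₁ ≡.refl = trans (*-congˡ (δ-≢ i v λ { ≡.refl → i≢v ≡.refl })) (zeroʳ _)
    ... | inj₂ eq     = trans (*-congʳ (reflexive eq)) (zeroˡ _)

    sum-δ : ∀ {d} (i : Step d) (f : Step d → Carrier) → sum (λ v → δ i v * f v) ≈ f i
    sum-δ []      f = *-identityˡ (f [])
    sum-δ (c ∷ i) f = trans (sum-cong λ v → select c v) (sum-δ i (λ v → f (c ∷ v)))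
      where
      select : ∀ c v → δᶜ c back * δ i v * f (back ∷ v) + (δᶜ c stay * δ i v * f (stay ∷ v) + δᶜ c forth * δ i v * f (forth ∷ v)) ≈ δ i v * f (c ∷ v)
      select back  v = solve 4 (λ d x y z → con 1 :* d :* x :+ (con 0 :* d :* y :+ con 0 :* d :* z) := d :* x) refl (δ i v) (f (back ∷ v)) (f (stay ∷ v)) (f (forth ∷ v))
      select stay  v = solve 4 (λ d x y z → con 0 :* d :* x :+ (con 1 :* d :* y :+ con 0 :* d :* z) := d :* y) refl (δ i v) (f (back ∷ v)) (f (stay ∷ v)) (f (forth ∷ v))
      select forth v = solve 4 (λ d x y z → con 0 :* d :* x :+ (con 0 :* d :* y :+ con 1 :* d :* z) := d :* z) refl (δ i v) (f (back ∷ v)) (f (stay ∷ v)) (f (forth ∷ v))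

    module _ {d : ℕ} (wt : Step d → Carrier) where
      -- Extends the weights of the listed steps by 0 to all vectors, the range of `sum`.
      spread : List (Step d) → Step d → Carrier
      spread steps v = lsum (λ i → wt i * δ i v) steps

      sum-spread : ∀ steps (f : Step d → Carrier) → sum (λ v → spread steps v * f v) ≈ lsum (λ i → wt i * f i) steps
      sum-spread []          f = trans (sum-*ˡ 0# f) (zeroˡ _)
      sum-spread (i ∷ steps) f = trans (sum-cong λ v → solve 4 (λ w x y z → (w :* x :+ y) :* z := w :* (x :* z) :+ y :* z) refl (wt i) (δ i v) (spread steps v) (f v))
        (trans (sum-+ (λ v → wt i * (δ i v * f v)) (λ v → spread steps v * f v))
          (+-cong (trans (sum-*ˡ (wt i) (λ v → δ i v * f v)) (*-congˡ (sum-δ i f))) (sum-spread steps f)))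

      0≤spread : (∀ i → 0# ≤ wt i) → ∀ steps v → 0# ≤ spread steps v
      0≤spread h []          v = ≤-refl
      0≤spread h (i ∷ steps) v = 0≤+ (0≤* (h i) (0≤δ i v)) (0≤spread h steps v)

      spread-∉ : ∀ steps v → v ∉ steps → spread steps v ≈ 0#
      spread-∉ []          v v∉ = refl
      spread-∉ (i ∷ steps) v v∉ = trans (+-cong (trans (*-congˡ (δ-≢ i v λ { ≡.refl → v∉ (here ≡.refl) })) (zeroʳ (wt i))) (spread-∉ steps v λ v∈ → v∉ (there v∈)))
        (+-identityˡ 0#)

      spread-∈ : ∀ {steps v} → Unique steps → v ∈ steps → spread steps v ≈ wt v
      spread-∈ {v ∷ steps} (v≢ ∷ _) (here ≡.refl) = trans (+-cong (trans (*-congˡ (δ-refl v)) (*-identityʳ (wt v)))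
          (spread-∉ steps v λ v∈ → LAll.lookup v≢ v∈ ≡.refl)) (+-identityʳ (wt v))
      spread-∈ {i ∷ steps} {v} (i≢ ∷ unique) (there v∈) = trans (+-cong (trans (*-congˡ (δ-≢ i v (LAll.lookup i≢ v∈))) (zeroʳ (wt i))) (spread-∈ unique v∈))
        (+-identityˡ (wt v))

      -- A vector outside the list is not flipped into it, as flipping back would put it there.
      -- Uniqueness ensures that a listed step is counted once.
      spread-flip : ∀ {steps} → Unique steps → ∀ k → (∀ i → i ∈ steps → flip i k ∈ steps × wt (flip i k) ≈ wt i) →
        ∀ v → spread steps (flip v k) ≈ spread steps v
      spread-flip {steps} unique k h v with any? (≡-dec _≟_ v) steps
      ... | yes v∈ = trans (spread-∈ unique (proj₁ (h v v∈))) (trans (proj₂ (h v v∈)) (sym (spread-∈ unique v∈)))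
      ... | no v∉  = trans (spread-∉ steps (flip v k) λ v′∈ → v∉ (subst (_∈ steps) (flip-involutive v k) (proj₁ (h (flip v k) v′∈))))
        (sym (spread-∉ steps v v∉))

      walkWeight : ∀ {n} → Vec (Step d) n → Carrier
      walkWeight []      = 1#
      walkWeight (i ∷ u) = wt i * walkWeight u

      walkSum-spread : ∀ steps n (Φ : Vec (Step d) n → Carrier) →
        walkSum (spread steps) n Φ ≈ lsum (λ u → walkWeight u * Φ u) (walks steps n)
      walkSum-spread steps zero    Φ = sym (trans (+-identityʳ _) (*-identityˡ _))
      walkSum-spread steps (suc n) Φ = trans
        (sum-spread steps (λ v → walkSum (spread steps) n (λ u → Φ (v ∷ u))))
        (trans (lsum-cong (λ i → trans (*-congˡ (walkSum-spread steps n (λ u → Φ (i ∷ u))))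
            (trans (sym (lsum-*ˡ (wt i) _ (walks steps n))) (lsum-cong (λ u → sym (*-assoc _ _ _)) (walks steps n)))) steps)
          (sym (lsum-cartesian (λ u → walkWeight u * Φ u) steps (walks steps n))))

      total-spread : ∀ steps n → total (spread steps) n ≈ lsum walkWeight (List.filter (staysInOrthant? origin) (walks steps n))
      total-spread steps n = trans (walkSum-spread steps n (λ u → ι (staysInOrthant u)))
        (trans (lsum-cong (λ u → *-congˡ (ι-cong (≡.sym (indicator-staysInOrthant u)))) (walks steps n))
          (sym (lsum-filter (staysInOrthant? origin) walkWeight (walks steps n))))

    coordinateSum : ∀ {d} → (Step d → Carrier) → Fin d → Coord → Carrier
    coordinateSum ω k c = sum (λ v → ω v * χ (lookup v k ≟ c))

    coordinateSum-suc : ∀ {d} (ω : Step (suc d) → Carrier) k c → coordinateSum ω (suc k) c ≈ coordinateSum (marginal ω) k c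
    coordinateSum-suc ω k c = sum-cong λ v →
      solve 4 (λ x y z e → x :* e :+ (y :* e :+ z :* e) := (x :+ (y :+ z)) :* e) refl (ω (back ∷ v)) (ω (stay ∷ v)) (ω (forth ∷ v)) (χ (lookup v k ≟ c))

    -- Flips of later coordinates pass to the marginal, so the first m coordinates are peeled off
    -- one by one. What remains is a single coordinate, whose two nonzero weights are the sums that
    -- the last hypothesis equates.
    symmetric-⁺ : ∀ m (ω : Step (suc m) → Carrier) → (∀ (k : Fin m) v → ω (flip v (inject₁ k)) ≈ ω v) →
      coordinateSum ω (fromℕ m) back ≈ coordinateSum ω (fromℕ m) forth → Symmetric ω
    symmetric-⁺ zero    ω flips last = (λ { [] → trans (sym (trans (+-cong (*-congˡ ι-1) (+-cong (*-congˡ ι-0) (*-congˡ ι-0)))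
          (solve 3 (λ x y z → x :* con 1 :+ (y :* con 0 :+ z :* con 0) := x) refl (ω (back ∷ [])) (ω (stay ∷ [])) (ω (forth ∷ [])))))
        (trans last (trans (+-cong (*-congˡ ι-0) (+-cong (*-congˡ ι-0) (*-congˡ ι-1)))
          (solve 3 (λ x y z → x :* con 0 :+ (y :* con 0 :+ z :* con 1) := z) refl (ω (back ∷ [])) (ω (stay ∷ [])) (ω (forth ∷ []))))) }) , tt
    symmetric-⁺ (suc m) ω flips last = (λ v → flips zero (forth ∷ v)) ,
      symmetric-⁺ m (marginal ω) (λ k v → +-cong (flips (suc k) (back ∷ v)) (+-cong (flips (suc k) (stay ∷ v)) (flips (suc k) (forth ∷ v))))
        (trans (sym (coordinateSum-suc ω (fromℕ m) back)) (trans last (coordinateSum-suc ω (fromℕ m) forth)))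

    forward-coordinateSum : ∀ {d} (ω : Step (suc d) → Carrier) → coordinateSum ω zero forth ≈ forward ω
    forward-coordinateSum ω = sum-cong λ v → trans (+-cong (*-congˡ ι-0) (+-cong (*-congˡ ι-0) (*-congˡ ι-1)))
      (solve 3 (λ x y z → x :* con 0 :+ (y :* con 0 :+ z :* con 1) := z) refl (ω (back ∷ v)) (ω (stay ∷ v)) (ω (forth ∷ v)))

  -- From the squared estimate to the ratio with the claimed rate.

  module Conclusion (F : OrderedAlgebra) (Π : WallisConstant F) where
    open OrderedAlgebraProperties F
    open Walks F
    open WallisConstant Π
    open Theorem F Π
    open StepLists F using (coordinateSum; coordinateSum-suc; forward-coordinateSum)

    product : ∀ {d} → (Fin d → Carrier) → Carrier
    product {zero}  f = 1#
    product {suc d} f = f zero * product (λ k → f (suc k))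

    scaling-product : ∀ {d} (ω : Step d → Carrier) n → scaling ω n ≈ ι ⟦ n ⟧ ^ d * (π ^ d * product (forwardIn ω))
    scaling-product {zero}  ω n = sym (trans (*-identityˡ _) (*-identityˡ _))
    scaling-product {suc d} ω n = trans (*-congˡ (scaling-product (marginal ω) n))
      (solve 6 (λ n p b x y z → n :* p :* b :* (x :* (y :* z)) := n :* x :* (p :* y :* (b :* z))) refl
        (ι ⟦ n ⟧) π (forward ω) (ι ⟦ n ⟧ ^ d) (π ^ d) (product (forwardIn (marginal ω))))

    forwardIn-coordinateSum : ∀ {d} (ω : Step d → Carrier) k → coordinateSum ω k forth ≈ forwardIn ω k
    forwardIn-coordinateSum ω zero    = forward-coordinateSum ω
    forwardIn-coordinateSum ω (suc k) = trans (coordinateSum-suc ω k forth) (forwardIn-coordinateSum (marginal ω) k)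

    -- g = x u⁻¹ (v w⁻¹) is the claimed rate, N the scaling and T the target. As g² N = T, the
    -- square of the reciprocal rate is N / T, in which no root is left.
    inverse-square : ∀ {N T T⁻ x u u⁻ v w w⁻ g⁻} → N ≈ u * u * (w * w) → T ≈ x * x * (v * v) → T * T⁻ ≈ 1# →
      u * u⁻ ≈ 1# → w * w⁻ ≈ 1# → x * u⁻ * (v * w⁻) * g⁻ ≈ 1# → g⁻ * g⁻ ≈ N * T⁻
    inverse-square {N} {T} {T⁻} {x} {u} {u⁻} {v} {w} {w⁻} {g⁻} N≈ T≈ TT⁻ uu⁻ ww⁻ gg⁻ =
      trans (sym (*-identityʳ _)) (trans (*-congˡ (trans (sym TT⁻) (*-congʳ (sym g²N≈T))))
        (trans (solve 4 (λ h g n t → h :* h :* (g :* g :* n :* t) := g :* h :* (g :* h) :* (n :* t)) refl g⁻ g N T⁻)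
          (trans (*-congʳ (*-cong gg⁻ gg⁻)) (solve 1 (λ t → con 1 :* con 1 :* t := t) refl (N * T⁻)))))
      where
      g : Carrier
      g = x * u⁻ * (v * w⁻)
      g²N≈T : g * g * N ≈ T
      g²N≈T = trans (*-congˡ N≈) (trans
        (solve 6 (λ x u u′ v w w′ → x :* u′ :* (v :* w′) :* (x :* u′ :* (v :* w′)) :* (u :* u :* (w :* w))
          := x :* x :* (v :* v) :* (u :* u′ :* (u :* u′)) :* (w :* w′ :* (w :* w′))) refl x u u⁻ v w w⁻)
        (trans (*-cong (*-cong (sym T≈) (*-cong uu⁻ uu⁻)) (*-cong ww⁻ ww⁻)) (solve 1 (λ t → t :* (con 1 :* con 1) :* (con 1 :* con 1) := t) refl T)))

    ratio² : ∀ {s N T⁻ g⁻} → g⁻ * g⁻ ≈ N * T⁻ → s * g⁻ * (s * g⁻) ≈ s * s * N * T⁻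
    ratio² {s} {N} {T⁻} {g⁻} h = trans (solve 2 (λ s g → s :* g :* (s :* g) := s :* s :* (g :* g)) refl s g⁻)
      (trans (*-congˡ h) (sym (*-assoc _ _ _)))

    ratio-upper : ∀ {μ s N T T⁻ g⁻} → g⁻ * g⁻ ≈ N * T⁻ → T * T⁻ ≈ 1# → 0# ≤ T⁻ →
      s * s * N ≤ ι μ * T → s * g⁻ * (s * g⁻) ≤ ι μ
    ratio-upper h TT⁻ 0≤T⁻ k = ≤-trans (≤-reflexive (ratio² h)) (≤-trans (*-monoʳ-≤ 0≤T⁻ k)
      (≤-reflexive (trans (*-assoc _ _ _) (trans (*-congˡ TT⁻) (*-identityʳ _)))))

    ratio-lower : ∀ {μ s N T T⁻ g⁻} → g⁻ * g⁻ ≈ N * T⁻ → T * T⁻ ≈ 1# → 0# ≤ T⁻ →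
      T ≤ ι μ * (s * s * N) → 1# ≤ ι μ * (s * g⁻ * (s * g⁻))
    ratio-lower h TT⁻ 0≤T⁻ k = ≤-trans (≈⇒≥ TT⁻) (≤-trans (*-monoʳ-≤ 0≤T⁻ k)
      (≤-reflexive (trans (*-assoc _ _ _) (*-congˡ (sym (ratio² h))))))

-- Cauchy reals as an ordered algebra.

module Real where
  open import Relation.Binary.Structures using (IsEquivalence)
  open import Data.Rational.Base using (∣_∣)
  open Defs using (ℝ; seq; _≃_; fromℚ; val)
  open Rat using (⟦_⟧; 2ℚ; Null; ≤⟦suc⟧; null-+; null-cong; remain; _≲_; mk≲; eventually; ≤⇒≲; ≲-trans; null-≲; wallis-upper; wallis-lower)
  open Walk using (OrderedAlgebra; WallisConstant)
  open ℚ-Solver using (solve; _:=_; _:+_; _:*_; _:-_; :-_; con)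

  module _ {x y : ℝ} where
    ≃⇒null : x ≃ y → Null (λ n → seq x n ℚ.- seq y n)
    ≃⇒null h ε 0<ε = proj₁ (h ε 0<ε) , λ n n≥ → ℚP.<⇒≤ (proj₂ (h ε 0<ε) n n≥)

    null⇒≃ : Null (λ n → seq x n ℚ.- seq y n) → x ≃ y
    null⇒≃ h ε 0<ε with N , hN ← h (½ ℚ.* ε) (Defs.RationalLemmas.half-pos 0<ε) =
      N , λ n n≥ → ℚP.≤-<-trans (hN n n≥) (Rat.<-slack {½ ℚ.* ε} {ε} (½ ℚ.* ε) (Defs.RationalLemmas.half-pos 0<ε) (≡.sym (Defs.RationalLemmas.half+half ε)))

    pointwise : (∀ n → seq x n ≡ seq y n) → x ≃ y
    pointwise h ε 0<ε = 0 , λ n _ → ≡.subst (ℚ._< ε) (≡.sym (cong ∣_∣ (≡.trans (cong (ℚ._- seq y n) (h n)) (ℚP.+-inverseʳ (seq y n))))) 0<ε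

  ≃-refl : ∀ {x} → x ≃ x
  ≃-refl {x} = pointwise {x} {x} λ _ → ≡.refl

  ≃-sym : ∀ {x y} → x ≃ y → y ≃ x
  ≃-sym {x} {y} h ε 0<ε = proj₁ (h ε 0<ε) , λ n n≥ →
    ≡.subst (ℚ._< ε) (Defs.RationalLemmas.∣-∣-comm (seq x n) (seq y n)) (proj₂ (h ε 0<ε) n n≥)

  ≃-trans : ∀ {x y z} → x ≃ y → y ≃ z → x ≃ z
  ≃-trans {x} {y} {z} h k = null⇒≃ {x} {z} (null-cong
    (λ n → solve 3 (λ x y z → (x :- y) :+ (y :- z) := x :- z) ≡.refl (seq x n) (seq y n) (seq z n))
    (null-+ (≃⇒null {x} {y} h) (≃⇒null {y} {z} k)))

  null-*-bounded : ∀ (x : ℝ) {u} → Null u → Null (λ n → seq x n ℚ.* u n)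
  null-*-bounded x {u} h ε 0<ε = M ℕ.⊔ N , λ n n≥ → begin
      ∣ seq x n ℚ.* u n ∣ ≡⟨ ℚP.∣p*q∣≡∣p∣*∣q∣ (seq x n) (u n) ⟩
      ∣ seq x n ∣ ℚ.* ∣ u n ∣ ≤⟨ Rat.*-mono-≤ (ℚP.0≤∣p∣ (seq x n)) (ℚP.≤-trans (bound n (ℕP.m⊔n≤o⇒m≤o M N n≥)) (proj₂ C)) (ℚP.0≤∣p∣ (u n)) (proj₂ small n (ℕP.m⊔n≤o⇒n≤o M N n≥)) ⟩
      ⟦ suc (proj₁ C) ⟧ ℚ.* (ε ℚ.* Rat.inv (proj₁ C)) ≡⟨ Rat.inv-cancel (proj₁ C) ε ⟩
      ε ∎
    where
    open ℚP.≤-Reasoning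
    bd = Defs.BoundLemmas.bounded x
    C = ≤⟦suc⟧ (proj₁ bd)
    M = proj₁ (proj₂ (proj₂ bd))
    bound = proj₂ (proj₂ (proj₂ bd))
    small = h (ε ℚ.* Rat.inv (proj₁ C)) (Rat.*-pos 0<ε (Rat.0<inv (proj₁ C)))
    N = proj₁ small

  +-cong : ∀ {x y u v} → x ≃ y → u ≃ v → x Defs.+ u ≃ y Defs.+ v
  +-cong {x} {y} {u} {v} h k = null⇒≃ {x Defs.+ u} {y Defs.+ v} (null-cong
    (λ n → solve 4 (λ x y u v → (x :- y) :+ (u :- v) := x :+ u :- (y :+ v)) ≡.refl (seq x n) (seq y n) (seq u n) (seq v n))
    (null-+ (≃⇒null {x} {y} h) (≃⇒null {u} {v} k)))

  *-cong : ∀ {x y u v} → x ≃ y → u ≃ v → x Defs.* u ≃ y Defs.* v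
  *-cong {x} {y} {u} {v} h k = null⇒≃ {x Defs.* u} {y Defs.* v} (null-cong
    (λ n → solve 4 (λ x y u v → x :* (u :- v) :+ v :* (x :- y) := x :* u :- y :* v) ≡.refl (seq x n) (seq y n) (seq u n) (seq v n))
    (null-+ (null-*-bounded x (≃⇒null {u} {v} k)) (null-*-bounded v (≃⇒null {x} {y} h))))

  infix 4 _≈_ _≤_

  -- Records rather than synonyms, so that the arguments can be inferred.
  record _≈_ (x y : ℝ) : Set where
    constructor mk≈
    field equal : x ≃ y

  record _≤_ (x y : ℝ) : Set where
    constructor mk≤
    field below : seq x ≲ seq y

  open _≈_ public
  open _≤_ public

  ≈-pointwise : ∀ {x y} → (∀ n → seq x n ≡ seq y n) → x ≈ y
  ≈-pointwise {x} {y} h = mk≈ (pointwise {x} {y} h)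

  infixl 6 _⊕_
  infixl 7 _⊗_

  -- Unfolding the operations of Defs exposes their Cauchy proofs to the
  -- conversion checker, hence these sealed copies.
  abstract
    _⊕_ _⊗_ : ℝ → ℝ → ℝ
    x ⊕ y = x Defs.+ y
    x ⊗ y = x Defs.* y

    ⊗-def : ∀ x y → x ⊗ y ≡ x Defs.* y
    ⊗-def x y = ≡.refl

    seq-⊕ : ∀ x y n → seq (x ⊕ y) n ≡ seq x n ℚ.+ seq y n
    seq-⊕ x y n = ≡.refl

    seq-⊗ : ∀ x y n → seq (x ⊗ y) n ≡ seq x n ℚ.* seq y n
    seq-⊗ x y n = ≡.refl

    ⊕-cong : ∀ {x y u v} → x ≈ y → u ≈ v → x ⊕ u ≈ y ⊕ v
    ⊕-cong {x} {y} {u} {v} h k = mk≈ (+-cong {x} {y} {u} {v} (equal h) (equal k))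

    ⊗-cong : ∀ {x y u v} → x ≈ y → u ≈ v → x ⊗ u ≈ y ⊗ v
    ⊗-cong {x} {y} {u} {v} h k = mk≈ (*-cong {x} {y} {u} {v} (equal h) (equal k))

    ⊕-assoc : ∀ x y z → (x ⊕ y) ⊕ z ≈ x ⊕ (y ⊕ z)
    ⊕-assoc x y z = ≈-pointwise λ n → ℚP.+-assoc (seq x n) (seq y n) (seq z n)

    ⊕-comm : ∀ x y → x ⊕ y ≈ y ⊕ x
    ⊕-comm x y = ≈-pointwise λ n → ℚP.+-comm (seq x n) (seq y n)

    ⊕-identityˡ : ∀ x → Defs.0ℝ ⊕ x ≈ x
    ⊕-identityˡ x = ≈-pointwise λ n → ℚP.+-identityˡ (seq x n)

    ⊕-identityʳ : ∀ x → x ⊕ Defs.0ℝ ≈ x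
    ⊕-identityʳ x = ≈-pointwise λ n → ℚP.+-identityʳ (seq x n)

    ⊗-assoc : ∀ x y z → (x ⊗ y) ⊗ z ≈ x ⊗ (y ⊗ z)
    ⊗-assoc x y z = ≈-pointwise λ n → ℚP.*-assoc (seq x n) (seq y n) (seq z n)

    ⊗-comm : ∀ x y → x ⊗ y ≈ y ⊗ x
    ⊗-comm x y = ≈-pointwise λ n → ℚP.*-comm (seq x n) (seq y n)

    ⊗-identityˡ : ∀ x → Defs.1ℝ ⊗ x ≈ x
    ⊗-identityˡ x = ≈-pointwise λ n → ℚP.*-identityˡ (seq x n)

    ⊗-identityʳ : ∀ x → x ⊗ Defs.1ℝ ≈ x
    ⊗-identityʳ x = ≈-pointwise λ n → ℚP.*-identityʳ (seq x n)

    ⊗-distribˡ : ∀ x y z → x ⊗ (y ⊕ z) ≈ x ⊗ y ⊕ x ⊗ z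
    ⊗-distribˡ x y z = ≈-pointwise λ n → ℚP.*-distribˡ-+ (seq x n) (seq y n) (seq z n)

    ⊗-distribʳ : ∀ x y z → (y ⊕ z) ⊗ x ≈ y ⊗ x ⊕ z ⊗ x
    ⊗-distribʳ x y z = ≈-pointwise λ n → ℚP.*-distribʳ-+ (seq x n) (seq y n) (seq z n)

    ⊗-zeroˡ : ∀ x → Defs.0ℝ ⊗ x ≈ Defs.0ℝ
    ⊗-zeroˡ x = ≈-pointwise λ n → ℚP.*-zeroˡ (seq x n)

    ⊗-zeroʳ : ∀ x → x ⊗ Defs.0ℝ ≈ Defs.0ℝ
    ⊗-zeroʳ x = ≈-pointwise λ n → ℚP.*-zeroʳ (seq x n)

    fromℚ-⊕ : ∀ p q → fromℚ (p ℚ.+ q) ≈ fromℚ p ⊕ fromℚ q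
    fromℚ-⊕ p q = ≈-pointwise λ _ → ≡.refl

    fromℚ-⊗ : ∀ p q → fromℚ (p ℚ.* q) ≈ fromℚ p ⊗ fromℚ q
    fromℚ-⊗ p q = ≈-pointwise λ _ → ≡.refl

  ℝ-semiring : CommutativeSemiring 0ℓ 0ℓ
  ℝ-semiring = record
    { Carrier = ℝ ; _≈_ = _≈_ ; _+_ = _⊕_ ; _*_ = _⊗_ ; 0# = Defs.0ℝ ; 1# = Defs.1ℝ
    ; isCommutativeSemiring = record
      { isSemiring = record
        { isSemiringWithoutAnnihilatingZero = record
          { +-isCommutativeMonoid = record
            { isMonoid = record
              { isSemigroup = record
                { isMagma = record { isEquivalence = isEquivalence ; ∙-cong = ⊕-cong } ; assoc = ⊕-assoc }
              ; identity = ⊕-identityˡ , ⊕-identityʳ }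
            ; comm = ⊕-comm }
          ; *-cong = ⊗-cong
          ; *-assoc = ⊗-assoc
          ; *-identity = ⊗-identityˡ , ⊗-identityʳ
          ; distrib = ⊗-distribˡ , ⊗-distribʳ }
        ; zero = ⊗-zeroˡ , ⊗-zeroʳ }
      ; *-comm = ⊗-comm } }
    where
    isEquivalence : IsEquivalence _≈_
    isEquivalence = record
      { refl = λ {x} → mk≈ (≃-refl {x}) ; sym = λ {x} {y} h → mk≈ (≃-sym {x} {y} (equal h))
      ; trans = λ {x} {y} {z} h k → mk≈ (≃-trans {x} {y} {z} (equal h) (equal k)) }

  ≲-+ : ∀ {u v w z} → u ≲ v → w ≲ z → (λ n → u n ℚ.+ w n) ≲ (λ n → v n ℚ.+ z n)
  ≲-+ {u} {v} {w} {z} h k = mk≲ λ ε 0<ε →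
    let M , hM = eventually h (½ ℚ.* ε) (Defs.RationalLemmas.half-pos 0<ε)
        N , hN = eventually k (½ ℚ.* ε) (Defs.RationalLemmas.half-pos 0<ε)
    in M ℕ.⊔ N , λ n n≥ → ℚP.≤-trans (ℚP.+-mono-≤ (hM n (ℕP.m⊔n≤o⇒m≤o M N n≥)) (hN n (ℕP.m⊔n≤o⇒n≤o M N n≥)))
      (ℚP.≤-reflexive (solve 3 (λ v z e → v :+ con ½ :* e :+ (z :+ con ½ :* e) := v :+ z :+ e) ≡.refl (v n) (z n) ε))

  ≲-cancelʳ : ∀ {u v} (w : ℕ → ℚ) → (λ n → u n ℚ.+ w n) ≲ (λ n → v n ℚ.+ w n) → u ≲ v
  ≲-cancelʳ {u} {v} w h = mk≲ λ ε 0<ε → proj₁ (eventually h ε 0<ε) , λ n n≥ → Rat.diff-≤ {u n} {v n ℚ.+ ε}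
    (≡.subst (0ℚ ℚ.≤_) (solve 4 (λ u v w e → v :+ w :+ e :- (u :+ w) := v :+ e :- u) ≡.refl (u n) (v n) (w n) ε)
      (Rat.0≤-diff (proj₂ (eventually h ε 0<ε) n n≥)))

  -- Terms of `z` are only eventually above -δ, so termwise monotonicity may fail. In zx = zy + (z +
  -- δ)(x - y) + δ(y - x) the first correction has a nonnegative factor, and boundedness of z and of
  -- x - y keeps both corrections small.
  ≲-*-monoˡ : ∀ (x y z : ℝ) → (λ _ → 0ℚ) ≲ seq z → seq x ≲ seq y → (λ n → seq z n ℚ.* seq x n) ≲ (λ n → seq z n ℚ.* seq y n)
  ≲-*-monoˡ x y z 0≤z x≤y = mk≲ go
    where
    open ℚP.≤-Reasoning
    bz = Defs.BoundLemmas.bounded z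
    bt = Defs.BoundLemmas.bounded (x Defs.- y)
    B = proj₁ bz
    C = proj₁ (≤⟦suc⟧ (proj₁ bt))
    go : ∀ ε → 0ℚ ℚ.< ε → ∃[ N ] ∀ n → N ℕ.≤ n → seq z n ℚ.* seq x n ℚ.≤ seq z n ℚ.* seq y n ℚ.+ ε
    go ε 0<ε = M ℕ.⊔ N , λ n n≥ → estimate n
        (proj₂ (proj₂ (proj₂ bz)) n (ℕP.m⊔n≤o⇒m≤o M₁ M₂ (ℕP.m⊔n≤o⇒m≤o M N n≥)))
        (proj₂ (proj₂ (proj₂ bt)) n (ℕP.m⊔n≤o⇒n≤o M₁ M₂ (ℕP.m⊔n≤o⇒m≤o M N n≥)))
        (proj₂ ev₁ n (ℕP.m⊔n≤o⇒m≤o N₁ N₂ (ℕP.m⊔n≤o⇒n≤o M N n≥)))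
        (proj₂ ev₂ n (ℕP.m⊔n≤o⇒n≤o N₁ N₂ (ℕP.m⊔n≤o⇒n≤o M N n≥)))
      where
      half = ½ ℚ.* ε
      0<half = Defs.RationalLemmas.half-pos 0<ε
      -- Chosen against the bound on x - y; `η` follows, against the bound on z + δ.
      δ = half ℚ.* Rat.inv C
      0<δ = Rat.*-pos 0<half (Rat.0<inv C)
      D = proj₁ (≤⟦suc⟧ (B ℚ.+ δ))
      η = half ℚ.* Rat.inv D
      0<η = Rat.*-pos 0<half (Rat.0<inv D)
      ev₁ = eventually 0≤z δ 0<δ
      ev₂ = eventually x≤y η 0<η
      M₁ = proj₁ (proj₂ (proj₂ bz))
      M₂ = proj₁ (proj₂ (proj₂ bt))
      M = M₁ ℕ.⊔ M₂
      N₁ = proj₁ ev₁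
      N₂ = proj₁ ev₂
      N = N₁ ℕ.⊔ N₂
      estimate : ∀ n → ∣ seq z n ∣ ℚ.≤ B → ∣ seq x n ℚ.- seq y n ∣ ℚ.≤ proj₁ bt → 0ℚ ℚ.≤ seq z n ℚ.+ δ → seq x n ℚ.≤ seq y n ℚ.+ η →
        seq z n ℚ.* seq x n ℚ.≤ seq z n ℚ.* seq y n ℚ.+ ε
      estimate n z≤B t≤C 0≤z+δ x≤y+η = begin
          c ℚ.* a
            ≡⟨ solve 4 (λ c a b d → c :* a := c :* b :+ (c :+ d) :* (a :- b) :+ d :* (b :- a)) ≡.refl c a b δ ⟩
          c ℚ.* b ℚ.+ (c ℚ.+ δ) ℚ.* (a ℚ.- b) ℚ.+ δ ℚ.* (b ℚ.- a)
            ≤⟨ ℚP.+-mono-≤ (ℚP.+-monoʳ-≤ (c ℚ.* b) first) second ⟩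
          c ℚ.* b ℚ.+ half ℚ.+ half
            ≡⟨ solve 2 (λ c e → c :+ con ½ :* e :+ con ½ :* e := c :+ e) ≡.refl (c ℚ.* b) ε ⟩
          c ℚ.* b ℚ.+ ε ∎
        where
        a = seq x n
        b = seq y n
        c = seq z n
        a-b≤η : a ℚ.- b ℚ.≤ η
        a-b≤η = Defs.RationalLemmas.≤-move {a} {b} {η} x≤y+η
        c+δ≤ : c ℚ.+ δ ℚ.≤ ⟦ suc D ⟧
        c+δ≤ = ℚP.≤-trans (ℚP.+-monoˡ-≤ δ (ℚP.≤-trans (Rat.p≤∣p∣ c) z≤B)) (proj₂ (≤⟦suc⟧ (B ℚ.+ δ)))
        first : (c ℚ.+ δ) ℚ.* (a ℚ.- b) ℚ.≤ half
        first = ℚP.≤-trans (Rat.*-monoʳ 0≤z+δ a-b≤η) (ℚP.≤-trans (Rat.*-monoˡ (ℚP.<⇒≤ 0<η) c+δ≤) (ℚP.≤-reflexive (Rat.inv-cancel D half)))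
        second : δ ℚ.* (b ℚ.- a) ℚ.≤ half
        second = ℚP.≤-trans (Rat.*-monoʳ (ℚP.<⇒≤ 0<δ) (ℚP.≤-trans (Rat.p≤∣p∣ (b ℚ.- a))
            (ℚP.≤-trans (ℚP.≤-reflexive (Defs.RationalLemmas.∣-∣-comm b a)) (ℚP.≤-trans t≤C (proj₂ (≤⟦suc⟧ (proj₁ bt)))))))
          (ℚP.≤-reflexive (≡.trans (ℚP.*-comm δ ⟦ suc C ⟧) (Rat.inv-cancel C half)))

  abstract
    ⊕-mono-≤ : ∀ {x y u v} → x ≤ y → u ≤ v → x ⊕ u ≤ y ⊕ v
    ⊕-mono-≤ h k = mk≤ (≲-+ (below h) (below k))

    ⊕-cancelʳ-≤ : ∀ x y z → x ⊕ z ≤ y ⊕ z → x ≤ y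
    ⊕-cancelʳ-≤ x y z h = mk≤ (≲-cancelʳ (seq z) (below h))

    ⊗-monoˡ-≤ : ∀ {x y z} → Defs.0ℝ ≤ z → x ≤ y → z ⊗ x ≤ z ⊗ y
    ⊗-monoˡ-≤ {x} {y} {z} h k = mk≤ (≲-*-monoˡ x y z (below h) (below k))

  ℝ-algebra : OrderedAlgebra
  ℝ-algebra = record
    { semiring    = ℝ-semiring
    ; _≤_         = _≤_
    ; ≤-reflexive = λ {x} {y} h → mk≤ (proj₁ (null-≲ {seq x} {seq y} (≃⇒null {x} {y} (equal h))))
    ; ≤-trans     = λ h k → mk≤ (≲-trans (below h) (below k))
    ; +-mono-≤    = ⊕-mono-≤
    ; +-cancelʳ-≤ = ⊕-cancelʳ-≤
    ; *-monoˡ-≤   = ⊗-monoˡ-≤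
    ; ι           = fromℚ
    ; ι-0         = mk≈ (≃-refl {Defs.0ℝ})
    ; ι-1         = mk≈ (≃-refl {Defs.1ℝ})
    ; ι-+         = fromℚ-⊕
    ; ι-*         = fromℚ-⊗
    ; ι-mono      = λ p≤q → mk≤ (≤⇒≲ λ _ → p≤q)
    }

  positive⇒≥0 : ∀ (x : Defs.ℝ⁺) → Defs.0ℝ ≤ val x
  positive⇒≥0 (x Defs.,⁺ 0<x) = let e , 0<e , N , h = Defs.PositivityLemmas.eventually {x} 0<x in
    mk≤ (mk≲ λ ε 0<ε → N , λ n n≥ → ℚP.≤-trans (ℚP.≤-trans (ℚP.<⇒≤ 0<e) (h n n≥)) (Rat.≤-slack {seq x n} {seq x n ℚ.+ ε} ε (ℚP.<⇒≤ 0<ε) ≡.refl))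

  -- The K-th rational term of π is `4ℚ * L K`, so Wallis' bounds for partial sums are the
  -- inequalities for π as they stand.
  ℝ-wallis : WallisConstant ℝ-algebra
  ℝ-wallis = record
    { π = val Defs.π ; 0≤π = positive⇒≥0 Defs.π

    ; wallis-upper = λ N → ≡.subst (_≤ fromℚ 2ℚ) (≡.sym (⊗-def (fromℚ (remain N ℚ.* remain N ℚ.* ⟦ N ⟧)) (val Defs.π))) (mk≤ (wallis-upper N))
    ; wallis-lower = λ N → ≡.subst (fromℚ 2ℚ ≤_) (≡.sym (⊗-def (fromℚ (remain N ℚ.* remain N ℚ.* ⟦ 2 ℕ.+ N ⟧)) (val Defs.π))) (mk≤ (wallis-lower N)) }

  -- A late term of the sequence serves as q: from there on, terms differ from it by at most (μ -
  -- 1)e, where e > 0 is a lower bound for all of them, so the additive error becomes a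
  -- multiplicative one.
  approximate-positive : ∀ (x : Defs.ℝ⁺) {μ} → 1ℚ ℚ.< μ →
    ∃[ q ] 0ℚ ℚ.< q × fromℚ q ≤ fromℚ μ ⊗ val x × val x ≤ fromℚ μ ⊗ fromℚ q
  approximate-positive (x Defs.,⁺ 0<x) {μ} 1<μ = q , ℚP.<-≤-trans 0<e e≤q ,
      ≡.subst (fromℚ q ≤_) (≡.sym (⊗-def (fromℚ μ) x)) (mk≤ (mk≲ λ ε 0<ε → K , λ n n≥ → ℚP.≤-trans (bound q (seq x n) (h n (ℕP.m⊔n≤o⇒m≤o M N n≥)) (ℚP.<⇒≤ (close K n (ℕP.m≤n⊔m M N) (ℕP.m⊔n≤o⇒n≤o M N n≥))))
        (Rat.≤-slack {μ ℚ.* seq x n} {μ ℚ.* seq x n ℚ.+ ε} ε (ℚP.<⇒≤ 0<ε) ≡.refl))) ,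
      ≡.subst (x ≤_) (≡.sym (⊗-def (fromℚ μ) (fromℚ q))) (mk≤ (mk≲ λ ε 0<ε → K , λ n n≥ → ℚP.≤-trans (bound (seq x n) q e≤q (ℚP.<⇒≤ (close n K (ℕP.m⊔n≤o⇒n≤o M N n≥) (ℕP.m≤n⊔m M N))))
        (Rat.≤-slack {μ ℚ.* q} {μ ℚ.* q ℚ.+ ε} ε (ℚP.<⇒≤ 0<ε) ≡.refl)))
    where
    ev = Defs.PositivityLemmas.eventually {x} 0<x
    e = proj₁ ev
    0<e = proj₁ (proj₂ ev)
    M = proj₁ (proj₂ (proj₂ ev))
    h = proj₂ (proj₂ (proj₂ ev))
    cauchy = Defs.isCauchy x ((μ ℚ.- 1ℚ) ℚ.* e) (Rat.*-pos (Rat.0<-diff 1<μ) 0<e)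
    N = proj₁ cauchy
    close = proj₂ cauchy
    K = M ℕ.⊔ N
    q = seq x K
    e≤q : e ℚ.≤ q
    e≤q = h K (ℕP.m≤m⊔n M N)
    bound : ∀ p r → e ℚ.≤ r → ∣ p ℚ.- r ∣ ℚ.≤ (μ ℚ.- 1ℚ) ℚ.* e → p ℚ.≤ μ ℚ.* r
    bound p r e≤r d≤ = ℚP.≤-trans (Defs.RationalLemmas.∣-∣-unfold p r) (ℚP.≤-trans (ℚP.+-monoʳ-≤ r
        (ℚP.≤-trans d≤ (Rat.*-monoʳ (ℚP.<⇒≤ (Rat.0<-diff 1<μ)) e≤r)))
      (ℚP.≤-reflexive (solve 2 (λ m r → r :+ (m :- con 1ℚ) :* r := m :* r) ≡.refl μ r)))

-- Reciprocals, square roots and limits of reals.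

module RealLimit where
  open import Data.Rational.Base using (∣_∣)
  open Defs using (ℝ; seq; val; _*⁺_; _⁻¹; √_)
  open Rat using (⟦_⟧; 2ℚ; Null; null-inv; null-+; null-cong; null-*ˡ; _≲_; mk≲; eventually)
  open Walk using (module OrderedAlgebraProperties; module Asymptotics)
  open Real using (ℝ-algebra; ℝ-wallis; _⊗_; ⊗-def; mk≈; mk≤; below; null⇒≃; null-*-bounded; approximate-positive)
  open ℚ-Solver using () renaming (solve to solve′; _:=_ to infix 4 _:=′_; _:*_ to infixl 7 _:*′_; _:-_ to infixl 6 _:-′_; _:+_ to infixl 6 _:+′_; con to con′)

  open OrderedAlgebraProperties ℝ-algebra

  from-product : ∀ {x y z} → x Defs.* y Defs.≃ z → x * y ≈ z
  from-product {x} {y} {z} h = ≡.subst (_≈ z) (≡.sym (⊗-def x y)) (mk≈ h)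

  val-*⁺ : ∀ x y → val (x *⁺ y) ≡ val x * val y
  val-*⁺ x y = ≡.sym (⊗-def (val x) (val y))

  -- The reciprocal inverts terms shifted by `N`, so the product differs from 1 by the reciprocal
  -- times `seq x n ℚ.- seq x (N ℕ.+ n)`, which is null by the Cauchy property.
  ⁻¹-inverse : ∀ x → val x * val (x ⁻¹) ≈ 1#
  ⁻¹-inverse X@(x Defs.,⁺ 0<x@(e , 0<e , N , _)) = from-product (null⇒≃ {val X Defs.* val (X ⁻¹)} {1#} (null-cong eq (null-*-bounded (val (X ⁻¹)) close)))
    where
    close : Null (λ n → seq x n ℚ.- seq x (N ℕ.+ n))
    close ε 0<ε = proj₁ (Defs.isCauchy x ε 0<ε) , λ n n≥ → ℚP.<⇒≤ (proj₂ (Defs.isCauchy x ε 0<ε) n (N ℕ.+ n) n≥ (ℕP.≤-trans n≥ (ℕP.m≤n+m n N)))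
    0<x+ : ∀ n → 0ℚ ℚ.< seq x (N ℕ.+ n)
    0<x+ n = ℚP.<-≤-trans 0<e (proj₂ (proj₂ (proj₂ (Defs.PositivityLemmas.eventually {x} 0<x))) (N ℕ.+ n) (ℕP.m≤m+n N n))
    cancel : ∀ y a b → y ℚ.* b ≡ 1ℚ → y ℚ.* (a ℚ.- b) ≡ a ℚ.* y ℚ.- 1ℚ
    cancel y a b h = ≡.trans (solve′ 3 (λ y a b → y :*′ (a :-′ b) :=′ a :*′ y :-′ y :*′ b) ≡.refl y a b) (cong (λ t → a ℚ.* y ℚ.- t) h)
    eq : ∀ n → seq (val (X ⁻¹)) n ℚ.* (seq x n ℚ.- seq x (N ℕ.+ n)) ≡ seq x n ℚ.* seq (val (X ⁻¹)) n ℚ.- 1ℚ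
    eq n = cancel (seq (val (X ⁻¹)) n) (seq x n) (seq x (N ℕ.+ n)) (ℚP.*-inverseˡ (seq x (N ℕ.+ n)) {{ℚ.>-nonZero (0<x+ n)}})

  val-^ : ∀ x n → val (x Defs.^ n) ≡ val x ^ n
  val-^ x zero    = ≡.refl
  val-^ x (suc n) = ≡.trans (val-*⁺ x (x Defs.^ n)) (cong (val x *_) (val-^ x n))

  -- The n-th approximation a satisfies a² ≤ x < (a + k)² with k = 1 / (n + 1); the gap 2ak + k² is
  -- null because a is bounded.
  √-square : ∀ x → val (√ x) * val (√ x) ≈ val x
  √-square (x Defs.,⁺ 0<x) = from-product (null⇒≃ {r Defs.* r} {x} bound)
    where
    r = Defs.sqrt x
    ev = Defs.PositivityLemmas.eventually {x} 0<x
    null-k : Null Rat.inv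
    null-k = null-inv 0 λ n → ℚP.≤-reflexive (≡.trans (ℚP.0≤p⇒∣p∣≡p (Rat.0≤inv n)) (≡.sym (ℚP.*-identityˡ (Rat.inv n))))
    null-k² : Null (λ n → Rat.inv n ℚ.* Rat.inv n)
    null-k² = null-inv 0 λ n → ℚP.≤-trans (ℚP.≤-reflexive (ℚP.0≤p⇒∣p∣≡p (Rat.0≤* (Rat.0≤inv n) (Rat.0≤inv n))))
      (Rat.*-monoˡ (Rat.0≤inv n) (ℚP.≤-trans (ℚP.≤-reflexive (≡.sym (ℚP.*-identityˡ (Rat.inv n))))
        (ℚP.≤-trans (Rat.*-monoˡ (Rat.0≤inv n) (Rat.⟦⟧-mono {1} {suc n} (s≤s z≤n))) (ℚP.≤-reflexive (Rat.⟦⟧-inv n)))))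
    gap : Null (λ n → seq r n ℚ.* (2ℚ ℚ.* Rat.inv n) ℚ.+ Rat.inv n ℚ.* Rat.inv n)
    gap = null-+ (null-*-bounded r (null-*ˡ 2ℚ null-k)) null-k²
    bound : Null (λ n → seq r n ℚ.* seq r n ℚ.- seq x n)
    bound ε 0<ε = proj₁ (gap ε 0<ε) ℕ.⊔ N , λ n n≥ → ℚP.≤-trans (at n (h n (ℕP.m⊔n≤o⇒n≤o _ N n≥)))
        (ℚP.≤-trans (Rat.p≤∣p∣ _) (proj₂ (gap ε 0<ε) n (ℕP.m⊔n≤o⇒m≤o _ N n≥)))
      where
      N = proj₁ (proj₂ (proj₂ ev))
      h = proj₂ (proj₂ (proj₂ ev))
      at : ∀ n → proj₁ ev ℚ.≤ seq x n → ∣ seq r n ℚ.* seq r n ℚ.- seq x n ∣ ℚ.≤ seq r n ℚ.* (2ℚ ℚ.* Rat.inv n) ℚ.+ Rat.inv n ℚ.* Rat.inv n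
      at n e≤x = Defs.RationalLemmas.∣-∣-≤ {a ℚ.* a} {seq x n}
          (ℚP.≤-trans a²≤ (Rat.≤-slack {seq x n} {seq x n ℚ.+ (a ℚ.* (2ℚ ℚ.* k) ℚ.+ k ℚ.* k)} (a ℚ.* (2ℚ ℚ.* k) ℚ.+ k ℚ.* k)
            (Rat.0≤+ (Rat.0≤* 0≤a (Rat.0≤* (Rat.0≤⟦⟧ 2) (Rat.0≤inv n))) (Rat.0≤* (Rat.0≤inv n) (Rat.0≤inv n))) ≡.refl))
          (ℚP.≤-trans (ℚP.<⇒≤ <a+k) (ℚP.≤-reflexive (solve′ 2 (λ a k → (a :+′ k) :*′ (a :+′ k) :=′ a :*′ a :+′ (a :*′ (con′ 2ℚ :*′ k) :+′ k :*′ k)) ≡.refl a k)))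
        where
        a = seq r n
        k = Rat.inv n
        0≤a : 0ℚ ℚ.≤ a
        0≤a = Defs.SqrtℚLemmas.0≤sqrtℚ n (seq x n)
        ∣x∣ : ∣ seq x n ∣ ≡ seq x n
        ∣x∣ = ℚP.0≤p⇒∣p∣≡p (ℚP.≤-trans (ℚP.<⇒≤ (proj₁ (proj₂ ev))) e≤x)
        a²≤ : a ℚ.* a ℚ.≤ seq x n
        a²≤ = ≡.subst (a ℚ.* a ℚ.≤_) ∣x∣ (Defs.SqrtℚLemmas.sqrtℚ-≤ n (seq x n))
        <a+k : seq x n ℚ.< (a ℚ.+ k) ℚ.* (a ℚ.+ k)
        <a+k = ≡.subst (ℚ._< (a ℚ.+ k) ℚ.* (a ℚ.+ k)) ∣x∣ (Defs.SqrtℚLemmas.sqrtℚ-< n (seq x n))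

  /2-square : ∀ x n → val (x Defs.^ n /2) * val (x Defs.^ n /2) ≈ val x ^ n
  /2-square x n = trans (*-cong e e) (trans (sym (^-distrib-* (val (√ x)) (val (√ x)) n)) (^-congˡ n (√-square x)))
    where
    e : val (x Defs.^ n /2) ≈ val (√ x) ^ n
    e = reflexive (val-^ (√ x) n)

  -- For μ ≥ 1, x² ≤ μ + ε < (μ + ε)² gives x < μ + ε. Having μ in place of its root loses nothing
  -- when tolerances tend to 1.
  ≤-square : ∀ {x μ} → 1ℚ ℚ.≤ μ → x * x ≤ ι μ → x ≤ ι μ
  ≤-square {x} {μ} 1≤μ h = mk≤ (mk≲ λ ε 0<ε → proj₁ (eventually (below h′) ε 0<ε) , λ n n≥ → ℚP.<⇒≤ (Defs.RationalLemmas.sq-cancel-<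
      (Rat.0≤+ 0≤μ (ℚP.<⇒≤ 0<ε)) (ℚP.≤-<-trans (proj₂ (eventually (below h′) ε 0<ε) n n≥) (bigger ε 0<ε))))
    where
    h′ : x Defs.* x ≤ ι μ
    h′ = ≡.subst (_≤ ι μ) (⊗-def x x) h
    0≤μ = ℚP.≤-trans Rat.0≤1 1≤μ
    bigger : ∀ ε → 0ℚ ℚ.< ε → μ ℚ.+ ε ℚ.< (μ ℚ.+ ε) ℚ.* (μ ℚ.+ ε)
    bigger ε 0<ε = ℚP.<-≤-trans
      (Rat.<-slack {μ ℚ.+ ε} {(1ℚ ℚ.+ ε) ℚ.* (μ ℚ.+ ε)} (ε ℚ.* (μ ℚ.+ ε)) (Rat.*-pos 0<ε (ℚP.+-mono-≤-< 0≤μ 0<ε))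
        (solve′ 2 (λ m e → (con′ 1ℚ :+′ e) :*′ (m :+′ e) :=′ m :+′ e :+′ e :*′ (m :+′ e)) ≡.refl μ ε))
      (Rat.*-monoˡ (Rat.0≤+ 0≤μ (ℚP.<⇒≤ 0<ε)) (ℚP.+-monoˡ-≤ ε 1≤μ))

  approximable : ∀ x {y} → val x ≈ y → Asymptotics.Approximable ℝ-algebra ℝ-wallis y
  approximable x {y} eq = Asymptotics.mkApproximable λ {μ} 1<μ → let q , 0<q , q≤ , ≤q = approximate-positive x 1<μ in
    q , 0<q , ≤-trans q≤ (≤-reflexive (*-congˡ {x = ι μ} eq)) , ≤-trans (≈⇒≥ eq) ≤q

  -- Four parts of η bound the distance to 1, by `near-1`; four more are the positive margin that
  -- the strict order on reals asks for.
  eighth : ∀ {e} → 0ℚ ℚ.< e → ∃[ η ] 0ℚ ℚ.< η × η ℚ.≤ 1ℚ × ⟦ 8 ⟧ ℚ.* η ℚ.≤ e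
  eighth {e} 0<e with ℚP.≤-total e 1ℚ
  ... | inj₁ e≤1 = Rat.inv 7 ℚ.* e , Rat.*-pos (Rat.0<inv 7) 0<e ,
    Rat.*-mono-≤ (Rat.0≤inv 7) (Defs.RationalLemmas./-mono-≤ 1 8 1 1 (s≤s z≤n)) (ℚP.<⇒≤ 0<e) e≤1 ,
    ℚP.≤-reflexive (≡.trans (≡.sym (ℚP.*-assoc ⟦ 8 ⟧ (Rat.inv 7) e)) (ℚP.*-identityˡ e))
  ... | inj₂ 1≤e = Rat.inv 7 , Rat.0<inv 7 , Defs.RationalLemmas./-mono-≤ 1 8 1 1 (s≤s z≤n) , 1≤e

  near-1 : ∀ {η x} → 0ℚ ℚ.≤ η → η ℚ.≤ 1ℚ → x ℚ.≤ 1ℚ ℚ.+ η ℚ.+ η → 1ℚ ℚ.≤ (1ℚ ℚ.+ η) ℚ.* x ℚ.+ η → ∣ x ℚ.- 1ℚ ∣ ℚ.≤ ⟦ 4 ⟧ ℚ.* η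
  near-1 {η} {x} 0≤η η≤1 x≤ ≤x = Defs.RationalLemmas.∣-∣-≤ {x} {1ℚ}
      (ℚP.≤-trans x≤ (Rat.≤-slack {1ℚ ℚ.+ η ℚ.+ η} {1ℚ ℚ.+ ⟦ 4 ⟧ ℚ.* η} (2ℚ ℚ.* η) (Rat.0≤* (Rat.0≤⟦⟧ 2) 0≤η)
        (solve′ 1 (λ h → con′ 1ℚ :+′ con′ ⟦ 4 ⟧ :*′ h :=′ con′ 1ℚ :+′ h :+′ h :+′ con′ 2ℚ :*′ h) ≡.refl η)))
      (ℚP.≤-trans ≤x (ℚP.≤-trans (ℚP.≤-reflexive (solve′ 2 (λ x h → (con′ 1ℚ :+′ h) :*′ x :+′ h :=′ x :+′ h :*′ x :+′ h) ≡.refl x η))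
        (ℚP.≤-trans (ℚP.+-monoˡ-≤ η (ℚP.+-monoʳ-≤ x (Rat.*-monoʳ 0≤η x≤3)))
          (ℚP.≤-reflexive (solve′ 2 (λ x h → x :+′ h :*′ con′ Rat.3ℚ :+′ h :=′ x :+′ con′ ⟦ 4 ⟧ :*′ h) ≡.refl x η)))))
    where
    x≤3 : x ℚ.≤ Rat.3ℚ
    x≤3 = ℚP.≤-trans x≤ (ℚP.+-mono-≤ (ℚP.+-monoʳ-≤ 1ℚ η≤1) η≤1)

  within : ∀ {η e x y} → 0ℚ ℚ.≤ η → η ℚ.≤ 1ℚ → ⟦ 8 ⟧ ℚ.* η ℚ.≤ e → x ℚ.≤ 1ℚ ℚ.+ η ℚ.+ η → 1ℚ ℚ.≤ (1ℚ ℚ.+ η) ℚ.* x ℚ.+ η → e ℚ.≤ y →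
    ∣ x ℚ.- 1ℚ ∣ ℚ.+ ⟦ 4 ⟧ ℚ.* η ℚ.≤ y
  within {η} {e} {x} {y} 0≤η η≤1 8η≤e x≤ ≤x e≤y = ℚP.≤-trans (ℚP.+-monoˡ-≤ (⟦ 4 ⟧ ℚ.* η) (near-1 {η} {x} 0≤η η≤1 x≤ ≤x))
    (ℚP.≤-trans (ℚP.≤-reflexive (solve′ 1 (λ h → con′ ⟦ 4 ⟧ :*′ h :+′ con′ ⟦ 4 ⟧ :*′ h :=′ con′ ⟦ 8 ⟧ :*′ h) ≡.refl η)) (ℚP.≤-trans 8η≤e e≤y))

  unseal : ∀ z y → 1# ≤ ι z * y → (λ _ → 1ℚ) ≲ (λ k → z ℚ.* seq y k)
  unseal z y h = below (≡.subst (1# ≤_) (⊗-def (ι z) y) h)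

  -- The upper bound also keeps u bounded, which turns the multiplicative lower bound 1 ≤ νu into an
  -- additive one.
  converges : ∀ {u : ℕ → ℝ} → (∀ {ν} → 1ℚ ℚ.< ν → ∃[ N ] ∀ n → N ℕ.≤ n → u n ≤ ι ν × 1# ≤ ι ν * u n) → u Defs.⟶ Defs.1ℝ
  converges {u} h ε 0<ε = from (Defs.PositivityLemmas.eventually {ε} 0<ε)
    where
    from : (∃[ e ] 0ℚ ℚ.< e × ∃[ M ] ∀ k → M ℕ.≤ k → e ℚ.≤ seq ε k) → ∃[ N ] ∀ n → N ℕ.≤ n → Defs.∣ u n Defs.- Defs.1ℝ ∣ Defs.< ε
    from (e , 0<e , M , e≤) = with-η (eighth 0<e)
      where
      with-η : (∃[ η ] 0ℚ ℚ.< η × η ℚ.≤ 1ℚ × ⟦ 8 ⟧ ℚ.* η ℚ.≤ e) → ∃[ N ] ∀ n → N ℕ.≤ n → Defs.∣ u n Defs.- Defs.1ℝ ∣ Defs.< ε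
      with-η (η , 0<η , η≤1 , 8η≤e) = with-N (h {1ℚ ℚ.+ η} (Rat.<-slack {1ℚ} {1ℚ ℚ.+ η} η 0<η ≡.refl))
        where
        ν = 1ℚ ℚ.+ η
        close : ∀ n → u n ≤ ι ν → (λ _ → 1ℚ) ≲ (λ k → ν ℚ.* seq (u n) k) → Defs.∣ u n Defs.- Defs.1ℝ ∣ Defs.< ε
        close n up lo = at (eventually (below up) η 0<η) (eventually lo η 0<η)
          where
          at : (∃[ K ] ∀ k → K ℕ.≤ k → seq (u n) k ℚ.≤ ν ℚ.+ η) → (∃[ L ] ∀ k → L ℕ.≤ k → 1ℚ ℚ.≤ ν ℚ.* seq (u n) k ℚ.+ η) → Defs.∣ u n Defs.- Defs.1ℝ ∣ Defs.< ε
          at (K , hK) (L , hL) = ⟦ 4 ⟧ ℚ.* η , Rat.*-pos (Rat.0<⟦suc⟧ 3) 0<η , M ℕ.⊔ (K ℕ.⊔ L) , λ k k≥ →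
            within {η} {e} {seq (u n) k} {seq ε k} (ℚP.<⇒≤ 0<η) η≤1 8η≤e
              (hK k (ℕP.m⊔n≤o⇒m≤o K L (ℕP.m⊔n≤o⇒n≤o M (K ℕ.⊔ L) k≥)))
              (hL k (ℕP.m⊔n≤o⇒n≤o K L (ℕP.m⊔n≤o⇒n≤o M (K ℕ.⊔ L) k≥)))
              (e≤ k (ℕP.m⊔n≤o⇒m≤o M (K ℕ.⊔ L) k≥))
        with-N : (∃[ N ] ∀ n → N ℕ.≤ n → u n ≤ ι ν × 1# ≤ ι ν * u n) → ∃[ N ] ∀ n → N ℕ.≤ n → Defs.∣ u n Defs.- Defs.1ℝ ∣ Defs.< ε
        with-N (N , hN) = N , λ n n≥ → close n (proj₁ (hN n n≥)) (unseal ν (u n) (proj₂ (hN n n≥)))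

-- The theorem for weighted step sets.

open import Data.Fin.Base using (Fin; zero; suc; inject₁; fromℕ)
open import Data.List.Base as List using (List; []; _∷_)
open import Data.Vec.Base as Vec using (Vec; []; _∷_; lookup; tabulate)
open import Defs
open import Data.Nat.Base using (NonZero)
open import Data.Vec.Properties using (lookup-zipWith; lookup-replicate)
open Real using (seq-⊕; seq-⊗; ≈-pointwise; ℝ-algebra; ℝ-wallis; ⊗-def; mk≈; positive⇒≥0)
module R = Walk.OrderedAlgebraProperties ℝ-algebra
open R using (_≈_; _≤_; 0#; 1#; ι)
open Walk.Walks ℝ-algebra using (sum; total; 0≤total)
open Walk.WalkBounds ℝ-algebra using (Symmetric)
open Walk.Asymptotics ℝ-algebra ℝ-wallis using (Approximable; _≾_; eventually)
open Walk.Theorem ℝ-algebra ℝ-wallis using (forwardIn; scaling; total²; target; asymptotics)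
open Walk.StepLists ℝ-algebra using (lsum; lsum-cong; lsum-filter; spread; sum-spread; 0≤spread; spread-flip; total-spread; coordinateSum; symmetric-⁺; χ)
  renaming (walkWeight to listWeight)
open Walk.Conclusion ℝ-algebra ℝ-wallis using (product; scaling-product; forwardIn-coordinateSum; inverse-square; ratio-upper; ratio-lower)
open RealLimit using (val-*⁺; ⁻¹-inverse; val-^; √-square; /2-square; ≤-square; approximable; converges)

Σᴸ-lsum : ∀ {X : Set} (f : X → ℝ⁺) xs → Σᴸ (List.map f xs) ≈ lsum (λ x → val (f x)) xs
Σᴸ-lsum f []       = R.refl
Σᴸ-lsum f (x ∷ xs) = R.trans (≈-pointwise λ n → ≡.sym (seq-⊕ (val (f x)) (Σᴸ (List.map f xs)) n))
  (R.+-congˡ (Σᴸ-lsum f xs))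

val-∏-∷ : ∀ {n} x (xs : Vec ℝ⁺ n) → val (∏ (x ∷ xs)) ≈ val x R.* val (∏ xs)
val-∏-∷ x xs = ≈-pointwise λ n → ≡.sym (seq-⊗ (val x) (val (∏ xs)) n)

val-∏-tabulate : ∀ {n} (f : Fin n → ℝ⁺) (h : Fin n → ℝ) → (∀ k → val (f k) ≈ h k) → val (∏ (tabulate f)) ≈ product h
val-∏-tabulate {zero}  f h eq = R.refl
val-∏-tabulate {suc n} f h eq = R.trans (val-∏-∷ (f zero) (tabulate (λ k → f (suc k))))
  (R.*-cong (eq zero) (val-∏-tabulate (λ k → f (suc k)) (λ k → h (suc k)) (λ k → eq (suc k))))

val-1⁻¹ : val (1ℝ⁺ ⁻¹) ≈ 1#
val-1⁻¹ = R.trans (R.sym (R.*-identityˡ (val (1ℝ⁺ ⁻¹)))) (⁻¹-inverse 1ℝ⁺)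

val-1^ᶜ : ∀ c → val (1ℝ⁺ ^ᶜ c) ≈ 1#
val-1^ᶜ back  = val-1⁻¹
val-1^ᶜ stay  = R.refl
val-1^ᶜ forth = R.refl

val-∏-𝟏 : ∀ {n} (xs : Vec ℝ⁺ n) → (∀ k → val (lookup xs k) ≈ 1#) → val (∏ xs) ≈ 1#
val-∏-𝟏 []       h = R.refl
val-∏-𝟏 (x ∷ xs) h = R.trans (val-∏-∷ x xs) (R.trans (R.*-cong (h zero) (val-∏-𝟏 xs (λ k → h (suc k)))) (R.*-identityˡ 1#))

val-monomial-𝟏 : ∀ {d} (i : Step d) → val (monomial 𝟏 i) ≈ 1#
val-monomial-𝟏 i = val-∏-𝟏 (Vec.zipWith _^ᶜ_ 𝟏 i) λ k → ≡.subst (λ z → val z ≈ 1#)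
  (≡.sym (≡.trans (lookup-zipWith _^ᶜ_ k 𝟏 i) (cong (_^ᶜ lookup i k) (lookup-replicate k 1ℝ⁺)))) (val-1^ᶜ (lookup i k))

module _ {d : ℕ} (𝒮 : WeightedStepSet d) where
  wt : Step d → ℝ
  wt i = val (weight 𝒮 i)

  ω : Step d → ℝ
  ω = spread wt (steps 𝒮)

  0≤ω : ∀ v → 0# ≤ ω v
  0≤ω = 0≤spread wt (λ i → positive⇒≥0 (weight 𝒮 i)) (steps 𝒮)

  val-walkWeight : ∀ {n} (u : Walk d n) → val (walkWeight 𝒮 u) ≈ listWeight wt u
  val-walkWeight []      = R.refl
  val-walkWeight (i ∷ u) = R.trans (val-∏-∷ (weight 𝒮 i) (Vec.map (weight 𝒮) u)) (R.*-congˡ (val-walkWeight u))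

  s-total : ∀ n → s 𝒮 n ≈ total ω n
  s-total n = R.trans (Σᴸ-lsum (walkWeight 𝒮) ws)
      (R.trans (lsum-cong (λ u → val-walkWeight u) ws) (R.sym (total-spread wt (steps 𝒮) n)))
    where ws = List.filter (staysInOrthant? origin) (walks (steps 𝒮) n)

  -- The map `p` is the identity for S and `Vec.init` for the coefficients A and B; at 𝟏 every
  -- monomial is 1 in either case.
  monomial-free : ∀ {k} (p : Step d → Step k) xs → Σᴸ (List.map (λ i → weight 𝒮 i *⁺ monomial 𝟏 (p i)) xs) ≈ lsum wt xs
  monomial-free p xs = R.trans (Σᴸ-lsum (λ i → weight 𝒮 i *⁺ monomial 𝟏 (p i)) xs)
    (lsum-cong (λ i → R.trans (R.reflexive (val-*⁺ (weight 𝒮 i) (monomial 𝟏 (p i))))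
      (R.trans (R.*-congˡ {x = wt i} (val-monomial-𝟏 (p i))) (R.*-identityʳ (wt i)))) xs)

  S-sum : S 𝒮 𝟏 ≈ sum ω
  S-sum = R.trans (monomial-free (λ i → i) (steps 𝒮))
    (R.trans (lsum-cong (λ i → R.sym (R.*-identityʳ (wt i))) (steps 𝒮))
      (R.trans (R.sym (sum-spread wt (steps 𝒮) (λ _ → 1#))) (Walk.Walks.sum-cong ℝ-algebra (λ v → R.*-identityʳ (ω v)))))

  stepsWith-sum : ∀ k c → lsum wt (stepsWith 𝒮 k c) ≈ coordinateSum ω k c
  stepsWith-sum k c = R.trans (lsum-filter (λ i → lookup i k ≟ c) wt (steps 𝒮))
    (R.sym (sum-spread wt (steps 𝒮) (λ i → χ (lookup i k ≟ c))))

  b-forwardIn : ∀ k h → val (b 𝒮 k h) ≈ forwardIn ω k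
  b-forwardIn k h = R.trans (Σᴸ-lsum (weight 𝒮) (stepsWith 𝒮 k forth))
    (R.trans (stepsWith-sum k forth) (forwardIn-coordinateSum ω k))

module _ {m : ℕ} (𝒮 : WeightedStepSet (suc m)) where
  coefficient-sum : ∀ c → coefficient 𝒮 c 𝟏 ≈ coordinateSum (ω 𝒮) (fromℕ m) c
  coefficient-sum c = R.trans (monomial-free 𝒮 Vec.init (stepsWith 𝒮 (fromℕ m) c)) (stepsWith-sum 𝒮 (fromℕ m) c)

  ω-symmetric : (∀ (k : Fin m) → SymmetricOver 𝒮 (inject₁ k)) → A 𝒮 𝟏 ≃ B 𝒮 𝟏 → Symmetric (ω 𝒮)
  ω-symmetric sym A≃B = symmetric-⁺ m (ω 𝒮)
    (λ k → spread-flip (wt 𝒮) (unique 𝒮) (inject₁ k) (λ i i∈ → proj₁ (sym k i i∈) , mk≈ (proj₂ (sym k i i∈))))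
    (R.trans (R.sym (coefficient-sum back)) (R.trans (mk≈ A≃B) (coefficient-sum forth)))

-- Stated for arbitrary factors, as unfolding the terms of the theorem is expensive.
reciprocal-square : ∀ x u v w T {N} → N ≈ val u R.* val u R.* (val w R.* val w) → val T ≈ val x R.* val x R.* (val v R.* val v) →
  val ((x *⁺ u ⁻¹ *⁺ (v *⁺ w ⁻¹)) ⁻¹) R.* val ((x *⁺ u ⁻¹ *⁺ (v *⁺ w ⁻¹)) ⁻¹) ≈ N R.* val (T ⁻¹)
reciprocal-square x u v w T N≈ T≈ = inverse-square N≈ T≈ (⁻¹-inverse T) (⁻¹-inverse u) (⁻¹-inverse w)
    (R.trans (R.*-congʳ (R.sym g≈)) (⁻¹-inverse (x *⁺ u ⁻¹ *⁺ (v *⁺ w ⁻¹))))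
  where
  g≈ : val (x *⁺ u ⁻¹ *⁺ (v *⁺ w ⁻¹)) ≈ val x R.* val (u ⁻¹) R.* (val v R.* val (w ⁻¹))
  g≈ = R.trans (R.reflexive (val-*⁺ (x *⁺ u ⁻¹) (v *⁺ w ⁻¹)))
    (R.*-cong (R.reflexive (val-*⁺ x (u ⁻¹))) (R.reflexive (val-*⁺ v (w ⁻¹))))

normaliser-square : ∀ p n d → val (n ^ d /2) R.* val (n ^ d /2) R.* (val (π ^ d /2 *⁺ √ p) R.* val (π ^ d /2 *⁺ √ p)) ≈
  val n R.^ d R.* (val π R.^ d R.* val p)
normaliser-square p n d = R.*-cong (/2-square n d) (R.trans (R.*-cong w≈ w≈)
    (R.trans (R.solve 2 (λ a c → a R.:* c R.:* (a R.:* c) R.:= a R.:* a R.:* (c R.:* c)) R.refl (val (π ^ d /2)) (val (√ p)))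
      (R.*-cong (/2-square π d) (√-square p))))
  where
  w≈ : val (π ^ d /2 *⁺ √ p) ≈ val (π ^ d /2) R.* val (√ p)
  w≈ = R.reflexive (val-*⁺ (π ^ d /2) (√ p))

val-product₃ : ∀ x y → val (x *⁺ x *⁺ y) ≈ val x R.* val x R.* val y
val-product₃ x y = R.trans (R.reflexive (val-*⁺ (x *⁺ x) y)) (R.*-congʳ (R.reflexive (val-*⁺ x x)))

-- X ≤ μ follows from X² ≤ μ; inserted once into 1 ≤ μX² it gives 1 ≤ μ²X, which is why ν has to
-- cover μ².
unsquare : ∀ {X μ ν} → 1ℚ ℚ.< μ → μ ℚ.* μ ℚ.≤ ν → 0# ≤ X → X R.* X ≤ ι μ → 1# ≤ ι μ R.* (X R.* X) → X ≤ ι ν × 1# ≤ ι ν R.* X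
unsquare {X} {μ} {ν} 1<μ μ²≤ν 0≤X up lo =
    R.≤-trans X≤μ (R.ι-mono (ℚP.≤-trans (Walk.1≤⇒≤* μ 0≤μ (ℚP.<⇒≤ 1<μ)) μ²≤ν)) ,
    R.≤-trans lo (R.≤-trans (R.*-monoˡ-≤ (R.0≤ι 0≤μ) (R.*-monoʳ-≤ 0≤X X≤μ))
      (R.≤-trans (R.≤-reflexive (R.trans (R.sym (R.*-assoc (ι μ) (ι μ) X)) (R.*-congʳ (R.sym (R.ι-* μ μ)))))
        (R.*-monoʳ-≤ 0≤X (R.ι-mono μ²≤ν))))
  where
  0≤μ = ℚP.<⇒≤ (Walk.0<1+ 1<μ)
  X≤μ : X ≤ ι μ
  X≤μ = ≤-square (ℚP.<⇒≤ 1<μ) up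

module _ {m : ℕ} (𝒮 : WeightedStepSet (suc m)) (sym : ∀ (k : Fin m) → SymmetricOver 𝒮 (inject₁ k)) (A≃B : A 𝒮 𝟏 ≃ B 𝒮 𝟏)
         (S₁ : ℝ⁺) (S₁≈ : val S₁ ≈ sum (ω 𝒮)) (forward-approximable : ∀ k → Approximable (forwardIn (ω 𝒮) k))
         -- The rate enters only through the square of its reciprocal, which equals a root-free
         -- expression.
         (g : (n : ℕ) .{{_ : NonZero n}} → ℝ⁺)
         (g⁻²≈ : ∀ n → val (g (suc n) ⁻¹) R.* val (g (suc n) ⁻¹) ≈
           scaling (ω 𝒮) (suc n) R.* val ((S₁ ^ suc n *⁺ S₁ ^ suc n *⁺ S₁ ^ suc m) ⁻¹)) where
  private
    result : total² (ω 𝒮) ≾ target (ω 𝒮) × target (ω 𝒮) ≾ total² (ω 𝒮)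
    result = asymptotics (ω 𝒮) (0≤ω 𝒮) (ω-symmetric 𝒮 sym A≃B) (approximable S₁ S₁≈) forward-approximable

    power : ∀ n → val (S₁ ^ n) ≈ sum (ω 𝒮) R.^ n
    power n = R.trans (R.reflexive (val-^ S₁ n)) (R.^-congˡ n S₁≈)

    T≈ : ∀ n → val (S₁ ^ n *⁺ S₁ ^ n *⁺ S₁ ^ suc m) ≈ target (ω 𝒮) n
    T≈ n = R.trans (val-product₃ (S₁ ^ n) (S₁ ^ suc m)) (R.*-cong (R.*-cong (power n) (power n)) (power (suc m)))

    TT⁻ : ∀ n → target (ω 𝒮) n R.* val ((S₁ ^ n *⁺ S₁ ^ n *⁺ S₁ ^ suc m) ⁻¹) ≈ 1#
    TT⁻ n = R.trans (R.*-congʳ (R.sym (T≈ n))) (⁻¹-inverse (S₁ ^ n *⁺ S₁ ^ n *⁺ S₁ ^ suc m))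

    X : ℕ → ℝ
    X n = total (ω 𝒮) (suc n) R.* val (g (suc n) ⁻¹)

    ratio≈X : ∀ n → s 𝒮 (suc n) * val (g (suc n) ⁻¹) ≈ X n
    ratio≈X n = R.trans (R.reflexive (≡.sym (⊗-def (s 𝒮 (suc n)) (val (g (suc n) ⁻¹))))) (R.*-congʳ (s-total 𝒮 (suc n)))

    0≤X : ∀ n → 0# ≤ X n
    0≤X n = R.0≤* (0≤total (0≤ω 𝒮) (suc n)) (positive⇒≥0 (g (suc n) ⁻¹))

    upper : ∀ {μ} n → total² (ω 𝒮) (suc n) ≤ ι μ R.* target (ω 𝒮) (suc n) → X n R.* X n ≤ ι μ
    upper {μ} n = ratio-upper {μ} {total (ω 𝒮) (suc n)} {scaling (ω 𝒮) (suc n)} {target (ω 𝒮) (suc n)}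
      (g⁻²≈ n) (TT⁻ (suc n)) (positive⇒≥0 ((S₁ ^ suc n *⁺ S₁ ^ suc n *⁺ S₁ ^ suc m) ⁻¹))

    lower : ∀ {μ} n → target (ω 𝒮) (suc n) ≤ ι μ R.* total² (ω 𝒮) (suc n) → 1# ≤ ι μ R.* (X n R.* X n)
    lower {μ} n = ratio-lower {μ} {total (ω 𝒮) (suc n)} {scaling (ω 𝒮) (suc n)} {target (ω 𝒮) (suc n)}
      (g⁻²≈ n) (TT⁻ (suc n)) (positive⇒≥0 ((S₁ ^ suc n *⁺ S₁ ^ suc n *⁺ S₁ ^ suc m) ⁻¹))

  equivalent : s 𝒮 ∼ g
  equivalent = converges {λ n → s 𝒮 (suc n) * val (g (suc n) ⁻¹)} λ {ν} 1<ν → bound ν (Walk.square-root 1<ν)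
    where
    bound : ∀ ν → (∃[ μ ] 1ℚ ℚ.< μ × μ ℚ.* μ ℚ.≤ ν) → ∃[ N ] ∀ n → N ℕ.≤ n →
      s 𝒮 (suc n) * val (g (suc n) ⁻¹) ≤ ι ν × 1# ≤ ι ν R.* (s 𝒮 (suc n) * val (g (suc n) ⁻¹))
    bound ν (μ , 1<μ , μ²≤ν) = at (eventually (proj₁ result) 1<μ) (eventually (proj₂ result) 1<μ)
      where
      at : (∃[ M ] ∀ n → M ℕ.≤ n → total² (ω 𝒮) n ≤ ι μ R.* target (ω 𝒮) n) → (∃[ N ] ∀ n → N ℕ.≤ n → target (ω 𝒮) n ≤ ι μ R.* total² (ω 𝒮) n) →
        ∃[ N ] ∀ n → N ℕ.≤ n → s 𝒮 (suc n) * val (g (suc n) ⁻¹) ≤ ι ν × 1# ≤ ι ν R.* (s 𝒮 (suc n) * val (g (suc n) ⁻¹))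
      at (M , hM) (N , hN) = M ℕ.⊔ N , λ n n≥ →
        let bounds = unsquare 1<μ μ²≤ν (0≤X n)
              (upper n (hM (suc n) (ℕP.m≤n⇒m≤1+n (ℕP.m⊔n≤o⇒m≤o M N n≥))))
              (lower n (hN (suc n) (ℕP.m≤n⇒m≤1+n (ℕP.m⊔n≤o⇒n≤o M N n≥))))
        in R.≤-trans (R.≤-reflexive (ratio≈X n)) (proj₁ bounds) ,
           R.≤-trans (proj₂ bounds) (R.≈⇒≥ (R.*-congˡ (ratio≈X n)))

rate-square : ∀ {m} (𝒮 : WeightedStepSet (suc m)) S₁ p → val p ≈ product (forwardIn (ω 𝒮)) → ∀ n →
  let g = S₁ ^ suc n *⁺ (fromℕ⁺ (suc n) ^ suc m /2) ⁻¹ *⁺ (S₁ ^ suc m /2 *⁺ (π ^ suc m /2 *⁺ √ p) ⁻¹) in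
  val (g ⁻¹) R.* val (g ⁻¹) ≈ scaling (ω 𝒮) (suc n) R.* val ((S₁ ^ suc n *⁺ S₁ ^ suc n *⁺ S₁ ^ suc m) ⁻¹)
rate-square {m} 𝒮 S₁ p p≈ n = reciprocal-square
  (S₁ ^ suc n) (fromℕ⁺ (suc n) ^ suc m /2) (S₁ ^ suc m /2) (π ^ suc m /2 *⁺ √ p) (S₁ ^ suc n *⁺ S₁ ^ suc n *⁺ S₁ ^ suc m)
  (R.trans (scaling-product (ω 𝒮) (suc n)) (R.trans (R.*-congˡ (R.*-congˡ (R.sym p≈))) (R.sym (normaliser-square p (fromℕ⁺ (suc n)) (suc m)))))
  (R.trans (val-product₃ (S₁ ^ suc n) (S₁ ^ suc m)) (R.*-congˡ (R.trans (R.reflexive (val-^ S₁ (suc m))) (R.sym (/2-square S₁ (suc m))))))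

asymptotic-form : ∀ m (𝒮 : WeightedStepSet (suc m)) → (∀ (k : Fin m) → SymmetricOver 𝒮 (inject₁ k)) → A 𝒮 𝟏 ≃ B 𝒮 𝟏 →
  ∀ S₁ p → val S₁ ≈ sum (ω 𝒮) → (∀ k → Approximable (forwardIn (ω 𝒮) k)) → val p ≈ product (forwardIn (ω 𝒮)) →
  s 𝒮 ∼ (λ n → S₁ ^ n *⁺ (fromℕ⁺ n ^ suc m /2) ⁻¹ *⁺ (S₁ ^ suc m /2 *⁺ (π ^ suc m /2 *⁺ √ p) ⁻¹))
-- The let makes Agda infer the type of the right-hand side rather than unify
-- it with the goal before the sequence is known.
asymptotic-form m 𝒮 sym A≃B S₁ p S₁≈ forward-approximable p≈ =
  let square = rate-square 𝒮 S₁ p p≈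
      form = equivalent 𝒮 sym A≃B S₁ S₁≈ forward-approximable
        (λ n {{n≢0}} → S₁ ^ n *⁺ (fromℕ⁺ n {{n≢0}} ^ suc m /2) ⁻¹ *⁺ (S₁ ^ suc m /2 *⁺ (π ^ suc m /2 *⁺ √ p) ⁻¹))
        square
  in form

mainTheorem1 : (m : ℕ) → let d = suc m in (𝒮 : WeightedStepSet d)
    → (∀ (k : Fin m) → SymmetricOver 𝒮 (inject₁ k))
    → (has : ∀ (j : Fin d) → HasStep 𝒮 j forth × HasStep 𝒮 j back)
    → A 𝒮 𝟏 ≃ B 𝒮 𝟏
    → let S𝟏 = S⁺ 𝒮 (proj₁ (has zero)) 𝟏
          ∏b = ∏ (tabulate (λ k → b 𝒮 k (proj₁ (has k))))
      in s 𝒮 ∼ (λ n → S𝟏 ^ n *⁺ (fromℕ⁺ n ^ d /2) ⁻¹ *⁺ (S𝟏 ^ d /2 *⁺ (π ^ d /2 *⁺ √ ∏b) ⁻¹))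
mainTheorem1 m 𝒮 sym has A≃B = asymptotic-form m 𝒮 sym A≃B
  (S⁺ 𝒮 (proj₁ (has zero)) 𝟏) (∏ (tabulate (λ k → b 𝒮 k (proj₁ (has k))))) (S-sum 𝒮)
  (λ k → approximable (b 𝒮 k (proj₁ (has k))) (b-forwardIn 𝒮 k (proj₁ (has k))))
  (val-∏-tabulate (λ k → b 𝒮 k (proj₁ (has k))) (forwardIn (ω 𝒮)) (λ k → b-forwardIn 𝒮 k (proj₁ (has k))))
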